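{- Let $\ell \ge 4$ be an integer and let $G$ be a $2$-connected bipartite graph with bipartition classes $A$ and $B$, where $|A| = a$, $|B| = b$ and $b \ge a \ge \ell$. Suppose $G$ contains no cycle of length at least $2\ell$. Then \[ |E(G)| \le \frac{\ell}{2}(a+b) + \left(\frac{\ell}{2}-2\right)(b-a-4) - 4 . \] Moreover, equality holds if and only if $G$ is isomorphic to the graph $B_2(a,b,2\ell)$, defined as follows: start from the complete bipartite graph $K_{\ell-2,\,b}$ (with parts $A_0$ of size $\ell-2$ and $B$ of size $b$), fix two distinct vertices $u_1,u_2 \in B$, and add $a-(\ell-2)$ new pairwise non-adjacent vertices, each adjacent to exactly $u_1$ and $u_2$ (so these new vertices together with $A_0$ form the class of size $a$).
   Context: All graphs are finite, simple and undirected. A graph is $2$-connected if it is connected and remains connected after deleting any single vertex. "Contains no cycle of length at least $2\ell$" means $G$ has no subgraph isomorphic to a cycle $C_m$ with $m \ge 2\ell$. -}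

module Defs where

open import Data.Nat using (ℕ; zero; suc; _+_; _*_; _∸_; _≤_; _<_; _<?_)
open import Data.Bool using (Bool; true; false; T; if_then_else_)
open import Data.Fin using (Fin; toℕ) renaming (zero to fzero; suc to fsuc)
open import Data.Sum using (_⊎_; inj₁; inj₂)
open import Data.Product using (Σ; _×_; _,_)
open import Data.Unit using (⊤)
open import Data.Empty using (⊥)
open import Data.Integer as ℤ using (ℤ; +_)
open import Relation.Nullary using (¬_; does)
open import Relation.Binary.PropositionalEquality using (_≡_; _≢_)
open import Function.Bundles using (_↔_; _⇔_; Inverse)
open import Function.Definitions using (Injective)

-- A finite simple bipartite graph with bipartition classes A = Fin a and
-- B = Fin b, given by its bipartite adjacency matrix (edges only go
-- between A and B).
BipGraph : ℕ → ℕ → Set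
BipGraph a b = Fin a → Fin b → Bool

Vertex : ℕ → ℕ → Set
Vertex a b = Fin a ⊎ Fin b

Adj : ∀ {a b} → BipGraph a b → Vertex a b → Vertex a b → Set
Adj E (inj₁ i) (inj₂ j) = T (E i j)
Adj E (inj₂ j) (inj₁ i) = T (E i j)
Adj E (inj₁ _) (inj₁ _) = ⊥
Adj E (inj₂ _) (inj₂ _) = ⊥

sumFin : (n : ℕ) → (Fin n → ℕ) → ℕ
sumFin zero    f = 0
sumFin (suc n) f = f fzero + sumFin n (λ i → f (fsuc i))

-- |E(G)|: number of edges (each edge has exactly one end in A).
edges : ∀ {a b} → BipGraph a b → ℕ
edges {a} {b} E = sumFin a (λ i → sumFin b (λ j → if E i j then 1 else 0))

data Reach {a b} (E : BipGraph a b) (P : Vertex a b → Set)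
     : Vertex a b → Vertex a b → Set where
  here : ∀ {u} → P u → Reach E P u u
  step : ∀ {u w v} → P u → Adj E u w → Reach E P w v → Reach E P u v

Connected : ∀ {a b} → BipGraph a b → Set
Connected E = ∀ u v → Reach E (λ _ → ⊤) u v

TwoConnected : ∀ {a b} → BipGraph a b → Set
TwoConnected {a} {b} E =
  Connected E ×
  (∀ (x u v : Vertex a b) → u ≢ x → v ≢ x → Reach E (λ w → w ≢ x) u v)

Consecutive : (m : ℕ) → Fin m → Fin m → Set
Consecutive m i j = (suc (toℕ i) ≡ toℕ j) ⊎ (suc (toℕ i) ≡ m × toℕ j ≡ 0)

HasCycle : ∀ {a b} → BipGraph a b → ℕ → Set
HasCycle {a} {b} E m =
  3 ≤ m × Σ (Fin m → Vertex a b) (λ c →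
    Injective _≡_ _≡_ c × (∀ i j → Consecutive m i j → Adj E (c i) (c j)))

NoCycleAtLeast : ∀ {a b} → BipGraph a b → ℕ → Set
NoCycleAtLeast E k = ∀ m → k ≤ m → ¬ HasCycle E m

Isomorphic : ∀ {a b a' b'} → BipGraph a b → BipGraph a' b' → Set
Isomorphic {a} {b} {a'} {b'} G H =
  Σ (Vertex a b ↔ Vertex a' b') (λ f →
    ∀ u v → Adj G u v ⇔ Adj H (Inverse.to f u) (Inverse.to f v))

-- B_2(a,b,2ℓ): A-vertices 0..ℓ-3 form A_0 (adjacent to all of B);
-- the remaining a-(ℓ-2) A-vertices are adjacent exactly to u₁ = 0, u₂ = 1 in B.
B₂ : (a b ℓ : ℕ) → BipGraph a b
B₂ a b ℓ i j =
  if does (toℕ i <? (ℓ ∸ 2)) then true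
  else does (toℕ j <? 2)

twiceBound : ℕ → ℕ → ℕ → ℤ
twiceBound ℓ a b =
  ((+ (ℓ * (a + b))) ℤ.+ (+ (ℓ ∸ 4)) ℤ.* (((+ b) ℤ.- (+ a)) ℤ.- (+ 4))) ℤ.- (+ 8)

{-# OPTIONS --safe #-}
module Submission where

-- Add edges as long as no cycle of length at least 2ℓ appears; then any two
-- non-adjacent vertices of different classes are joined by a path on 2ℓ or more
-- vertices.  The neighbours of the two ends along such a path either cross, or,
-- by 2-connectivity, are linked by two disjoint paths; in both cases a cycle of
-- length at least 2ℓ arises when the end degrees are large (Kopylov's argument).
-- So deleting vertices of small degree either uses up the graph, which bounds
-- the number of edges, or leaves dense cores on both sides that are completely
-- joined to each other: a biclique with more than ℓ/2 vertices in each class.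
-- A second deletion process, relative to a maximal biclique K, bounds the number
-- of edges in terms of the sizes of the sides of K.  The bound of the theorem is
-- reached only if one side has ℓ-2 vertices and the other is a whole class, and
-- then the short cycles force the remaining vertices to share two neighbours.
-- For ℓ ≤ 6 the degree thresholds are too small for the general counting, and
-- cycles through small explicit configurations replace it.

open import Defs
open import Data.Nat using (ℕ; zero; suc; _+_; _*_; _∸_; _≤_; _<_; z≤n; s≤s; s≤s⁻¹; _≤?_; _<?_; _≟_)
open import Data.Nat.Properties
open import Data.Bool using (Bool; true; false; T; not; _∧_; if_then_else_)
open import Data.Bool.Properties using (T?; not-involutive) renaming (_≟_ to _≟ᵇ_)
open import Data.Fin using (Fin; toℕ; fromℕ; join; splitAt; punchIn; #_) renaming (zero to fzero; suc to fsuc)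
import Data.Fin.Properties as Fin
open import Data.Sum using (_⊎_; inj₁; inj₂; [_,_]′)
import Data.Sum.Properties as Sum
open import Data.Product using (Σ; ∃; _×_; _,_; proj₁; proj₂)
open import Data.Unit using (⊤; tt)
open import Data.Empty using (⊥; ⊥-elim)
open import Data.List using (List; []; _∷_; _++_; [_]; length; map; filter; lookup; tabulate; allFin; take; concat)
open import Data.List.Properties using (length-++; ++-assoc; length-map; length-tabulate; length-take; ∷-injective; map-++)
open import Data.List.Membership.Propositional using (_∈_; _∉_; find; lose)
open import Data.List.Membership.Propositional.Properties
open import Data.List.Relation.Unary.Any as Any using (Any; here; there)
open import Data.List.Relation.Unary.All as All using (All; []; _∷_)
import Data.List.Relation.Unary.All.Properties as All
open import Data.List.Relation.Unary.AllPairs as AllPairs using ([]; _∷_)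
open import Data.List.Relation.Unary.Unique.Propositional using (Unique)
import Data.List.Relation.Unary.Unique.Propositional.Properties as Uniq
open import Data.List.Relation.Binary.Permutation.Propositional using (_↭_; ↭⇒↭ₛ; ↭-sym; ↭-trans; ↭-refl; prep; ↭-reflexive; swap)
import Data.List.Relation.Binary.Permutation.Propositional.Properties as ↭
import Data.List.Relation.Binary.Permutation.Setoid.Properties as ↭S
open import Relation.Nullary using (¬_; Dec; yes; no; does)
open import Relation.Nullary.Decidable using (_×-dec_; _⊎-dec_; ¬?; decidable-stable; isYes; True; toWitness; fromWitness)
open import Relation.Unary using (Decidable)
open import Relation.Binary.PropositionalEquality hiding ([_])
open import Function using (_∘_; id)
open import Data.Nat.Tactic.RingSolver using (solve-∀)
import Data.List.Relation.Binary.Permutation.Propositional as ↭P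
open import Relation.Binary.Definitions using (tri<; tri≈; tri>)
import Data.List.Relation.Unary.Unique.DecPropositional as DecUnique
open import Data.Fin.Permutation using (Permutation; _⟨$⟩ʳ_; insert; insert-punchIn) renaming (id to idₚ)
import Data.List.Relation.Unary.AllPairs.Properties as AllPairs
open import Data.Sum.Function.Propositional using (_⊎-↔_)
open import Function.Bundles using (_⇔_; Inverse; Equivalence; mk⇔; mk↔ₛ′)
open import Function.Construct.Composition using (_↔-∘_; _⇔-∘_)

-- Trails and cycles

-- With m = ℓ - 2 the bound reads e + 2m ≤ mb + 2a. The obstacle is a loss of one for ends in a
-- common class: on a path with at least 2ℓ vertices, ends in different classes have at most ℓ
-- neighbours in total, but ends in the same class may have ℓ + 1. Thresholds for deleting vertices
-- of A and of B must therefore give sums of at least ℓ + 1 across the classes and ℓ + 2 within a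
-- class. For s + t = ℓ this is met by comparing the core for (s, t) with the core for (t, s), so
-- the two sides of the first biclique come from different cores. Near the extremal sizes for ℓ = 5
-- and ℓ = 6 the deletion relative to a biclique misses the second condition by one. A path with end
-- sum exactly ℓ + 1 has at most 3ℓ - 5 edges, few enough to name all its vertices and to find a
-- second way in and out of the biclique. The bound and its equality case are one argument: a graph
-- with at least mb + 2a - 2m edges is shown to have m vertices joined to the whole opposite class.

side : ∀ {a b} → Vertex a b → Bool
side (inj₁ _) = true
side (inj₂ _) = false

infix 4 _≟ᵛ_
_≟ᵛ_ : ∀ {a b} (u v : Vertex a b) → Dec (u ≡ v)
_≟ᵛ_ = Sum.≡-dec Fin._≟_ Fin._≟_

_∈?_ : ∀ {a b} (v : Vertex a b) (xs : List (Vertex a b)) → Dec (v ∈ xs)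
v ∈? xs = Any.any? (v ≟ᵛ_) xs

adj? : ∀ {a b} (E : BipGraph a b) u v → Dec (Adj E u v)
adj? E (inj₁ i) (inj₁ j) = no id
adj? E (inj₁ i) (inj₂ j) = T? (E i j)
adj? E (inj₂ i) (inj₁ j) = T? (E j i)
adj? E (inj₂ i) (inj₂ j) = no id

adj-sym : ∀ {a b} (E : BipGraph a b) u v → Adj E u v → Adj E v u
adj-sym E (inj₁ i) (inj₂ j) e = e
adj-sym E (inj₂ i) (inj₁ j) e = e

adj-side : ∀ {a b} (E : BipGraph a b) u v → Adj E u v → side v ≡ not (side u)
adj-side E (inj₁ i) (inj₂ j) e = refl
adj-side E (inj₂ i) (inj₁ j) e = refl

module _ {A : Set} where

  -- The first argument is the start of the trail. The reversed list ends there and loses the old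
  -- end, because the list of a trail omits its first vertex.
  rev : A → List A → List A
  rev u []       = []
  rev u (w ∷ xs) = rev w xs ++ u ∷ []

  rev-length : ∀ u xs → length (rev u xs) ≡ length xs
  rev-length u []       = refl
  rev-length u (w ∷ xs) = trans (length-++ (rev w xs)) (trans (+-comm _ 1) (cong suc (rev-length w xs)))

  unique-↭ : ∀ {xs ys : List A} → xs ↭ ys → Unique xs → Unique ys
  unique-↭ p = ↭S.Unique-resp-↭ (setoid A) (↭⇒↭ₛ p)

  unique-++ˡ : ∀ (xs : List A) {ys} → Unique (xs ++ ys) → Unique xs
  unique-++ˡ []       _        = []
  unique-++ˡ (x ∷ xs) (h ∷ un) = All.++⁻ˡ xs h ∷ unique-++ˡ xs un

  unique-++ʳ : ∀ (xs : List A) {ys} → Unique (xs ++ ys) → Unique ys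
  unique-++ʳ []       un       = un
  unique-++ʳ (x ∷ xs) (h ∷ un) = unique-++ʳ xs un

  unique-disj : ∀ (xs : List A) {ys} → Unique (xs ++ ys) → ∀ {v} → v ∈ xs → v ∈ ys → ⊥
  unique-disj (x ∷ xs) (h ∷ un) (here refl) m = All.lookup (All.++⁻ʳ xs h) m refl
  unique-disj (x ∷ xs) (h ∷ un) (there n)   m = unique-disj xs un n m

  unique-++ : ∀ {xs ys : List A} → Unique xs → Unique ys → (∀ {v} → v ∈ xs → v ∈ ys → ⊥) → Unique (xs ++ ys)
  unique-++ p q d = Uniq.++⁺ p q (λ (m , n) → d m n)

  unique-∷ : ∀ {x : A} {xs} → x ∉ xs → Unique xs → Unique (x ∷ xs)
  unique-∷ n un = All.¬Any⇒All¬ _ n ∷ un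

  lookup-inj : ∀ {xs : List A} → Unique xs → ∀ i j → lookup xs i ≡ lookup xs j → i ≡ j
  lookup-inj {_ ∷ _} (h ∷ un) fzero    fzero    eq = refl
  lookup-inj {_ ∷ _} (h ∷ un) fzero    (fsuc j) eq = ⊥-elim (All.lookup h (∈-lookup j) eq)
  lookup-inj {_ ∷ _} (h ∷ un) (fsuc i) fzero    eq = ⊥-elim (All.lookup h (∈-lookup i) (sym eq))
  lookup-inj {_ ∷ _} (h ∷ un) (fsuc i) (fsuc j) eq = cong fsuc (lookup-inj un i j eq)

parity : ℕ → Bool
parity zero    = false
parity (suc n) = not (parity n)

flipBy : Bool → Bool → Bool
flipBy true  s = not s
flipBy false s = s

-- The list of a trail omits its first vertex, so trails compose by _++_ and
-- a closed trail with a repetition-free list is a cycle.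
data Tr {a b} (E : BipGraph a b) : Vertex a b → List (Vertex a b) → Vertex a b → Set where
  []  : ∀ {u} → Tr E u [] u
  _∷_ : ∀ {u w xs v} → Adj E u w → Tr E w xs v → Tr E u (w ∷ xs) v

module _ {a b} {E : BipGraph a b} where

  private
    V : Set
    V = Vertex a b

  infixr 5 _++ᵗ_
  _++ᵗ_ : ∀ {u v w : V} {xs ys} → Tr E u xs v → Tr E v ys w → Tr E u (xs ++ ys) w
  []      ++ᵗ q = q
  (e ∷ p) ++ᵗ q = e ∷ (p ++ᵗ q)

  edge : ∀ {u v : V} → Adj E u v → Tr E u (v ∷ []) v
  edge e = e ∷ []

  revᵗ : ∀ {u xs v} → Tr E u xs v → Tr E v (rev u xs) u
  revᵗ []                  = []
  revᵗ {u} (_∷_ {w = w} e p) = revᵗ p ++ᵗ edge (adj-sym E u w e)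

  rev-↭ : ∀ {u xs v} → Tr E u xs v → v ∷ rev u xs ↭ u ∷ xs
  rev-↭ []                    = ↭-refl
  rev-↭ {u} {_} {v} (_∷_ {w = w} {xs = xs} e p) =
    ↭-trans (↭.++-comm (v ∷ rev w xs) (u ∷ [])) (prep u (rev-↭ p))

  end∈ : ∀ {u xs v} → Tr E u xs v → v ∈ u ∷ xs
  end∈ []      = here refl
  end∈ (e ∷ p) = there (end∈ p)

  ∈-rev : ∀ {u xs v w} → Tr E u xs v → w ∈ rev u xs → w ∈ u ∷ xs
  ∈-rev p m = ↭.∈-resp-↭ (rev-↭ p) (there m)

  split∈ : ∀ {u xs v w} → Tr E u xs v → w ∈ u ∷ xs →
    Σ (List V) λ ys → Σ (List V) λ zs → xs ≡ ys ++ zs × Tr E u ys w × Tr E w zs v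
  split∈ p       (here refl) = [] , _ , refl , [] , p
  split∈ []      (there ())
  split∈ (e ∷ p) (there m)   with split∈ p m
  ... | ys , zs , refl , q , r = _ ∷ ys , zs , refl , e ∷ q , r

  side-Tr : ∀ {u xs v} → Tr E u xs v → side v ≡ flipBy (parity (length xs)) (side u)
  side-Tr [] = refl
  side-Tr {u} {_ ∷ xs} (_∷_ {w = w} e p) with parity (length xs) | side-Tr p
  ... | true  | q = trans q (trans (cong not (adj-side E u w e)) (not-involutive _))
  ... | false | q = trans q (adj-side E u w e)

  closed-even : ∀ {u xs} → Tr E u xs u → parity (length xs) ≡ false
  closed-even {u} {xs} p with parity (length xs) | side-Tr p
  ... | false | _ = refl
  ... | true  | q with side u | q
  ...   | true  | ()
  ...   | false | ()

  private
    trNext : ∀ {u xs v} → Tr E u xs v → ∀ i j → suc (toℕ i) ≡ toℕ j → Adj E (lookup xs i) (lookup xs j)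
    trNext (e ∷ (e' ∷ p)) fzero (fsuc fzero) eq = e'
    trNext (e ∷ p) (fsuc i) (fsuc j) eq = trNext p i j (suc-injective eq)
    trNext (e ∷ (e' ∷ p)) fzero (fsuc (fsuc j)) ()

    trLast : ∀ {u xs v} → Tr E u xs v → ∀ i → suc (toℕ i) ≡ length xs → lookup xs i ≡ v
    trLast (e ∷ []) fzero eq = refl
    trLast (e ∷ p@(_ ∷ _)) (fsuc i) eq = trLast p i (suc-injective eq)

    trHead : ∀ {u xs v} → Tr E u xs v → ∀ i → toℕ i ≡ 0 → Adj E u (lookup xs i)
    trHead (e ∷ p) fzero eq = e

  closed⇒HasCycle : ∀ {u xs} → Tr E u xs u → Unique xs → 3 ≤ length xs → HasCycle E (length xs)
  closed⇒HasCycle {u} {xs} p un 3≤ = 3≤ , lookup xs , (λ {i} {j} → lookup-inj un i j) , adj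
    where
    adj : ∀ i j → Consecutive (length xs) i j → Adj E (lookup xs i) (lookup xs j)
    adj i j (inj₁ eq)        = trNext p i j eq
    adj i j (inj₂ (eq , z)) = subst (λ w → Adj E w (lookup xs j)) (sym (trLast p i eq)) (trHead p j z)

  tabTr : ∀ n (f : Fin (suc n) → V) → (∀ i j → suc (toℕ i) ≡ toℕ j → Adj E (f i) (f j)) →
    Tr E (f fzero) (tabulate (f ∘ fsuc)) (f (fromℕ n))
  tabTr zero    f h = []
  tabTr (suc n) f h = h fzero (fsuc fzero) refl ∷ tabTr n (f ∘ fsuc) (λ i j eq → h (fsuc i) (fsuc j) (cong suc eq))

  HasCycle⇒closed : ∀ {m} → HasCycle E m →
    Σ V λ u → Σ (List V) λ xs → Tr E u xs u × Unique xs × length xs ≡ m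
  HasCycle⇒closed {suc n} (3≤ , c , inj , adj) =
    c (fromℕ n) , tabulate c ,
    adj (fromℕ n) fzero (inj₂ (cong suc (Fin.toℕ-fromℕ n) , refl)) ∷ tabTr n c (λ i j eq → adj i j (inj₁ eq)) ,
    Uniq.tabulate⁺ inj , length-tabulate c

-- This bound makes the extension of a path inside its regions terminate.
unique-length : ∀ {a b} {xs : List (Vertex a b)} → Unique xs → length xs ≤ a + b
unique-length {a} {b} {xs} un = Fin.injective⇒≤ {f = λ i → join a b (lookup xs i)}
  (λ {i} {j} eq → lookup-inj un i j (join-inj _ _ eq))
  where
  join-inj : ∀ u v → join a b u ≡ join a b v → u ≡ v
  join-inj u v eq = trans (sym (Fin.splitAt-join a b u)) (trans (cong (splitAt a) eq) (Fin.splitAt-join a b v))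

-- Disjoint paths from 2-connectivity

-- The part of a walk between its last visit to `S` and the next visit to `T`, with loops removed.
-- If `S` is not visited after `u`, it begins at `u` itself.
record Segment {a b} (E : BipGraph a b) (P S T : Vertex a b → Set) (u : Vertex a b) : Set where
  field
    {from to} : Vertex a b
    {path}    : List (Vertex a b)
    start     : from ≡ u ⊎ S from
    trail     : Tr E from path to
    arrives   : T to
    uni       : Unique (from ∷ path)
    good      : ∀ {w} → w ∈ from ∷ path → P w
    leaves    : ∀ {w} → w ∈ path → ¬ S w
    firstHit  : ∀ {w} → w ∈ from ∷ path → T w → w ≡ to

module _ {a b} {E : BipGraph a b} {P S T : Vertex a b → Set}
         (S? : Decidable S) (T? : Decidable T) where

  segment : ∀ {u t} → Reach E P u t → T t → Segment E P S T u
  segment {u} (here p) t = record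
    { start = inj₁ refl ; trail = [] ; arrives = t ; uni = [] ∷ []
    ; good = λ { (here refl) → p } ; leaves = λ () ; firstHit = λ { (here refl) _ → refl } }
  segment {u} (step {w = w} p e r) t with segment r t
  ... | record { start = inj₂ s ; trail = tr ; arrives = ar ; uni = un ; good = g ; leaves = l ; firstHit = f } =
        record { start = inj₂ s ; trail = tr ; arrives = ar ; uni = un ; good = g ; leaves = l ; firstHit = f }
  ... | record { to = q ; path = zs ; start = inj₁ refl ; trail = tr ; arrives = ar ; uni = un ; good = g ; leaves = l ; firstHit = f }
      -- A start in `S` freezes the segment: the earlier part of the walk only leads to it.
      with S? w
  ...   | yes s = record { start = inj₂ s ; trail = tr ; arrives = ar ; uni = un ; good = g ; leaves = l ; firstHit = f }
  ...   | no ¬s with T? u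
  ...     | yes tu = record
    { start = inj₁ refl ; trail = [] ; arrives = tu ; uni = [] ∷ []
    ; good = λ { (here refl) → p } ; leaves = λ () ; firstHit = λ { (here refl) _ → refl } }
  ...     | no ¬tu with u ∈? (w ∷ zs)
  ...       | no u∉ = record
    { start = inj₁ refl ; trail = e ∷ tr ; arrives = ar ; uni = unique-∷ u∉ un
    ; good = λ { (here refl) → p ; (there m) → g m }
    ; leaves = λ { (here refl) → ¬s ; (there m) → l m }
    ; firstHit = λ { (here refl) tu → ⊥-elim (¬tu tu) ; (there m) → f m } }
  ...       | yes u∈ with split∈ tr u∈
  ...         | ys , zs' , refl , tr₀ , tr' = record
    { start = inj₁ refl ; trail = tr' ; arrives = ar ; uni = un'
    ; good = λ m → g (back m) ; leaves = λ m → l (∈-++⁺ʳ ys m) ; firstHit = λ m → f (back m) }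
    where
    back : ∀ {v} → v ∈ u ∷ zs' → v ∈ w ∷ ys ++ zs'
    back (here refl) = u∈
    back (there m)   = there (∈-++⁺ʳ ys m)
    un' : Unique (u ∷ zs')
    un' = unique-∷ (unique-disj (w ∷ ys) un (end∈ tr₀)) (unique-++ʳ (w ∷ ys) un)

Robust : ∀ {a b} → BipGraph a b → Set
Robust {a} {b} E = ∀ (x u v : Vertex a b) → u ≢ x → v ≢ x → Reach E (λ w → w ≢ x) u v

-- Two disjoint paths leaving Lf ∪ {ps}, one of them from ps, and reaching
-- {v} ∪ suf, one of them at v.
record Half {a b} (E : BipGraph a b) (Lf : List (Vertex a b)) (s e : Vertex a b) : Set where
  constructor half
  field
    vs   : List (Vertex a b)
    tr   : Tr E s vs e
    uni  : Unique (s ∷ vs)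
    away : ∀ {w} → w ∈ vs → w ∉ Lf
open Half public

record Link {a b} (E : BipGraph a b) (Lf : List (Vertex a b)) (ps v : Vertex a b) (suf : List (Vertex a b)) : Set where
  field
    {z q dh oh} : Vertex a b
    D     : Half E Lf ps dh
    O     : Half E Lf z oh
    z∈    : z ∈ Lf
    q∈    : q ∈ suf
    disj  : ∀ {w} → w ∈ ps ∷ vs D → w ∈ z ∷ vs O → ⊥
    onlyD : ∀ {w} → w ∈ ps ∷ vs D → w ∈ suf → w ≡ q
    onlyO : ∀ {w} → w ∈ z ∷ vs O → w ∈ suf → w ≡ q
    ends  : (dh ≡ v × oh ≡ q) ⊎ (dh ≡ q × oh ≡ v)

module _ {a b} {E : BipGraph a b} {Lf : List (Vertex a b)} where

  private
    V : Set
    V = Vertex a b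

    extend : ∀ {s e v'} (H : Half E Lf s e) → Adj E e v' → v' ∉ Lf → v' ∉ s ∷ vs H →
      Σ (Half E Lf s v') λ H' → ∀ {w} → w ∈ s ∷ vs H' → w ∈ s ∷ vs H ⊎ w ≡ v'
    extend {s} {e} {v'} H adj v'∉L v'∉ =
      half (vs H ++ [ v' ]) (tr H ++ᵗ edge adj)
        (unique-++ (uni H) ([] ∷ []) λ { m (here refl) → v'∉ m })
        (λ m → [ away H , (λ { (here refl) → v'∉L }) ]′ (∈-++⁻ (vs H) m)) ,
      λ { (here refl) → inj₁ (here refl)
        ; (there m) → [ (λ n → inj₁ (there n)) , (λ { (here refl) → inj₂ refl }) ]′ (∈-++⁻ (vs H) m) }

    toNext : ∀ {s e v v'} (H : Half E Lf s e) → Adj E v v' → v' ∉ Lf →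
      (e ≡ v × v' ∉ s ∷ vs H) ⊎ e ≡ v' →
      Σ (Half E Lf s v') λ H' → ∀ {w} → w ∈ s ∷ vs H' → w ∈ s ∷ vs H ⊎ w ≡ v'
    toNext H adj n (inj₁ (refl , n')) = extend H adj n n'
    toNext H adj n (inj₂ refl)        = H , inj₁

    -- Follow `H` as far as `z₀` and leave along `zs`. The clause `w ≡ e → z₀ ≡ e` records that the
    -- old end survives only if the cut is made there.
    cutJoin : ∀ {s e z₀ q'} {zs : List V} (H : Half E Lf s e) → z₀ ∈ s ∷ vs H → Tr E z₀ zs q' →
      Unique (z₀ ∷ zs) → (∀ {w} → w ∈ zs → w ∉ Lf × w ∉ s ∷ vs H) →
      Σ (Half E Lf s q') λ H' →
        (∀ {w} → w ∈ s ∷ vs H' → w ∈ s ∷ vs H × (w ≡ e → z₀ ≡ e) ⊎ w ∈ zs)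
    cutJoin {s} {e} {z₀} {_} {zs} H z₀∈ tz uz out with split∈ (tr H) z₀∈ | uni H
    ... | ys , ws , eq , t₁ , t₂ | uH rewrite eq =
      half (ys ++ zs) (t₁ ++ᵗ tz)
        (unique-++ (unique-++ˡ (s ∷ ys) uH) (AllPairs.tail uz) (λ m n → proj₂ (out n) (up m)))
        (λ m → [ (λ n → away H (subst (_ ∈_) (sym eq) (∈-++⁺ˡ n))) , (λ n → proj₁ (out n)) ]′ (∈-++⁻ ys m)) ,
      λ m → [ (λ n → inj₁ (up n , λ { refl → end-eq n })) , inj₂ ]′ (∈-++⁻ (s ∷ ys) m)
      where
      up : ∀ {w} → w ∈ s ∷ ys → w ∈ s ∷ ys ++ ws
      up = ∈-++⁺ˡ
      end-eq : e ∈ s ∷ ys → z₀ ≡ e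
      end-eq m with end∈ t₂
      ... | here refl = refl
      ... | there n   = ⊥-elim (unique-disj (s ∷ ys) uH m n)

  -- The path from `ps` is trivial, and deleting `ps` leaves a path from `Lf` to `suf`.
  linkStart : Robust E → ∀ {x y ps suf} → x ∈ Lf → y ∈ suf → ps ∉ Lf → ps ∉ suf →
    Link E Lf ps ps suf
  linkStart rob {x} {y} {ps} {suf} x∈ y∈ ps∉L ps∉s
    with segment {S = _∈ Lf} {T = _∈ suf} (_∈? Lf) (_∈? suf)
           (rob ps x y (λ { refl → ps∉L x∈ }) (λ { refl → ps∉s y∈ })) y∈
  ... | record { from = z ; to = q ; path = zs ; start = st ; trail = t ; arrives = ar ; uni = un ; good = g ; leaves = l ; firstHit = f } =
    record
      { D = half [] [] ([] ∷ []) (λ ())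
      ; O = half zs t un l
      ; z∈ = [ (λ { refl → x∈ }) , id ]′ st
      ; q∈ = ar
      ; disj = λ { (here refl) m → g m refl }
      ; onlyD = λ { (here refl) m → ⊥-elim (ps∉s m) }
      ; onlyO = f
      ; ends = inj₁ (refl , refl) }

  private
    -- The path `X` that takes the detour now ends at `q'`, so `Y` has to reach `v'`. Either it ends
    -- there already, or it ends at `v` and can use the edge to `v'`: the cut has removed `v'` from
    -- `X`, as the detour avoids it.
    cutStep : ∀ {s₁ s₂ h₁ h₂ v v' q' z₀ suf'} {zs : List V}
      (X : Half E Lf s₁ h₁) (Y : Half E Lf s₂ h₂) →
      (∀ {w} → w ∈ s₁ ∷ vs X → w ∈ s₂ ∷ vs Y → ⊥) →
      (h₁ ≡ v × h₂ ≡ v') ⊎ (h₁ ≡ v' × h₂ ≡ v) →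
      Adj E v v' → v' ∉ Lf → v' ∉ suf' →
      (∀ {w} → w ∈ s₁ ∷ vs X → w ∉ suf') → (∀ {w} → w ∈ s₂ ∷ vs Y → w ∉ suf') →
      z₀ ∈ s₁ ∷ vs X → Tr E z₀ zs q' → Unique (z₀ ∷ zs) → (∀ {w} → w ∈ z₀ ∷ zs → w ≢ v') →
      (∀ {w} → w ∈ zs → w ∉ Lf × w ∉ s₁ ∷ vs X × w ∉ s₂ ∷ vs Y) →
      (∀ {w} → w ∈ z₀ ∷ zs → w ∈ suf' → w ≡ q') →
      Σ (Half E Lf s₁ q') λ X' → Σ (Half E Lf s₂ v') λ Y' →
        (∀ {w} → w ∈ s₁ ∷ vs X' → w ∈ s₂ ∷ vs Y' → ⊥) ×
        (∀ {w} → w ∈ s₁ ∷ vs X' → w ∈ suf' → w ≡ q') ×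
        (∀ {w} → w ∈ s₂ ∷ vs Y' → w ∈ suf' → w ≡ q')
    cutStep {s₁} {s₂} {h₁} {h₂} {v} {v'} {q'} {z₀} {suf'} {zs} X Y dj en adj v'∉L v'∉s nX nY z₀∈ tz uz av out fh =
      X' , Y' , dj' , oX , oY
      where
      XX = cutJoin X z₀∈ tz uz (λ m → proj₁ (out m) , proj₁ (proj₂ (out m)))
      X' = proj₁ XX
      pos : (h₁ ≡ v × h₂ ≡ v') ⊎ (h₁ ≡ v' × h₂ ≡ v) → (h₂ ≡ v × v' ∉ s₂ ∷ vs Y) ⊎ h₂ ≡ v'
      pos (inj₁ (_ , e))    = inj₂ e
      pos (inj₂ (refl , e)) = inj₁ (e , λ m → dj (end∈ (tr X)) m)
      YY = toNext Y adj v'∉L (pos en)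
      Y' = proj₁ YY
      v'∉X' : (h₁ ≡ v × h₂ ≡ v') ⊎ (h₁ ≡ v' × h₂ ≡ v) → v' ∉ s₁ ∷ vs X'
      v'∉X' en m with proj₂ XX m
      ... | inj₂ n = av (there n) refl
      v'∉X' (inj₁ (_ , refl)) m | inj₁ (n , _) = dj n (end∈ (tr Y))
      v'∉X' (inj₂ (refl , _)) m | inj₁ (n , k) = av (here refl) (k refl)
      dj' : ∀ {w} → w ∈ s₁ ∷ vs X' → w ∈ s₂ ∷ vs Y' → ⊥
      dj' m n with proj₂ YY n
      ... | inj₂ refl = v'∉X' en m
      ... | inj₁ n' with proj₂ XX m
      ...   | inj₁ (m' , _) = dj m' n'
      ...   | inj₂ m'       = proj₂ (proj₂ (out m')) n'
      oX : ∀ {w} → w ∈ s₁ ∷ vs X' → w ∈ suf' → w ≡ q'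
      oX m n with proj₂ XX m
      ... | inj₁ (m' , _) = ⊥-elim (nX m' n)
      ... | inj₂ m'       = fh (there m') n
      oY : ∀ {w} → w ∈ s₂ ∷ vs Y' → w ∈ suf' → w ≡ q'
      oY m n with proj₂ YY m
      ... | inj₂ refl = ⊥-elim (v'∉s n)
      ... | inj₁ m'   = ⊥-elim (nY m' n)

  -- One augmentation as in Menger's theorem for two paths. If `q` is not `v'`, the edge from `v` to
  -- `v'` extends the path ending at `v`. Otherwise the target `q` has left the suffix, and a path
  -- avoiding `v'` supplies a new one: from its last meeting with `Lf` and the two paths it reroutes
  -- one of them or replaces `O`.
  linkStep : Robust E → ∀ {x y ps v v' suf'} → Link E Lf ps v (v' ∷ suf') → Adj E v v' →
    x ∈ Lf → y ∈ suf' → v' ∉ Lf → v' ∉ suf' → Link E Lf ps v' suf'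
  linkStep rob {x} {y} {ps} {v} {v'} {suf'} L adj x∈ y∈ v'∉L v'∉s with Link.q L ≟ᵛ v'
  ... | no q≢ = ext (ends)
    where
    open Link L
    q∈' : q ∈ suf'
    q∈' with q∈
    ... | here e  = ⊥-elim (q≢ e)
    ... | there m = m
    v'∉D : v' ∉ ps ∷ vs D
    v'∉D m = q≢ (sym (onlyD m (here refl)))
    v'∉O : v' ∉ z ∷ vs O
    v'∉O m = q≢ (sym (onlyO m (here refl)))
    ext : (dh ≡ v × oh ≡ q) ⊎ (dh ≡ q × oh ≡ v) → Link E Lf ps v' suf'
    ext (inj₁ (refl , eq)) with extend D adj v'∉L v'∉D
    ... | D' , k = record { D = D' ; O = O ; z∈ = z∈ ; q∈ = q∈'
      ; disj = λ m n → [ (λ m' → disj m' n) , (λ { refl → v'∉O n }) ]′ (k m)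
      ; onlyD = λ m n → [ (λ m' → onlyD m' (there n)) , (λ { refl → ⊥-elim (v'∉s n) }) ]′ (k m)
      ; onlyO = λ m n → onlyO m (there n) ; ends = inj₁ (refl , eq) }
    ext (inj₂ (eq , refl)) with extend O adj v'∉L v'∉O
    ... | O' , k = record { D = D ; O = O' ; z∈ = z∈ ; q∈ = q∈'
      ; disj = λ m n → [ (λ n' → disj m n') , (λ { refl → v'∉D m }) ]′ (k n)
      ; onlyD = λ m n → onlyD m (there n)
      ; onlyO = λ m n → [ (λ m' → onlyO m' (there n)) , (λ { refl → ⊥-elim (v'∉s n) }) ]′ (k m)
      ; ends = inj₂ (eq , refl) }
  ... | yes refl = res
    where
    open Link L
    S : V → Set
    S w = w ∈ Lf ⊎ (w ∈ ps ∷ vs D ⊎ w ∈ z ∷ vs O)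
    detour = segment {S = S} {T = _∈ suf'} (λ w → (w ∈? Lf) ⊎-dec ((w ∈? (ps ∷ vs D)) ⊎-dec (w ∈? (z ∷ vs O))))
      (_∈? suf') (rob v' x y (λ { refl → v'∉L x∈ }) (λ { refl → v'∉s y∈ })) y∈
    open Segment detour renaming (uni to unZ)
    nD : ∀ {w} → w ∈ ps ∷ vs D → w ∉ suf'
    nD m n with onlyD m (there n)
    ... | refl = v'∉s n
    nO : ∀ {w} → w ∈ z ∷ vs O → w ∉ suf'
    nO m n with onlyO m (there n)
    ... | refl = v'∉s n
    fresh : from ∈ Lf → from ∉ ps ∷ vs D → Link E Lf ps v' suf'
    fresh f∈ f∉ with toNext D adj v'∉L ([ (λ { (e , refl) → inj₁ (e , λ k → disj k (end∈ (tr O))) }) , (λ (e , _) → inj₂ e) ]′ ends)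
    ... | D' , k = record
      { D = D' ; O = half path trail unZ (λ n l → leaves n (inj₁ l)) ; z∈ = f∈ ; q∈ = arrives
      ; disj = dj ; onlyD = λ m n → [ (λ m' → ⊥-elim (nD m' n)) , (λ { refl → ⊥-elim (v'∉s n) }) ]′ (k m)
      ; onlyO = firstHit ; ends = inj₁ (refl , refl) }
      where
      dj : ∀ {w} → w ∈ ps ∷ vs D' → w ∈ from ∷ path → ⊥
      dj m n with k m
      ... | inj₂ refl = good n refl
      dj m (here refl) | inj₁ m' = f∉ m'
      dj m (there n)   | inj₁ m' = leaves n (inj₂ (inj₁ m'))
    res : Link E Lf ps v' suf'
    res with from ∈? (ps ∷ vs D)
    ... | yes m with cutStep D O disj ends adj v'∉L v'∉s nD nO m trail unZ good
                       (λ n → (λ k → leaves n (inj₁ k)) , (λ k → leaves n (inj₂ (inj₁ k))) , (λ k → leaves n (inj₂ (inj₂ k)))) firstHit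
    ...   | D' , O' , dj , oD , oO = record { D = D' ; O = O' ; z∈ = z∈ ; q∈ = arrives ; disj = dj ; onlyD = oD ; onlyO = oO ; ends = inj₂ (refl , refl) }
    res | no m∉D with from ∈? (z ∷ vs O)
    ... | yes m with cutStep O D (λ k l → disj l k) ([ (λ (p , q) → inj₂ (q , p)) , (λ (p , q) → inj₁ (q , p)) ]′ ends) adj v'∉L v'∉s nO nD m trail unZ good
                       (λ n → (λ k → leaves n (inj₁ k)) , (λ k → leaves n (inj₂ (inj₂ k))) , (λ k → leaves n (inj₂ (inj₁ k)))) firstHit
    ...   | O' , D' , dj , oO , oD = record { D = D' ; O = O' ; z∈ = z∈ ; q∈ = arrives ; disj = λ k l → dj l k ; onlyD = oD ; onlyO = oO ; ends = inj₁ (refl , refl) }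
    res | no m∉D | no m∉O with start
    ... | inj₂ (inj₂ (inj₁ m)) = ⊥-elim (m∉D m)
    ... | inj₂ (inj₂ (inj₂ m)) = ⊥-elim (m∉O m)
    ... | inj₁ eq              = fresh (subst (_∈ Lf) (sym eq) x∈) m∉D
    ... | inj₂ (inj₁ m)        = fresh m m∉D

  -- Advancing the frontier along `M` turns the trivial link at `ps` into two disjoint paths that
  -- bridge the whole of `M`.
  linkAlong : Robust E → ∀ {x y ps v} (M : List V) {R t} → Link E Lf ps v (M ++ R) → Tr E v M t →
    x ∈ Lf → y ∈ R → (∀ {w} → w ∈ M → w ∉ Lf) → Unique (M ++ R) → Link E Lf ps t R
  linkAlong rob []      L []       x∈ y∈ aw un       = L
  linkAlong rob (w ∷ M) L (e ∷ t) x∈ y∈ aw (h ∷ un) =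
    linkAlong rob M (linkStep rob L e x∈ (∈-++⁺ʳ M y∈) (aw (here refl)) (λ m → All.lookup h m refl)) t
      x∈ y∈ (λ m → aw (there m)) un

-- Neighbours along a path

splitFirst : ∀ {A : Set} {Q : A → Set} → Decidable Q → (xs : List A) →
  (Σ (List A) λ l → Σ A λ p → Σ (List A) λ r → xs ≡ l ++ p ∷ r × Q p × All (λ w → ¬ Q w) l) ⊎ All (λ w → ¬ Q w) xs
splitFirst Q? []       = inj₂ []
splitFirst Q? (x ∷ xs) with Q? x
... | yes q = inj₁ ([] , x , xs , refl , q , [])
... | no ¬q with splitFirst Q? xs
...   | inj₁ (l , p , r , refl , q , h) = inj₁ (x ∷ l , p , r , refl , q , ¬q ∷ h)
...   | inj₂ h = inj₂ (¬q ∷ h)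

splitLast : ∀ {A : Set} {Q : A → Set} → Decidable Q → (xs : List A) →
  (Σ (List A) λ l → Σ A λ p → Σ (List A) λ r → xs ≡ l ++ p ∷ r × Q p × All (λ w → ¬ Q w) r) ⊎ All (λ w → ¬ Q w) xs
splitLast Q? []       = inj₂ []
splitLast Q? (x ∷ xs) with splitLast Q? xs
... | inj₁ (l , p , r , refl , q , h) = inj₁ (x ∷ l , p , r , refl , q , h)
... | inj₂ h with Q? x
...   | yes q = inj₁ ([] , x , xs , refl , q , h)
...   | no ¬q = inj₂ (¬q ∷ h)

endOf : ∀ {A : Set} → A → List A → A
endOf u []       = u
endOf u (w ∷ ws) = endOf w ws

endOf-++ : ∀ {A : Set} (u : A) xs w ys → endOf u (xs ++ w ∷ ys) ≡ endOf w ys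
endOf-++ u []       w ys = refl
endOf-++ u (x ∷ xs) w ys = endOf-++ x xs w ys

bit : ∀ {A : Set} → Dec A → ℕ
bit d = if does d then 1 else 0

bit≤1 : ∀ {A : Set} (d : Dec A) → bit d ≤ 1
bit≤1 (yes _) = ≤-refl
bit≤1 (no _)  = z≤n

bit-no : ∀ {A : Set} (d : Dec A) → ¬ A → bit d ≡ 0
bit-no (yes a) n = ⊥-elim (n a)
bit-no (no _)  n = refl

bit-excl : ∀ {A B : Set} (d : Dec A) (e : Dec B) → ¬ (A × B) → bit d + bit e ≤ 1
bit-excl (yes a) (yes b) n = ⊥-elim (n (a , b))
bit-excl (yes a) (no _)  n = ≤-refl
bit-excl (no _)  e       n = bit≤1 e

module _ {a b} (E : BipGraph a b) where

  private
    V : Set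
    V = Vertex a b

  nb : V → List V → ℕ
  nb x []       = 0
  nb x (w ∷ ws) = bit (adj? E x w) + nb x ws

  nb-++ : ∀ x xs ys → nb x (xs ++ ys) ≡ nb x xs + nb x ys
  nb-++ x []       ys = refl
  nb-++ x (w ∷ xs) ys = trans (cong (bit (adj? E x w) +_) (nb-++ x xs ys)) (sym (+-assoc (bit (adj? E x w)) _ _))

  nb-none : ∀ x xs → All (λ w → ¬ Adj E x w) xs → nb x xs ≡ 0
  nb-none x []       []      = refl
  nb-none x (w ∷ xs) (n ∷ h) = cong₂ _+_ (bit-no (adj? E x w) n) (nb-none x xs h)

  sameSide-nonadj : ∀ {u v : V} → side u ≡ side v → ¬ Adj E u v
  sameSide-nonadj {u} {v} eq e with side u | side v | adj-side E u v e | eq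
  ... | true  | false | refl | ()
  ... | false | true  | refl | ()

  δ : V → V → ℕ
  δ (inj₁ _) (inj₁ _) = 0
  δ (inj₂ _) (inj₂ _) = 0
  δ (inj₁ _) (inj₂ _) = 1
  δ (inj₂ _) (inj₁ _) = 1

  δ-next : ∀ x u w → Adj E u w → δ x u + δ x w ≡ 1
  δ-next (inj₁ _) (inj₁ _) (inj₂ _) e = refl
  δ-next (inj₁ _) (inj₂ _) (inj₁ _) e = refl
  δ-next (inj₂ _) (inj₁ _) (inj₂ _) e = refl
  δ-next (inj₂ _) (inj₂ _) (inj₁ _) e = refl

  bit≤δ : ∀ x u → bit (adj? E x u) ≤ δ x u
  bit≤δ (inj₁ _) (inj₁ _) = z≤n
  bit≤δ (inj₁ i) (inj₂ j) = bit≤1 (adj? E (inj₁ i) (inj₂ j))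
  bit≤δ (inj₂ i) (inj₁ j) = bit≤1 (adj? E (inj₂ i) (inj₁ j))
  bit≤δ (inj₂ _) (inj₂ _) = z≤n

  δ-same : ∀ x u → side x ≡ side u → δ x u ≡ 0
  δ-same (inj₁ _) (inj₁ _) e = refl
  δ-same (inj₂ _) (inj₂ _) e = refl

  δ≤1 : ∀ x u → δ x u ≤ 1
  δ≤1 (inj₁ _) (inj₁ _) = z≤n
  δ≤1 (inj₁ _) (inj₂ _) = ≤-refl
  δ≤1 (inj₂ _) (inj₁ _) = ≤-refl
  δ≤1 (inj₂ _) (inj₂ _) = z≤n

  -- Neighbours of x occupy every other position of a trail.
  nb-half : ∀ x {u xs v} → Tr E u xs v → 2 * nb x (u ∷ xs) ≤ length xs + δ x u + δ x v
  nb-half x {u} [] = begin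
    2 * (bit (adj? E x u) + 0) ≡⟨ cong (2 *_) (+-identityʳ (bit (adj? E x u))) ⟩
    2 * bit (adj? E x u)       ≤⟨ *-monoʳ-≤ 2 (bit≤δ x u) ⟩
    2 * δ x u                  ≡⟨ cong (δ x u +_) (+-identityʳ (δ x u)) ⟩
    δ x u + δ x u              ∎
    where open ≤-Reasoning
  nb-half x {u} {w ∷ ws} {v} (e ∷ t) = begin
    2 * (bit (adj? E x u) + nb x (w ∷ ws))      ≡⟨ *-distribˡ-+ 2 (bit (adj? E x u)) _ ⟩
    2 * bit (adj? E x u) + 2 * nb x (w ∷ ws)    ≤⟨ +-mono-≤ (*-monoʳ-≤ 2 (bit≤δ x u)) (nb-half x t) ⟩
    2 * δ x u + (length ws + δ x w + δ x v)     ≡⟨ arith (δ x u) (length ws) (δ x w) (δ x v) ⟩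
    length ws + (δ x u + δ x w) + δ x u + δ x v ≡⟨ cong (λ k → length ws + k + δ x u + δ x v) (δ-next x u w e) ⟩
    length ws + 1 + δ x u + δ x v               ≡⟨ cong (λ k → k + δ x u + δ x v) (+-comm (length ws) 1) ⟩
    suc (length ws) + δ x u + δ x v             ∎
    where
    open ≤-Reasoning
    arith : ∀ p l q r → 2 * p + (l + q + r) ≡ l + (p + q) + p + r
    arith = solve-∀

  splitTr : ∀ {u} xs {ys v} → Tr E u (xs ++ ys) v → Tr E u xs (endOf u xs) × Tr E (endOf u xs) ys v
  splitTr []       t       = [] , t
  splitTr (x ∷ xs) (e ∷ t) = let p , q = splitTr xs t in e ∷ p , q

-- Cycles are even, so excluding the lengths from 2l on bounds them by 2l - 2.
EvenShort : ∀ {a b} → BipGraph a b → ℕ → Set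
EvenShort {a} {b} E l = ∀ {u : Vertex a b} {xs} → Tr E u xs u → Unique xs → 2 + length xs ≤ 2 * l

-- Cycles through the neighbours of both ends

module _ {a b} {E : BipGraph a b} where

  private
    V : Set
    V = Vertex a b

  ≢-adj : ∀ {u v : V} → Adj E u v → u ≢ v
  ≢-adj {u} e refl = sameSide-nonadj E {u} refl e

  -- From z walk back to x, jump to the first neighbour of x after z, and
  -- walk on to ps: no neighbour of x is missed.
  leftRoute : ∀ {x L ps z} → Tr E x (L ++ [ ps ]) ps → Unique (x ∷ L ++ [ ps ]) → Adj E x ps → z ∈ x ∷ L →
    Σ (List V) λ Lr → Tr E z Lr ps × Unique (z ∷ Lr) × (∀ {w} → w ∈ Lr → w ∈ x ∷ L ++ [ ps ]) ×
      2 * nb E x (x ∷ L ++ [ ps ]) ≤ length Lr + 2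
  leftRoute {x} {L} {ps} {z} t un e z∈ with split∈ t (∈-++⁺ˡ z∈)
  ... | Z₁ , Z₂ , eq , t₁ , t₂ with splitFirst (adj? E x) Z₂
  ...   | inj₂ none = ⊥-elim (All.lookup none (endIn t₂ z≢) e)
    where
    z≢ : z ≢ ps
    z≢ refl = unique-disj (x ∷ L) un z∈ (here refl)
    endIn : ∀ {u xs v} → Tr E u xs v → u ≢ v → v ∈ xs
    endIn t n with end∈ t
    ... | here refl = ⊥-elim (n refl)
    ... | there m   = m
  ...   | inj₁ (m , k , n , refl , xk , none) rewrite eq =
    rev x Z₁ ++ k ∷ n , revᵗ t₁ ++ᵗ (xk ∷ tk) , un' , sub , count
    where
    tk : Tr E k n ps
    tk with splitTr E m t₂
    ... | _ , (_ ∷ q) = q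
    unR : Unique (z ∷ rev x Z₁)
    unR = unique-↭ (↭-sym (rev-↭ t₁)) (unique-++ˡ (x ∷ Z₁) un)
    toR : ∀ {w} → w ∈ z ∷ rev x Z₁ → w ∈ x ∷ Z₁
    toR = ↭.∈-resp-↭ (rev-↭ t₁)
    un' : Unique ((z ∷ rev x Z₁) ++ k ∷ n)
    un' = unique-++ unR (unique-++ʳ m (unique-++ʳ (x ∷ Z₁) un))
            (λ p q → unique-disj (x ∷ Z₁) un (toR p) (∈-++⁺ʳ m q))
    sub : ∀ {w} → w ∈ rev x Z₁ ++ k ∷ n → w ∈ x ∷ Z₁ ++ (m ++ k ∷ n)
    sub w∈ = [ (λ p → ∈-++⁺ˡ (toR (there p))) , (λ q → ∈-++⁺ʳ (x ∷ Z₁) (∈-++⁺ʳ m q)) ]′ (∈-++⁻ (rev x Z₁) w∈)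
    open ≤-Reasoning
    lem : ∀ p q → 2 * (p + (0 + q)) ≡ 2 * p + 2 * q
    lem = solve-∀
    lem2 : ∀ z n → (z + 0 + 1) + (n + 1 + 1) ≡ (z + suc n) + 2
    lem2 = solve-∀
    count : 2 * nb E x (x ∷ Z₁ ++ (m ++ k ∷ n)) ≤ length (rev x Z₁ ++ k ∷ n) + 2
    count = begin
      2 * nb E x ((x ∷ Z₁) ++ (m ++ k ∷ n))
        ≡⟨ cong (2 *_) (nb-++ E x (x ∷ Z₁) (m ++ k ∷ n)) ⟩
      2 * (nb E x (x ∷ Z₁) + nb E x (m ++ k ∷ n))
        ≡⟨ cong (λ c → 2 * (nb E x (x ∷ Z₁) + c)) (trans (nb-++ E x m (k ∷ n)) (cong (_+ nb E x (k ∷ n)) (nb-none E x m none))) ⟩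
      2 * (nb E x (x ∷ Z₁) + (0 + nb E x (k ∷ n)))
        ≡⟨ lem (nb E x (x ∷ Z₁)) (nb E x (k ∷ n)) ⟩
      2 * nb E x (x ∷ Z₁) + 2 * nb E x (k ∷ n)
        ≤⟨ +-mono-≤ (nb-half E x t₁) (nb-half E x tk) ⟩
      (length Z₁ + δ E x x + δ E x z) + (length n + δ E x k + δ E x ps)
        ≤⟨ +-mono-≤ (+-mono-≤ (≤-reflexive (cong (length Z₁ +_) (δ-same E x x refl))) (δ≤1 E x z))
                    (+-mono-≤ (+-monoʳ-≤ (length n) (δ≤1 E x k)) (δ≤1 E x ps)) ⟩
      (length Z₁ + 0 + 1) + (length n + 1 + 1)
        ≡⟨ lem2 (length Z₁) (length n) ⟩
      (length Z₁ + suc (length n)) + 2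
        ≡⟨ cong (_+ 2) (trans (cong (_+ suc (length n)) (sym (rev-length x Z₁))) (sym (length-++ (rev x Z₁)))) ⟩
      length (rev x Z₁ ++ k ∷ n) + 2 ∎

  nb-↭ : ∀ x {xs ys} → xs ↭ ys → nb E x xs ≡ nb E x ys
  nb-↭ x ↭P.refl          = refl
  nb-↭ x (prep w p)    = cong (bit (adj? E x w) +_) (nb-↭ x p)
  nb-↭ x (swap u w p)  = trans (cong (λ c → bit (adj? E x u) + (bit (adj? E x w) + c)) (nb-↭ x p))
    (lem (bit (adj? E x u)) (bit (adj? E x w)) _)
    where lem : ∀ p q r → p + (q + r) ≡ q + (p + r)
          lem = solve-∀
  nb-↭ x (↭P.trans p q) = trans (nb-↭ x p) (nb-↭ x q)

  -- The mirror image of `leftRoute`, obtained by reversing both the path and the route.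
  rightRoute : ∀ {y R pt q} → Tr E pt R y → Unique (pt ∷ R) → Adj E y pt → q ∈ R →
    Σ (List V) λ W → Tr E pt W q × Unique (pt ∷ W) × (∀ {w} → w ∈ pt ∷ W → w ∈ pt ∷ R) ×
      2 * nb E y (pt ∷ R) ≤ length W + 2
  rightRoute {y} {w ∷ R} {pt} {q} t un e q∈
    with leftRoute (revᵗ t) (unique-↭ (↭-sym (rev-↭ t)) un) e q∈'
    where
    q∈' : q ∈ y ∷ rev w R
    q∈' with ∈-++⁻ (y ∷ rev w R) (↭.∈-resp-↭ (↭-sym (rev-↭ t)) (there q∈))
    ... | inj₁ m = m
    ... | inj₂ (here refl) = ⊥-elim (unique-disj [ pt ] un (here refl) q∈)
  ... | Lr , tl , unl , sub , cnt =
    rev q Lr , revᵗ tl , unique-↭ (↭-sym (rev-↭ tl)) unl , subW ,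
    subst₂ (λ c d → 2 * c ≤ d + 2) (nb-↭ y (rev-↭ t)) (sym (rev-length q Lr)) cnt
    where
    subW : ∀ {v} → v ∈ pt ∷ rev q Lr → v ∈ pt ∷ w ∷ R
    subW m with ↭.∈-resp-↭ (rev-↭ tl) m
    ... | here refl = there q∈
    ... | there k   = ↭.∈-resp-↭ (rev-↭ t) (sub k)

  -- Intended for `ps` the last neighbour of `x` and `pt` the first neighbour of `y`. Each of the
  -- two routes falls short by 2, the path between them that leaves `x ∷ L` gives back 1, and the
  -- one from `ps` gives back another 1 unless `ps` and `pt` coincide.
  LinkedCycle : (x y : V) (L : List V) (ps pt : V) (R : List V) → Set
  LinkedCycle x y L ps pt R =
    Σ V λ u → Σ (List V) λ cs → Tr E u cs u × Unique cs ×
      2 * nb E x (x ∷ L ++ [ ps ]) + 2 * nb E y (pt ∷ R) ≤ length cs + 3 ×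
      (ps ≢ pt → 2 * nb E x (x ∷ L ++ [ ps ]) + 2 * nb E y (pt ∷ R) ≤ length cs + 2)

  private
    closeLink : ∀ {x y L ps M pt R} → Tr E x (L ++ [ ps ]) ps → Tr E ps M pt → Tr E pt R y →
      Unique (x ∷ L ++ ps ∷ M ++ R) → Adj E x ps → Adj E y pt → Link E (x ∷ L) ps pt R →
      LinkedCycle x y L ps pt R
    closeLink {x} {y} {L} {ps} {M} {pt} {R} tl tm tr un xps ypt
      record { z = z ; q = q ; dh = dh ; oh = oh ; D = D ; O = O ; z∈ = z∈ ; q∈ = q∈ ; disj = disj ; onlyD = onlyD ; onlyO = onlyO ; ends = ends } =
      z , Lr ++ vs D ++ W ++ rev z (vs O) , tLr ++ᵗ (Half.tr D ++ᵗ (tW ++ᵗ revᵗ (Half.tr O))) , unC , cnt₁ , cnt₂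
      where
      unLps : Unique (x ∷ L ++ [ ps ])
      unLps = unique-++ˡ (x ∷ L ++ [ ps ]) {M ++ R} (subst (λ l → Unique (x ∷ l)) (sym (++-assoc L [ ps ] (M ++ R))) un)
      un-rest : Unique (ps ∷ M ++ R)
      un-rest = unique-++ʳ (x ∷ L) un
      disjL : ∀ {w} → w ∈ x ∷ L → w ∈ ps ∷ M ++ R → ⊥
      disjL = unique-disj (x ∷ L) un
      pt∈ : pt ∈ ps ∷ M
      pt∈ = end∈ tm
      unR : Unique (pt ∷ R)
      unR = unique-∷ (λ m → unique-disj (ps ∷ M) un-rest pt∈ m) (unique-++ʳ (ps ∷ M) un-rest)
      LL = leftRoute tl unLps xps z∈
      Lr = proj₁ LL
      tLr = proj₁ (proj₂ LL)
      unzLr = proj₁ (proj₂ (proj₂ LL))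
      subLr = proj₁ (proj₂ (proj₂ (proj₂ LL)))
      cntL = proj₂ (proj₂ (proj₂ (proj₂ LL)))
      RR = rightRoute tr unR ypt q∈
      W₀ = proj₁ RR
      -- The two linking paths end at `pt` and `q` in either order, and the route between these
      -- vertices is traversed accordingly.
      record Mid : Set where
        field
          W   : List V
          tW  : Tr E dh W oh
          unW : Unique (dh ∷ W)
          subW : ∀ {w} → w ∈ W → w ∈ pt ∷ R
          lenW : length W ≡ length W₀
          both : ∀ {w} → w ∈ pt ∷ R → w ∈ ps ∷ vs D ⊎ w ∈ z ∷ vs O → w ≡ dh ⊎ w ≡ oh
      mid : (dh ≡ pt × oh ≡ q) ⊎ (dh ≡ q × oh ≡ pt) → Mid
      mid en@(inj₁ (refl , refl)) = record
        { W = W₀ ; tW = proj₁ (proj₂ RR) ; unW = proj₁ (proj₂ (proj₂ RR))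
        ; subW = λ m → proj₁ (proj₂ (proj₂ (proj₂ RR))) (there m) ; lenW = refl
        ; both = λ { (here refl) _ → inj₁ refl ; (there m) (inj₁ k) → inj₂ (onlyD k m) ; (there m) (inj₂ k) → inj₂ (onlyO k m) } }
      mid en@(inj₂ (refl , refl)) = record
        { W = rev pt W₀ ; tW = revᵗ (proj₁ (proj₂ RR)) ; unW = unique-↭ (↭-sym (rev-↭ (proj₁ (proj₂ RR)))) (proj₁ (proj₂ (proj₂ RR)))
        ; subW = λ m → proj₁ (proj₂ (proj₂ (proj₂ RR))) (∈-rev (proj₁ (proj₂ RR)) m) ; lenW = rev-length pt W₀
        ; both = λ { (here refl) _ → inj₂ refl ; (there m) (inj₁ k) → inj₁ (onlyD k m) ; (there m) (inj₂ k) → inj₁ (onlyO k m) } }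
      open Mid (mid ends)
      tO = Half.tr O
      un-ohO : Unique (oh ∷ rev z (vs O))
      un-ohO = unique-↭ (↭-sym (rev-↭ tO)) (uni O)
      toO : ∀ {w} → w ∈ rev z (vs O) → w ∈ z ∷ vs O
      toO = ∈-rev tO
      dDW : ∀ {w} → w ∈ ps ∷ vs D → w ∈ W → ⊥
      dDW m n with both (subW n) (inj₁ m)
      ... | inj₁ refl = unique-disj [ dh ] unW (here refl) n
      ... | inj₂ refl = disj m (end∈ tO)
      dWO : ∀ {w} → w ∈ W → w ∈ rev z (vs O) → ⊥
      dWO m n with both (subW m) (inj₂ (toO n))
      ... | inj₁ refl = disj (end∈ (Half.tr D)) (toO n)
      ... | inj₂ refl = unique-disj [ oh ] un-ohO (here refl) n
      psCase : ∀ {w} → w ∈ x ∷ L ++ [ ps ] → w ∈ x ∷ L ⊎ w ≡ ps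
      psCase m with ∈-++⁻ (x ∷ L) m
      ... | inj₁ k = inj₁ k
      ... | inj₂ (here refl) = inj₂ refl
      dLD : ∀ {w} → w ∈ Lr → w ∈ vs D → ⊥
      dLD m n with psCase (subLr m)
      ... | inj₁ k    = away D n k
      ... | inj₂ refl = unique-disj [ ps ] (uni D) (here refl) n
      inR : ∀ {w} → w ∈ pt ∷ R → w ∈ ps ∷ M ++ R
      inR (here refl) = ∈-++⁺ˡ pt∈
      inR (there m)   = ∈-++⁺ʳ (ps ∷ M) m
      dLW : ∀ {w} → w ∈ Lr → w ∈ W → ⊥
      dLW m n with psCase (subLr m)
      ... | inj₁ k    = disjL k (inR (subW n))
      ... | inj₂ refl = dDW (here refl) n
      dLO : ∀ {w} → w ∈ Lr → w ∈ rev z (vs O) → ⊥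
      dLO m n with toO n | psCase (subLr m)
      ... | here refl | _         = unique-disj [ z ] unzLr (here refl) m
      ... | there k   | inj₁ l    = away O k l
      ... | there k   | inj₂ refl = disj (here refl) (there k)
      unC : Unique (Lr ++ vs D ++ W ++ rev z (vs O))
      unC = unique-++ (AllPairs.tail unzLr)
              (unique-++ (AllPairs.tail (uni D))
                (unique-++ (AllPairs.tail unW) (AllPairs.tail un-ohO) dWO)
                (λ m n → [ dDW (there m) , (λ k → disj (there m) (toO k)) ]′ (∈-++⁻ W n)))
              (λ m n → [ dLD m , (λ k → [ dLW m , dLO m ]′ (∈-++⁻ W k)) ]′ (∈-++⁻ (vs D) n))
      lenC : length (Lr ++ vs D ++ W ++ rev z (vs O)) ≡ length Lr + (length (vs D) + (length W₀ + length (vs O)))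
      lenC = trans (length-++ Lr) (cong (length Lr +_) (trans (length-++ (vs D)) (cong (length (vs D) +_)
               (trans (length-++ W) (cong₂ _+_ lenW (rev-length z (vs O)))))))
      posO : 1 ≤ length (vs O)
      posO = nonempty tO (λ e → disjL (subst (_∈ x ∷ L) e z∈) (inR (subst (_∈ pt ∷ R) refl oh∈)))
        where
        oh∈ : oh ∈ pt ∷ R
        oh∈ = [ (λ { (_ , refl) → there q∈ }) , (λ { (_ , refl) → here refl }) ]′ ends
        nonempty : ∀ {u xs v} → Tr E u xs v → u ≢ v → 1 ≤ length xs
        nonempty []      n = ⊥-elim (n refl)
        nonempty (e ∷ t) n = s≤s z≤n
      posD : ps ≢ pt → 1 ≤ length (vs D)
      posD ps≢ = nonempty (Half.tr D) ([ (λ { (refl , _) → ps≢ }) , (λ { (refl , _) e → unique-disj (ps ∷ M) un-rest (here refl) (subst (_∈ R) (sym e) q∈) }) ]′ ends)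
        where
        nonempty : ∀ {u xs v} → Tr E u xs v → u ≢ v → 1 ≤ length xs
        nonempty []      n = ⊥-elim (n refl)
        nonempty (e ∷ t) n = s≤s z≤n
      cntR = proj₂ (proj₂ (proj₂ (proj₂ RR)))
      open ≤-Reasoning
      cnt : ∀ d → d ≤ length (vs D) → 2 * nb E x (x ∷ L ++ [ ps ]) + 2 * nb E y (pt ∷ R) + d ≤ length (Lr ++ vs D ++ W ++ rev z (vs O)) + 3
      cnt d d≤ = begin
        2 * nb E x (x ∷ L ++ [ ps ]) + 2 * nb E y (pt ∷ R) + d ≤⟨ +-mono-≤ (+-mono-≤ cntL cntR) d≤ ⟩
        (length Lr + 2) + (length W₀ + 2) + length (vs D) ≡⟨ lem (length Lr) (length W₀) (length (vs D)) ⟩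
        length Lr + (length (vs D) + (length W₀ + 1)) + 3 ≤⟨ +-monoˡ-≤ 3 (+-monoʳ-≤ (length Lr) (+-monoʳ-≤ (length (vs D)) (+-monoʳ-≤ (length W₀) posO))) ⟩
        length Lr + (length (vs D) + (length W₀ + length (vs O))) + 3 ≡⟨ cong (_+ 3) (sym lenC) ⟩
        length (Lr ++ vs D ++ W ++ rev z (vs O)) + 3 ∎
        where
        lem : ∀ p q r → (p + 2) + (q + 2) + r ≡ p + (r + (q + 1)) + 3
        lem = solve-∀
      cnt₁ : 2 * nb E x (x ∷ L ++ [ ps ]) + 2 * nb E y (pt ∷ R) ≤ length (Lr ++ vs D ++ W ++ rev z (vs O)) + 3
      cnt₁ = ≤-trans (≤-reflexive (sym (+-identityʳ _))) (cnt 0 z≤n)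
      cnt₂ : ps ≢ pt → 2 * nb E x (x ∷ L ++ [ ps ]) + 2 * nb E y (pt ∷ R) ≤ length (Lr ++ vs D ++ W ++ rev z (vs O)) + 2
      cnt₂ ne = +-cancelʳ-≤ 1 _ _ (≤-trans (cnt 1 (posD ne)) (≤-reflexive (sym (+-assoc (length (Lr ++ vs D ++ W ++ rev z (vs O))) 2 1))))

  linkCycle : Robust E → ∀ {x y L ps M pt R} → Tr E x (L ++ [ ps ]) ps → Tr E ps M pt → Tr E pt R y →
    Unique (x ∷ L ++ ps ∷ M ++ R) → Adj E x ps → Adj E y pt →
    LinkedCycle x y L ps pt R
  linkCycle rob {x} {y} {L} {ps} {M} {pt} {R} tl tm tr un xps ypt = closeLink tl tm tr un xps ypt link
    where
    y∈R : y ∈ R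
    y∈R with end∈ tr
    ... | here refl = ⊥-elim (≢-adj {u = y} ypt refl)
    ... | there m   = m
    un-rest : Unique (ps ∷ M ++ R)
    un-rest = unique-++ʳ (x ∷ L) un
    disjL : ∀ {w} → w ∈ x ∷ L → w ∈ ps ∷ M ++ R → ⊥
    disjL = unique-disj (x ∷ L) un
    link : Link E (x ∷ L) ps pt R
    link = linkAlong rob M
      (linkStart rob (here refl) (∈-++⁺ʳ M y∈R) (λ m → disjL m (here refl)) (λ m → unique-disj [ ps ] un-rest (here refl) m))
      tm (here refl) y∈R (λ m k → disjL k (there (∈-++⁺ˡ m))) (AllPairs.tail un-rest)

module _ {a b} {E : BipGraph a b} where

  private
    V : Set
    V = Vertex a b

  -- A neighbour of `y` precedes a neighbour `j` of `x` on the path, and `M` lies strictly between.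
  -- The neighbour of `y` is the last vertex of `x ∷ X`, so it may be `x` itself.
  record Cross (x : V) (P : List V) (y : V) : Set where
    constructor cross
    field
      X M Y : List V
      j     : V
      eq    : P ≡ X ++ M ++ j ∷ Y
      yi    : Adj E y (endOf x X)
      xj    : Adj E x j

  private
    -- A neighbour of `x` inside the gap can take the place of `j`, and a neighbour of `y` inside it
    -- the place of the end of `X`. Both shorten the gap.
    shrink : ∀ {x P y} n (c : Cross x P y) → length (Cross.M c) ≤ n →
      Σ (Cross x P y) λ c → All (λ w → ¬ Adj E x w) (Cross.M c) × All (λ w → ¬ Adj E y w) (Cross.M c)
    shrink {x} {P} {y} n c@(cross X M Y j eq yi xj) h with splitFirst (adj? E x) M | splitLast (adj? E y) M
    ... | inj₂ nx | inj₂ ny = c , nx , ny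
    shrink {x} {P} {y} zero    c@(cross X M Y j eq yi xj) h | inj₁ (l , p , r , refl , q , none) | _ =
      ⊥-elim (1+n≰n (≤-trans (≤-trans (m≤n+m _ (length l)) (≤-reflexive (sym (length-++ l)))) (≤-trans h z≤n)))
    shrink {x} {P} {y} (suc n) c@(cross X M Y j eq yi xj) h | inj₁ (l , p , r , refl , q , none) | _ =
      shrink n (cross X l (r ++ j ∷ Y) p (trans eq (cong (X ++_) (++-assoc l (p ∷ r) (j ∷ Y)))) yi q)
        (s≤s⁻¹ (≤-trans (≤-trans (s≤s (m≤m+n _ (length r))) (≤-reflexive (trans (sym (+-suc _ _)) (sym (length-++ l))))) h))
    shrink {x} {P} {y} zero    c@(cross X M Y j eq yi xj) h | inj₂ _ | inj₁ (l , p , r , refl , q , none) =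
      ⊥-elim (1+n≰n (≤-trans (≤-trans (m≤n+m _ (length l)) (≤-reflexive (sym (length-++ l)))) (≤-trans h z≤n)))
    shrink {x} {P} {y} (suc n) c@(cross X M Y j eq yi xj) h | inj₂ _ | inj₁ (l , p , r , refl , q , none) =
      shrink n (cross (X ++ l ++ [ p ]) r Y j
          (trans eq (trans (cong (X ++_) (trans (++-assoc l (p ∷ r) (j ∷ Y)) (sym (++-assoc l [ p ] (r ++ j ∷ Y))))) (sym (++-assoc X (l ++ [ p ]) (r ++ j ∷ Y)))))
          (subst (Adj E y) (sym (trans (cong (endOf x) (sym (++-assoc X l [ p ]))) (endOf-++ x (X ++ l) p []))) q) xj)
        (s≤s⁻¹ (≤-trans (≤-trans (m≤n+m _ (length l)) (≤-reflexive (sym (length-++ l)))) h))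

  minCross : ∀ {x P y} → Cross x P y →
    Σ (Cross x P y) λ c → All (λ w → ¬ Adj E x w) (Cross.M c) × All (λ w → ¬ Adj E y w) (Cross.M c)
  minCross c = shrink _ c ≤-refl

  module _ {x P y} (t : Tr E x P y) (un : Unique (x ∷ P)) where

    module _ (c : Cross x P y) where
      open Cross c
      private
        i : V
        i = endOf x X
        t' : Tr E x (X ++ M ++ j ∷ Y) y
        t' = subst (λ l → Tr E x l y) eq t
        tX : Tr E x X i
        tX = proj₁ (splitTr E X t')
        tMY : Tr E i (M ++ j ∷ Y) y
        tMY = proj₂ (splitTr E X t')
        un' : Unique ((x ∷ X) ++ M ++ j ∷ Y)
        un' = subst (λ l → Unique (x ∷ l)) eq un
        tYhead : Tr E (endOf i M) (j ∷ Y) y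
        tYhead = proj₂ (splitTr E M tMY)

      crossTrails : Tr E x X i × Tr E i (M ++ [ j ]) j × Tr E j Y y
      crossTrails with tYhead
      ... | e ∷ q = tX , proj₁ (splitTr E M tMY) ++ᵗ edge e , q

      private
        tY : Tr E j Y y
        tY = proj₂ (proj₂ crossTrails)

      -- x … i y … j x
      crossCycle : Σ V λ u → Σ (List V) λ cs → Tr E u cs u × Unique cs × length cs ≡ 2 + length X + length Y
      crossCycle = x , X ++ (y ∷ rev j Y) ++ [ x ] ,
        tX ++ᵗ ((adj-sym E y i yi ∷ revᵗ tY) ++ᵗ edge (adj-sym E x j xj)) ,
        unique-↭ perm (unique-++ (unique-++ˡ (x ∷ X) un') (unique-++ʳ M (unique-++ʳ (x ∷ X) un'))
          (λ m n → unique-disj (x ∷ X) un' m (∈-++⁺ʳ M n))) ,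
        len
        where
        perm : (x ∷ X) ++ (j ∷ Y) ↭ X ++ (y ∷ rev j Y) ++ [ x ]
        perm = ↭-trans (prep x (↭.++⁺ˡ X (↭-sym (rev-↭ tY))))
                 (↭-trans (↭.++-comm [ x ] (X ++ y ∷ rev j Y)) (↭-reflexive (++-assoc X (y ∷ rev j Y) [ x ])))
        len : length (X ++ (y ∷ rev j Y) ++ [ x ]) ≡ 2 + length X + length Y
        len = trans (↭.↭-length (↭-sym perm)) (trans (cong suc (length-++ X)) (cong suc (trans (+-suc _ _) refl)))

      -- i … y i
      rightCycle : Σ V λ u → Σ (List V) λ cs → Tr E u cs u × Unique cs × length cs ≡ 2 + length M + length Y
      rightCycle = i , (M ++ j ∷ Y) ++ [ i ] , tMY ++ᵗ edge yi ,
        unique-↭ (↭.++-comm [ i ] (M ++ j ∷ Y))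
          (unique-∷ (λ m → unique-disj (x ∷ X) un' (end∈ tX) m) (unique-++ʳ (x ∷ X) un')) ,
        trans (length-++ (M ++ j ∷ Y)) (trans (+-comm _ 1) (cong suc (trans (length-++ M) (+-suc _ _))))

      -- x … j x
      leftCycle : Σ V λ u → Σ (List V) λ cs → Tr E u cs u × Unique cs × length cs ≡ 2 + length X + length M
      leftCycle = x , (X ++ M ++ [ j ]) ++ [ x ] ,
        (tX ++ᵗ proj₁ (proj₂ crossTrails)) ++ᵗ edge (adj-sym E x j xj) ,
        unique-↭ (↭.++-comm [ x ] (X ++ M ++ [ j ]))
          (unique-++ˡ (x ∷ X ++ M ++ [ j ]) {Y} (subst (λ l → Unique (x ∷ l))
             (sym (trans (++-assoc X (M ++ [ j ]) Y) (cong (X ++_) (++-assoc M [ j ] Y)))) un')) ,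
        trans (length-++ (X ++ M ++ [ j ])) (trans (+-comm _ 1) (cong suc
          (trans (length-++ X) (trans (cong (length X +_) (trans (length-++ M) (+-comm _ 1))) (+-suc _ _)))))

    pred∈ : 1 ≤ length P → Σ V λ w → w ∈ x ∷ P × Adj E y w
    pred∈ = go t
      where
      go : ∀ {u P} → Tr E u P y → 1 ≤ length P → Σ V λ w → w ∈ u ∷ P × Adj E y w
      go {u} (e ∷ [])        _ = u , here refl , adj-sym E u _ e
      go     (e ∷ (e' ∷ p)) _ = let w , m , f = go (e' ∷ p) (s≤s z≤n) in w , there m , f

    ClosesUp : Set
    ClosesUp = Σ V λ u → Σ (List V) λ cs → Tr E u cs u × Unique cs ×
      2 * (nb E x (x ∷ P) + nb E y (x ∷ P)) ≤ length cs + 3 ×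
      (side y ≢ side x → 2 * (nb E x (x ∷ P) + nb E y (x ∷ P)) ≤ length cs + 2)

    private
      closeUp : Robust E → ∀ L ps M pt R → P ≡ L ++ ps ∷ M ++ R → Tr E ps M pt → Tr E pt R y →
        Adj E x ps → Adj E y pt → (ps ≡ pt → side y ≡ side x) →
        2 * (nb E x (x ∷ P) + nb E y (x ∷ P)) ≡ 2 * nb E x (x ∷ L ++ [ ps ]) + 2 * nb E y (pt ∷ R) → ClosesUp
      closeUp rob L ps M pt R eq tm tr xps ypt same count =
        wrap (linkCycle rob (tl (splitTr E L (subst (λ l → Tr E x l y) eq t))) tm tr (subst (λ l → Unique (x ∷ l)) eq un) xps ypt)
        where
        tl : Tr E x L (endOf x L) × Tr E (endOf x L) (ps ∷ M ++ R) y → Tr E x (L ++ [ ps ]) ps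
        tl (p , (e ∷ _)) = p ++ᵗ edge e
        wrap : LinkedCycle x y L ps pt R → ClosesUp
        wrap (u , cs , tc , uc , c₁ , c₂) = u , cs , tc , uc ,
          subst (_≤ length cs + 3) (sym count) c₁ ,
          λ ne → subst (_≤ length cs + 2) (sym count) (c₂ (λ e → ne (same e)))

      nb-x : ∀ L ps R₀ → All (λ w → ¬ Adj E x w) R₀ → nb E x (x ∷ L ++ ps ∷ R₀) ≡ nb E x (x ∷ L ++ [ ps ])
      nb-x L ps R₀ none = trans (cong (nb E x) (cong (x ∷_) (sym (++-assoc L [ ps ] R₀))))
        (trans (nb-++ E x (x ∷ L ++ [ ps ]) R₀) (trans (cong (nb E x (x ∷ L ++ [ ps ]) +_) (nb-none E x R₀ none)) (+-identityʳ _)))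

      nb-y : ∀ L R → All (λ w → ¬ Adj E y w) L → nb E y (L ++ R) ≡ nb E y R
      nb-y L R none = trans (nb-++ E y L R) (cong (_+ nb E y R) (nb-none E y L none))

    -- Take the last neighbour `ps` of `x`. A neighbour of `y` before it gives a crossing. Otherwise
    -- all neighbours of `y` come at or after `ps`, and a link joins the stretch with the neighbours
    -- of `x` to the one with those of `y`.
    crossOrLink : Robust E → 1 ≤ length P → Cross x P y ⊎ ClosesUp
    crossOrLink rob pos with splitLast (adj? E x) P
    ... | inj₂ none = ⊥-elim (hd t pos none)
      where
      hd : ∀ {P} → Tr E x P y → 1 ≤ length P → All (λ w → ¬ Adj E x w) P → ⊥
      hd (e ∷ _) _ (n ∷ _) = n e
    ... | inj₁ (L , ps , R₀ , refl , xps , nx) with splitFirst (adj? E y) (x ∷ L)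
    ...   | inj₁ ([] , i , l₂ , refl , yi , _) = inj₁ (cross [] l₂ R₀ ps refl yi xps)
    ...   | inj₁ (_ ∷ l₁ , i , l₂ , refl , yi , _) =
            inj₁ (cross (l₁ ++ [ i ]) l₂ R₀ ps (trans (++-assoc l₁ (i ∷ l₂) (ps ∷ R₀)) (sym (++-assoc l₁ [ i ] (l₂ ++ ps ∷ R₀))))
              (subst (Adj E y) (sym (endOf-++ x l₁ i [])) yi) xps)
    ...   | inj₂ ny with splitFirst (adj? E y) (ps ∷ R₀)
    ...     | inj₂ none = let w , m , e = pred∈ pos in ⊥-elim (All.lookup (All.++⁺ ny none) m e)
    ...     | inj₁ (R₁ , pt , R , eq , ypt , none) = inj₂ (go R₁ eq none)
      where
      tps : Tr E ps R₀ y
      tps with splitTr E L t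
      ... | _ , (_ ∷ q) = q
      sideOf : ∀ {u v} → Adj E u v → side u ≡ not (side v)
      sideOf {u} {v} e = adj-side E v u (adj-sym E u v e)
      go : ∀ R₁ → ps ∷ R₀ ≡ R₁ ++ pt ∷ R → All (λ w → ¬ Adj E y w) R₁ → ClosesUp
      -- The last neighbour of `x` is the first neighbour of `y`; this happens only for ends in the
      -- same class and costs the better constant.
      go []       refl none = closeUp rob L ps [] ps R refl [] tps xps ypt
        (λ _ → trans (sideOf ypt) (sym (sideOf xps)))
        (trans (cong₂ (λ p q → 2 * (p + q)) (nb-x L ps R nx) (nb-y (x ∷ L) (ps ∷ R) ny)) (*-distribˡ-+ 2 (nb E x (x ∷ L ++ [ ps ])) _))
      go (_ ∷ M) refl (n ∷ none) = closeUp rob L ps (M ++ [ pt ]) pt R (cong (λ l → L ++ ps ∷ l) (sym (++-assoc M [ pt ] R)))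
        (proj₁ tmr) (proj₂ tmr) xps ypt (λ { refl → ⊥-elim (n ypt) })
        (trans (cong₂ (λ p q → 2 * (p + q)) (nb-x L ps (M ++ pt ∷ R) nx)
             (trans (nb-y (x ∷ L) (ps ∷ M ++ pt ∷ R) ny) (nb-y (ps ∷ M) (pt ∷ R) (n ∷ none))))
          (*-distribˡ-+ 2 (nb E x (x ∷ L ++ [ ps ])) _))
        where
        tmr : Tr E ps (M ++ [ pt ]) pt × Tr E pt R y
        tmr with splitTr E M tps
        ... | p , (e ∷ q) = p ++ᵗ edge e , q

-- Degree sums at the ends of a long path

halve-≤ : ∀ {m n} → 2 * m ≤ 1 + 2 * n → m ≤ n
halve-≤ {m} {n} h with m ≤? n
... | yes p = p
... | no ¬p = ⊥-elim (1+n≰n (≤-trans (≤-trans (≤-reflexive (lem n)) (*-monoʳ-≤ 2 (≰⇒> ¬p))) h))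
  where lem : ∀ n → suc (1 + 2 * n) ≡ 2 * suc n
        lem = solve-∀

-- Linear inequalities without subtraction; k is the slack.
lin : ∀ {x y} L R k → x ≤ y → L + y + k ≡ R + x → L ≤ R
lin {x} {y} L R k h e = +-cancelʳ-≤ y L R
  (≤-trans (≤-trans (m≤m+n (L + y) k) (≤-reflexive e)) (+-monoʳ-≤ R h))

lin⊥ : ∀ {x y} k → x ≤ y → suc y + k ≡ x → ⊥
lin⊥ {x} {y} k h e = 1+n≰n (≤-trans (≤-trans (m≤m+n (suc y) k) (≤-reflexive e)) h)

module _ {a b} {E : BipGraph a b} where

  private
    V : Set
    V = Vertex a b

  flip-side : ∀ {u v w : V} → side u ≢ side v → side w ≡ not (side u) → side w ≡ side v
  flip-side {u} {v} ne eq with side u | side v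
  ... | true  | true  = ⊥-elim (ne refl)
  ... | true  | false = eq
  ... | false | true  = eq
  ... | false | false = ⊥-elim (ne refl)

  module _ (x y : V) where

    private
      f g : V → ℕ
      f w = bit (adj? E x w)
      g w = bit (adj? E y w)
      c : List V → ℕ
      c xs = nb E x xs + nb E y xs

      f0 : ∀ {w} → side w ≡ side x → f w ≡ 0
      f0 {w} e = bit-no (adj? E x w) (sameSide-nonadj E (sym e))
      g0 : ∀ {w} → side w ≡ side y → g w ≡ 0
      g0 {w} e = bit-no (adj? E y w) (sameSide-nonadj E (sym e))

      2g≤ : ∀ u → 2 * g u ≤ 1 + δ E y u
      2g≤ u = ≤-trans (≤-reflexive (cong (g u +_) (+-identityʳ (g u)))) (+-mono-≤ (bit≤1 (adj? E y u)) (bit≤δ E y u))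

      -- No neighbour of `y` is directly followed by a neighbour of `x`: such a crossing has an
      -- empty gap.
      NC : V → List V → Set
      NC u []       = ⊤
      NC u (w ∷ ws) = ¬ (Adj E y u × Adj E x w) × NC w ws

      -- For ends in the same class all their neighbours lie in one class, so the pairs to exclude
      -- are two steps apart: crossings with a single vertex in the gap.
      NC₂ : V → List V → Set
      NC₂ u []           = ⊤
      NC₂ u (w ∷ [])     = ⊤
      NC₂ u (w ∷ t ∷ ts) = ¬ (Adj E y u × Adj E x t) × NC₂ w (t ∷ ts)

      -- Positions are grouped into pairs of a possible neighbour `u` of `y` and the following
      -- possible neighbour `w` of `x`. By `NC` each pair contributes at most 1.
      diff₁ : ∀ {u xs v} → side y ≢ side x → side u ≡ side x → Tr E u xs v → NC u xs → 2 * c (u ∷ xs) ≤ 1 + length xs + δ E y v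
      diff₂ : ∀ {u xs v} → side y ≢ side x → side u ≡ side y → Tr E u xs v → NC u xs → 2 * c xs ≤ length xs + δ E y v
      diff₁ {u} ne su [] _ rewrite f0 su | +-identityʳ (g u) = 2g≤ u
      diff₁ {u} {w ∷ ws} {v} ne su (e ∷ t) (n , nc) = begin
        2 * ((f u + (f w + nb E x ws)) + (g u + (g w + nb E y ws)))
          ≡⟨ cong₂ (λ p q → 2 * ((p + (f w + nb E x ws)) + (g u + (q + nb E y ws)))) (f0 su) (g0 sw) ⟩
        2 * ((f w + nb E x ws) + (g u + nb E y ws))
          ≡⟨ lem (f w) (nb E x ws) (g u) (nb E y ws) ⟩
        2 * (g u + f w) + 2 * c ws
          ≤⟨ +-mono-≤ (*-monoʳ-≤ 2 (bit-excl (adj? E y u) (adj? E x w) n)) (diff₂ ne sw t nc) ⟩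
        2 + (length ws + δ E y v) ∎
        where
        open ≤-Reasoning
        lem : ∀ p q r s → 2 * ((p + q) + (r + s)) ≡ 2 * (r + p) + 2 * (q + s)
        lem = solve-∀
        sw : side w ≡ side y
        sw = flip-side {x} {y} {w} (λ e → ne (sym e)) (trans (adj-side E u w e) (cong not su))
      diff₂ ne su [] _ = z≤n
      diff₂ {u} {w ∷ ws} ne su (e ∷ t) (_ , nc) =
        diff₁ ne (flip-side {y} {x} {w} ne (trans (adj-side E u w e) (cong not su))) t nc

      -- Adjacency of `y` to one position is paired with adjacency of `x` to the position two steps
      -- later. The term `g u` carries over the half that is still waiting for its partner.
      same₂ : ∀ {u xs v} → side y ≡ side x → side u ≢ side x → Tr E u xs v → NC₂ u xs →
        2 * (g u + c xs) ≤ length xs + 1 + δ E y v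
      same₂ {u} eq su [] _ rewrite +-identityʳ (g u) = 2g≤ u
      same₂ {u} {w ∷ []} eq su (e ∷ []) _
        rewrite f0 {w} (flip-side {u} {x} {w} su (adj-side E u w e)) | g0 {w} (trans (flip-side {u} {x} {w} su (adj-side E u w e)) (sym eq)) | +-identityʳ (g u) =
        ≤-trans (*-monoʳ-≤ 2 (bit≤1 (adj? E y u))) (m≤m+n 2 _)
      same₂ {u} {w ∷ t ∷ ts} {v} eq su (e ∷ (e' ∷ p)) (n , nc) = begin
        2 * (g u + ((f w + (f t + nb E x ts)) + (g w + (g t + nb E y ts))))
          ≡⟨ cong₂ (λ p q → 2 * (g u + ((p + (f t + nb E x ts)) + (q + (g t + nb E y ts))))) (f0 sw) (g0 (trans sw (sym eq))) ⟩
        2 * (g u + ((f t + nb E x ts) + (g t + nb E y ts)))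
          ≡⟨ lem (g u) (f t) (nb E x ts) (g t) (nb E y ts) ⟩
        2 * (g u + f t) + 2 * (g t + c ts)
          ≤⟨ +-mono-≤ (*-monoʳ-≤ 2 (bit-excl (adj? E y u) (adj? E x t) n)) (same₂ eq st p (drop2 ts nc)) ⟩
        2 + (length ts + 1 + δ E y v) ∎
        where
        open ≤-Reasoning
        lem : ∀ k p q r s → 2 * (k + ((p + q) + (r + s))) ≡ 2 * (k + p) + 2 * (r + (q + s))
        lem = solve-∀
        sw : side w ≡ side x
        sw = flip-side {u} {x} {w} su (adj-side E u w e)
        st : side t ≢ side x
        st q with side x | side t | trans (adj-side E w t e') (cong not sw) | q
        ... | true  | false | refl | ()
        ... | false | true  | refl | ()
        drop2 : ∀ ts → NC₂ w (t ∷ ts) → NC₂ t ts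
        drop2 []       _       = tt
        drop2 (_ ∷ ts) (_ , h) = h

      NC-++ : ∀ u xs {ys} → NC u (xs ++ ys) → NC u xs × NC (endOf u xs) ys
      NC-++ u []       h       = tt , h
      NC-++ u (w ∷ xs) (n , h) = let p , q = NC-++ w xs h in (n , p) , q

      NC₂-++ : ∀ u xs {ys} → NC₂ u (xs ++ ys) → NC₂ u xs × NC₂ (endOf u xs) ys
      NC₂-++ u []           h = tt , h
      NC₂-++ u (w ∷ [])     {[]}     h       = tt , tt
      NC₂-++ u (w ∷ [])     {y ∷ ys} (n , h) = tt , h
      NC₂-++ u (w ∷ t ∷ ts) (n , h) = let p , q = NC₂-++ w (t ∷ ts) h in (n , p) , q

    module _ {P : List V} (t : Tr E x P y) (un : Unique (x ∷ P)) (l : ℕ) (short : EvenShort E l) (long : 2 * l ≤ suc (length P)) where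

      private
        lenP : (k : Cross {E = E} x P y) → length P ≡ length (Cross.X k) + (length (Cross.M k) + suc (length (Cross.Y k)))
        lenP k = trans (cong length (Cross.eq k)) (trans (length-++ (Cross.X k)) (cong (length (Cross.X k) +_) (length-++ (Cross.M k))))

        shortOf : ∀ {n} → (Σ V λ u → Σ (List V) λ cs → Tr E u cs u × Unique cs × length cs ≡ n) → 2 + n ≤ 2 * l
        shortOf (u , cs , tc , uc , refl) = short tc uc

        -- The cycle of a crossing misses exactly the gap. It has at most 2l - 2 of the at least 2l
        -- vertices of the path.
        gap : (k : Cross {E = E} x P y) → 2 ≤ length (Cross.M k)
        gap k = lin 2 (length (Cross.M k)) 0
          (+-mono-≤ (shortOf (crossCycle t un k)) (≤-trans long (≤-reflexive (cong suc (lenP k)))))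
          (lem (length (Cross.X k)) (length (Cross.Y k)) (2 * l) (length (Cross.M k)))
          where lem : ∀ X Y L M → 2 + (L + suc (X + (M + suc Y))) + 0 ≡ M + (2 + (2 + X + Y) + L)
                lem = solve-∀

        mkNC : ∀ X Z → P ≡ X ++ Z → NC (endOf x X) Z
        mkNC X []      eq = tt
        mkNC X (w ∷ Z) eq = (λ (p , q) → 1+n≰n (≤-trans (gap (cross X [] Z w eq p q)) z≤n)) ,
          subst (λ v → NC v Z) (endOf-++ x X w []) (mkNC (X ++ [ w ]) Z (trans eq (sym (++-assoc X [ w ] Z))))

        mkNC₂ : ∀ X Z → P ≡ X ++ Z → NC₂ (endOf x X) Z
        mkNC₂ X []           eq = tt
        mkNC₂ X (w ∷ [])     eq = tt
        mkNC₂ X (w ∷ v ∷ Z) eq = (λ (p , q) → 1+n≰n (gap (cross X [ w ] Z v eq p q))) ,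
          subst (λ u → NC₂ u (v ∷ Z)) (endOf-++ x X w []) (mkNC₂ (X ++ [ w ]) (v ∷ Z) (trans eq (sym (++-assoc X [ w ] (v ∷ Z)))))

        countCross : (k : Cross {E = E} x P y) → All (λ w → ¬ Adj E x w) (Cross.M k) → All (λ w → ¬ Adj E y w) (Cross.M k) →
          c (x ∷ P) ≡ c (x ∷ Cross.X k) + c (Cross.j k ∷ Cross.Y k)
        countCross k nx ny = trans (cong₂ _+_ (one x nx) (one y ny)) (lem (nb E x (x ∷ X)) _ (nb E y (x ∷ X)) _)
          where
          open Cross k
          lem : ∀ p q r s → (p + q) + (r + s) ≡ (p + r) + (q + s)
          lem = solve-∀
          one : ∀ v → All (λ w → ¬ Adj E v w) M → nb E v (x ∷ P) ≡ nb E v (x ∷ X) + nb E v (j ∷ Y)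
          one v none = trans (cong (λ l → nb E v (x ∷ l)) eq) (trans (nb-++ E v (x ∷ X) (M ++ j ∷ Y))
            (cong (nb E v (x ∷ X) +_) (trans (nb-++ E v M (j ∷ Y)) (cong (_+ nb E v (j ∷ Y)) (nb-none E v M none)))))

        pos : 1 ≤ l → 1 ≤ length P
        pos l≥ = lin 1 (length P) 0 (+-mono-≤ long (*-monoʳ-≤ 2 l≥)) (lem (2 * l) (length P))
          where lem : ∀ L P → 1 + (suc P + L) + 0 ≡ P + (L + 2)
                lem = solve-∀

        sideAdj : ∀ {u v} → Adj E u v → side v ≡ not (side u)
        sideAdj {u} {v} = adj-side E u v

      -- In a minimal crossing the gap holds no neighbours, and the doubled counts on its two sides
      -- are at most 2 + |X| and 2 + |Y|. Together they exceed the length of the crossing cycle by 2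
      -- only. Without a crossing the linked cycle gives the same bound.
      ends-diff : Robust E → 1 ≤ l → side y ≢ side x → c (x ∷ P) ≤ l
      ends-diff rob l≥ ne with crossOrLink t un rob (pos l≥)
      ... | inj₂ (u , cs , tc , uc , _ , h) = halve-≤ (≤-trans (h ne) (≤-trans (≤-reflexive (+-comm (length cs) 2)) (≤-trans (short tc uc) (n≤1+n _))))
      ... | inj₁ k₀ with minCross k₀
      ...   | k , nx , ny = halve-≤ (lin (2 * c (x ∷ P)) (1 + 2 * l) 1 (+-mono-≤ bound (shortOf (crossCycle t un k)))
                              (lem (2 * c (x ∷ P)) (length X) (length Y) (2 * l)))
        where
        open Cross k
        trails = crossTrails t un k
        ncP : NC x (X ++ M ++ j ∷ Y)
        ncP = mkNC [] _ eq
        ncX = proj₁ (NC-++ x X ncP)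
        ncY : NC j Y
        ncY = proj₂ (proj₂ (NC-++ (endOf x X) M (proj₂ (NC-++ x X ncP))))
        lem : ∀ C X Y L → C + (4 + X + Y + L) + 1 ≡ 1 + L + (C + (2 + (2 + X + Y)))
        lem = solve-∀
        sj : side j ≡ side y
        sj = flip-side {x} {y} {j} (λ e → ne (sym e)) (sideAdj xj)
        bX : 2 * c (x ∷ X) ≤ 2 + length X
        bX = ≤-trans (diff₁ ne refl (proj₁ trails) ncX) (≤-trans (+-monoʳ-≤ (1 + length X) (δ≤1 E y _)) (≤-reflexive (+-comm (1 + length X) 1)))
        bY : 2 * c (j ∷ Y) ≤ 2 + length Y
        bY = begin
          2 * ((f j + nb E x Y) + (g j + nb E y Y)) ≡⟨ cong (λ q → 2 * ((f j + nb E x Y) + (q + nb E y Y))) (g0 sj) ⟩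
          2 * ((f j + nb E x Y) + nb E y Y) ≡⟨ lem2 (f j) (nb E x Y) (nb E y Y) ⟩
          2 * f j + 2 * c Y ≤⟨ +-mono-≤ (*-monoʳ-≤ 2 (bit≤1 (adj? E x j))) (diff₂ ne sj (proj₂ (proj₂ trails)) ncY) ⟩
          2 + (length Y + δ E y y) ≡⟨ cong (λ d → 2 + (length Y + d)) (δ-same E y y refl) ⟩
          2 + (length Y + 0) ≡⟨ cong (2 +_) (+-identityʳ (length Y)) ⟩
          2 + length Y ∎
          where
          open ≤-Reasoning
          lem2 : ∀ p q r → 2 * ((p + q) + r) ≡ 2 * p + 2 * (q + r)
          lem2 = solve-∀
        bound : 2 * c (x ∷ P) ≤ 4 + length X + length Y
        bound = begin
          2 * c (x ∷ P) ≡⟨ cong (2 *_) (countCross k nx ny) ⟩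
          2 * (c (x ∷ X) + c (j ∷ Y)) ≡⟨ *-distribˡ-+ 2 (c (x ∷ X)) _ ⟩
          2 * c (x ∷ X) + 2 * c (j ∷ Y) ≤⟨ +-mono-≤ bX bY ⟩
          (2 + length X) + (2 + length Y) ≡⟨ lem3 (length X) (length Y) ⟩
          4 + length X + length Y ∎
          where
          open ≤-Reasoning
          lem3 : ∀ p q → (2 + p) + (2 + q) ≡ 4 + p + q
          lem3 = solve-∀

      -- Pairs two steps apart leave half a neighbour more on each side of the gap than in
      -- `ends-diff`, hence one more in total. The length bound serves to list the vertices of a
      -- path on which this extra one is attained.
      ends-same : Robust E → 1 ≤ l → side y ≡ side x →
        c (x ∷ P) ≤ l ⊎ (c (x ∷ P) ≤ suc l × (c (x ∷ P) ≡ suc l → length P + 5 ≤ 3 * l) × Cross {E = E} x P y)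
      ends-same rob l≥ es with crossOrLink t un rob (pos l≥)
      ... | inj₂ (u , cs , tc , uc , h , _) = inj₁ (halve-≤ (≤-trans h (≤-trans (≤-reflexive (+-comm (length cs) 3)) (s≤s (short tc uc)))))
      ... | inj₁ k₀ with minCross k₀
      ...   | k , nx , ny = inj₂ (halve-≤ (lin (2 * c (x ∷ P)) (1 + 2 * suc l) 1 (+-mono-≤ bound (shortOf (crossCycle t un k)))
                              (lem (2 * c (x ∷ P)) (length X) (length Y) l)) , lenBound , k)
        where
        open Cross k
        trails = crossTrails t un k
        ncP : NC₂ x (X ++ M ++ j ∷ Y)
        ncP = mkNC₂ [] _ eq
        ncX = proj₁ (NC₂-++ x X ncP)
        ncY : NC₂ j Y
        ncY = drop2 Y (proj₂ (NC₂-++ (endOf x X) M (proj₂ (NC₂-++ x X ncP))))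
          where
          drop2 : ∀ ts {w} → NC₂ w (j ∷ ts) → NC₂ j ts
          drop2 []       _       = tt
          drop2 (_ ∷ ts) (_ , h) = h
        lem : ∀ C X Y l → C + (6 + X + Y + 2 * l) + 1 ≡ 1 + 2 * suc l + (C + (2 + (2 + X + Y)))
        lem = solve-∀
        adj-ne : ∀ {u v} → Adj E u v → side v ≢ side u
        adj-ne {u} {v} e q = sameSide-nonadj E {u} {v} (sym q) e
        startX : ∀ X → Tr E x X (endOf x X) → NC₂ x X → Adj E y (endOf x X) → 2 * c (x ∷ X) ≤ 3 + length X
        startX [] _ _ yi = ⊥-elim (adj-ne yi (sym es))
        startX (w ∷ X') (e ∷ q) nc yi = begin
          2 * ((f x + (f w + nb E x X')) + (g x + (g w + nb E y X')))
            ≡⟨ cong₂ (λ p q → 2 * ((p + (f w + nb E x X')) + (q + (g w + nb E y X')))) (f0 refl) (g0 (sym es)) ⟩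
          2 * ((f w + nb E x X') + (g w + nb E y X')) ≡⟨ lem2 (f w) (nb E x X') (g w) (nb E y X') ⟩
          2 * f w + 2 * (g w + c X') ≤⟨ +-mono-≤ (*-monoʳ-≤ 2 (bit≤1 (adj? E x w))) (same₂ es (adj-ne e) q (drop1 X' nc)) ⟩
          2 + (length X' + 1 + δ E y (endOf w X')) ≤⟨ +-monoʳ-≤ 2 (+-monoʳ-≤ (length X' + 1) (δ≤1 E y _)) ⟩
          2 + (length X' + 1 + 1) ≡⟨ lem3 (length X') ⟩
          3 + suc (length X') ∎
          where
          open ≤-Reasoning
          lem2 : ∀ p q r s → 2 * ((p + q) + (r + s)) ≡ 2 * p + 2 * (r + (q + s))
          lem2 = solve-∀
          lem3 : ∀ p → 2 + (p + 1 + 1) ≡ 3 + suc p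
          lem3 = solve-∀
          drop1 : ∀ X' → NC₂ x (w ∷ X') → NC₂ w X'
          drop1 []       _       = tt
          drop1 (_ ∷ ts) (_ , h) = h
        bY : 2 * c (j ∷ Y) ≤ 3 + length Y
        bY = begin
          2 * ((f j + nb E x Y) + (g j + nb E y Y)) ≡⟨ lem2 (f j) (nb E x Y) (g j) (nb E y Y) ⟩
          2 * f j + 2 * (g j + c Y) ≤⟨ +-mono-≤ (*-monoʳ-≤ 2 (bit≤1 (adj? E x j))) (same₂ es (adj-ne xj) (proj₂ (proj₂ trails)) ncY) ⟩
          2 + (length Y + 1 + δ E y y) ≡⟨ cong (λ d → 2 + (length Y + 1 + d)) (δ-same E y y refl) ⟩
          2 + (length Y + 1 + 0) ≡⟨ lem3 (length Y) ⟩
          3 + length Y ∎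
          where
          open ≤-Reasoning
          lem2 : ∀ p q r s → 2 * ((p + q) + (r + s)) ≡ 2 * p + 2 * (r + (q + s))
          lem2 = solve-∀
          lem3 : ∀ p → 2 + (p + 1 + 0) ≡ 3 + p
          lem3 = solve-∀
        bound : 2 * c (x ∷ P) ≤ 6 + length X + length Y
        bound = begin
          2 * c (x ∷ P) ≡⟨ cong (2 *_) (countCross k nx ny) ⟩
          2 * (c (x ∷ X) + c (j ∷ Y)) ≡⟨ *-distribˡ-+ 2 (c (x ∷ X)) _ ⟩
          2 * c (x ∷ X) + 2 * c (j ∷ Y) ≤⟨ +-mono-≤ (startX X (proj₁ trails) ncX yi) bY ⟩
          (3 + length X) + (3 + length Y) ≡⟨ lem3 (length X) (length Y) ⟩
          6 + length X + length Y ∎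
          where
          open ≤-Reasoning
          lem3 : ∀ p q → (3 + p) + (3 + q) ≡ 6 + p + q
          lem3 = solve-∀
        -- 2|P| + 10 is bounded by adding the lengths of the three cycles of the crossing.
        lenBound : c (x ∷ P) ≡ suc l → length P + 5 ≤ 3 * l
        lenBound e = halve-≤ (≤-trans (lin (2 * (length P + 5)) (2 * (3 * l)) 0
            (+-mono-≤ (subst (λ k → 2 * k ≤ 6 + length X + length Y) e bound)
              (+-mono-≤ (shortOf (crossCycle t un k)) (+-mono-≤ (shortOf (crossCycle t un k))
                (+-mono-≤ (shortOf (rightCycle t un k)) (shortOf (leftCycle t un k))))))
            (trans (cong (λ p → 2 * (p + 5) + _ + 0) (lenP k)) (lem4 (length X) (length M) (length Y) l))) (n≤1+n _))
          where
          lem4 : ∀ X M Y l → 2 * ((X + (M + suc Y)) + 5) + (6 + X + Y + (2 * l + (2 * l + (2 * l + 2 * l)))) + 0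
                ≡ 2 * (3 * l) + (2 * suc l + ((2 + (2 + X + Y)) + ((2 + (2 + X + Y)) + ((2 + (2 + M + Y)) + (2 + (2 + X + M))))))
          lem4 = solve-∀

-- Saturated graphs

⊆-length : ∀ {A : Set} {ns ms : List A} → Unique ns → (∀ {w} → w ∈ ns → w ∈ ms) → length ns ≤ length ms
⊆-length {ns = []}     un sub = z≤n
⊆-length {ns = n ∷ ns} (h ∷ un) sub with ∈-∃++ (sub (here refl))
... | l , r , refl = ≤-trans (s≤s (⊆-length un sub')) (≤-reflexive (sym (trans (length-++ l) (trans (+-suc _ _) (cong suc (sym (length-++ l)))))))
  where
  sub' : ∀ {w} → w ∈ ns → w ∈ l ++ r
  sub' m with ∈-++⁻ l (sub (there m))
  ... | inj₁ k           = ∈-++⁺ˡ k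
  ... | inj₂ (here refl) = ⊥-elim (All.lookup h m refl)
  ... | inj₂ (there k)   = ∈-++⁺ʳ l k

LongPath : ∀ {a b} → BipGraph a b → ℕ → Vertex a b → Vertex a b → Set
LongPath {a} {b} E l u v = Σ (List (Vertex a b)) λ P → Tr E u P v × Unique (u ∷ P) × 2 * l ≤ suc (length P)

-- The path comes from the failure of `NoCycleAtLeast`, a negative statement, hence the double
-- negation. It is harmless because the path is only used to derive contradictions or decidable
-- facts.
Saturated : ∀ {a b} → BipGraph a b → ℕ → Set
Saturated E l = ∀ i j → ¬ T (E i j) → ¬ ¬ LongPath E l (inj₁ i) (inj₂ j)

-- A vertex set with a minimum degree inside itself, depending on the class. Neighbours are given as
-- a list because path extension searches it for a vertex off the path.
record Region {a b} (E : BipGraph a b) (thr : Bool → ℕ) : Set₁ where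
  field
    In   : Vertex a b → Set
    nbrs : ∀ v → In v → Σ (List (Vertex a b)) λ ns →
           Unique ns × thr (side v) ≤ length ns × All (λ w → Adj E v w × In w) ns

-- A long path that cannot be prolonged inside the regions at either end: all the listed neighbours
-- of its ends lie on it.
record Stuck {a b} {E : BipGraph a b} {thr thr' : Bool → ℕ} (R : Region E thr) (R' : Region E thr') (l : ℕ) : Set where
  open Region
  field
    x y  : Vertex a b
    P    : List (Vertex a b)
    tr   : Tr E x P y
    un   : Unique (x ∷ P)
    long : 2 * l ≤ suc (length P)
    inx  : In R x
    iny  : In R' y
    onx  : All (_∈ x ∷ P) (proj₁ (nbrs R x inx))
    ony  : All (_∈ x ∷ P) (proj₁ (nbrs R' y iny))

module _ {a b} {E : BipGraph a b} where

  private
    V : Set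
    V = Vertex a b

  nb-≥ : ∀ x {ns F : List V} → Unique ns → All (Adj E x) ns → All (_∈ F) ns → length ns ≤ nb E x F
  nb-≥ x {ns} {F} un adj on = ≤-trans (⊆-length un (λ m → ∈-filter⁺ (adj? E x) (All.lookup on m) (All.lookup adj m)))
    (≤-reflexive (filt F))
    where
    filt : ∀ F → length (filter (adj? E x) F) ≡ nb E x F
    filt []      = refl
    filt (w ∷ F) with adj? E x w
    ... | yes _ = cong suc (filt F)
    ... | no _  = filt F

  longPath-rev : ∀ {l u v} → LongPath E l u v → LongPath E l v u
  longPath-rev {l} {u} {v} (P , t , un , h) =
    rev u P , revᵗ t , unique-↭ (↭-sym (rev-↭ t)) un , subst (λ n → 2 * l ≤ suc n) (sym (rev-length u P)) h

  module _ {thr thr' : Bool → ℕ} (R : Region E thr) (R' : Region E thr') (l : ℕ) where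
    open Region

    private
      grow : ∀ n {x y P} → Tr E x P y → Unique (x ∷ P) → 2 * l ≤ suc (length P) → In R x → In R' y →
        a + b ≤ n + length P → Stuck R R' l
      grow n {x} {y} {P} t un lg ix iy fuel
        with All.all? (_∈? (x ∷ P)) (proj₁ (nbrs R x ix)) | All.all? (_∈? (x ∷ P)) (proj₁ (nbrs R' y iy))
      ... | yes p | yes q = record { tr = t ; un = un ; long = lg ; inx = ix ; iny = iy ; onx = p ; ony = q }
      grow zero    {x} {y} {P} t un lg ix iy fuel | no ¬p | _     = ⊥-elim (1+n≰n (≤-trans (unique-length un) fuel))
      grow zero    {x} {y} {P} t un lg ix iy fuel | yes _ | no ¬q = ⊥-elim (1+n≰n (≤-trans (unique-length un) fuel))
      grow (suc n) {x} {y} {P} t un lg ix iy fuel | no ¬p | _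
        with find (All.¬All⇒Any¬ (_∈? (x ∷ P)) _ ¬p)
      ... | z , z∈ , z∉ = grow n (adj-sym E x z (proj₁ zz) ∷ t) (unique-∷ z∉ un) (≤-trans lg (n≤1+n _)) (proj₂ zz) iy
              (≤-trans fuel (≤-reflexive (sym (+-suc n _))))
        where zz = All.lookup (proj₂ (proj₂ (proj₂ (nbrs R x ix)))) z∈
      grow (suc n) {x} {y} {P} t un lg ix iy fuel | yes _ | no ¬q
        with find (All.¬All⇒Any¬ (_∈? (x ∷ P)) _ ¬q)
      ... | z , z∈ , z∉ = grow n (t ++ᵗ edge (proj₁ zz)) (unique-↭ (↭.++-comm [ z ] (x ∷ P)) (unique-∷ z∉ un))
              (≤-trans lg (≤-trans (n≤1+n _) (≤-reflexive (cong suc (sym len))))) ix (proj₂ zz)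
              (≤-trans fuel (≤-reflexive (trans (sym (+-suc n _)) (cong (n +_) (sym len)))))
        where
        zz = All.lookup (proj₂ (proj₂ (proj₂ (nbrs R' y iy)))) z∈
        len : length (P ++ [ z ]) ≡ suc (length P)
        len = trans (length-++ P) (+-comm _ 1)

    makeStuck : ∀ {u v} → LongPath E l u v → In R u → In R' v → Stuck R R' l
    makeStuck (P , t , un , lg) iu iv = grow (a + b) t un lg iu iv (m≤m+n _ _)

    module _ (S : Stuck R R' l) where
      open Stuck S
      stuck-count : thr (side x) + thr' (side y) ≤ nb E x (x ∷ P) + nb E y (x ∷ P)
      stuck-count with nbrs R x inx | onx | nbrs R' y iny | ony
      ... | ns , u₁ , l₁ , h₁ | o₁ | ns' , u₂ , l₂ , h₂ | o₂ =
        +-mono-≤ (≤-trans l₁ (nb-≥ x u₁ (All.map proj₁ h₁) o₁)) (≤-trans l₂ (nb-≥ y u₂ (All.map proj₁ h₂) o₂))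

record Ctx (l a b : ℕ) : Set where
  field
    E     : BipGraph a b
    rob   : Robust E
    short : EvenShort E l
    sat   : Saturated E l
    l≥1   : 1 ≤ l

-- Stuck paths whose ends lie on the same side and have exactly l + 1 neighbours
-- in total escape the counting argument; they are handled separately.
record OneShort {a b} {E : BipGraph a b} {thr thr' : Bool → ℕ} (R : Region E thr) (R' : Region E thr') (l : ℕ) : Set where
  field
    S     : Stuck R R' l
    same  : side (Stuck.y S) ≡ side (Stuck.x S)
    tight : thr (side (Stuck.x S)) + thr' (side (Stuck.y S)) ≤ suc l
    ccount : nb E (Stuck.x S) (Stuck.x S ∷ Stuck.P S) + nb E (Stuck.y S) (Stuck.x S ∷ Stuck.P S) ≡ suc l
    small : length (Stuck.P S) + 5 ≤ 3 * l
    crs   : Cross {E = E} (Stuck.x S) (Stuck.P S) (Stuck.y S)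

module _ {l a b} (G : Ctx l a b) where
  open Ctx G

  -- Prolonging the path inside the regions keeps it long and ends with both thresholds counted on
  -- the path, where `ends-diff` and `ends-same` apply. Only ends in one class with sum exactly l +
  -- 1 survive.
  noLink₁ : ∀ {thr thr'} (R : Region E thr) (R' : Region E thr') →
    (∀ s s' → s ≢ s' → suc l ≤ thr s + thr' s') → (∀ s → suc l ≤ thr s + thr' s) →
    ∀ {u v} → LongPath E l u v → Region.In R u → Region.In R' v → OneShort R R' l
  noLink₁ {thr} {thr'} R R' hd hs p iu iv with makeStuck R R' l p iu iv
  ... | S with _≟ᵇ_ (side (Stuck.y S)) (side (Stuck.x S))
  ...   | no ne = ⊥-elim (1+n≰n (≤-trans (hd _ _ (λ e → ne (sym e)))
            (≤-trans (stuck-count R R' l S) (ends-diff _ _ (Stuck.tr S) (Stuck.un S) l short (Stuck.long S) rob l≥1 ne))))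
  ...   | yes es with ends-same _ _ (Stuck.tr S) (Stuck.un S) l short (Stuck.long S) rob l≥1 es
  ...     | inj₁ h = ⊥-elim (1+n≰n (≤-trans (subst (λ s → suc l ≤ thr (side (Stuck.x S)) + thr' s) (sym es) (hs _)) (≤-trans (stuck-count R R' l S) h)))
  ...     | inj₂ (h , sm , k) = record { S = S ; same = es ; tight = ≤-trans (stuck-count R R' l S) h ; ccount = ce ; small = sm ce ; crs = k }
    where ce = ≤-antisym h (≤-trans (subst (λ s → suc l ≤ thr (side (Stuck.x S)) + thr' s) (sym es) (hs _)) (stuck-count R R' l S))

  noLink : ∀ {thr thr'} (R : Region E thr) (R' : Region E thr') →
    (∀ s s' → s ≢ s' → suc l ≤ thr s + thr' s') → (∀ s → 2 + l ≤ thr s + thr' s) →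
    ∀ {u v} → LongPath E l u v → Region.In R u → Region.In R' v → ⊥
  noLink {thr} {thr'} R R' hd hs p iu iv with noLink₁ R R' hd (λ s → ≤-trans (n≤1+n _) (hs s)) p iu iv
  ... | o = 1+n≰n (≤-trans (subst (λ s → 2 + l ≤ thr (side (Stuck.x S)) + thr' s) (sym same) (hs _)) tight)
    where open OneShort o

evenShort : ∀ {a b} {E : BipGraph a b} {l} → 2 ≤ l → NoCycleAtLeast E (2 * l) → EvenShort E l
evenShort {l = l} 2≤l none {u} {xs} t un with 2 * l ≤? length xs
... | yes h = ⊥-elim (none (length xs) h (closed⇒HasCycle t un (≤-trans (≤-trans (s≤s (s≤s (s≤s z≤n))) (*-monoʳ-≤ 2 2≤l)) h)))
... | no h  = ≤∧≢⇒< (≰⇒> h) λ e → odd l (length xs) (sym e) (closed-even t)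
  where
  parity-2* : ∀ n → parity (2 * n) ≡ false
  parity-2* zero    = refl
  parity-2* (suc n) = trans (cong parity (cong suc (+-suc n (n + 0)))) (trans (not-involutive _) (parity-2* n))
  odd : ∀ l n → 2 * l ≡ suc n → parity n ≡ false → ⊥
  odd l n e p with trans (sym (parity-2* l)) (trans (cong parity e) (cong not p))
  ... | ()

-- Exchanging the two classes

flipE : ∀ {a b} → BipGraph a b → BipGraph b a
flipE E j i = E i j

sw : ∀ {a b} → Vertex a b → Vertex b a
sw (inj₁ i) = inj₂ i
sw (inj₂ j) = inj₁ j

sw-sw : ∀ {a b} (u : Vertex a b) → sw (sw u) ≡ u
sw-sw (inj₁ _) = refl
sw-sw (inj₂ _) = refl

sw-injective : ∀ {a b} {u v : Vertex a b} → sw u ≡ sw v → u ≡ v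
sw-injective {u = u} {v} e = trans (sym (sw-sw u)) (trans (cong sw e) (sw-sw v))

module _ {a b} {E : BipGraph a b} where

  sw-adj : ∀ u v → Adj E u v → Adj (flipE E) (sw u) (sw v)
  sw-adj (inj₁ _) (inj₂ _) e = e
  sw-adj (inj₂ _) (inj₁ _) e = e

  sw-Tr : ∀ {u xs v} → Tr E u xs v → Tr (flipE E) (sw u) (map sw xs) (sw v)
  sw-Tr []      = []
  sw-Tr {u} (_∷_ {w = w} e t) = sw-adj u w e ∷ sw-Tr t

  sw-Reach : ∀ {x u v} → Reach E (λ w → w ≢ x) u v → Reach (flipE E) (λ w → w ≢ sw x) (sw u) (sw v)
  sw-Reach (here p)     = here (λ e → p (sw-injective e))
  sw-Reach {u = u} (step {w = w} p e r) = step (λ e → p (sw-injective e)) (sw-adj u w e) (sw-Reach r)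

  flip-robust : Robust E → Robust (flipE E)
  flip-robust rob x u v nu nv = subst₂ (λ p q → Reach (flipE E) (λ w → w ≢ x) p q) (sw-sw u) (sw-sw v)
    (subst (λ y → Reach (flipE E) (λ w → w ≢ y) (sw (sw u)) (sw (sw v))) (sw-sw x)
      (sw-Reach (rob (sw x) (sw u) (sw v) (λ e → nu (sw-injective e)) (λ e → nv (sw-injective e)))))

  sw-LongPath : ∀ {l u v} → LongPath E l u v → LongPath (flipE E) l (sw u) (sw v)
  sw-LongPath {l} (P , t , un , h) = map sw P , sw-Tr t , Uniq.map⁺ sw-injective un , subst (λ n → 2 * l ≤ suc n) (sym (length-map sw P)) h

flip-short : ∀ {a b l} {E : BipGraph a b} → EvenShort E l → EvenShort (flipE E) l
flip-short {l = l} short {u} {xs} t un = subst (λ n → 2 + n ≤ 2 * l) (length-map sw xs) (short (sw-Tr t) (Uniq.map⁺ sw-injective un))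

flipCtx : ∀ {l a b} → Ctx l a b → Ctx l b a
flipCtx {l} G = record { E = flipE E ; rob = flip-robust rob ; short = flip-short {l = l} short ; l≥1 = l≥1
                   ; sat = λ j i n k → sat i j n (λ p → k (longPath-rev {l = l} (sw-LongPath {l = l} p))) }
  where open Ctx G

-- Cycles created by a new edge

addE : ∀ {a b} → BipGraph a b → Fin a → Fin b → BipGraph a b
addE E i j k l = if does (k Fin.≟ i) then (if does (l Fin.≟ j) then true else E k l) else E k l

module _ {a b} {E : BipGraph a b} {i : Fin a} {j : Fin b} where

  private
    V : Set
    V = Vertex a b

    New : V → V → Set
    New p w = (p ≡ inj₁ i × w ≡ inj₂ j) ⊎ (p ≡ inj₂ j × w ≡ inj₁ i)

    addE-old : ∀ k l → T (addE E i j k l) → T (E k l) ⊎ (k ≡ i × l ≡ j)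
    addE-old k l h with k Fin.≟ i
    ... | no _  = inj₁ h
    ... | yes e with l Fin.≟ j
    ...   | no _   = inj₁ h
    ...   | yes e' = inj₂ (e , e')

    adj-old : ∀ u v → Adj (addE E i j) u v → Adj E u v ⊎ New u v
    adj-old (inj₁ k) (inj₂ l) h with addE-old k l h
    ... | inj₁ e             = inj₁ e
    ... | inj₂ (refl , refl) = inj₂ (inj₁ (refl , refl))
    adj-old (inj₂ l) (inj₁ k) h with addE-old k l h
    ... | inj₁ e             = inj₁ e
    ... | inj₂ (refl , refl) = inj₂ (inj₂ (refl , refl))

    firstNew : ∀ {u xs v} → Tr (addE E i j) u xs v → Tr E u xs v ⊎
      (Σ (List V) λ ys → Σ V λ w → Σ (List V) λ zs → Σ V λ p →
        xs ≡ ys ++ w ∷ zs × Tr (addE E i j) u ys p × New p w × Tr (addE E i j) w zs v)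
    firstNew [] = inj₁ []
    firstNew {u} (_∷_ {w = w} {xs = xs} e t) with adj-old u w e
    ... | inj₂ n  = inj₂ ([] , w , xs , u , refl , [] , n , t)
    ... | inj₁ e' with firstNew t
    ...   | inj₁ t' = inj₁ (e' ∷ t')
    ...   | inj₂ (ys , w' , zs , p , refl , t₁ , n , t₂) = inj₂ (w ∷ ys , w' , zs , p , refl , e ∷ t₁ , n , t₂)

    New-sym : ∀ {p w s s'} → New p w → New s s' → (s ≡ p × s' ≡ w) ⊎ (s ≡ w × s' ≡ p)
    New-sym (inj₁ (refl , refl)) (inj₁ (refl , refl)) = inj₁ (refl , refl)
    New-sym (inj₁ (refl , refl)) (inj₂ (refl , refl)) = inj₂ (refl , refl)
    New-sym (inj₂ (refl , refl)) (inj₁ (refl , refl)) = inj₂ (refl , refl)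
    New-sym (inj₂ (refl , refl)) (inj₂ (refl , refl)) = inj₁ (refl , refl)

    later : ∀ {p w s zs v} → New p w → Tr (addE E i j) s zs v → s ≢ w → w ∉ zs → Tr E s zs v
    later n [] ne w∉ = []
    later {s = s} n (_∷_ {w = s'} e t) ne w∉ with adj-old s s' e
    ... | inj₁ e' = e' ∷ later n t (λ q → w∉ (here (sym q))) (λ m → w∉ (there m))
    ... | inj₂ n' with New-sym n n'
    ...   | inj₁ (_ , refl) = ⊥-elim (w∉ (here refl))
    ...   | inj₂ (refl , _) = ⊥-elim (ne refl)

    -- The ends of the new edge are the ends of this trail, so distinct vertices keep the trail off
    -- the edge unless it is that edge alone. The length condition excludes this.
    allOld : ∀ {p w zs} → New p w → Tr (addE E i j) w zs p → Unique (w ∷ zs) → 2 ≤ length zs → Tr E w zs p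
    allOld n [] un ()
    allOld {p} {w} n (_∷_ {w = s'} {xs = zs} e t) (h ∷ un) 2≤ with adj-old w s' e
    ... | inj₁ e' = e' ∷ later n t (λ q → All.lookup h (here refl) (sym q)) (λ m → All.lookup h (there m) refl)
    ... | inj₂ n' with New-sym n n'
    ...   | inj₁ (refl , refl) = ⊥-elim (All.lookup h (here refl) refl)
    ...   | inj₂ (_ , refl) with t
    ...     | []      = ⊥-elim (1+n≰n 2≤)
    ...     | e₁ ∷ t₁ = ⊥-elim (unique-disj [ p ] un (here refl) (end∈ t₁))

  -- A long cycle has to use the new edge. Rotated to begin with it, the rest of the cycle is a path
  -- of the old graph on all the vertices of the cycle.
  newCycle : ∀ {l m} → 2 ≤ l → NoCycleAtLeast E (2 * l) → 2 * l ≤ m → HasCycle (addE E i j) m → LongPath E l (inj₁ i) (inj₂ j)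
  newCycle {l} {m} 2≤l none 2l≤m cyc with HasCycle⇒closed cyc
  ... | u , xs , t , un , refl with firstNew t
  ...   | inj₁ t' = ⊥-elim (none _ 2l≤m (closed⇒HasCycle t' un (proj₁ cyc)))
  ...   | inj₂ (ys , w , zs , p , refl , t₁ , n , t₂) = fin n tE
    where
    perm : ys ++ w ∷ zs ↭ w ∷ zs ++ ys
    perm = ↭.++-comm ys (w ∷ zs)
    un' : Unique (w ∷ zs ++ ys)
    un' = unique-↭ perm un
    big : 2 * l ≤ suc (length (zs ++ ys))
    big = ≤-trans 2l≤m (≤-reflexive (↭.↭-length perm))
    tE : Tr E w (zs ++ ys) p
    tE = allOld n (t₂ ++ᵗ t₁) un' (s≤s⁻¹ (≤-trans (≤-trans (s≤s (s≤s (s≤s z≤n))) (*-monoʳ-≤ 2 2≤l)) big))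
    fin : New p w → Tr E w (zs ++ ys) p → LongPath E l (inj₁ i) (inj₂ j)
    fin (inj₁ (refl , refl)) t = longPath-rev {l = l} (zs ++ ys , t , un' , big)
    fin (inj₂ (refl , refl)) t = zs ++ ys , t , un' , big

saturated : ∀ {a b} {E : BipGraph a b} {l} → 2 ≤ l → NoCycleAtLeast E (2 * l) →
  (∀ i j → ¬ T (E i j) → ¬ NoCycleAtLeast (addE E i j) (2 * l)) → Saturated E l
saturated {l = l} 2≤l none h i j nadj k = h i j nadj (λ m 2l≤m cyc → k (newCycle {l = l} 2≤l none 2l≤m cyc))

-- Counting edges and deleting vertices of small degree

𝟙 : Bool → ℕ
𝟙 c = if c then 1 else 0

sum-cong : ∀ {n} {f g : Fin n → ℕ} → (∀ i → f i ≡ g i) → sumFin n f ≡ sumFin n g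
sum-cong {zero}  h = refl
sum-cong {suc n} h = cong₂ _+_ (h fzero) (sum-cong (h ∘ fsuc))

sum-mono : ∀ {n} {f g : Fin n → ℕ} → (∀ i → f i ≤ g i) → sumFin n f ≤ sumFin n g
sum-mono {zero}  h = z≤n
sum-mono {suc n} h = +-mono-≤ (h fzero) (sum-mono (h ∘ fsuc))

sum-+ : ∀ {n} (f g : Fin n → ℕ) → sumFin n (λ i → f i + g i) ≡ sumFin n f + sumFin n g
sum-+ {zero}  f g = refl
sum-+ {suc n} f g = trans (cong (f fzero + g fzero +_) (sum-+ (f ∘ fsuc) (g ∘ fsuc))) (lem (f fzero) (g fzero) _ _)
  where lem : ∀ p q r s → p + q + (r + s) ≡ p + r + (q + s)
        lem = solve-∀

sum-0 : ∀ n → sumFin n (λ _ → 0) ≡ 0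
sum-0 zero    = refl
sum-0 (suc n) = sum-0 n

sum-*ˡ : ∀ n k (f : Fin n → ℕ) → sumFin n (λ i → k * f i) ≡ k * sumFin n f
sum-*ˡ zero    k f = sym (*-zeroʳ k)
sum-*ˡ (suc n) k f = trans (cong (k * f fzero +_) (sum-*ˡ n k (f ∘ fsuc))) (sym (*-distribˡ-+ k (f fzero) _))

sum-swap : ∀ m n (f : Fin m → Fin n → ℕ) → sumFin m (λ i → sumFin n (f i)) ≡ sumFin n (λ j → sumFin m (λ i → f i j))
sum-swap zero    n f = sym (sum-0 n)
sum-swap (suc m) n f = trans (cong (sumFin n (f fzero) +_) (sum-swap m n (f ∘ fsuc))) (sym (sum-+ (f fzero) _))

sum-at : ∀ {n} (f : Fin n → ℕ) i → sumFin n f ≡ f i + sumFin n (λ k → if does (k Fin.≟ i) then 0 else f k)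
sum-at {suc n} f fzero    = refl
sum-at {suc n} f (fsuc i) = trans (cong (f fzero +_) (trans (sum-at (f ∘ fsuc) i) (cong (f (fsuc i) +_) (sum-cong λ k → lem k))))
  (lem2 (f fzero) (f (fsuc i)) _)
  where
  lem : ∀ k → (if does (k Fin.≟ i) then 0 else f (fsuc k)) ≡ (if does (fsuc k Fin.≟ fsuc i) then 0 else f (fsuc k))
  lem k = refl
  lem2 : ∀ p q r → p + (q + r) ≡ q + (p + r)
  lem2 = solve-∀

size : ∀ {n} → (Fin n → Bool) → ℕ
size S = sumFin _ (λ i → 𝟙 (S i))

infixl 6 _∖_
_∖_ : ∀ {n} → (Fin n → Bool) → Fin n → Fin n → Bool
(S ∖ i) k = if does (k Fin.≟ i) then false else S k

∖-self : ∀ {n} (S : Fin n → Bool) i → ¬ T ((S ∖ i) i)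
∖-self S i h with i Fin.≟ i
... | yes _ = h
... | no n  = n refl

∖-other : ∀ {n} (S : Fin n → Bool) {i k} → k ≢ i → T (S k) → T ((S ∖ i) k)
∖-other S {i} {k} n h with k Fin.≟ i
... | yes e = n e
... | no _  = h

∖-sub : ∀ {n} (S : Fin n → Bool) {i k} → T ((S ∖ i) k) → T (S k)
∖-sub S {i} {k} h with k Fin.≟ i
... | no _  = h

sum-∖ : ∀ {n} (S : Fin n → Bool) (f : Fin n → ℕ) i → T (S i) →
  sumFin n (λ k → if S k then f k else 0) ≡ f i + sumFin n (λ k → if (S ∖ i) k then f k else 0)
sum-∖ {n} S f i h = trans (sum-at _ i) (cong₂ _+_ (self (S i) h) (sum-cong rest))
  where
  self : ∀ c → T c → (if c then f i else 0) ≡ f i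
  self true _ = refl
  rest : ∀ k → (if does (k Fin.≟ i) then 0 else (if S k then f k else 0)) ≡ (if (S ∖ i) k then f k else 0)
  rest k with k Fin.≟ i
  ... | yes _ = refl
  ... | no _  = refl

size-∖ : ∀ {n} (S : Fin n → Bool) i → T (S i) → size S ≡ suc (size (S ∖ i))
size-∖ S i h = sum-∖ S (λ _ → 1) i h

elems : ∀ {n} → (Fin n → Bool) → List (Fin n)
elems S = filter (λ i → T? (S i)) (allFin _)

elems-unique : ∀ {n} (S : Fin n → Bool) → Unique (elems S)
elems-unique S = Uniq.filter⁺ (λ i → T? (S i)) (Uniq.allFin⁺ _)

∈-elems : ∀ {n} (S : Fin n → Bool) {i} → T (S i) → i ∈ elems S
∈-elems S h = ∈-filter⁺ (λ i → T? (S i)) (∈-allFin _) h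

elems-∈ : ∀ {n} (S : Fin n → Bool) {i} → i ∈ elems S → T (S i)
elems-∈ {n} S m = proj₂ (∈-filter⁻ (λ i → T? (S i)) {xs = allFin n} m)

length-elems : ∀ {n} (S : Fin n → Bool) → length (elems S) ≡ size S
length-elems {n} S = go n id
  where
  go : ∀ m (f : Fin m → Fin n) → length (filter (λ i → T? (S i)) (tabulate f)) ≡ sumFin m (λ i → 𝟙 (S (f i)))
  go zero    f = refl
  go (suc m) f with S (f fzero)
  ... | true  = cong suc (go m (f ∘ fsuc))
  ... | false = go m (f ∘ fsuc)

size-mono : ∀ {n} {S S' : Fin n → Bool} → (∀ i → T (S i) → T (S' i)) → size S ≤ size S'
size-mono {S = S} {S'} h = sum-mono λ i → lem (S i) (S' i) (h i)
  where
  lem : ∀ p q → (T p → T q) → 𝟙 p ≤ 𝟙 q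
  lem false q     h = z≤n
  lem true  true  h = ≤-refl
  lem true  false h = ⊥-elim (h tt)

size-full : ∀ n → size {n} (λ _ → true) ≡ n
size-full zero    = refl
size-full (suc n) = cong suc (size-full n)

size-≤ : ∀ {n} (S : Fin n → Bool) → size S ≤ n
size-≤ {n} S = ≤-trans (size-mono {S = S} {λ _ → true} (λ _ _ → tt)) (≤-reflexive (size-full n))

list-size : ∀ {n} (S : Fin n → Bool) {xs : List (Fin n)} → Unique xs → All (λ i → T (S i)) xs → length xs ≤ size S
list-size S un h = ≤-trans (⊆-length un (λ m → ∈-elems S (All.lookup h m))) (≤-reflexive (length-elems S))

size-pos : ∀ {n} (S : Fin n → Bool) → 1 ≤ size S → Σ (Fin n) λ i → T (S i)
size-pos S h with elems S | elems-∈ S | length-elems S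
... | []     | _ | e = ⊥-elim (1+n≰n (≤-trans h (≤-reflexive (sym e))))
... | i ∷ _ | k | _ = i , k (here refl)

size-escape : ∀ {n} (S K : Fin n → Bool) → size K < size S → Σ (Fin n) λ i → T (S i) × ¬ T (K i)
size-escape S K h with Fin.any? (λ i → T? (S i) ×-dec ¬? (T? (K i)))
... | yes p = p
... | no ¬p = ⊥-elim (<⇒≱ h (size-mono {S = S} {K} (λ i s → decidable-stable (T? (K i)) (λ k → ¬p (i , s , k)))))

degA : ∀ {a b} → BipGraph a b → (Fin b → Bool) → Fin a → ℕ
degA E SB i = size (λ j → SB j ∧ E i j)

eS : ∀ {a b} → BipGraph a b → (Fin a → Bool) → (Fin b → Bool) → ℕ
eS {a} E SA SB = sumFin a (λ i → if SA i then degA E SB i else 0)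

eS-flip : ∀ {a b} (E : BipGraph a b) SA SB → eS E SA SB ≡ eS (flipE E) SB SA
eS-flip {a} {b} E SA SB = trans (sum-cong (λ i → push (SA i) (λ j → SB j ∧ E i j)))
  (trans (sum-swap a b _) (sum-cong λ j → trans (sum-cong (λ i → comm (SA i) (SB j) (E i j))) (sym (push (SB j) (λ i → SA i ∧ E i j)))))
  where
  push : ∀ {n} c (S : Fin n → Bool) → (if c then size S else 0) ≡ sumFin n (λ j → 𝟙 (c ∧ S j))
  push true  S = refl
  push {n} false S = sym (sum-0 n)
  comm : ∀ p q r → 𝟙 (p ∧ (q ∧ r)) ≡ 𝟙 (q ∧ (p ∧ r))
  comm true  true  r = refl
  comm true  false r = refl
  comm false true  r = refl
  comm false false r = refl

eS-∖ : ∀ {a b} (E : BipGraph a b) SA SB i → T (SA i) → eS E SA SB ≡ degA E SB i + eS E (SA ∖ i) SB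
eS-∖ E SA SB i h = sum-∖ SA (degA E SB) i h

eS-∖ᵇ : ∀ {a b} (E : BipGraph a b) SA SB j → T (SB j) → eS E SA SB ≡ degA (flipE E) SA j + eS E SA (SB ∖ j)
eS-∖ᵇ E SA SB j h = trans (eS-flip E SA SB) (trans (eS-∖ (flipE E) SB SA j h) (cong (degA (flipE E) SA j +_) (sym (eS-flip E SA (SB ∖ j)))))

eS≤ : ∀ {a b} (E : BipGraph a b) SA SB d → (∀ i → T (SA i) → degA E SB i ≤ d) → eS E SA SB ≤ d * size SA
eS≤ {a} E SA SB d h = ≤-trans (sum-mono λ i → lem i (SA i) (h i)) (≤-reflexive (sum-*ˡ a d (λ i → 𝟙 (SA i))))
  where
  lem : ∀ i c → (T c → degA E SB i ≤ d) → (if c then degA E SB i else 0) ≤ d * 𝟙 c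
  lem i true  h = ≤-trans (h tt) (≤-reflexive (sym (*-identityʳ d)))
  lem i false h = z≤n

deg≤size : ∀ {a b} (E : BipGraph a b) SB i → degA E SB i ≤ size SB
deg≤size E SB i = size-mono {S = λ j → SB j ∧ E i j} {SB} (λ j h → proj₁ (to-∧ (SB j) h))
  where
  to-∧ : ∀ p {q} → T (p ∧ q) → T p × T q
  to-∧ true h = tt , h

deg-mono : ∀ {a b} (E : BipGraph a b) {SB SB'} i → (∀ j → T (SB j) → T (SB' j)) → degA E SB i ≤ degA E SB' i
deg-mono E {SB} {SB'} i h = size-mono {S = λ j → SB j ∧ E i j} {λ j → SB' j ∧ E i j} (λ j → lem (SB j) (SB' j) (h j))
  where
  lem : ∀ p p' {q} → (T p → T p') → T (p ∧ q) → T (p' ∧ q)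
  lem true true h k = k
  lem true false h k = ⊥-elim (h tt)

-- The stopping rule and the invariant are parameters because the process runs in two ways: with
-- nothing protected until one class has a prescribed size, and with a biclique `KA`, `KB` protected
-- until few vertices are left outside it.
module Removal {a b} (E : BipGraph a b) (KA : Fin a → Bool) (KB : Fin b → Bool) (s t : ℕ)
  (Stop Inv : (Fin a → Bool) → (Fin b → Bool) → Set) where

  data Rem (SA : Fin a → Bool) (SB : Fin b → Bool) : Set where
    stop : Stop SA SB → Inv SA SB → Rem SA SB
    remA : ¬ Stop SA SB → Inv SA SB → ∀ i → T (SA i) → ¬ T (KA i) → degA E SB i ≤ s → Rem (SA ∖ i) SB → Rem SA SB
    remB : ¬ Stop SA SB → Inv SA SB → ∀ j → T (SB j) → ¬ T (KB j) → degA (flipE E) SA j ≤ t → Rem SA (SB ∖ j) → Rem SA SB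

  record Core : Set where
    field
      SA      : Fin a → Bool
      SB      : Fin b → Bool
      richA   : ∀ i → T (SA i) → ¬ T (KA i) → s < degA E SB i
      richB   : ∀ j → T (SB j) → ¬ T (KB j) → t < degA (flipE E) SA j
      running : ¬ Stop SA SB
      inv     : Inv SA SB

  process : (∀ SA SB → Dec (Stop SA SB)) →
    (∀ {SA SB} i → ¬ Stop SA SB → T (SA i) → ¬ T (KA i) → Inv SA SB → Inv (SA ∖ i) SB) →
    (∀ {SA SB} j → ¬ Stop SA SB → T (SB j) → ¬ T (KB j) → Inv SA SB → Inv SA (SB ∖ j)) →
    ∀ SA SB → Inv SA SB → Rem SA SB ⊎ Core
  process stop? invA invB SA SB = go _ SA SB ≤-refl
    where
    go : ∀ n SA SB → size SA + size SB ≤ n → Inv SA SB → Rem SA SB ⊎ Core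
    go n SA SB h inv with stop? SA SB
    ... | yes st = inj₁ (stop st inv)
    ... | no ¬st with Fin.any? (λ i → T? (SA i) ×-dec (¬? (T? (KA i)) ×-dec (degA E SB i ≤? s)))
                    | Fin.any? (λ j → T? (SB j) ×-dec (¬? (T? (KB j)) ×-dec (degA (flipE E) SA j ≤? t)))
    ...   | no ¬p | no ¬q = inj₂ (record { SA = SA ; SB = SB
              ; richA = λ i p q → ≰⇒> (λ d → ¬p (i , p , q , d))
              ; richB = λ j p q → ≰⇒> (λ d → ¬q (j , p , q , d)) ; running = ¬st ; inv = inv })
    go zero    SA SB h inv | no ¬st | yes (i , p , q , d) | _ = ⊥-elim (1+n≰n (≤-trans (≤-trans (≤-trans (s≤s z≤n) (≤-reflexive (sym (size-∖ SA i p)))) (m≤m+n _ _)) h))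
    go zero    SA SB h inv | no ¬st | no _ | yes (j , p , q , d) = ⊥-elim (1+n≰n (≤-trans (≤-trans (≤-trans (s≤s z≤n) (≤-reflexive (sym (size-∖ SB j p)))) (m≤n+m _ _)) h))
    go (suc n) SA SB h inv | no ¬st | yes (i , p , q , d) | _
      with go n (SA ∖ i) SB (s≤s⁻¹ (≤-trans (≤-reflexive (cong (_+ size SB) (sym (size-∖ SA i p)))) h)) (invA i ¬st p q inv)
    ... | inj₁ r = inj₁ (remA ¬st inv i p q d r)
    ... | inj₂ c = inj₂ c
    go (suc n) SA SB h inv | no ¬st | no _ | yes (j , p , q , d)
      with go n SA (SB ∖ j) (s≤s⁻¹ (≤-trans (≤-reflexive (trans (sym (+-suc _ _)) (cong (size SA +_) (sym (size-∖ SB j p))))) h)) (invB j ¬st p q inv)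
    ... | inj₁ r = inj₁ (remB ¬st inv j p q d r)
    ... | inj₂ c = inj₂ c

  -- Each deletion costs at most `s` or `t` edges. Sizes before and after stand on opposite sides of
  -- the inequality, which avoids subtraction.
  record Stopped (SA : Fin a → Bool) (SB : Fin b → Bool) : Set where
    field
      SA' : Fin a → Bool
      SB' : Fin b → Bool
      stp : Stop SA' SB'
      inv : Inv SA' SB'
      bound : eS E SA SB + s * size SA' + t * size SB' ≤ eS E SA' SB' + s * size SA + t * size SB

  stopped : ∀ {SA SB} → Rem SA SB → Stopped SA SB
  stopped (stop st inv) = record { stp = st ; inv = inv ; bound = ≤-refl }
  stopped {SA} {SB} (remA _ _ i p q d r) = record { stp = stp ; inv = inv ; bound = bound' }
    where
    open Stopped (stopped r)
    open ≤-Reasoning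
    bound' : eS E SA SB + s * size SA' + t * size SB' ≤ eS E SA' SB' + s * size SA + t * size SB
    bound' = begin
      eS E SA SB + s * size SA' + t * size SB' ≡⟨ cong (λ e → e + s * size SA' + t * size SB') (eS-∖ E SA SB i p) ⟩
      degA E SB i + eS E (SA ∖ i) SB + s * size SA' + t * size SB' ≡⟨ lem (degA E SB i) _ _ _ ⟩
      degA E SB i + (eS E (SA ∖ i) SB + s * size SA' + t * size SB') ≤⟨ +-mono-≤ d bound ⟩
      s + (eS E SA' SB' + s * size (SA ∖ i) + t * size SB) ≡⟨ lem2 s (eS E SA' SB') (size (SA ∖ i)) (t * size SB) ⟩
      eS E SA' SB' + s * suc (size (SA ∖ i)) + t * size SB ≡⟨ cong (λ k → eS E SA' SB' + s * k + t * size SB) (sym (size-∖ SA i p)) ⟩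
      eS E SA' SB' + s * size SA + t * size SB ∎
      where
      lem : ∀ p q r s → p + q + r + s ≡ p + (q + r + s)
      lem = solve-∀
      lem2 : ∀ s e n t → s + (e + s * n + t) ≡ e + s * suc n + t
      lem2 = solve-∀
  stopped {SA} {SB} (remB _ _ j p q d r) = record { stp = stp ; inv = inv ; bound = bound' }
    where
    open Stopped (stopped r)
    open ≤-Reasoning
    bound' : eS E SA SB + s * size SA' + t * size SB' ≤ eS E SA' SB' + s * size SA + t * size SB
    bound' = begin
      eS E SA SB + s * size SA' + t * size SB' ≡⟨ cong (λ e → e + s * size SA' + t * size SB') (eS-∖ᵇ E SA SB j p) ⟩
      degA (flipE E) SA j + eS E SA (SB ∖ j) + s * size SA' + t * size SB' ≡⟨ lem (degA (flipE E) SA j) _ _ _ ⟩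
      degA (flipE E) SA j + (eS E SA (SB ∖ j) + s * size SA' + t * size SB') ≤⟨ +-mono-≤ d bound ⟩
      t + (eS E SA' SB' + s * size SA + t * size (SB ∖ j)) ≡⟨ lem2 t (eS E SA' SB') (s * size SA) (size (SB ∖ j)) ⟩
      eS E SA' SB' + s * size SA + t * suc (size (SB ∖ j)) ≡⟨ cong (λ k → eS E SA' SB' + s * size SA + t * k) (sym (size-∖ SB j p)) ⟩
      eS E SA' SB' + s * size SA + t * size SB ∎
      where
      lem : ∀ p q r s → p + q + r + s ≡ p + (q + r + s)
      lem = solve-∀
      lem2 : ∀ t e x n → t + (e + x + t * n) ≡ e + x + t * suc n
      lem2 = solve-∀

-- Ears on a biclique

pick : ∀ {A : Set} {x : A} {xs} → x ∈ xs → Unique xs →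
  Σ (List A) λ ys → Unique (x ∷ ys) × length xs ≡ suc (length ys) × (∀ {w} → w ∈ ys → w ∈ xs)
pick {x = x} m un with ∈-∃++ m
... | l , r , refl = l ++ r , unique-↭ p un , ↭.↭-length p , λ k → ↭.∈-resp-↭ (↭-sym p) (there k)
  where p = ↭.shift x l r

pick₂ : ∀ {A : Set} {x y : A} {xs} → x ∈ xs → y ∈ xs → x ≢ y → Unique xs →
  Σ (List A) λ ys → Unique (x ∷ y ∷ ys) × length xs ≡ 2 + length ys × (∀ {w} → w ∈ ys → w ∈ xs)
pick₂ {x = x} {y} m k ne un with ∈-∃++ m
... | l , r , refl with pick {xs = l ++ r} (y∈ (∈-++⁻ l k)) (AllPairs.tail (unique-↭ (↭.shift x l r) un))
  where
  y∈ : y ∈ l ⊎ y ∈ x ∷ r → y ∈ l ++ r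
  y∈ (inj₁ p)           = ∈-++⁺ˡ p
  y∈ (inj₂ (here refl)) = ⊥-elim (ne refl)
  y∈ (inj₂ (there p))   = ∈-++⁺ʳ l p
...   | ys , uy , ly , sy = ys , unique-∷ x∉ uy , trans (↭.↭-length (↭.shift x l r)) (cong suc ly) , λ p → up (sy p)
  where
  ux : Unique (x ∷ l ++ r)
  ux = unique-↭ (↭.shift x l r) un
  up : ∀ {w} → w ∈ l ++ r → w ∈ l ++ x ∷ r
  up p = ↭.∈-resp-↭ (↭-sym (↭.shift x l r)) (there p)
  x∉ : x ∉ y ∷ ys
  x∉ (here refl) = ne refl
  x∉ (there p)   = All.lookup (AllPairs.head ux) (sy p) refl

endOf-∈ : ∀ {A : Set} (y : A) ys → endOf y ys ∈ y ∷ ys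
endOf-∈ y []        = here refl
endOf-∈ y (y' ∷ ys) = there (endOf-∈ y' ys)

module _ {a b : ℕ} where

  zig : List (Fin a) → List (Fin b) → List (Vertex a b)
  zig (x ∷ xs) (y ∷ ys) = inj₁ x ∷ inj₂ y ∷ zig xs ys
  zig _        _        = []

  zig-∈ : ∀ xs ys {v} → v ∈ zig xs ys → (Σ (Fin a) λ x → x ∈ xs × v ≡ inj₁ x) ⊎ (Σ (Fin b) λ y → y ∈ ys × v ≡ inj₂ y)
  zig-∈ (x ∷ xs) (y ∷ ys) (here refl)         = inj₁ (x , here refl , refl)
  zig-∈ (x ∷ xs) (y ∷ ys) (there (here refl)) = inj₂ (y , here refl , refl)
  zig-∈ (x ∷ xs) (y ∷ ys) (there (there m)) with zig-∈ xs ys m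
  ... | inj₁ (x' , k , e) = inj₁ (x' , there k , e)
  ... | inj₂ (y' , k , e) = inj₂ (y' , there k , e)

  zig-∈₁ : ∀ xs ys {x} → inj₁ x ∈ zig xs ys → x ∈ xs
  zig-∈₁ xs ys m with zig-∈ xs ys m
  ... | inj₁ (_ , k , refl) = k
  ... | inj₂ (_ , _ , ())

  zig-∈₂ : ∀ xs ys {y} → inj₂ y ∈ zig xs ys → y ∈ ys
  zig-∈₂ xs ys m with zig-∈ xs ys m
  ... | inj₁ (_ , _ , ())
  ... | inj₂ (_ , k , refl) = k

  zig-unique : ∀ {xs ys} → Unique xs → Unique ys → Unique (zig xs ys)
  zig-unique {[]}     {ys}     _ _ = []
  zig-unique {x ∷ xs} {[]}     _ _ = []
  zig-unique {x ∷ xs} {y ∷ ys} (h ∷ u) (k ∷ w) =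
    unique-∷ (λ { (there m) → All.lookup h (zig-∈₁ xs ys m) refl })
      (unique-∷ (λ m → All.lookup k (zig-∈₂ xs ys m) refl) (zig-unique u w))

  zig-length : ∀ xs ys → length xs ≡ length ys → length (zig xs ys) ≡ 2 * length xs
  zig-length []       ys       e = refl
  zig-length (x ∷ xs) (y ∷ ys) e = cong suc (trans (cong suc (zig-length xs ys (suc-injective e))) (sym (+-suc _ _)))

  module _ {E : BipGraph a b} where

    zigTr : ∀ y xs ys → length xs ≡ length ys → (∀ {x y'} → x ∈ xs → y' ∈ y ∷ ys → T (E x y')) →
      Tr E (inj₂ y) (zig xs ys) (inj₂ (endOf y ys))
    zigTr y []       []        e h = []
    zigTr y (x ∷ xs) (y' ∷ ys) e h =
      h (here refl) (here refl) ∷ (h (here refl) (there (here refl)) ∷ zigTr y' xs ys (suc-injective e) (λ p q → h (there p) (there q)))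

record Biclique {a b} (E : BipGraph a b) (n : ℕ) : Set where
  field
    As  : List (Fin a)
    Bs  : List (Fin b)
    uA  : Unique As
    uB  : Unique Bs
    lA  : length As ≡ n
    lB  : length Bs ≡ n
    all : ∀ {x y} → x ∈ As → y ∈ Bs → T (E x y)

flipBi : ∀ {a b n} {E : BipGraph a b} → Biclique E n → Biclique (flipE E) n
flipBi K = record { As = Bs ; Bs = As ; uA = uB ; uB = uA ; lA = lB ; lB = lA ; all = λ p q → all q p }
  where open Biclique K

module _ {a b} {E : BipGraph a b} {n : ℕ} (K : Biclique E n) where
  open Biclique K

  inK : Vertex a b → Set
  inK (inj₁ x) = x ∈ As
  inK (inj₂ y) = y ∈ Bs

  inK? : Decidable inK
  inK? (inj₁ x) = Any.any? (x Fin.≟_) As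
  inK? (inj₂ y) = Any.any? (y Fin.≟_) Bs

  -- x … y outside K, closed up by a Hamiltonian path of K.
  earAB : EvenShort E (suc n) → ∀ {x y es} → x ∈ As → y ∈ Bs → Tr E (inj₁ x) es (inj₂ y) → Unique (inj₁ x ∷ es) →
    (∀ {w} → w ∈ es → inK w → w ≡ inj₂ y) → 3 ≤ length es → ⊥
  earAB short {x} {y} {es} x∈ y∈ t un out big with pick x∈ uA | pick y∈ uB
  ... | xs , ux , lx , sx | ys , uy , ly , sy = lin⊥ 1
        (+-mono-≤ (subst₂ (λ k m → 2 + k ≤ 2 * suc m) len (trans (sym lA) lx) (short tc uc)) big)
        (arith (length xs) (length es))
    where
    lxy : length xs ≡ length ys
    lxy = suc-injective (trans (sym lx) (trans lA (trans (sym lB) ly)))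
    cyc : List (Vertex a b)
    cyc = es ++ zig xs ys ++ [ inj₁ x ]
    end∈B : ∀ {z} → z ∈ y ∷ ys → z ∈ Bs
    end∈B (here refl) = y∈
    end∈B (there m)   = sy m
    tc : Tr E (inj₁ x) cyc (inj₁ x)
    tc = t ++ᵗ (zigTr y xs ys lxy (λ p q → all (sx p) (end∈B q)) ++ᵗ edge (all x∈ (end∈B (endOf-∈ y ys))))
    clash : ∀ {w} → w ∈ es → (Σ (Fin a) λ x → x ∈ xs × w ≡ inj₁ x) ⊎ (Σ (Fin b) λ y → y ∈ ys × w ≡ inj₂ y) → ⊥
    clash p (inj₁ (x' , m , refl)) with out p (sx m)
    ... | ()
    clash p (inj₂ (y' , m , refl)) with out p (sy m)
    ... | refl = All.lookup (AllPairs.head uy) m refl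
    uc : Unique cyc
    uc = unique-++ (AllPairs.tail un) (unique-++ (zig-unique (AllPairs.tail ux) (AllPairs.tail uy)) ([] ∷ [])
             (λ { m (here refl) → All.lookup (AllPairs.head ux) (zig-∈₁ xs ys m) refl }))
           (λ p q → [ (λ m → clash p (zig-∈ xs ys m)) , (λ { (here refl) → unique-disj [ inj₁ x ] un (here refl) p }) ]′ (∈-++⁻ (zig xs ys) q))
    len : length cyc ≡ length es + (2 * length xs + 1)
    len = trans (length-++ es) (cong (length es +_) (trans (length-++ (zig xs ys)) (cong (_+ 1) (zig-length xs ys lxy))))
    arith : ∀ m e → suc (2 * suc (suc m) + e) + 1 ≡ 2 + (e + (2 * m + 1)) + 3
    arith = solve-∀

  -- The path of K that closes the ear visits all of `As` but only n - 1 vertices of `Bs` (`z` is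
  -- left out), so the ear needs one edge more than in `earAB`.
  earAA : EvenShort E (suc n) → ∀ {x x' es} → x ∈ As → x' ∈ As → x ≢ x' → Tr E (inj₁ x) es (inj₁ x') → Unique (inj₁ x ∷ es) →
    (∀ {w} → w ∈ es → inK w → w ≡ inj₁ x') → 4 ≤ length es → ⊥
  earAA short {x} {x'} {es} x∈ x'∈ ne t un out big = go (pick₂ x∈ x'∈ ne uA) Bs uB id lB
    where
    go : (Σ (List (Fin a)) λ xs → Unique (x ∷ x' ∷ xs) × length As ≡ 2 + length xs × (∀ {w} → w ∈ xs → w ∈ As)) →
      ∀ ys' → Unique ys' → (∀ {w} → w ∈ ys' → w ∈ Bs) → length ys' ≡ n → ⊥
    go (xs , ux , lx , sx) []            _  _  e = 0≢1+n (trans e (trans (sym lA) lx))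
    go (xs , ux , lx , sx) (_ ∷ [])      _  _  e = 0≢1+n (suc-injective (trans e (trans (sym lA) lx)))
    go (xs , ux , lx , sx) (z ∷ y ∷ ys) (uz ∷ uy) sy e = lin⊥ 1
        (+-mono-≤ (subst₂ (λ k m → 2 + k ≤ 2 * suc m) len (trans (sym lA) lx) (short tc uc)) big)
        (arith (length xs) (length es))
      where
      lxy : length xs ≡ length ys
      lxy = suc-injective (suc-injective (trans (sym lx) (trans lA (sym e))))
      cyc : List (Vertex a b)
      cyc = es ++ inj₂ y ∷ zig xs ys ++ [ inj₁ x ]
      tc : Tr E (inj₁ x) cyc (inj₁ x)
      tc = t ++ᵗ (all x'∈ (sy (there (here refl))) ∷ (zigTr y xs ys lxy (λ p q → all (sx p) (sy (there q))) ++ᵗ edge (all x∈ (sy (there (endOf-∈ y ys))))))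
      clash : ∀ {w} → w ∈ es → (Σ (Fin a) λ x → x ∈ xs × w ≡ inj₁ x) ⊎ (Σ (Fin b) λ y → y ∈ ys × w ≡ inj₂ y) → ⊥
      clash p (inj₁ (_ , m , refl)) with out p (sx m)
      ... | refl = All.lookup (AllPairs.head (AllPairs.tail ux)) m refl
      clash p (inj₂ (_ , m , refl)) with out p (sy (there (there m)))
      ... | ()
      uc : Unique cyc
      uc = unique-++ (AllPairs.tail un)
             (unique-∷ (λ m → [ (λ k → All.lookup (AllPairs.head uy) (zig-∈₂ xs ys k) refl) , (λ { (here ()) ; (there ()) }) ]′ (∈-++⁻ (zig xs ys) m))
               (unique-++ (zig-unique (AllPairs.tail (AllPairs.tail ux)) (AllPairs.tail uy)) ([] ∷ [])
                 (λ { m (here refl) → All.lookup (AllPairs.head ux) (there (zig-∈₁ xs ys m)) refl })))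
             (λ { p (here refl) → notB p
                ; p (there q) → [ (λ m → clash p (zig-∈ xs ys m)) , (λ { (here refl) → unique-disj [ inj₁ x ] un (here refl) p }) ]′ (∈-++⁻ (zig xs ys) q) })
        where
        notB : inj₂ y ∈ es → ⊥
        notB p with out p (sy (there (here refl)))
        ... | ()
      len : length cyc ≡ length es + suc (2 * length xs + 1)
      len = trans (length-++ es) (cong (λ k → length es + suc k) (trans (length-++ (zig xs ys)) (cong (_+ 1) (zig-length xs ys lxy))))
      arith : ∀ m e → suc (2 * suc (2 + m) + e) + 1 ≡ 2 + (e + suc (2 * m + 1)) + 4
      arith = solve-∀

  -- Single vertices attached to K on both sides: one cycle passes through K, `v` and `z`, with 2n +
  -- 2 vertices.
  twoEars : EvenShort E (suc n) → ∀ {v z u₁ u₂ x₁ x₂} → v ∉ As → z ∉ Bs → u₁ ∈ Bs → u₂ ∈ Bs → u₁ ≢ u₂ → x₁ ∈ As → x₂ ∈ As → x₁ ≢ x₂ →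
    T (E v u₁) → T (E v u₂) → T (E x₁ z) → T (E x₂ z) → ⊥
  twoEars short {v} {z} {u₁} {u₂} {x₁} {x₂} v∉ z∉ u₁∈ u₂∈ nu x₁∈ x₂∈ nx vu₁ vu₂ xz₁ xz₂ with pick₂ x₁∈ x₂∈ nx uA | pick₂ u₁∈ u₂∈ nu uB
  ... | xs , ux , lx , sx | ys , uy , ly , sy = lin⊥ 1
      (subst₂ (λ k m → 2 + k ≤ 2 * suc m) len (trans (sym lA) lx) (short tc uc)) (arith (length xs))
    where
    lxy : length xs ≡ length ys
    lxy = suc-injective (suc-injective (trans (sym lx) (trans lA (trans (sym lB) ly))))
    end∈B : ∀ {w} → w ∈ u₂ ∷ ys → w ∈ Bs
    end∈B (here refl) = u₂∈
    end∈B (there m)   = sy m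
    tail : List (Vertex a b)
    tail = inj₁ x₁ ∷ inj₂ z ∷ inj₁ x₂ ∷ inj₂ u₁ ∷ []
    cyc : List (Vertex a b)
    cyc = inj₁ v ∷ inj₂ u₂ ∷ zig xs ys ++ tail
    tc : Tr E (inj₂ u₁) cyc (inj₂ u₁)
    tc = vu₁ ∷ (vu₂ ∷ (zigTr u₂ xs ys lxy (λ p q → all (sx p) (end∈B q)) ++ᵗ (all x₁∈ (end∈B (endOf-∈ u₂ ys)) ∷ (xz₁ ∷ (xz₂ ∷ edge (all x₂∈ u₁∈))))))
    zigout : ∀ {w} → w ∈ zig xs ys → w ∈ tail → ⊥
    zigout m (here refl)                         = All.lookup (AllPairs.head ux) (there (zig-∈₁ xs ys m)) refl
    zigout m (there (here refl))                 = z∉ (sy (zig-∈₂ xs ys m))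
    zigout m (there (there (here refl)))         = All.lookup (AllPairs.head (AllPairs.tail ux)) (zig-∈₁ xs ys m) refl
    zigout m (there (there (there (here refl)))) = All.lookup (AllPairs.head uy) (there (zig-∈₂ xs ys m)) refl
    utail : Unique tail
    utail = ((λ ()) ∷ (λ { refl → nx refl }) ∷ (λ ()) ∷ []) ∷ ((λ ()) ∷ (λ { refl → z∉ u₁∈ }) ∷ []) ∷ ((λ ()) ∷ []) ∷ [] ∷ []
    uc : Unique cyc
    uc = unique-∷ (λ { (there m) → [ (λ k → v∉ (sx (zig-∈₁ xs ys k))) , (λ { (here refl) → v∉ x₁∈ ; (there (there (here refl))) → v∉ x₂∈ ; (there (there (there (there ())))) }) ]′ (∈-++⁻ (zig xs ys) m) })
           (unique-∷ (λ m → [ (λ k → All.lookup (AllPairs.head (AllPairs.tail uy)) (zig-∈₂ xs ys k) refl)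
                            , (λ { (there (here refl)) → z∉ u₂∈ ; (there (there (there (here refl)))) → nu refl }) ]′ (∈-++⁻ (zig xs ys) m))
             (unique-++ (zig-unique (AllPairs.tail (AllPairs.tail ux)) (AllPairs.tail (AllPairs.tail uy))) utail zigout))
    len : length cyc ≡ 2 + (2 * length xs + 4)
    len = cong (2 +_) (trans (length-++ (zig xs ys)) (cong (_+ 4) (zig-length xs ys lxy)))
    arith : ∀ m → suc (2 * suc (2 + m)) + 1 ≡ 2 + (2 + (2 * m + 4))
    arith = solve-∀

record Ear {a b} (E : BipGraph a b) (K₂ : Vertex a b → Set) : Set where
  field
    {u o q}  : Vertex a b
    {zs}     : List (Vertex a b)
    u∈       : K₂ u
    q∈       : K₂ q
    o∉       : ¬ K₂ o
    u~o      : Adj E u o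
    trl      : Tr E o zs q
    unq      : Unique (u ∷ o ∷ zs)
    hit      : ∀ {w} → w ∈ zs → K₂ w → w ≡ q

-- 2-connectivity is applied twice: leave the set towards `w` while avoiding `k₁`, then return from
-- the first outer vertex `o` while avoiding the vertex of departure.
ear : ∀ {a b} {E : BipGraph a b} → Robust E → {K₂ : Vertex a b → Set} → Decidable K₂ →
  ∀ {k₀ k₁ w} → K₂ k₀ → K₂ k₁ → k₀ ≢ k₁ → ¬ K₂ w → Ear E K₂
ear {a} {b} {E} rob {K₂} K₂? {k₀} {k₁} {w} k₀∈ k₁∈ ne w∉ = first (segment {S = K₂} {T = _≡ w} K₂? (_≟ᵛ w) (rob k₁ k₀ w ne (λ { refl → w∉ k₁∈ })) refl)
  where
  V = Vertex a b
  other : ∀ z → Σ V λ t → K₂ t × t ≢ z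
  other z with k₀ ≟ᵛ z
  ... | no n     = k₀ , k₀∈ , n
  ... | yes refl = k₁ , k₁∈ , λ e → ne (sym e)
  second : ∀ {z₀ o} → K₂ z₀ → ¬ K₂ o → Adj E z₀ o → (t : Σ V λ t → K₂ t × t ≢ z₀) → Segment E (λ v → v ≢ z₀) (_≡ o) K₂ o → Ear E K₂
  second {z₀} {o} z₀∈ o∉ e _ record { from = f ; to = q ; path = zs ; start = st ; trail = tr ; arrives = ar ; uni = un ; good = g ; firstHit = fh } with same st
    where
    same : f ≡ o ⊎ f ≡ o → f ≡ o
    same = [ id , id ]′
  ... | refl = record { u∈ = z₀∈ ; q∈ = ar ; o∉ = o∉ ; u~o = e ; trl = tr ; unq = unique-∷ (λ m → g m refl) un ; hit = λ m → fh (there m) }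
  first : Segment E (λ v → v ≢ k₁) K₂ (_≡ w) k₀ → Ear E K₂
  first record { start = st ; trail = [] ; arrives = refl } = ⊥-elim (w∉ ([ (λ { refl → k₀∈ }) , id ]′ st))
  first record { from = z₀ ; start = st ; trail = _∷_ {w = o} e _ ; leaves = l } =
    let z₀∈ = [ (λ { refl → k₀∈ }) , id ]′ st
        o∉  = l (here refl)
        t   = other z₀
    in second z₀∈ o∉ e t (segment {S = _≡ o} {T = K₂} (_≟ᵛ o) K₂? (rob z₀ o (proj₁ t) (λ { refl → o∉ z₀∈ }) (proj₂ (proj₂ t))) (proj₁ (proj₂ t)))

outside : ∀ {n} (xs : List (Fin n)) → length xs < n → Σ (Fin n) (_∉ xs)
outside {n} xs h with Fin.any? (λ i → ¬? (Any.any? (i Fin.≟_) xs))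
... | yes p = p
... | no ¬p = ⊥-elim (<⇒≱ h (≤-trans (≤-reflexive (sym (length-tabulate id)))
    (⊆-length (Uniq.allFin⁺ n) (λ {i} _ → decidable-stable (Any.any? (i Fin.≟_) xs) (λ k → ¬p (i , k))))))

module _ {a b n} {E : BipGraph a b} (short : EvenShort E (suc n)) (K : Biclique E n) where
  open Biclique K

  earFromA : ∀ {x v es} → x ∈ As → inK K v → inj₁ x ≢ v → Tr E (inj₁ x) es v → Unique (inj₁ x ∷ es) →
    (∀ {w} → w ∈ es → inK K w → w ≡ v) → 3 ≤ length es → ⊥
  earFromA {v = inj₂ y} x∈ v∈ ne t un hit big = earAB K short x∈ v∈ t un hit big
  earFromA {v = inj₁ x'} {es} x∈ v∈ ne t un hit big = earAA K short x∈ v∈ (λ e → ne (cong inj₁ e)) t un hit (four es big (side-Tr t))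
    where
    -- Both ends lie in A, so the length is even and three edges are in fact four.
    four : ∀ es → 3 ≤ length es → true ≡ flipBy (parity (length es)) true → 4 ≤ length es
    four (_ ∷ _ ∷ _ ∷ [])        _ ()
    four (_ ∷ _ ∷ _ ∷ _ ∷ _)     _ _ = s≤s (s≤s (s≤s (s≤s z≤n)))
    four (_ ∷ [])     (s≤s ()) _
    four (_ ∷ _ ∷ []) (s≤s (s≤s ())) _

earContra : ∀ {a b n} {E : BipGraph a b} (short : EvenShort E (suc n)) (K : Biclique E n) {u v : Vertex a b} {es : List (Vertex a b)} →
  inK K u → inK K v → u ≢ v → Tr E u es v → Unique (u ∷ es) → (∀ {w} → w ∈ es → inK K w → w ≡ v) → 3 ≤ length es → ⊥
earContra short K {inj₁ x} = earFromA short K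
earContra {a} {b} {n} {E} short K {inj₂ y} {v} {es} u∈ v∈ ne t un hit big =
  earFromA (flip-short {l = suc n} short) (flipBi K) u∈ (toFlip v v∈) (λ e → ne (sw-injective e)) (sw-Tr t) (Uniq.map⁺ sw-injective un) hit'
    (subst (3 ≤_) (sym (length-map sw es)) big)
  where
  toFlip : ∀ w → inK K w → inK (flipBi K) (sw w)
  toFlip (inj₁ _) h = h
  toFlip (inj₂ _) h = h
  fromFlip : ∀ w → inK (flipBi K) (sw w) → inK K w
  fromFlip (inj₁ _) h = h
  fromFlip (inj₂ _) h = h
  hit' : ∀ {w} → w ∈ map sw es → inK (flipBi K) w → w ≡ sw v
  hit' m k with ∈-map⁻ sw m
  ... | w , w∈ , refl = cong sw (hit w∈ (fromFlip w k))

-- Adjoin to K every vertex with two neighbours in K. If nothing else remains, an outer vertex of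
-- each class yields `twoEars`. Otherwise there is an ear through a vertex that is not attached; its
-- ends are prolonged into K where necessary, and it has at least three edges.
noBiclique : ∀ {a b n} {E : BipGraph a b} → Robust E → EvenShort E (suc n) → 2 ≤ n → Biclique E n → n < a → n < b → ⊥
noBiclique {a} {b} {n} {E} rob short n≥2 K n<a n<b = go As Bs refl refl
  where
  open Biclique K
  V = Vertex a b
  Kl : List V
  Kl = map inj₁ As ++ map inj₂ Bs
  toKl : ∀ {v} → inK K v → v ∈ Kl
  toKl {inj₁ x} m = ∈-++⁺ˡ (∈-map⁺ inj₁ m)
  toKl {inj₂ y} m = ∈-++⁺ʳ (map inj₁ As) (∈-map⁺ inj₂ m)
  fromKl : ∀ {v} → v ∈ Kl → inK K v
  fromKl m with ∈-++⁻ (map inj₁ As) m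
  ... | inj₁ k with ∈-map⁻ inj₁ k
  ...   | _ , x∈ , refl = x∈
  fromKl m | inj₂ k with ∈-map⁻ inj₂ k
  ...   | _ , y∈ , refl = y∈
  Att : V → Set
  Att o = Any (λ k → Adj E o k × Any (λ k' → k ≢ k' × Adj E o k') Kl) Kl
  att? : Decidable Att
  att? o = Any.any? (λ k → adj? E o k ×-dec Any.any? (λ k' → ¬? (k ≟ᵛ k') ×-dec adj? E o k') Kl) Kl
  mkAtt : ∀ {o k k'} → inK K k → inK K k' → k ≢ k' → Adj E o k → Adj E o k' → Att o
  mkAtt p q ne e e' = lose (toKl p) (e , lose (toKl q) (ne , e'))
  unAtt : ∀ {o} → Att o → Σ V λ k → Σ V λ k' → inK K k × inK K k' × k ≢ k' × Adj E o k × Adj E o k'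
  unAtt h with find h
  ... | k , k∈ , e , h' with find h'
  ...   | k' , k'∈ , ne , e' = k , k' , fromKl k∈ , fromKl k'∈ , ne , e , e'
  K₂ : V → Set
  K₂ v = inK K v ⊎ Att v
  K₂? : Decidable K₂
  K₂? v = inK? K v ⊎-dec att? v
  -- Prolong an end of the ear into K by one edge if necessary.
  Exit : V → Set
  Exit v = inK K v ⊎ (¬ inK K v × Att v)
  exit : ∀ {v} → K₂ v → Exit v
  exit {v} h with inK? K v
  ... | yes p = inj₁ p
  ... | no ¬p = inj₂ (¬p , [ (λ p → ⊥-elim (¬p p)) , id ]′ h)
  choose : ∀ {o} (bad : V) → Att o → Σ V λ k → inK K k × k ≢ bad × Adj E o k
  choose {o} bad h with unAtt {o} h
  ... | k , k' , p , p' , ne , e , e' with k ≟ᵛ bad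
  ...   | no n     = k , p , n , e
  ...   | yes refl = k' , p' , (λ q → ne (sym q)) , e'
  earOut : Ear E K₂ → ⊥
  earOut record { u = u ; o = o ; q = q ; zs = zs ; u∈ = u∈ ; q∈ = q∈ ; o∉ = o∉ ; u~o = u~o ; trl = t ; unq = un ; hit = hit } = cases (exit u∈) (exit q∈)
    where
    q≢o : q ≢ o
    q≢o refl = o∉ q∈
    q∈zs : q ∈ zs
    q∈zs with end∈ t
    ... | here e  = ⊥-elim (q≢o e)
    ... | there m = m
    u≢q : u ≢ q
    u≢q refl = unique-disj [ u ] un (here refl) (there q∈zs)
    1≤zs : 1 ≤ length zs
    1≤zs = ∈-length q∈zs
    hitK : ∀ {w} → w ∈ o ∷ zs → inK K w → w ≡ q
    hitK (here refl) k = ⊥-elim (o∉ (inj₁ k))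
    hitK (there m)   k = hit m (inj₁ k)
    -- If `o` were the only vertex between two vertices of K, it would be attached itself.
    long : ∀ zs → Tr E o zs q → inK K u → inK K q → 2 ≤ length zs
    long []           []             p r = ⊥-elim (q≢o refl)
    long (_ ∷ [])     (e ∷ [])       p r = ⊥-elim (o∉ (inj₂ (mkAtt {o} p r u≢q (adj-sym E u o u~o) e)))
    long (_ ∷ _ ∷ _) _              p r = s≤s (s≤s z≤n)
    cases : Exit u → Exit q → ⊥
    cases (inj₁ p) (inj₁ r) = earContra short K p r u≢q (u~o ∷ t) un hitK (s≤s (long zs t p r))
    cases (inj₂ (u∉ , at)) (inj₁ r) with choose {u} q at
    ... | k , k∈ , k≢q , e = earContra short K k∈ r k≢q (adj-sym E u k e ∷ (u~o ∷ t)) (unique-∷ k∉ un) hit' (s≤s (s≤s 1≤zs))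
      where
      hit' : ∀ {w} → w ∈ u ∷ o ∷ zs → inK K w → w ≡ q
      hit' (here refl) h = ⊥-elim (u∉ h)
      hit' (there m)   h = hitK m h
      k∉ : k ∉ u ∷ o ∷ zs
      k∉ m = k≢q (hit' m k∈)
    cases (inj₁ p) (inj₂ (q∉ , at)) with choose {q} u at
    ... | k , k∈ , k≢u , e = earContra short K p k∈ (λ x → k≢u (sym x)) ((u~o ∷ t) ++ᵗ edge e)
            (unique-↭ (↭.++-comm [ k ] (u ∷ o ∷ zs)) (unique-∷ k∉ un)) hit'
            (s≤s (≤-trans (s≤s 1≤zs) (≤-reflexive (sym (trans (length-++ zs) (+-comm _ 1))))))
      where
      none : ∀ {w} → w ∈ o ∷ zs → ¬ inK K w
      none m h with hitK m h
      ... | refl = q∉ h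
      k∉ : k ∉ u ∷ o ∷ zs
      k∉ (here e)  = k≢u e
      k∉ (there m) = none m k∈
      hit' : ∀ {w} → w ∈ (o ∷ zs) ++ [ k ] → inK K w → w ≡ k
      hit' m h with ∈-++⁻ (o ∷ zs) m
      ... | inj₁ m'          = ⊥-elim (none m' h)
      ... | inj₂ (here refl) = refl
    cases (inj₂ (u∉ , at)) (inj₂ (q∉ , at')) with unAtt {u} at
    ... | k , _ , k∈ , _ , _ , e , _ with choose {q} k at'
    ...   | k' , k'∈ , k'≢k , e' = earContra short K k∈ k'∈ (λ x → k'≢k (sym x)) (adj-sym E u k e ∷ (u~o ∷ t) ++ᵗ edge e')
            (unique-∷ k∉' (unique-↭ (↭.++-comm [ k' ] (u ∷ o ∷ zs)) (unique-∷ (λ m → none m k'∈) un))) hit'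
            (s≤s (s≤s (≤-trans 1≤zs (≤-trans (m≤m+n _ 1) (≤-reflexive (sym (length-++ zs)))))))
      where
      none : ∀ {w} → w ∈ u ∷ o ∷ zs → ¬ inK K w
      none (here refl) h = u∉ h
      none (there m)   h with hitK m h
      ... | refl = q∉ h
      hit' : ∀ {w} → w ∈ (u ∷ o ∷ zs) ++ [ k' ] → inK K w → w ≡ k'
      hit' m h with ∈-++⁻ (u ∷ o ∷ zs) m
      ... | inj₁ m'          = ⊥-elim (none m' h)
      ... | inj₂ (here refl) = refl
      k∉' : k ∉ (u ∷ o ∷ zs) ++ [ k' ]
      k∉' m = k'≢k (sym (hit' m k∈))
  attA : ∀ {v} → Att (inj₁ v) → Σ (Fin b) λ u₁ → Σ (Fin b) λ u₂ → u₁ ∈ Bs × u₂ ∈ Bs × u₁ ≢ u₂ × T (E v u₁) × T (E v u₂)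
  attA {v} h with unAtt {inj₁ v} h
  ... | inj₂ k , inj₂ k' , p , p' , ne , e , e' = k , k' , p , p' , (λ q → ne (cong inj₂ q)) , e , e'
  attB : ∀ {z} → Att (inj₂ z) → Σ (Fin a) λ u₁ → Σ (Fin a) λ u₂ → u₁ ∈ As × u₂ ∈ As × u₁ ≢ u₂ × T (E u₁ z) × T (E u₂ z)
  attB {z} h with unAtt {inj₂ z} h
  ... | inj₁ k , inj₁ k' , p , p' , ne , e , e' = k , k' , p , p' , (λ q → ne (cong inj₁ q)) , e , e'
  go : ∀ as bs → as ≡ As → bs ≡ Bs → ⊥
  go []       _  refl _ = 1+n≰n (≤-trans n≥2 (≤-trans (≤-reflexive (sym lA)) z≤n))
  go (_ ∷ _) [] _ refl = 1+n≰n (≤-trans n≥2 (≤-trans (≤-reflexive (sym lB)) z≤n))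
  go (x ∷ _) (y ∷ _) refl refl with outside As (≤-trans (≤-reflexive (cong suc lA)) n<a) | outside Bs (≤-trans (≤-reflexive (cong suc lB)) n<b)
  ... | v , v∉ | z , z∉ with K₂? (inj₁ v) | K₂? (inj₂ z)
  ...   | no ¬p | _     = earOut (ear rob K₂? {k₀ = inj₁ x} {k₁ = inj₂ y} {w = inj₁ v} (inj₁ (here refl)) (inj₁ (here refl)) (λ ()) ¬p)
  ...   | yes _ | no ¬q = earOut (ear rob K₂? {k₀ = inj₁ x} {k₁ = inj₂ y} {w = inj₂ z} (inj₁ (here refl)) (inj₁ (here refl)) (λ ()) ¬q)
  ...   | yes (inj₁ p) | _ = v∉ p
  ...   | yes (inj₂ _) | yes (inj₁ q) = z∉ q
  ...   | yes (inj₂ p) | yes (inj₂ q) with attA {v} p | attB {z} q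
  ...     | u₁ , u₂ , m₁ , m₂ , ne , e₁ , e₂ | x₁ , x₂ , k₁ , k₂ , ne' , f₁ , f₂ =
    twoEars K short v∉ z∉ m₁ m₂ ne k₁ k₂ ne' e₁ e₂ f₁ f₂

-- Universal vertices force the extremal graph

firstStep : ∀ {a b} {E : BipGraph a b} {P : Vertex a b → Set} {u v} → Reach E P u v → u ≢ v → Σ (Vertex a b) λ w → Adj E u w × P w
firstStep (here _)                    n = ⊥-elim (n refl)
firstStep (step _ e (here p))         n = _ , e , p
firstStep (step _ e (step p _ _))     n = _ , e , p

avoid : ∀ {n} (F : List (Fin n)) k → k + length F ≤ n → Σ (List (Fin n)) λ ys → Unique ys × length ys ≡ k × (∀ {w} → w ∈ ys → w ∉ F)
avoid F zero    h = [] , [] , refl , λ ()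
avoid F (suc k) h with avoid F k (≤-trans (n≤1+n _) h)
... | ys , un , refl , out with outside (ys ++ F) (≤-trans (≤-reflexive (cong suc (length-++ ys))) h)
...   | y , y∉ = y ∷ ys , unique-∷ (λ m → y∉ (∈-++⁺ˡ m)) un , refl , λ { (here refl) m → y∉ (∈-++⁺ʳ ys m) ; (there k) → out k }

-- A first neighbour is needed to reach `i'` at all; deleting it leaves a second.
twoNbrs : ∀ {a b} {E : BipGraph a b} → Robust E → ∀ {i i' : Fin a} {y : Fin b} → i' ≢ i → Σ (Fin b) λ j → Σ (Fin b) λ j' → j ≢ j' × T (E i j) × T (E i j')
twoNbrs {E = E} rob {i} {i'} {y} ne with firstStep (rob (inj₂ y) (inj₁ i) (inj₁ i') (λ ()) (λ ())) (λ { refl → ne refl })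
... | inj₂ j , e , _ with firstStep (rob (inj₂ j) (inj₁ i) (inj₁ i') (λ ()) (λ ())) (λ { refl → ne refl })
...   | inj₂ j' , e' , n = j , j' , (λ q → n (cong inj₂ (sym q))) , e , e'

-- The extremal graph up to relabelling within the classes.
record Good {a b} (E : BipGraph a b) (m : ℕ) : Set where
  field
    A₀    : Fin a → Bool
    u₁ u₂ : Fin b
    u₁≢u₂ : u₁ ≢ u₂
    card  : size A₀ ≡ m
    univ  : ∀ i → T (A₀ i) → ∀ j → T (E i j)
    rest  : ∀ i → ¬ T (A₀ i) → ∀ j → T (E i j) → j ≡ u₁ ⊎ j ≡ u₂
    rest₁ : ∀ i → ¬ T (A₀ i) → T (E i u₁)
    rest₂ : ∀ i → ¬ T (A₀ i) → T (E i u₂)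

module _ {a b m} {E : BipGraph a b} (short : EvenShort E (2 + m)) (b≥ : 2 + m ≤ b)
         (As : List (Fin a)) (uA : Unique As) (lA : length As ≡ m) (univ : ∀ {x} → x ∈ As → ∀ j → T (E x j)) where

  private
    V : Set
    V = Vertex a b

  -- The path from `c` through `x`, `d`, `x'` to `e` is closed by a path through all m universal
  -- vertices. The cycle has 2m + 4 vertices, two for each unit of 2 + m.
  pairsShare : 1 ≤ m → ∀ {x x' c d e} → x ∉ As → x' ∉ As → x ≢ x' → c ≢ d → c ≢ e → d ≢ e →
    T (E x c) → T (E x d) → T (E x' d) → T (E x' e) → ⊥
  pairsShare m≥ {x} {x'} {c} {d} {e} x∉ x'∉ ne c≢d c≢e d≢e xc xd x'd x'e
    with avoid (c ∷ d ∷ e ∷ []) (m ∸ 1) (≤-trans (≤-reflexive (trans (+-suc _ _) (cong suc (trans (+-suc _ _) (cong suc (trans (+-comm _ 1) (m+[n∸m]≡n m≥))))))) b≥)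
  ... | ys , uy , ly , out = lin⊥ 1 (subst (λ k → 2 + k ≤ 2 * (2 + m)) len (short tc uc)) (arith m)
    where
    zs = ys ++ [ c ]
    lz : length As ≡ length zs
    lz = trans lA (sym (trans (length-++ ys) (trans (cong (_+ 1) ly) (m∸n+n≡m m≥))))
    cyc : List V
    cyc = inj₁ x ∷ inj₂ d ∷ inj₁ x' ∷ inj₂ e ∷ zig As zs
    tc : Tr E (inj₂ c) cyc (inj₂ c)
    tc = xc ∷ (xd ∷ (x'd ∷ (x'e ∷ subst (λ k → Tr E (inj₂ e) (zig As zs) (inj₂ k)) (endOf-++ e ys c []) (zigTr e As zs lz (λ p _ → univ p _)))))
    uz : Unique zs
    uz = unique-++ uy ([] ∷ []) (λ { m (here refl) → out m (here refl) })
    dz : ∀ {w} → w ∈ zs → w ≢ c → w ∉ c ∷ d ∷ e ∷ []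
    dz m n k with ∈-++⁻ ys m
    ... | inj₁ p           = out p k
    ... | inj₂ (here refl) = n refl
    uc : Unique cyc
    uc = ((λ ()) ∷ (λ { refl → ne refl }) ∷ (λ ()) ∷ All.tabulate (λ { k refl → x∉ (zig-∈₁ As zs k) }))
       ∷ ((λ ()) ∷ (λ { refl → d≢e refl }) ∷ All.tabulate (λ { k refl → dz (zig-∈₂ As zs k) (λ q → c≢d (sym q)) (there (here refl)) }))
       ∷ ((λ ()) ∷ All.tabulate (λ { k refl → x'∉ (zig-∈₁ As zs k) }))
       ∷ (All.tabulate (λ { k refl → dz (zig-∈₂ As zs k) (λ q → c≢e (sym q)) (there (there (here refl))) }))
       ∷ zig-unique uA uz
    len : length cyc ≡ 4 + 2 * m
    len = cong (4 +_) (trans (zig-length As zs lz) (cong (2 *_) lA))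
    arith : ∀ m → suc (2 * (2 + m)) + 1 ≡ 2 + (4 + 2 * m)
    arith = solve-∀

-- One universal vertex is spent on the connection from `d` to `e`, and the others close the cycle,
-- again with 2m + 4 vertices. At least one other must remain, hence `2 ≤ m`.
pairsDisjoint : ∀ {a b m} {E : BipGraph a b} → EvenShort E (2 + m) → 2 + m ≤ b →
  (As : List (Fin a)) → Unique As → length As ≡ m → (∀ {x} → x ∈ As → ∀ j → T (E x j)) →
  2 ≤ m → ∀ {x x' c d e f} → x ∉ As → x' ∉ As → x ≢ x' →
    Unique (c ∷ d ∷ e ∷ f ∷ []) → T (E x c) → T (E x d) → T (E x' e) → T (E x' f) → ⊥
pairsDisjoint short b≥ [] _ refl _ ()
pairsDisjoint short b≥ (_ ∷ []) _ refl _ (s≤s ())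
pairsDisjoint {a} {b} {E = E} short b≥ (a₁ ∷ As@(_ ∷ As')) (h₁ ∷ uA) refl univ m≥ {x} {x'} {c} {d} {e} {f} x∉ x'∉ ne
    ((c≢d ∷ c≢e ∷ c≢f ∷ []) ∷ (d≢e ∷ d≢f ∷ []) ∷ (e≢f ∷ []) ∷ _) xc xd x'e x'f
    with avoid (c ∷ d ∷ e ∷ f ∷ []) (length As') (≤-trans (≤-reflexive (+-comm (length As') 4)) b≥)
... | ys , uy , ly , out = lin⊥ 1 (subst (λ k → 2 + k ≤ 2 * (2 + suc (suc (length As')))) len (short tc uc)) (arith (length As'))
  where
  zs = ys ++ [ c ]
  lz : length As ≡ length zs
  lz = sym (trans (length-++ ys) (trans (+-comm _ 1) (cong suc ly)))
  cyc : List (Vertex a b)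
  cyc = inj₁ x ∷ inj₂ d ∷ inj₁ a₁ ∷ inj₂ e ∷ inj₁ x' ∷ inj₂ f ∷ zig As zs
  tc : Tr E (inj₂ c) cyc (inj₂ c)
  tc = xc ∷ (xd ∷ (univ (here refl) d ∷ (univ (here refl) e ∷ (x'e ∷ (x'f ∷
         subst (λ k → Tr E (inj₂ f) (zig As zs) (inj₂ k)) (endOf-++ f ys c []) (zigTr f As zs lz (λ p _ → univ (there p) _)))))))
  uz : Unique zs
  uz = unique-++ uy ([] ∷ []) (λ { m (here refl) → out m (here refl) })
  dz : ∀ {w} → w ∈ zs → w ≢ c → w ∉ c ∷ d ∷ e ∷ f ∷ []
  dz m n k with ∈-++⁻ ys m
  ... | inj₁ p           = out p k
  ... | inj₂ (here refl) = n refl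
  uc : Unique cyc
  uc = ((λ ()) ∷ (λ { refl → x∉ (here refl) }) ∷ (λ ()) ∷ (λ { refl → ne refl }) ∷ (λ ()) ∷ All.tabulate (λ { k refl → x∉ (there (zig-∈₁ As zs k)) }))
     ∷ ((λ ()) ∷ (λ { refl → d≢e refl }) ∷ (λ ()) ∷ (λ { refl → d≢f refl }) ∷ All.tabulate (λ { k refl → dz (zig-∈₂ As zs k) (λ q → c≢d (sym q)) (there (here refl)) }))
     ∷ ((λ ()) ∷ (λ { refl → x'∉ (here refl) }) ∷ (λ ()) ∷ All.tabulate (λ { k refl → All.lookup h₁ (zig-∈₁ As zs k) refl }))
     ∷ ((λ ()) ∷ (λ { refl → e≢f refl }) ∷ All.tabulate (λ { k refl → dz (zig-∈₂ As zs k) (λ q → c≢e (sym q)) (there (there (here refl))) }))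
     ∷ ((λ ()) ∷ All.tabulate (λ { k refl → x'∉ (there (zig-∈₁ As zs k)) }))
     ∷ All.tabulate (λ { k refl → dz (zig-∈₂ As zs k) (λ q → c≢f (sym q)) (there (there (there (here refl)))) })
     ∷ zig-unique uA uz
  len : length cyc ≡ 6 + 2 * length As
  len = cong (6 +_) (zig-length As zs lz)
  arith : ∀ m → suc (2 * (2 + suc (suc m))) + 1 ≡ 2 + (6 + 2 * suc m)
  arith = solve-∀

-- Any two neighbours of one outer vertex coincide as a pair with any two neighbours of another one.
-- Since 2-connectivity provides two neighbours everywhere, all outer vertices have the same two and
-- no others.
universal⇒Good : ∀ {a b m} {E : BipGraph a b} → Robust E → EvenShort E (2 + m) → 2 ≤ m → 2 + m ≤ a → 2 + m ≤ b →
  (A₀ : Fin a → Bool) → size A₀ ≡ m → (∀ i → T (A₀ i) → ∀ j → T (E i j)) → Good E m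
universal⇒Good {a} {b} {m} {E} rob short m≥ a≥ b≥ A₀ card univ
  with outside (elems A₀) (≤-trans (≤-trans (≤-reflexive (cong suc (trans (length-elems A₀) card))) (n≤1+n _)) a≥)
... | i₀ , i₀∉ with outside (i₀ ∷ elems A₀) (≤-trans (≤-reflexive (cong (2 +_) (trans (length-elems A₀) card))) a≥) | outside {b} [] (≤-trans (s≤s z≤n) b≥)
...   | i₁ , i₁∉ | y , _ with twoNbrs rob {i₀} {i₁} {y} (λ e → i₁∉ (here e))
...     | u₁ , u₂ , ne , e₁ , e₂ = record
    { A₀ = A₀ ; u₁ = u₁ ; u₂ = u₂ ; u₁≢u₂ = ne ; card = card ; univ = univ
    ; rest = rest ; rest₁ = λ i n → proj₁ (both i n) ; rest₂ = λ i n → proj₂ (both i n) }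
  where
  As = elems A₀
  lA = trans (length-elems A₀) card
  un : ∀ {x} → x ∈ As → ∀ j → T (E x j)
  un m = univ _ (elems-∈ A₀ m)
  i₀≢i₁ : i₀ ≢ i₁
  i₀≢i₁ e = i₁∉ (here (sym e))
  Same : Fin b → Fin b → Fin b → Fin b → Set
  Same c d c' d' = (c' ≡ c × d' ≡ d) ⊎ (c' ≡ d × d' ≡ c)
  same : ∀ {x x' c d c' d'} → x ∉ As → x' ∉ As → x ≢ x' → c ≢ d → c' ≢ d' → T (E x c) → T (E x d) → T (E x' c') → T (E x' d') → Same c d c' d'
  same {x} {x'} {c} {d} {c'} {d'} p p' n q q' xc xd xc' xd' with c' Fin.≟ c | c' Fin.≟ d | d' Fin.≟ c | d' Fin.≟ d
  ... | yes refl | _ | _ | yes refl = inj₁ (refl , refl)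
  ... | yes refl | _ | _ | no r = ⊥-elim (share p p' n (λ e → q (sym e)) (λ e → r (sym e)) q' xd xc xc' xd')
    where share = pairsShare short b≥ As (elems-unique A₀) lA un (≤-trans (n≤1+n 1) m≥)
  ... | no _ | yes refl | yes refl | _ = inj₂ (refl , refl)
  ... | no _ | yes refl | no r | _ = ⊥-elim (share p p' n q (λ e → r (sym e)) q' xc xd xc' xd')
    where share = pairsShare short b≥ As (elems-unique A₀) lA un (≤-trans (n≤1+n 1) m≥)
  ... | no r | no s | yes refl | _ = ⊥-elim (share p p' n (λ e → q (sym e)) (λ e → s (sym e)) (λ e → r (sym e)) xd xc xd' xc')
    where share = pairsShare short b≥ As (elems-unique A₀) lA un (≤-trans (n≤1+n 1) m≥)
  ... | no r | no s | no _ | yes refl = ⊥-elim (share p p' n q (λ e → r (sym e)) (λ e → s (sym e)) xc xd xd' xc')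
    where share = pairsShare short b≥ As (elems-unique A₀) lA un (≤-trans (n≤1+n 1) m≥)
  ... | no r | no s | no v | no w = ⊥-elim (pairsDisjoint short b≥ As (elems-unique A₀) lA un m≥ p p' n
      ((q ∷ (λ e → r (sym e)) ∷ (λ e → v (sym e)) ∷ []) ∷ ((λ e → s (sym e)) ∷ (λ e → w (sym e)) ∷ []) ∷ (q' ∷ []) ∷ [] ∷ []) xc xd xc' xd')
  notIn : ∀ {i} → ¬ T (A₀ i) → i ∉ As
  notIn n m = n (elems-∈ A₀ m)
  i₁∉As : i₁ ∉ As
  i₁∉As m = i₁∉ (there m)
  U : Fin b → Set
  U j = j ≡ u₁ ⊎ j ≡ u₂
  inU : ∀ {c d c' d'} → U c → U d → Same c d c' d' → U c' × U d'
  inU p q (inj₁ (refl , refl)) = p , q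
  inU p q (inj₂ (refl , refl)) = q , p
  nbrs₁ = twoNbrs rob {i₁} {i₀} {y} i₀≢i₁
  other : ∀ i → i ≢ i₀ → Σ (Fin b) λ j → Σ (Fin b) λ j' → j ≢ j' × T (E i j) × T (E i j')
  other i n = twoNbrs rob {i} {i₀} {y} (λ e → n (sym e))
  rest : ∀ i → ¬ T (A₀ i) → ∀ j → T (E i j) → U j
  rest i n j e with i Fin.≟ i₀
  ... | no i≢ with other i i≢
  ...   | p , q , p≢q , ep , eq with j Fin.≟ p
  ...     | no j≢p   = proj₂ (inU (inj₁ refl) (inj₂ refl) (same i₀∉ (notIn n) (λ x → i≢ (sym x)) ne (λ x → j≢p (sym x)) e₁ e₂ ep e))
  ...     | yes refl = proj₁ (inU (inj₁ refl) (inj₂ refl) (same i₀∉ (notIn n) (λ x → i≢ (sym x)) ne p≢q e₁ e₂ ep eq))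
  -- A further neighbour of `i₀` is ruled out by comparison with the pair of a second outer vertex
  -- `i₁`.
  rest i n j e | yes refl with j Fin.≟ u₁
  ... | yes p = inj₁ p
  ... | no j≢ with nbrs₁
  ...   | p , q , p≢q , ep , eq with inU (inj₁ refl) (inj₂ refl) (same i₀∉ i₁∉As i₀≢i₁ ne p≢q e₁ e₂ ep eq)
  ...     | up , uq = proj₁ (inU up uq (same i₁∉As i₀∉ (λ x → i₀≢i₁ (sym x)) p≢q j≢ ep eq e e₁))
  both : ∀ i → ¬ T (A₀ i) → T (E i u₁) × T (E i u₂)
  both i n with i Fin.≟ i₀
  ... | yes refl = e₁ , e₂
  ... | no i≢ with other i i≢
  ...   | p , q , p≢q , ep , eq with same i₀∉ (notIn n) (λ x → i≢ (sym x)) ne p≢q e₁ e₂ ep eq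
  ...     | inj₁ (refl , refl) = ep , eq
  ...     | inj₂ (refl , refl) = eq , ep

-- Maximal bicliques

T-∧₁ : ∀ p {q} → T (p ∧ q) → T p
T-∧₁ true _ = tt

T-∧₂ : ∀ p {q} → T (p ∧ q) → T q
T-∧₂ true h = h

T-∧ᶜ : ∀ p {q} → T p → T q → T (p ∧ q)
T-∧ᶜ true _ h = h

by-side : ℕ → ℕ → Bool → ℕ
by-side α β true  = α
by-side α β false = β

full : ∀ {n} → Fin n → Bool
full _ = true

member : ∀ {a b} → (Fin a → Bool) → (Fin b → Bool) → Vertex a b → Set
member SA SB (inj₁ i) = T (SA i)
member SA SB (inj₂ j) = T (SB j)

setRegion : ∀ {a b} (E : BipGraph a b) SA SB {α β} →
  (∀ i → T (SA i) → α ≤ degA E SB i) → (∀ j → T (SB j) → β ≤ degA (flipE E) SA j) → Region E (by-side α β)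
setRegion {a} {b} E SA SB {α} {β} hA hB = record { In = member SA SB ; nbrs = nbrs }
  where
  nbrs : ∀ v → member SA SB v → Σ (List (Vertex a b)) λ ns →
    Unique ns × by-side α β (side v) ≤ length ns × All (λ w → Adj E v w × member SA SB w) ns
  nbrs (inj₁ i) h = map inj₂ (elems S) , Uniq.map⁺ (λ { refl → refl }) (elems-unique S) ,
    ≤-trans (hA i h) (≤-reflexive (sym (trans (length-map inj₂ (elems S)) (length-elems S)))) ,
    All.map⁺ (All.tabulate (λ {j} m → T-∧₂ (SB j) (elems-∈ S m) , T-∧₁ (SB j) (elems-∈ S m)))
    where S = λ j → SB j ∧ E i j
  nbrs (inj₂ j) h = map inj₁ (elems S) , Uniq.map⁺ (λ { refl → refl }) (elems-unique S) ,
    ≤-trans (hB j h) (≤-reflexive (sym (trans (length-map inj₁ (elems S)) (length-elems S)))) ,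
    All.map⁺ (All.tabulate (λ {i} m → T-∧₂ (SA i) (elems-∈ S m) , T-∧₁ (SA i) (elems-∈ S m)))
    where S = λ i → SA i ∧ E i j

sideCase : ∀ {n α β α' β'} → n ≤ α + β' → n ≤ β + α' → ∀ s s' → s ≢ s' → n ≤ by-side α β s + by-side α' β' s'
sideCase p q true  true  ne = ⊥-elim (ne refl)
sideCase p q true  false ne = p
sideCase p q false true  ne = q
sideCase p q false false ne = ⊥-elim (ne refl)

sideSame : ∀ {n α β α' β'} → n ≤ α + α' → n ≤ β + β' → ∀ s → n ≤ by-side α β s + by-side α' β' s
sideSame p q true  = p
sideSame p q false = q

-- A missing edge would be bridged by a long path between the regions. The first two sums concern
-- path ends in different classes, the last two ends in the same class.
joined : ∀ {l a b} (G : Ctx l a b) {α β α' β'} (R : Region (Ctx.E G) (by-side α β)) (R' : Region (Ctx.E G) (by-side α' β')) →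
  suc l ≤ α + β' → suc l ≤ β + α' → 2 + l ≤ α + α' → 2 + l ≤ β + β' →
  ∀ i j → Region.In R (inj₁ i) → Region.In R' (inj₂ j) → T (Ctx.E G i j)
joined {l} G R R' h₁ h₂ h₃ h₄ i j p q = decidable-stable (T? (Ctx.E G i j))
  (λ n → Ctx.sat G i j n (λ lp → noLink G R R' (sideCase h₁ h₂) (sideSame h₃ h₄) lp p q))

record MaxBi {a b} (E : BipGraph a b) : Set where
  field
    KA   : Fin a → Bool
    KB   : Fin b → Bool
    comp : ∀ i j → T (KA i) → T (KB j) → T (E i j)
    maxA : ∀ i → ¬ T (KA i) → Σ (Fin b) λ j → T (KB j) × ¬ T (E i j)
    maxB : ∀ j → ¬ T (KB j) → Σ (Fin a) λ i → T (KA i) × ¬ T (E i j)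

flipMax : ∀ {a b} {E : BipGraph a b} → MaxBi E → MaxBi (flipE E)
flipMax M = record { KA = KB ; KB = KA ; comp = λ i j p q → comp j i q p ; maxA = maxB ; maxB = maxA }
  where open MaxBi M

size-⊆ : ∀ {n} {S S' : Fin n → Bool} → (∀ i → T (S i) → T (S' i)) → size S ≡ size S' → ∀ i → T (S' i) → T (S i)
size-⊆ {S = S} {S'} sub e i h = decidable-stable (T? (S i)) λ n → 1+n≰n
  (≤-trans (≤-reflexive (sym (size-∖ S' i h))) (≤-trans (≤-reflexive (sym e))
    (size-mono {S = S} {S' ∖ i} (λ k s → ∖-other S' (λ { refl → n s }) (sub k s)))))

deg-complete : ∀ {a b} (E : BipGraph a b) SB i → (∀ j → T (SB j) → T (E i j)) → size SB ≤ degA E SB i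
deg-complete E SB i h = size-mono {S = SB} {λ j → SB j ∧ E i j} (λ j p → T-∧ᶜ (SB j) p (h j p))

module Relative {a b} {E : BipGraph a b} (M : MaxBi E) where
  open MaxBi M

  Above : (Fin a → Bool) → (Fin b → Bool) → Set
  Above SA SB = (∀ i → T (KA i) → T (SA i)) × (∀ j → T (KB j) → T (SB j))

  KRegion : Region E (by-side (size KB) (size KA))
  KRegion = setRegion E KA KB (λ i h → deg-complete E KB i (λ j → comp i j h)) (λ j h → deg-complete (flipE E) KA j (λ i k → comp i j k h))

  -- The removal process that never touches the biclique, stopping when r vertices are left outside.
  module Proc (s t r : ℕ) where
    AtStop : (Fin a → Bool) → (Fin b → Bool) → Set
    AtStop SA SB = size SA + size SB ≤ r + (size KA + size KB)

    Room : (Fin a → Bool) → (Fin b → Bool) → Set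
    Room SA SB = Above SA SB × r + (size KA + size KB) ≤ size SA + size SB

    open Removal E KA KB s t AtStop Room public

    run : r + (size KA + size KB) ≤ a + b → Rem full full ⊎ Core
    run room = process (λ SA SB → _ ≤? _)
      (λ {SA} {SB} i ns h n ((p , q) , _) → ((λ k h → ∖-other SA (λ { refl → n h }) (p k h)) , q) ,
        s≤s⁻¹ (≤-trans (≰⇒> ns) (≤-reflexive (cong (_+ size SB) (size-∖ SA i h)))))
      (λ {SA} {SB} j ns h n ((p , q) , _) → (p , (λ k h → ∖-other SB (λ { refl → n h }) (q k h))) ,
        s≤s⁻¹ (≤-trans (≰⇒> ns) (≤-reflexive (trans (cong (size SA +_) (size-∖ SB j h)) (+-suc _ _)))))
      full full (((λ _ _ → tt) , (λ _ _ → tt)) , ≤-trans room (≤-reflexive (sym (cong₂ _+_ (size-full a) (size-full b)))))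

    room₀ : r ≡ 0 → r + (size KA + size KB) ≤ a + b
    room₀ refl = +-mono-≤ (size-≤ KA) (size-≤ KB)

    module _ (C : Core) where
      open Core C
      -- Vertices outside K have large degree because they could not be deleted, those of K because
      -- of K itself.
      coreRegion : suc s ≤ size KB → suc t ≤ size KA → Region E (by-side (suc s) (suc t))
      coreRegion hs ht = setRegion E SA SB rA rB
        where
        rA : ∀ i → T (SA i) → suc s ≤ degA E SB i
        rA i h with T? (KA i)
        ... | no n  = richA i h n
        ... | yes k = ≤-trans hs (≤-trans (deg-complete E KB i (λ j → comp i j k)) (deg-mono E i (proj₂ (proj₁ inv))))
        rB : ∀ j → T (SB j) → suc t ≤ degA (flipE E) SA j
        rB j h with T? (KB j)
        ... | no n  = richB j h n
        ... | yes k = ≤-trans ht (≤-trans (deg-complete (flipE E) KA j (λ i q → comp i j q k)) (deg-mono (flipE E) j (proj₁ (proj₁ inv))))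

      outer : (Σ (Fin a) λ i → T (SA i) × ¬ T (KA i)) ⊎ (Σ (Fin b) λ j → T (SB j) × ¬ T (KB j))
      outer with size KA <? size SA | size KB <? size SB
      ... | yes p | _     = inj₁ (size-escape SA KA p)
      ... | no _  | yes q = inj₂ (size-escape SB KB q)
      ... | no p  | no q  = ⊥-elim (running (≤-trans (+-mono-≤ (≮⇒≥ p) (≮⇒≥ q)) (m≤n+m _ r)))

module _ {l a b} (G : Ctx l a b) (M : MaxBi (Ctx.E G)) where
  open Ctx G
  open MaxBi M
  open Relative M

  private
    p q : ℕ
    p = size KA
    q = size KB

  -- By maximality a core vertex outside K misses some vertex of K, and saturation puts a long path
  -- between the two.
  coreLink : ∀ {s t r} (C : Proc.Core s t r) → (hs : suc s ≤ q) → (ht : suc t ≤ p) →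
    suc l ≤ suc s + p → suc l ≤ suc t + q → suc l ≤ suc s + q → suc l ≤ suc t + p →
    ¬ ¬ OneShort (Proc.coreRegion s t r C hs ht) KRegion l
  coreLink {s} {t} {r} C hs ht h₁ h₂ h₃ h₄ k with Proc.outer s t r C
  ... | inj₁ (i , i∈ , i∉) with maxA i i∉
  ...   | j , j∈ , nadj = sat i j nadj (λ lp → k (noLink₁ G (Proc.coreRegion s t r C hs ht) KRegion (sideCase h₁ h₂) (sideSame h₃ h₄) lp i∈ j∈))
  coreLink {s} {t} {r} C hs ht h₁ h₂ h₃ h₄ k | inj₂ (j , j∈ , j∉) with maxB j j∉
  ...   | i , i∈ , nadj = sat i j nadj (λ lp → k (noLink₁ G (Proc.coreRegion s t r C hs ht) KRegion (sideCase h₁ h₂) (sideSame h₃ h₄) (longPath-rev {l = l} lp) j∈ i∈))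

  -- With `r` equal to 0 the process stops exactly at K, which spans at most pq edges.
  stopBound : ∀ {s t} → Proc.Rem s t 0 full full → edges E + s * p + t * q ≤ p * q + s * a + t * b
  stopBound {s} {t} R = ≤-trans (+-mono-≤ (+-monoʳ-≤ (edges E) (*-monoʳ-≤ s (≤-reflexive (sym szA)))) (*-monoʳ-≤ t (≤-reflexive (sym szB))))
      (≤-trans bound (+-mono-≤ (+-mono-≤ eK (*-monoʳ-≤ s (≤-reflexive (size-full a)))) (*-monoʳ-≤ t (≤-reflexive (size-full b)))))
    where
    open Proc s t 0
    open Stopped (stopped R)
    geA : p ≤ size SA'
    geA = size-mono {S = KA} {SA'} (proj₁ (proj₁ inv))
    geB : q ≤ size SB'
    geB = size-mono {S = KB} {SB'} (proj₂ (proj₁ inv))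
    szA : size SA' ≡ p
    szA = ≤-antisym (+-cancelʳ-≤ q (size SA') p (≤-trans (+-monoʳ-≤ (size SA') geB) stp)) geA
    szB : size SB' ≡ q
    szB = ≤-antisym (+-cancelˡ-≤ p (size SB') q (≤-trans (+-monoˡ-≤ (size SB') geA) stp)) geB
    eK : eS E SA' SB' ≤ p * q
    eK = ≤-trans (eS≤ E SA' SB' (size SB') (λ i _ → deg≤size E SB' i)) (≤-reflexive (trans (cong₂ _*_ szB szA) (*-comm q p)))

  -- The biclique is the whole core when no end-degree sum is deficient.
  relBound : ∀ s t → suc s ≤ q → suc t ≤ p → l ≤ s + p → l ≤ t + q → suc l ≤ s + q → suc l ≤ t + p →
    edges E + s * p + t * q ≤ p * q + s * a + t * b
  relBound s t hs ht h₁ h₂ h₃ h₄ with Proc.run s t 0 (Proc.room₀ s t 0 refl)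
  ... | inj₁ R = stopBound R
  ... | inj₂ C = ⊥-elim (coreLink C hs ht (s≤s h₁) (s≤s h₂) (≤-trans h₃ (n≤1+n _)) (≤-trans h₄ (n≤1+n _)) contra)
    where
    contra : ¬ OneShort (Proc.coreRegion s t 0 C hs ht) KRegion l
    contra o = 1+n≰n (≤-trans (subst (λ z → 2 + l ≤ by-side (suc s) (suc t) (side (Stuck.x S)) + by-side q p z) (sym same) (sideSame {α = suc s} {suc t} {q} {p} (s≤s h₃) (s≤s h₄) (side (Stuck.x S)))) tight)
      where open OneShort o

-- Deletion without protected vertices

module _ {a b} (E : BipGraph a b) where

  private
    none : ∀ {n} → Fin n → Bool
    none _ = false

  module Absolute (s t α₀ β₀ : ℕ) where
    AtStop Big : (Fin a → Bool) → (Fin b → Bool) → Set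
    AtStop SA SB = size SA ≡ α₀ ⊎ size SB ≡ β₀
    Big SA SB    = α₀ ≤ size SA × β₀ ≤ size SB

    open Removal E none none s t AtStop Big public

    run : α₀ ≤ a → β₀ ≤ b → Rem full full ⊎ Core
    run ha hb = process (λ SA SB → (size SA ≟ α₀) ⊎-dec (size SB ≟ β₀))
      (λ {SA} i ns h _ (p , q) → s≤s⁻¹ (≤-trans (≤∧≢⇒< p (λ e → ns (inj₁ (sym e)))) (≤-reflexive (size-∖ SA i h))) , q)
      (λ {_} {SB} j ns h _ (p , q) → p , s≤s⁻¹ (≤-trans (≤∧≢⇒< q (λ e → ns (inj₂ (sym e)))) (≤-reflexive (size-∖ SB j h))))
      full full (≤-trans ha (≤-reflexive (sym (size-full a))) , ≤-trans hb (≤-reflexive (sym (size-full b))))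

    module _ (C : Core) where
      open Core C
      absRegion : Region E (by-side (suc s) (suc t))
      absRegion = setRegion E SA SB (λ i h → richA i h id) (λ j h → richB j h id)

      sizeA : suc t ≤ size SA
      sizeA with size-pos SB (≤-trans (s≤s z≤n) (≤∧≢⇒< (proj₂ inv) (λ e → running (inj₂ (sym e)))))
      ... | j , h = ≤-trans (richB j h id) (deg≤size (flipE E) SA j)

      sizeB : suc s ≤ size SB
      sizeB with size-pos SA (≤-trans (s≤s z≤n) (≤∧≢⇒< (proj₁ inv) (λ e → running (inj₁ (sym e)))))
      ... | i , h = ≤-trans (richA i h id) (deg≤size E SB i)

  -- The stopping sizes make (|SA'| - t)(|SB'| - s) vanish, so the trivial bound |SA'||SB'| for the
  -- remaining edges equals s|SA'| + t|SB'| - st.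
  absBound : ∀ s t → Absolute.Rem s t t s full full → edges E + s * t ≤ s * a + t * b
  absBound s t R = lin (edges E + s * t) (s * a + t * b) 0
      (+-mono-≤ bound (+-mono-≤ (eStop stp) (+-mono-≤ (*-monoʳ-≤ s (≤-reflexive (size-full a))) (*-monoʳ-≤ t (≤-reflexive (size-full b))))))
      (arith (edges E) (s * t) (s * a) (t * b) (eS E SA' SB') (s * size SA') (t * size SB') (s * size {a} full) (t * size {b} full))
    where
    open Absolute s t t s
    open Stopped (stopped R)
    eStop : size SA' ≡ t ⊎ size SB' ≡ s → eS E SA' SB' + s * t ≤ s * size SA' + t * size SB'
    eStop (inj₁ e) = ≤-trans (+-monoˡ-≤ (s * t) (≤-trans (eS≤ E SA' SB' (size SB') (λ i _ → deg≤size E SB' i)) (≤-reflexive (trans (*-comm (size SB') (size SA')) (cong (_* size SB') e)))))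
                       (≤-reflexive (trans (+-comm _ (s * t)) (cong (λ k → s * k + t * size SB') (sym e))))
    eStop (inj₂ e) = +-mono-≤ (≤-trans (eS≤ E SA' SB' (size SB') (λ i _ → deg≤size E SB' i)) (≤-reflexive (cong (_* size SA') e)))
                       (≤-reflexive (trans (*-comm s t) (cong (t *_) (sym e))))
    arith : ∀ e st sa tb k x y fa fb → e + st + ((k + fa + fb) + ((x + y) + (sa + tb))) + 0 ≡ sa + tb + ((e + x + y) + ((k + st) + (fa + fb)))
    arith = solve-∀

AllIn : ∀ {a b} (E : BipGraph a b) (S : Fin b → Bool) (i : Fin a) → Dec (∀ j → ¬ (T (S j) × ¬ T (E i j)))
AllIn E S i = Fin.all? (λ j → ¬? (T? (S j) ×-dec ¬? (T? (E i j))))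

toAll : ∀ {a b} → BipGraph a b → (Fin b → Bool) → Fin a → Bool
toAll E S i = isYes (AllIn E S i)

module _ {a b} (E : BipGraph a b) (S : Fin b → Bool) where
  toAll-adj : ∀ {i} → T (toAll E S i) → ∀ j → T (S j) → T (E i j)
  toAll-adj {i} h j s = decidable-stable (T? (E i j)) (λ n → toWitness {a? = AllIn E S i} h j (s , n))

  adj-toAll : ∀ {i} → (∀ j → T (S j) → T (E i j)) → T (toAll E S i)
  adj-toAll {i} h = fromWitness {a? = AllIn E S i} (λ j (s , n) → n (h j s))

  toAll-miss : ∀ {i} → ¬ T (toAll E S i) → Σ (Fin b) λ j → T (S j) × ¬ T (E i j)
  toAll-miss {i} h with Fin.any? (λ j → T? (S j) ×-dec ¬? (T? (E i j)))
  ... | yes p = p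
  ... | no ¬p = ⊥-elim (h (adj-toAll (λ j s → decidable-stable (T? (E i j)) (λ n → ¬p (j , s , n)))))

-- The Galois closure: all vertices joined to `SB`, then all vertices joined to those.
maxClosure : ∀ {a b} (E : BipGraph a b) (SA : Fin a → Bool) (SB : Fin b → Bool) → (∀ i j → T (SA i) → T (SB j) → T (E i j)) →
  Σ (MaxBi E) λ M → (∀ i → T (SA i) → T (MaxBi.KA M i)) × (∀ j → T (SB j) → T (MaxBi.KB M j))
maxClosure E SA SB comp = record
  { KA = KA ; KB = KB
  ; comp = λ i j p q → toAll-adj (flipE E) KA q i p
  ; maxA = λ i n → let j , s , m = toAll-miss E SB n in j , SB⊆ j s , m
  ; maxB = λ j n → toAll-miss (flipE E) KA n } , (λ i h → adj-toAll E SB (λ j s → comp i j h s)) , SB⊆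
  where
  KA = toAll E SB
  KB = toAll (flipE E) KA
  SB⊆ : ∀ j → T (SB j) → T (KB j)
  SB⊆ j s = adj-toAll (flipE E) KA (λ i k → toAll-adj E SB k j s)

biclique-take : ∀ {a b} {E : BipGraph a b} n KA KB → (∀ i j → T (KA i) → T (KB j) → T (E i j)) → n ≤ size KA → n ≤ size KB → Biclique E n
biclique-take n KA KB comp hA hB = record
  { As = take n (elems KA) ; Bs = take n (elems KB)
  ; uA = Uniq.take⁺ n (elems-unique KA) ; uB = Uniq.take⁺ n (elems-unique KB)
  ; lA = len KA hA ; lB = len KB hB
  ; all = λ p q → comp _ _ (elems-∈ KA (take-∈ n (elems KA) p)) (elems-∈ KB (take-∈ n (elems KB) q)) }
  where
  len : ∀ {k} (S : Fin k → Bool) → n ≤ size S → length (take n (elems S)) ≡ n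
  len S h = trans (length-take n (elems S)) (m≤n⇒m⊓n≡m (≤-trans h (≤-reflexive (sym (length-elems S)))))
  take-∈ : ∀ {A : Set} n (xs : List A) {w} → w ∈ take n xs → w ∈ xs
  take-∈ (suc n) (x ∷ xs) (here e)  = here e
  take-∈ (suc n) (x ∷ xs) (there m) = there (take-∈ n xs m)

Universal : ∀ {a b} → BipGraph a b → ℕ → Set
Universal {a} E m = Σ (Fin a → Bool) λ A₀ → size A₀ ≡ m × (∀ i → T (A₀ i) → ∀ j → T (E i j))

full-set : ∀ {n} {S : Fin n → Bool} → n ≤ size S → ∀ i → T (S i)
full-set {n} {S} h i = size-⊆ {S = S} {full} (λ _ _ → tt) (≤-antisym (size-mono {S = S} {full} (λ _ _ → tt)) (≤-trans (≤-reflexive (size-full n)) h)) i tt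

module Large {m a b} (G : Ctx (2 + m) a b) (s t : ℕ) (l≡ : 2 + m ≡ s + t) (s≥3 : 3 ≤ s) (s≤t : s ≤ t) (t≤s+1 : t ≤ suc s)
  (a≥ : 2 + m ≤ a) (a≤b : a ≤ b) (big : m * b + 2 * a ≤ edges (Ctx.E G) + 2 * m) where
  open Ctx G

  private
    l : ℕ
    l = 2 + m

    -- With both thresholds at least 3 the bound of the deletion process falls below the assumed
    -- number of edges. This is the reason for treating ℓ ≥ 6 separately.
    absContra : ∀ s' t' → m ≡ s' + t' + 4 → edges E + (3 + s') * (3 + t') ≤ (3 + s') * a + (3 + t') * b → ⊥
    absContra s' t' refl h = lin⊥ (d * suc s' + (s' + t' + s' * t')) (+-mono-≤ (subst (λ x → m * x + 2 * a ≤ edges E + 2 * m) b≡ big) (subst (λ x → edges E + (3 + s') * (3 + t') ≤ (3 + s') * a + (3 + t') * x) b≡ h))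
        (arith s' t' a d (edges E))
      where
      d : ℕ
      d = b ∸ a
      b≡ : b ≡ a + d
      b≡ = sym (m+[n∸m]≡n a≤b)
      arith : ∀ s t a d e → suc ((e + 2 * (s + t + 4)) + ((3 + s) * a + (3 + t) * (a + d))) + (d * suc s + (s + t + s * t))
            ≡ ((s + t + 4) * (a + d) + 2 * a) + (e + (3 + s) * (3 + t))
      arith = solve-∀

    absContra' : ∀ s t → 3 ≤ s → 3 ≤ t → l ≡ s + t → edges E + s * t ≤ s * a + t * b → ⊥
    absContra' (suc (suc (suc s'))) (suc (suc (suc t'))) _ _ e h = absContra s' t' (suc-injective (suc-injective (trans e (lem s' t')))) h
      where lem : ∀ s t → 3 + s + (3 + t) ≡ 2 + (s + t + 4)
            lem = solve-∀
    absContra' 0 _ () _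
    absContra' 1 _ (s≤s ()) _
    absContra' 2 _ (s≤s (s≤s ())) _
    absContra' (suc (suc (suc _))) 0 _ ()
    absContra' (suc (suc (suc _))) 1 _ (s≤s ())
    absContra' (suc (suc (suc _))) 2 _ (s≤s (s≤s ()))

    t≥3 : 3 ≤ t
    t≥3 = ≤-trans s≥3 s≤t
    l≤2t : l ≤ t + t
    l≤2t = ≤-trans (≤-reflexive l≡) (+-monoˡ-≤ t s≤t)
    l≤2s+1 : l ≤ suc (s + s)
    l≤2s+1 = ≤-trans (≤-reflexive l≡) (≤-trans (+-monoʳ-≤ s t≤s+1) (≤-reflexive (+-suc s s)))
    s≤a : s ≤ a
    s≤a = ≤-trans (≤-trans (m≤m+n s t) (≤-reflexive (sym l≡))) a≥
    t≤a : t ≤ a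
    t≤a = ≤-trans (≤-trans (m≤n+m t s) (≤-reflexive (sym l≡))) a≥

  -- The A-side of the core for (s, t) and the B-side of the core for (t, s) have at least t + 1
  -- vertices each. Path ends in one class then have sum (s + 1) + (t + 1) = l + 2, which a single
  -- core would not give for odd l.
  bigBiclique : Σ (MaxBi E) λ M → suc t ≤ size (MaxBi.KA M) × suc t ≤ size (MaxBi.KB M)
  bigBiclique with Absolute.run E s t t s t≤a (≤-trans s≤a a≤b) | Absolute.run E t s s t s≤a (≤-trans t≤a a≤b)
  ... | inj₁ R | _      = ⊥-elim (absContra' s t s≥3 t≥3 l≡ (absBound E s t R))
  ... | inj₂ _ | inj₁ R = ⊥-elim (absContra' t s t≥3 s≥3 (trans l≡ (+-comm s t)) (absBound E t s R))
  ... | inj₂ C | inj₂ C' with maxClosure E (H₁.Core.SA C) (H₂.Core.SB C')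
        (λ i j p q → joined G (H₁.absRegion C) (H₂.absRegion C')
          (s≤s (≤-trans l≤2s+1 (≤-reflexive (sym (+-suc s s)))))
          (s≤s (≤-trans l≤2t (≤-trans (n≤1+n _) (≤-reflexive (sym (+-suc t t))))))
          (≤-reflexive (cong suc (trans (cong suc l≡) (sym (+-suc s t)))))
          (≤-reflexive (cong suc (trans (cong suc (trans l≡ (+-comm s t))) (sym (+-suc t s))))) i j p q)
    where
    module H₁ = Absolute E s t t s
    module H₂ = Absolute E t s s t
  ...   | M , subA , subB = M , ≤-trans (H₁.sizeA C) (size-mono {S = H₁.Core.SA C} {MaxBi.KA M} subA) , ≤-trans (H₂.sizeB C') (size-mono {S = H₂.Core.SB C'} {MaxBi.KB M} subB)
    where
    module H₁ = Absolute E s t t s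
    module H₂ = Absolute E t s s t

-- The case ℓ ≥ 6

-- Here |KA| = 3 + p'' and r = m - |KA|. The threshold 2 + p'' is |KA| - 1, so that q enters the
-- comparison with coefficient one.
lessCase : ∀ p'' q r a d e → (r + (3 + p'')) * (a + d) + 2 * a ≤ e + 2 * (r + (3 + p'')) →
  e + (2 + r) * (3 + p'') + (2 + p'') * q ≤ (3 + p'') * q + (2 + r) * a + (2 + p'') * (a + d) →
  (a + d) + (r + (r * p'' + r * d)) ≤ q
lessCase p'' q r a d e h₁ h₂ = lin _ q 0 (+-mono-≤ h₁ h₂) (arith p'' q r a d e)
  where
  arith : ∀ p q r a d e → (a + d) + (r + (r * p + r * d)) + ((e + 2 * (r + (3 + p))) + ((3 + p) * q + (2 + r) * a + (2 + p) * (a + d))) + 0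
    ≡ q + (((r + (3 + p)) * (a + d) + 2 * a) + (e + (2 + r) * (3 + p) + (2 + p) * q))
  arith = solve-∀

greaterCase : ∀ q'' p r a d e → (r + (3 + q'')) * (a + d) + 2 * a ≤ e + 2 * (r + (3 + q'')) →
  e + (2 + r) * (3 + q'') + (2 + q'') * p ≤ (3 + q'') * p + (2 + r) * (a + d) + (2 + q'') * a →
  (a + d) + (r + (r * q'' + q'' * d)) ≤ p
greaterCase q'' p r a d e h₁ h₂ = lin _ p 0 (+-mono-≤ h₁ h₂) (arith q'' p r a d e)
  where
  arith : ∀ q p r a d e → (a + d) + (r + (r * q + q * d)) + ((e + 2 * (r + (3 + q))) + ((3 + q) * p + (2 + r) * (a + d) + (2 + q) * a)) + 0
    ≡ p + (((r + (3 + q)) * (a + d) + 2 * a) + (e + (2 + r) * (3 + q) + (2 + q) * p))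
  arith = solve-∀

-- For sides of equal size p: ρ = m - p, k = p - 4 - ρ and c = a - (m + 2). The bounds are
-- compatible only for ℓ = 6 and K(4,4).
equalCase : ∀ ρ k c d e → let p = 4 + ρ + k ; a = 6 + 2 * ρ + k + c ; m = 4 + 2 * ρ + k in
  m * (a + d) + 2 * a ≤ e + 2 * m → e + (3 + ρ) * p + (3 + ρ) * p ≤ p * p + (3 + ρ) * a + (3 + ρ) * (a + d) → ρ ≡ 0 × k ≡ 0
equalCase zero    zero    c d e h₁ h₂ = refl , refl
equalCase (suc ρ) k       c d e h₁ h₂ = ⊥-elim (lin⊥ (2 + 4 * ρ + ρ * ρ + 4 * k + 2 * ρ * k + k * c + 2 * d + ρ * d + k * d) (+-mono-≤ h₁ h₂) (arith ρ k c d e))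
  where
  arith : ∀ ρ k c d e → suc ((e + 2 * (4 + 2 * suc ρ + k)) + ((4 + suc ρ + k) * (4 + suc ρ + k) + (3 + suc ρ) * (6 + 2 * suc ρ + k + c) + (3 + suc ρ) * (6 + 2 * suc ρ + k + c + d)))
      + (2 + 4 * ρ + ρ * ρ + 4 * k + 2 * ρ * k + k * c + 2 * d + ρ * d + k * d)
    ≡ ((4 + 2 * suc ρ + k) * (6 + 2 * suc ρ + k + c + d) + 2 * (6 + 2 * suc ρ + k + c)) + (e + (3 + suc ρ) * (4 + suc ρ + k) + (3 + suc ρ) * (4 + suc ρ + k))
  arith = solve-∀
equalCase zero    (suc k) c d e h₁ h₂ = ⊥-elim (lin⊥ (1 + 2 * k + c + k * c + 2 * d + k * d) (+-mono-≤ h₁ h₂) (arith k c d e))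
  where
  arith : ∀ k c d e → suc ((e + 2 * (4 + 0 + suc k)) + ((4 + 0 + suc k) * (4 + 0 + suc k) + (3 + 0) * (6 + 0 + suc k + c) + (3 + 0) * (6 + 0 + suc k + c + d)))
      + (1 + 2 * k + c + k * c + 2 * d + k * d)
    ≡ ((4 + 0 + suc k) * (6 + 0 + suc k + c + d) + 2 * (6 + 0 + suc k + c)) + (e + (3 + 0) * (4 + 0 + suc k) + (3 + 0) * (4 + 0 + suc k))
  arith = solve-∀

-- Universal vertices in B reach the bound only for a = b once m exceeds 2; for m = 2 they yield
-- universal vertices in A as well.
Outcome : ∀ {a b} → BipGraph a b → ℕ → Set
Outcome {a} {b} E m = Universal E m ⊎ (a ≡ b × Universal (flipE E) m)

module LargeEnd {m a b} (G : Ctx (2 + m) a b) (M : MaxBi (Ctx.E G)) (t : ℕ) (m≥4 : 4 ≤ m) (t≥3 : 3 ≤ t) (l≤2t : 2 + m ≤ t + t)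
  (a≥ : 2 + m ≤ a) (a≤b : a ≤ b) (big : m * b + 2 * a ≤ edges (Ctx.E G) + 2 * m)
  (p≥ : suc t ≤ size (MaxBi.KA M)) (q≥ : suc t ≤ size (MaxBi.KB M))
  (six : m ≡ 4 → size (MaxBi.KA M) ≡ 4 → size (MaxBi.KB M) ≡ 4 → ⊥) where
  open Ctx G
  open MaxBi M

  private
    d = b ∸ a
    b≡ : b ≡ a + d
    b≡ = sym (m+[n∸m]≡n a≤b)

    notBoth : suc m ≤ size KA → suc m ≤ size KB → ⊥
    notBoth hA hB = noBiclique rob short (≤-trans (s≤s (s≤s z≤n)) (≤-trans m≥4 (n≤1+n m))) (biclique-take (suc m) KA KB comp hA hB) a≥ (≤-trans a≥ a≤b)

    from3 : ∀ {n} → suc t ≤ n → Σ ℕ λ k → n ≡ 3 + k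
    from3 {n} h = n ∸ 3 , sym (m+[n∸m]≡n (≤-trans t≥3 (≤-trans (n≤1+n t) h)))

    double≥ : ∀ {n} → suc t ≤ n → 4 + m ≤ n + n
    double≥ h = ≤-trans (≤-trans (s≤s (s≤s l≤2t)) (≤-reflexive (cong suc (sym (+-suc t t))))) (+-mono-≤ h h)

    -- The A-threshold is l - p, the least one with l ≤ s + p, and the B-threshold is p - 1, the
    -- largest that vertices of `KB` survive through K alone. The comparison then leaves q no choice
    -- but b, and p none but m.
    less : size KA < size KB → Universal E m
    less p<q with suc m ≤? size KA
    ... | yes h = ⊥-elim (notBoth h (≤-trans h (<⇒≤ p<q)))
    ... | no h with from3 p≥
    ...   | p'' , p≡ = KA , trans p≡ (sym (trans m≡ (cong (_+ (3 + p'')) r≡0))) , λ i k j → comp i j k (full-set {S = KB} b≤q j)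
      where
      r : ℕ
      r = m ∸ (3 + p'')
      m≡ : m ≡ r + (3 + p'')
      m≡ = sym (m∸n+n≡m (≤-trans (≤-reflexive (sym p≡)) (≮⇒≥ h)))
      q = size KB
      hp : 4 + m ≤ (3 + p'') + (3 + p'')
      hp = subst (λ n → 4 + m ≤ n + n) p≡ (double≥ p≥)
      hr : 4 + r ≤ 3 + p''
      hr = +-cancelʳ-≤ (3 + p'') (4 + r) (3 + p'') (≤-trans (≤-reflexive (trans (+-assoc 4 r (3 + p'')) (cong (4 +_) (sym m≡)))) hp)
      pq : 4 + p'' ≤ q
      pq = ≤-trans (≤-reflexive (cong suc (sym p≡))) p<q
      bound : edges E + (2 + r) * (3 + p'') + (2 + p'') * q ≤ (3 + p'') * q + (2 + r) * a + (2 + p'') * b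
      bound = subst (λ p → edges E + (2 + r) * p + (2 + p'') * q ≤ p * q + (2 + r) * a + (2 + p'') * b) p≡
        (relBound G M (2 + r) (2 + p'') (≤-trans (≤-trans (n≤1+n _) hr) (≤-trans (n≤1+n _) pq)) (≤-reflexive (sym p≡))
          (≤-reflexive (trans (cong (2 +_) m≡) (cong ((2 + r) +_) (sym p≡))))
          (lin (2 + m) (2 + p'' + q) 2 (+-mono-≤ hp pq) (ar₁ m p'' q))
          (≤-trans (≤-reflexive (trans (cong (3 +_) m≡) (trans (cong suc (sym (+-assoc 2 r (3 + p'')))) (sym (+-suc (2 + r) (3 + p'')))))) (+-monoʳ-≤ (2 + r) pq))
          (lin (3 + m) (2 + p'' + size KA) 0 hp (trans (ar₂ m p'') (cong (λ n → 2 + p'' + n + (4 + m)) (sym p≡)))))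
        where
        ar₁ : ∀ m p q → 2 + m + (((3 + p) + (3 + p)) + q) + 2 ≡ 2 + p + q + ((4 + m) + (4 + p))
        ar₁ = solve-∀
        ar₂ : ∀ m p → 3 + m + ((3 + p) + (3 + p)) + 0 ≡ 2 + p + (3 + p) + (4 + m)
        ar₂ = solve-∀
      main : (a + d) + (r + (r * p'' + r * d)) ≤ q
      main = lessCase p'' q r a d (edges E)
        (subst₂ (λ n x → n * x + 2 * a ≤ edges E + 2 * n) m≡ b≡ big)
        (subst (λ x → edges E + (2 + r) * (3 + p'') + (2 + p'') * q ≤ (3 + p'') * q + (2 + r) * a + (2 + p'') * x) b≡ bound)
      b≤q : b ≤ q
      b≤q = ≤-trans (≤-reflexive b≡) (≤-trans (m≤m+n (a + d) _) main)
      r≡0 : r ≡ 0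
      r≡0 = n≤0⇒n≡0 (≤-trans (m≤m+n r _) (+-cancelˡ-≤ (a + d) _ 0 (≤-trans main (≤-trans (size-≤ KB) (≤-reflexive (trans b≡ (sym (+-identityʳ _))))))))

    -- The same thresholds with the classes exchanged. Now q = m and the large side would need at
    -- least b vertices in A, so a = b.
    greater : size KB < size KA → a ≡ b × Universal (flipE E) m
    greater q<p with suc m ≤? size KB
    ... | yes h = ⊥-elim (notBoth (≤-trans h (<⇒≤ q<p)) h)
    ... | no h with from3 q≥
    ...   | q'' , q≡ = ≤-antisym a≤b (≤-trans b≤p (size-≤ KA)) ,
            KB , trans q≡ (sym (trans m≡ (cong (_+ (3 + q'')) r≡0))) , λ j k i → comp i j (full-set {S = KA} (≤-trans a≤b b≤p) i) k
      where
      r : ℕ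
      r = m ∸ (3 + q'')
      m≡ : m ≡ r + (3 + q'')
      m≡ = sym (m∸n+n≡m (≤-trans (≤-reflexive (sym q≡)) (≮⇒≥ h)))
      p = size KA
      hq : 4 + m ≤ (3 + q'') + (3 + q'')
      hq = subst (λ n → 4 + m ≤ n + n) q≡ (double≥ q≥)
      hr : 4 + r ≤ 3 + q''
      hr = +-cancelʳ-≤ (3 + q'') (4 + r) (3 + q'') (≤-trans (≤-reflexive (trans (+-assoc 4 r (3 + q'')) (cong (4 +_) (sym m≡)))) hq)
      qp : 4 + q'' ≤ p
      qp = ≤-trans (≤-reflexive (cong suc (sym q≡))) q<p
      eF : edges (flipE E) ≡ edges E
      eF = eS-flip (flipE E) full full
      bound : edges E + (2 + r) * (3 + q'') + (2 + q'') * p ≤ (3 + q'') * p + (2 + r) * b + (2 + q'') * a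
      bound = subst₂ (λ q e → e + (2 + r) * q + (2 + q'') * p ≤ q * p + (2 + r) * b + (2 + q'') * a) q≡ eF
        (relBound (flipCtx G) (flipMax M) (2 + r) (2 + q'') (≤-trans (≤-trans (n≤1+n _) hr) (≤-trans (n≤1+n _) qp)) (≤-reflexive (sym q≡))
          (≤-reflexive (trans (cong (2 +_) m≡) (cong ((2 + r) +_) (sym q≡))))
          (lin (2 + m) (2 + q'' + p) 2 (+-mono-≤ hq qp) (ar₁ m q'' p))
          (≤-trans (≤-reflexive (trans (cong (3 +_) m≡) (trans (cong suc (sym (+-assoc 2 r (3 + q'')))) (sym (+-suc (2 + r) (3 + q'')))))) (+-monoʳ-≤ (2 + r) qp))
          (lin (3 + m) (2 + q'' + size KB) 0 hq (trans (ar₂ m q'') (cong (λ n → 2 + q'' + n + (4 + m)) (sym q≡)))))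
        where
        ar₁ : ∀ m p q → 2 + m + (((3 + p) + (3 + p)) + q) + 2 ≡ 2 + p + q + ((4 + m) + (4 + p))
        ar₁ = solve-∀
        ar₂ : ∀ m p → 3 + m + ((3 + p) + (3 + p)) + 0 ≡ 2 + p + (3 + p) + (4 + m)
        ar₂ = solve-∀
      main : (a + d) + (r + (r * q'' + q'' * d)) ≤ p
      main = greaterCase q'' p r a d (edges E)
        (subst₂ (λ n x → n * x + 2 * a ≤ edges E + 2 * n) m≡ b≡ big)
        (subst (λ x → edges E + (2 + r) * (3 + q'') + (2 + q'') * p ≤ (3 + q'') * p + (2 + r) * x + (2 + q'') * a) b≡ bound)
      b≤p : b ≤ p
      b≤p = ≤-trans (≤-reflexive b≡) (≤-trans (m≤m+n (a + d) _) main)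
      r≡0 : r ≡ 0
      r≡0 = n≤0⇒n≡0 (≤-trans (m≤m+n r _) (+-cancelˡ-≤ (a + d) _ 0 (≤-trans main (≤-trans (size-≤ KA) (≤-trans (m≤m+n a d) (≤-reflexive (sym (+-identityʳ _))))))))

    -- Ends in the same class force s + q ≥ l + 1, hence both thresholds are l + 1 - p = 3 + ρ.
    equal : size KA ≡ size KB → ⊥
    equal p≡q with suc m ≤? size KA
    ... | yes h = notBoth h (≤-trans h (≤-reflexive p≡q))
    ... | no h = six (trans m≡' (cong₂ (λ x y → 4 + 2 * x + y) ρ0 k0)) (trans p≡ (cong₂ (λ x y → 4 + x + y) ρ0 k0)) (trans (sym p≡q) (trans p≡ (cong₂ (λ x y → 4 + x + y) ρ0 k0)))
      where
      p = size KA
      ρ = m ∸ p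
      m≡ : m ≡ ρ + p
      m≡ = sym (m∸n+n≡m (≮⇒≥ h))
      hp : 4 + ρ ≤ p
      hp = +-cancelʳ-≤ p (4 + ρ) p (≤-trans (≤-reflexive (trans (+-assoc 4 ρ p) (cong (4 +_) (sym m≡)))) (double≥ p≥))
      k = p ∸ (4 + ρ)
      p≡ : p ≡ 4 + ρ + k
      p≡ = sym (m+[n∸m]≡n hp)
      m≡' : m ≡ 4 + 2 * ρ + k
      m≡' = trans m≡ (trans (cong (ρ +_) p≡) (ar ρ k))
        where ar : ∀ ρ k → ρ + (4 + ρ + k) ≡ 4 + 2 * ρ + k
              ar = solve-∀
      c = a ∸ (2 + m)
      a≡ : a ≡ 6 + 2 * ρ + k + c
      a≡ = trans (sym (m+[n∸m]≡n a≥)) (cong (λ x → 2 + x + c) m≡')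
      bound : edges E + (3 + ρ) * p + (3 + ρ) * p ≤ p * p + (3 + ρ) * a + (3 + ρ) * b
      bound = subst (λ q → edges E + (3 + ρ) * p + (3 + ρ) * q ≤ p * q + (3 + ρ) * a + (3 + ρ) * b) (sym p≡q)
        (relBound G M (3 + ρ) (3 + ρ) (≤-trans hp (≤-reflexive p≡q)) hp
          (≤-trans (≤-reflexive (cong (2 +_) m≡)) (n≤1+n _)) (≤-trans (≤-reflexive (cong (2 +_) (trans m≡ (cong (ρ +_) p≡q)))) (n≤1+n _))
          (≤-reflexive (cong (3 +_) (trans m≡ (cong (ρ +_) p≡q)))) (≤-reflexive (cong (3 +_) m≡)))
      both : ρ ≡ 0 × k ≡ 0
      both = equalCase ρ k c d (edges E)
        (subst₂ (λ n x → n * (x + d) + 2 * x ≤ edges E + 2 * n) m≡' a≡ (subst (λ x → m * x + 2 * a ≤ edges E + 2 * m) b≡ big))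
        (subst₂ (λ p x → edges E + (3 + ρ) * p + (3 + ρ) * p ≤ p * p + (3 + ρ) * x + (3 + ρ) * (x + d)) p≡ a≡
          (subst (λ x → edges E + (3 + ρ) * p + (3 + ρ) * p ≤ p * p + (3 + ρ) * a + (3 + ρ) * x) b≡ bound))
      ρ0 = proj₁ both
      k0 = proj₂ both

  outcome : Outcome E m
  outcome with <-cmp (size KA) (size KB)
  ... | tri< h _ _ = inj₁ (less h)
  ... | tri≈ _ h _ = ⊥-elim (equal h)
  ... | tri> _ _ h = inj₂ (greater h)

-- Legs of a biclique

-- Distinctness of a selection from a named path is decided on the positions, so explicit cycles
-- need no pairwise comparisons.
uniqueAt : ∀ {A : Set} (xs : List A) → Unique xs → (is : List (Fin (length xs))) → {True (DecUnique.unique? Fin._≟_ is)} → Unique (map (lookup xs) is)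
uniqueAt xs un is {h} = Uniq.map⁺ (λ {i} {j} → lookup-inj un i j) (toWitness h)

flat : ∀ {a b} → List (Fin b × Fin a) → List (Vertex a b)
flat []             = []
flat ((j , i) ∷ ps) = inj₂ j ∷ inj₁ i ∷ flat ps

data Alt {a b} (E : BipGraph a b) : Fin a → List (Fin b × Fin a) → Fin a → Set where
  []   : ∀ {x} → Alt E x [] x
  step : ∀ {x j i ps w} → T (E x j) → T (E i j) → Alt E i ps w → Alt E x ((j , i) ∷ ps) w

module _ {a b} {E : BipGraph a b} where

  toAlt : ∀ {x P w} → Tr E (inj₁ x) P (inj₁ w) → Σ (List (Fin b × Fin a)) λ ps → Alt E x ps w × P ≡ flat ps
  toAlt [] = [] , [] , refl
  toAlt (_∷_ {w = inj₂ j} e (_∷_ {w = inj₁ i} e' t)) with toAlt t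
  ... | ps , al , refl = (j , i) ∷ ps , step e e' al , refl

  flat-∈₁ : ∀ ps {i} → i ∈ map proj₂ ps → inj₁ i ∈ flat {a} {b} ps
  flat-∈₁ ((j , i) ∷ ps) (here refl) = there (here refl)
  flat-∈₁ ((j , i) ∷ ps) (there m)   = there (there (flat-∈₁ ps m))

  flat-∈₂ : ∀ ps {j} → j ∈ map proj₁ ps → inj₂ j ∈ flat {a} {b} ps
  flat-∈₂ ((j , i) ∷ ps) (here refl) = here refl
  flat-∈₂ ((j , i) ∷ ps) (there m)   = there (there (flat-∈₂ ps m))

  flat-∋₂ : ∀ ps {j} → inj₂ j ∈ flat {a} {b} ps → j ∈ map proj₁ ps
  flat-∋₂ ((j , i) ∷ ps) (here refl)       = here refl
  flat-∋₂ ((j , i) ∷ ps) (there (there m)) = there (flat-∋₂ ps m)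

  flat-unique₁ : ∀ ps → Unique (flat {a} {b} ps) → Unique (map proj₂ ps)
  flat-unique₁ []             _             = []
  flat-unique₁ ((j , i) ∷ ps) (_ ∷ h ∷ un) = unique-∷ (λ m → All.lookup h (flat-∈₁ ps m) refl) (flat-unique₁ ps un)

  flat-unique₂ : ∀ ps → Unique (flat {a} {b} ps) → Unique (map proj₁ ps)
  flat-unique₂ []             _            = []
  flat-unique₂ ((j , i) ∷ ps) (h ∷ _ ∷ un) = unique-∷ (λ m → All.lookup h (there (flat-∈₂ ps m)) refl) (flat-unique₂ ps un)

  flat-length : ∀ ps → length (flat {a} {b} ps) ≡ 2 * length ps
  flat-length []       = refl
  flat-length (_ ∷ ps) = cong suc (trans (cong suc (flat-length ps)) (sym (+-suc _ _)))

  noCross : ∀ {x y : Vertex a b} P₁ p P₂ → All (λ v → ¬ Adj E y v) (x ∷ P₁) → All (λ v → ¬ Adj E x v) P₂ → ¬ Cross {E = E} x (P₁ ++ p ∷ P₂) y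
  noCross {x} {y} P₁ p P₂ hy hx (cross X M Y j eq yi xj) = go P₁ X eq hy yi
    where
    go : ∀ {u} P₁ X → P₁ ++ p ∷ P₂ ≡ X ++ M ++ j ∷ Y → All (λ v → ¬ Adj E y v) (u ∷ P₁) → Adj E y (endOf u X) → ⊥
    go P₁        []      eq (n ∷ _) yi = n yi
    go []        (c ∷ X) refl _      yi = All.lookup hx (∈-++⁺ʳ X (∈-++⁺ʳ M (here refl))) xj
    go (c ∷ P₁) (_ ∷ X) eq (_ ∷ h) yi with ∷-injective eq
    ... | refl , eq' = go P₁ X eq' h yi

  stuck-x : ∀ {thr thr'} {R : Region E thr} {R' : Region E thr'} {l} (S : Stuck R R' l) → thr (side (Stuck.x S)) ≤ nb E (Stuck.x S) (Stuck.x S ∷ Stuck.P S)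
  stuck-x {R = R} S with Region.nbrs R (Stuck.x S) (Stuck.inx S) | Stuck.onx S
  ... | ns , u , h , adj | on = ≤-trans h (nb-≥ (Stuck.x S) u (All.map proj₁ adj) on)

-- A path u α₁ β α₂ v leaving and re-entering the biclique through its B-side.
record Legs {a b} (E : BipGraph a b) (KA : Fin a → Bool) (KB : Fin b → Bool) : Set where
  field
    u v β : Fin b
    α₁ α₂ : Fin a
    u≢v   : u ≢ v
    α₁≢α₂ : α₁ ≢ α₂
    u∈    : T (KB u)
    v∈    : T (KB v)
    α₁∉   : ¬ T (KA α₁)
    α₂∉   : ¬ T (KA α₂)
    β∉    : ¬ T (KB β)
    uα₁   : T (E α₁ u)
    α₁β   : T (E α₁ β)
    α₂β   : T (E α₂ β)
    α₂v   : T (E α₂ v)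
    far   : ∀ i → T (KA i) → ¬ T (E i β)

bits-late : ∀ {A B : Set} (d : Dec A) (e : Dec B) {n} → 3 ≤ bit d + (bit e + n) → 1 ≤ n
bits-late d e {zero}  h = ⊥-elim (1+n≰n (≤-trans h (+-mono-≤ (bit≤1 d) (≤-trans (≤-reflexive (+-identityʳ _)) (bit≤1 e)))))
bits-late d e {suc n} h = s≤s z≤n

bits-some : ∀ {A : Set} (d : Dec A) {n} → 1 ≤ bit d + n → A ⊎ 1 ≤ n
bits-some (yes p) h = inj₁ p
bits-some (no _)  h = inj₂ h

fills : ∀ {n} (S : Fin n → Bool) {xs : List (Fin n)} → Unique xs → (∀ j → T (S j) → j ∈ xs) → length xs ≤ size S → ∀ {x} → x ∈ xs → T (S x)
fills S {xs} un sub len {x} m with T? (S x)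
... | yes s = s
... | no n with ∈-∃++ m
...   | l , r , refl = ⊥-elim (1+n≰n (≤-trans (≤-reflexive (sym (↭.↭-length (↭.shift x l r))))
        (≤-trans len (≤-trans (≤-reflexive (sym (length-elems S))) (⊆-length (elems-unique S) (λ {w} k → inRest (elems-∈ S k)))))))
  where
  inRest : ∀ {w} → T (S w) → w ∈ l ++ r
  inRest {w} s with ∈-++⁻ l (sub w s)
  ... | inj₁ k           = ∈-++⁺ˡ k
  ... | inj₂ (here refl) = ⊥-elim (n s)
  ... | inj₂ (there k)   = ∈-++⁺ʳ l k

remaining : ∀ {n} (S : Fin n → Bool) {i} → T (S i) → Σ (List (Fin n)) λ ys → Unique (i ∷ ys) × size S ≡ suc (length ys) × (∀ {w} → w ∈ ys → T (S w))
remaining S h with pick (∈-elems S h) (elems-unique S)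
... | ys , un , len , sub = ys , un , trans (sym (length-elems S)) len , λ m → elems-∈ S (sub m)

other₁ : ∀ {n} (S : Fin n → Bool) {i} → T (S i) → 2 ≤ size S → Σ (Fin n) λ k → T (S k) × i ≢ k
other₁ S h h₂ with remaining S h
... | []     , _  , len , _   = ⊥-elim (1+n≰n (≤-trans h₂ (≤-reflexive len)))
... | k ∷ _ , un , _   , sub = k , sub (here refl) , All.lookup (AllPairs.head un) (here refl)

other₂ : ∀ {n} (S : Fin n → Bool) {i} → T (S i) → 3 ≤ size S → Σ (Fin n) λ k → Σ (Fin n) λ k' → T (S k) × T (S k') × Unique (i ∷ k ∷ k' ∷ [])
other₂ S h h₃ with remaining S h
... | []          , _  , len , _   = ⊥-elim (1+n≰n (≤-trans h₃ (≤-trans (≤-reflexive len) (s≤s z≤n))))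
... | _ ∷ []      , _  , len , _   = ⊥-elim (1+n≰n (≤-trans h₃ (≤-reflexive len)))
... | k ∷ k' ∷ ys , un , _   , sub = k , k' , sub (here refl) , sub (there (here refl)) , Uniq.take⁺ 3 un

ring : ∀ {a b n} {E : BipGraph a b} → EvenShort E n → ∀ {y xs ys} → Tr E (inj₂ y) (zig xs ys) (inj₂ y) → Unique xs → Unique ys →
  length xs ≡ n → length ys ≡ n → ⊥
ring {n = n} short {y} {xs} {ys} t ux uy lx ly = 1+n≰n (≤-trans (n≤1+n _) (subst (λ k → 2 + k ≤ 2 * n) (trans (zig-length xs ys (trans lx (sym ly))) (cong (2 *_) lx)) (short t (zig-unique ux uy))))

escape : ∀ {n} (S : Fin n → Bool) (xs : List (Fin n)) → suc (length xs) ≤ size S → Σ (Fin n) λ k → T (S k) × k ∉ xs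
escape S xs h with Fin.any? (λ k → T? (S k) ×-dec ¬? (Any.any? (k Fin.≟_) xs))
... | yes p = p
... | no ¬p = ⊥-elim (1+n≰n (≤-trans h (≤-trans (≤-reflexive (sym (length-elems S)))
      (⊆-length (elems-unique S) (λ {k} m → decidable-stable (Any.any? (k Fin.≟_) xs) (λ n → ¬p (k , elems-∈ S m , n)))))))

-- The indices are positions on a path whose first vertex is `x` and whose eleventh is `w`. All of
-- `KB` lies on it, and any crossing with a gap of one vertex closes a cycle through the other ten.
module Legs₅ {a b} {E : BipGraph a b} (short : EvenShort E 5) (KA : Fin a → Bool) (KB : Fin b → Bool)
  (comp : ∀ i j → T (KA i) → T (KB j) → T (E i j)) (|KA| : 3 ≤ size KA) (|KB| : 3 ≤ size KB)
  {x a3 a5 a7 a9 w : Fin a} {b2 b4 b6 b8 b10 : Fin b}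
  (x2 : T (E x b2)) (a32 : T (E a3 b2)) (a34 : T (E a3 b4)) (a54 : T (E a5 b4)) (a56 : T (E a5 b6)) (a76 : T (E a7 b6))
  (a78 : T (E a7 b8)) (a98 : T (E a9 b8)) (a910 : T (E a9 b10)) (w10 : T (E w b10))
  (uA : Unique (x ∷ a3 ∷ a5 ∷ a7 ∷ a9 ∷ w ∷ [])) (uB : Unique (b2 ∷ b4 ∷ b6 ∷ b8 ∷ b10 ∷ []))
  (w∈ : T (KA w)) (KB⊆ : ∀ j → T (KB j) → j ∈ b2 ∷ b4 ∷ b6 ∷ b8 ∷ b10 ∷ [])
  (crs : Cross {E = E} (inj₁ x) (flat ((b2 , a3) ∷ (b4 , a5) ∷ (b6 , a7) ∷ (b8 , a9) ∷ (b10 , w) ∷ [])) (inj₁ w))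
  where

  pA = uniqueAt _ uA
  pB = uniqueAt _ uB

  w≁2 : ¬ T (E w b2)
  w≁2 e = ring short {xs = a3 ∷ a5 ∷ a7 ∷ a9 ∷ w ∷ []} {b4 ∷ b6 ∷ b8 ∷ b10 ∷ b2 ∷ []}
    (a32 ∷ a34 ∷ a54 ∷ a56 ∷ a76 ∷ a78 ∷ a98 ∷ a910 ∷ w10 ∷ e ∷ [])
    (pA (# 1 ∷ # 2 ∷ # 3 ∷ # 4 ∷ # 5 ∷ [])) (pB (# 1 ∷ # 2 ∷ # 3 ∷ # 4 ∷ # 0 ∷ [])) refl refl

  x≁10 : ¬ T (E x b10)
  x≁10 e = ring short {xs = x ∷ a3 ∷ a5 ∷ a7 ∷ a9 ∷ []} {b2 ∷ b4 ∷ b6 ∷ b8 ∷ b10 ∷ []}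
    (e ∷ x2 ∷ a32 ∷ a34 ∷ a54 ∷ a56 ∷ a76 ∷ a78 ∷ a98 ∷ a910 ∷ [])
    (pA (# 0 ∷ # 1 ∷ # 2 ∷ # 3 ∷ # 4 ∷ [])) uB refl refl

  -- The crossing at `b4` and `b6` skips only `a5`.
  not46 : T (E w b4) → T (E x b6) → ⊥
  not46 w4 x6 = ring short {xs = x ∷ a3 ∷ w ∷ a9 ∷ a7 ∷ []} {b2 ∷ b4 ∷ b10 ∷ b8 ∷ b6 ∷ []}
    (x6 ∷ x2 ∷ a32 ∷ a34 ∷ w4 ∷ w10 ∷ a910 ∷ a98 ∷ a78 ∷ a76 ∷ [])
    (pA (# 0 ∷ # 1 ∷ # 5 ∷ # 4 ∷ # 3 ∷ [])) (pB (# 0 ∷ # 1 ∷ # 4 ∷ # 3 ∷ # 2 ∷ [])) refl refl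

  not68 : T (E w b6) → T (E x b8) → ⊥
  not68 w6 x8 = ring short {xs = x ∷ a3 ∷ a5 ∷ w ∷ a9 ∷ []} {b2 ∷ b4 ∷ b6 ∷ b10 ∷ b8 ∷ []}
    (x8 ∷ x2 ∷ a32 ∷ a34 ∷ a54 ∷ a56 ∷ w6 ∷ w10 ∷ a910 ∷ a98 ∷ [])
    (pA (# 0 ∷ # 1 ∷ # 2 ∷ # 5 ∷ # 4 ∷ [])) (pB (# 0 ∷ # 1 ∷ # 2 ∷ # 4 ∷ # 3 ∷ [])) refl refl

  wK : ∀ {j} → T (KB j) → T (E w j)
  wK k = comp w _ w∈ k

  -- If `x` is adjacent to `b6`, then `KB` has to be `b6`, `b8`, `b10`. Hence `w` has no neighbour
  -- before `b6` and `x` none after it, which leaves no crossing.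
  x≁6 : ¬ T (E x b6)
  x≁6 x6 = noCross (inj₂ b2 ∷ inj₁ a3 ∷ inj₂ b4 ∷ inj₁ a5 ∷ []) (inj₂ b6) _
    (id ∷ w≁2 ∷ id ∷ (λ e → not46 e x6) ∷ id ∷ []) (id ∷ (λ e → not68 (wK K6) e) ∷ id ∷ x≁10 ∷ id ∷ []) crs
    where
    sub : ∀ j → T (KB j) → j ∈ b6 ∷ b8 ∷ b10 ∷ []
    sub j k with KB⊆ j k
    ... | here refl         = ⊥-elim (w≁2 (wK k))
    ... | there (here refl) = ⊥-elim (not46 (wK k) x6)
    ... | there (there m)   = m
    K6 : T (KB b6)
    K6 = fills KB (pB (# 2 ∷ # 3 ∷ # 4 ∷ [])) sub |KB| (here refl)

  -- With `x` adjacent to `b8`, the set `KB` is `b4`, `b8`, `b10`. The path leaves it at `b4` and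
  -- returns at `b8`; cycles of length ten show that `a5`, `b6` and `a7` are outside K and `b6` is
  -- far from `KA`.
  legs₅ : T (E x b6) ⊎ T (E x b8) → Legs E KA KB × ¬ T (KA x)
  legs₅ (inj₁ x6) = ⊥-elim (x≁6 x6)
  legs₅ (inj₂ x8) = (record
    { u = b4 ; v = b8 ; β = b6 ; α₁ = a5 ; α₂ = a7
    ; u≢v = All.lookup (AllPairs.head (AllPairs.tail uB)) (there (here refl))
    ; α₁≢α₂ = All.lookup (AllPairs.head (AllPairs.tail (AllPairs.tail uA))) (here refl)
    ; u∈ = K4 ; v∈ = K8 ; α₁∉ = a5∉ ; α₂∉ = a7∉ ; β∉ = λ k → not68 (wK k) x8
    ; uα₁ = a54 ; α₁β = a56 ; α₂β = a76 ; α₂v = a78 ; far = far }) , x∉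
    where
    sub : ∀ j → T (KB j) → j ∈ b4 ∷ b8 ∷ b10 ∷ []
    sub j k with KB⊆ j k
    ... | here refl                 = ⊥-elim (w≁2 (wK k))
    ... | there (here refl)         = here refl
    ... | there (there (here refl)) = ⊥-elim (not68 (wK k) x8)
    ... | there (there (there m))   = there m
    fill : ∀ {j} → j ∈ b4 ∷ b8 ∷ b10 ∷ [] → T (KB j)
    fill = fills KB (pB (# 1 ∷ # 3 ∷ # 4 ∷ [])) sub |KB|
    K4 = fill (here refl)
    K8 = fill (there (here refl))
    K10 = fill (there (there (here refl)))
    x∉ : ¬ T (KA x)
    x∉ k = x≁10 (comp _ _ k K10)
    a3∉ : ¬ T (KA a3)
    a3∉ k = ring short {xs = x ∷ a3 ∷ w ∷ a5 ∷ a7 ∷ []} {b2 ∷ b10 ∷ b4 ∷ b6 ∷ b8 ∷ []}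
      (x8 ∷ x2 ∷ a32 ∷ comp _ _ k K10 ∷ w10 ∷ wK K4 ∷ a54 ∷ a56 ∷ a76 ∷ a78 ∷ [])
      (pA (# 0 ∷ # 1 ∷ # 5 ∷ # 2 ∷ # 3 ∷ [])) (pB (# 0 ∷ # 4 ∷ # 1 ∷ # 2 ∷ # 3 ∷ [])) refl refl
    a5∉ : ¬ T (KA a5)
    a5∉ k = ring short {xs = x ∷ a3 ∷ w ∷ a5 ∷ a7 ∷ []} {b2 ∷ b4 ∷ b10 ∷ b6 ∷ b8 ∷ []}
      (x8 ∷ x2 ∷ a32 ∷ a34 ∷ wK K4 ∷ w10 ∷ comp _ _ k K10 ∷ a56 ∷ a76 ∷ a78 ∷ [])
      (pA (# 0 ∷ # 1 ∷ # 5 ∷ # 2 ∷ # 3 ∷ [])) (pB (# 0 ∷ # 1 ∷ # 4 ∷ # 2 ∷ # 3 ∷ [])) refl refl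
    a7∉ : ¬ T (KA a7)
    a7∉ k = ring short {xs = x ∷ a3 ∷ a5 ∷ a7 ∷ w ∷ []} {b2 ∷ b4 ∷ b6 ∷ b10 ∷ b8 ∷ []}
      (x8 ∷ x2 ∷ a32 ∷ a34 ∷ a54 ∷ a56 ∷ a76 ∷ comp _ _ k K10 ∷ w10 ∷ wK K8 ∷ [])
      (pA (# 0 ∷ # 1 ∷ # 2 ∷ # 3 ∷ # 5 ∷ [])) (pB (# 0 ∷ # 1 ∷ # 2 ∷ # 4 ∷ # 3 ∷ [])) refl refl
    far : ∀ i → T (KA i) → ¬ T (E i b6)
    far i i∈ e with other₁ KA i∈ (≤-trans (n≤1+n 2) |KA|)
    ... | k , k∈ , i≢k = ring short {xs = x ∷ a3 ∷ a5 ∷ i ∷ k ∷ []} {b2 ∷ b4 ∷ b6 ∷ b10 ∷ b8 ∷ []}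
      (x8 ∷ x2 ∷ a32 ∷ a34 ∷ a54 ∷ a56 ∷ e ∷ comp _ _ i∈ K10 ∷ comp _ _ k∈ K10 ∷ comp _ _ k∈ K8 ∷ [])
      (unique-++ {xs = x ∷ a3 ∷ a5 ∷ []} (pA (# 0 ∷ # 1 ∷ # 2 ∷ [])) ((i≢k ∷ []) ∷ [] ∷ [])
        (λ p q → out p (inKA q)))
      (pB (# 0 ∷ # 1 ∷ # 2 ∷ # 4 ∷ # 3 ∷ [])) refl refl
      where
      inKA : ∀ {v} → v ∈ i ∷ k ∷ [] → T (KA v)
      inKA (here refl)         = i∈
      inKA (there (here refl)) = k∈
      out : ∀ {v} → v ∈ x ∷ a3 ∷ a5 ∷ [] → ¬ T (KA v)
      out (here refl)                 = x∉
      out (there (here refl))         = a3∉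
      out (there (there (here refl))) = a5∉

-- As in `Legs₅`, on a path with thirteen vertices and cycles of length twelve. The additional
-- possibility is that `x` is adjacent to `b10`.
module Legs₆ {a b} {E : BipGraph a b} (short : EvenShort E 6) (KA : Fin a → Bool) (KB : Fin b → Bool)
  (comp : ∀ i j → T (KA i) → T (KB j) → T (E i j)) (|KA| : 4 ≤ size KA) (|KB| : 4 ≤ size KB)
  {x a3 a5 a7 a9 a11 w : Fin a} {b2 b4 b6 b8 b10 b12 : Fin b}
  (x2 : T (E x b2)) (a32 : T (E a3 b2)) (a34 : T (E a3 b4)) (a54 : T (E a5 b4)) (a56 : T (E a5 b6)) (a76 : T (E a7 b6))
  (a78 : T (E a7 b8)) (a98 : T (E a9 b8)) (a910 : T (E a9 b10)) (a1110 : T (E a11 b10)) (a1112 : T (E a11 b12)) (w12 : T (E w b12))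
  (uA : Unique (x ∷ a3 ∷ a5 ∷ a7 ∷ a9 ∷ a11 ∷ w ∷ [])) (uB : Unique (b2 ∷ b4 ∷ b6 ∷ b8 ∷ b10 ∷ b12 ∷ []))
  (w∈ : T (KA w)) (KB⊆ : ∀ j → T (KB j) → j ∈ b2 ∷ b4 ∷ b6 ∷ b8 ∷ b10 ∷ b12 ∷ [])
  (crs : Cross {E = E} (inj₁ x) (flat ((b2 , a3) ∷ (b4 , a5) ∷ (b6 , a7) ∷ (b8 , a9) ∷ (b10 , a11) ∷ (b12 , w) ∷ [])) (inj₁ w))
  where

  pA = uniqueAt _ uA
  pB = uniqueAt _ uB

  w≁2 : ¬ T (E w b2)
  w≁2 e = ring short {xs = a3 ∷ a5 ∷ a7 ∷ a9 ∷ a11 ∷ w ∷ []} {b4 ∷ b6 ∷ b8 ∷ b10 ∷ b12 ∷ b2 ∷ []}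
    (a32 ∷ a34 ∷ a54 ∷ a56 ∷ a76 ∷ a78 ∷ a98 ∷ a910 ∷ a1110 ∷ a1112 ∷ w12 ∷ e ∷ [])
    (pA (# 1 ∷ # 2 ∷ # 3 ∷ # 4 ∷ # 5 ∷ # 6 ∷ [])) (pB (# 1 ∷ # 2 ∷ # 3 ∷ # 4 ∷ # 5 ∷ # 0 ∷ [])) refl refl

  x≁12 : ¬ T (E x b12)
  x≁12 e = ring short {xs = x ∷ a3 ∷ a5 ∷ a7 ∷ a9 ∷ a11 ∷ []} {b2 ∷ b4 ∷ b6 ∷ b8 ∷ b10 ∷ b12 ∷ []}
    (e ∷ x2 ∷ a32 ∷ a34 ∷ a54 ∷ a56 ∷ a76 ∷ a78 ∷ a98 ∷ a910 ∷ a1110 ∷ a1112 ∷ [])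
    (pA (# 0 ∷ # 1 ∷ # 2 ∷ # 3 ∷ # 4 ∷ # 5 ∷ [])) uB refl refl

  not46 : T (E w b4) → T (E x b6) → ⊥
  not46 w4 x6 = ring short {xs = x ∷ a3 ∷ w ∷ a11 ∷ a9 ∷ a7 ∷ []} {b2 ∷ b4 ∷ b12 ∷ b10 ∷ b8 ∷ b6 ∷ []}
    (x6 ∷ x2 ∷ a32 ∷ a34 ∷ w4 ∷ w12 ∷ a1112 ∷ a1110 ∷ a910 ∷ a98 ∷ a78 ∷ a76 ∷ [])
    (pA (# 0 ∷ # 1 ∷ # 6 ∷ # 5 ∷ # 4 ∷ # 3 ∷ [])) (pB (# 0 ∷ # 1 ∷ # 5 ∷ # 4 ∷ # 3 ∷ # 2 ∷ [])) refl refl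

  not68 : T (E w b6) → T (E x b8) → ⊥
  not68 w6 x8 = ring short {xs = x ∷ a3 ∷ a5 ∷ w ∷ a11 ∷ a9 ∷ []} {b2 ∷ b4 ∷ b6 ∷ b12 ∷ b10 ∷ b8 ∷ []}
    (x8 ∷ x2 ∷ a32 ∷ a34 ∷ a54 ∷ a56 ∷ w6 ∷ w12 ∷ a1112 ∷ a1110 ∷ a910 ∷ a98 ∷ [])
    (pA (# 0 ∷ # 1 ∷ # 2 ∷ # 6 ∷ # 5 ∷ # 4 ∷ [])) (pB (# 0 ∷ # 1 ∷ # 2 ∷ # 5 ∷ # 4 ∷ # 3 ∷ [])) refl refl

  not810 : T (E w b8) → T (E x b10) → ⊥
  not810 w8 x10 = ring short {xs = x ∷ a3 ∷ a5 ∷ a7 ∷ w ∷ a11 ∷ []} {b2 ∷ b4 ∷ b6 ∷ b8 ∷ b12 ∷ b10 ∷ []}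
    (x10 ∷ x2 ∷ a32 ∷ a34 ∷ a54 ∷ a56 ∷ a76 ∷ a78 ∷ w8 ∷ w12 ∷ a1112 ∷ a1110 ∷ [])
    (pA (# 0 ∷ # 1 ∷ # 2 ∷ # 3 ∷ # 6 ∷ # 5 ∷ [])) (pB (# 0 ∷ # 1 ∷ # 2 ∷ # 3 ∷ # 5 ∷ # 4 ∷ [])) refl refl

  wK : ∀ {j} → T (KB j) → T (E w j)
  wK k = comp w _ w∈ k

  x≁6 : ¬ T (E x b6)
  x≁6 x6 = noCross (inj₂ b2 ∷ inj₁ a3 ∷ inj₂ b4 ∷ inj₁ a5 ∷ []) (inj₂ b6) _
    (id ∷ w≁2 ∷ id ∷ (λ e → not46 e x6) ∷ id ∷ [])
    (id ∷ (λ e → not68 (wK (fill (here refl))) e) ∷ id ∷ (λ e → not810 (wK (fill (there (here refl)))) e) ∷ id ∷ x≁12 ∷ id ∷ []) crs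
    where
    sub : ∀ j → T (KB j) → j ∈ b6 ∷ b8 ∷ b10 ∷ b12 ∷ []
    sub j k with KB⊆ j k
    ... | here refl         = ⊥-elim (w≁2 (wK k))
    ... | there (here refl) = ⊥-elim (not46 (wK k) x6)
    ... | there (there m)   = m
    fill : ∀ {j} → j ∈ b6 ∷ b8 ∷ b10 ∷ b12 ∷ [] → T (KB j)
    fill = fills KB (pB (# 2 ∷ # 3 ∷ # 4 ∷ # 5 ∷ [])) sub |KB|

  -- Now `KB` is `b4`, `b6`, `b10`, `b12`. A further vertex `k` of `KA` allows a passage from `b4`
  -- to `b6` through `w`, `b12` and `k`, which completes a cycle of length twelve.
  x≁10 : ¬ T (E x b10)
  x≁10 x10 with escape KA (w ∷ a7 ∷ a9 ∷ []) |KA|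
  ... | k , k∈ , k∉ = final
    where
    sub : ∀ j → T (KB j) → j ∈ b4 ∷ b6 ∷ b10 ∷ b12 ∷ []
    sub j h with KB⊆ j h
    ... | here refl                         = ⊥-elim (w≁2 (wK h))
    ... | there (here refl)                 = here refl
    ... | there (there (here refl))         = there (here refl)
    ... | there (there (there (here refl))) = ⊥-elim (not810 (wK h) x10)
    ... | there (there (there (there m)))   = there (there m)
    fill : ∀ {j} → j ∈ b4 ∷ b6 ∷ b10 ∷ b12 ∷ [] → T (KB j)
    fill = fills KB (pB (# 1 ∷ # 2 ∷ # 4 ∷ # 5 ∷ [])) sub |KB|
    K4 = fill (here refl)
    K6 = fill (there (here refl))
    K12 = fill (there (there (there (here refl))))
    a3∉ : ¬ T (KA a3)
    a3∉ h = ring short {xs = x ∷ a3 ∷ w ∷ a5 ∷ a7 ∷ a9 ∷ []} {b2 ∷ b12 ∷ b4 ∷ b6 ∷ b8 ∷ b10 ∷ []}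
      (x10 ∷ x2 ∷ a32 ∷ comp _ _ h K12 ∷ w12 ∷ wK K4 ∷ a54 ∷ a56 ∷ a76 ∷ a78 ∷ a98 ∷ a910 ∷ [])
      (pA (# 0 ∷ # 1 ∷ # 6 ∷ # 2 ∷ # 3 ∷ # 4 ∷ [])) (pB (# 0 ∷ # 5 ∷ # 1 ∷ # 2 ∷ # 3 ∷ # 4 ∷ [])) refl refl
    k≢ : k ∉ x ∷ a3 ∷ w ∷ a7 ∷ a9 ∷ []
    k≢ (here refl)                 = x≁12 (comp _ _ k∈ K12)
    k≢ (there (here refl))         = a3∉ k∈
    k≢ (there (there m))           = k∉ m
    final : ⊥
    final = ring short {xs = x ∷ a3 ∷ w ∷ k ∷ a7 ∷ a9 ∷ []} {b2 ∷ b4 ∷ b12 ∷ b6 ∷ b8 ∷ b10 ∷ []}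
      (x10 ∷ x2 ∷ a32 ∷ a34 ∷ wK K4 ∷ w12 ∷ comp _ _ k∈ K12 ∷ comp _ _ k∈ K6 ∷ a76 ∷ a78 ∷ a98 ∷ a910 ∷ [])
      (uniqueAt (k ∷ x ∷ a3 ∷ w ∷ a7 ∷ a9 ∷ []) (unique-∷ k≢ (pA (# 0 ∷ # 1 ∷ # 6 ∷ # 3 ∷ # 4 ∷ []))) (# 1 ∷ # 2 ∷ # 3 ∷ # 0 ∷ # 4 ∷ # 5 ∷ []))
      (pB (# 0 ∷ # 1 ∷ # 5 ∷ # 2 ∷ # 3 ∷ # 4 ∷ [])) refl refl

  legs₆ : T (E x b6) ⊎ T (E x b8) ⊎ T (E x b10) → Legs E KA KB
  legs₆ (inj₁ x6) = ⊥-elim (x≁6 x6)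
  legs₆ (inj₂ (inj₂ x10)) = ⊥-elim (x≁10 x10)
  legs₆ (inj₂ (inj₁ x8)) = record
    { u = b4 ; v = b8 ; β = b6 ; α₁ = a5 ; α₂ = a7
    ; u≢v = All.lookup (AllPairs.head (AllPairs.tail uB)) (there (here refl))
    ; α₁≢α₂ = All.lookup (AllPairs.head (AllPairs.tail (AllPairs.tail uA))) (here refl)
    ; u∈ = K4 ; v∈ = K8 ; α₁∉ = a5∉ ; α₂∉ = a7∉ ; β∉ = λ k → not68 (wK k) x8
    ; uα₁ = a54 ; α₁β = a56 ; α₂β = a76 ; α₂v = a78 ; far = far }
    where
    sub : ∀ j → T (KB j) → j ∈ b4 ∷ b8 ∷ b10 ∷ b12 ∷ []
    sub j k with KB⊆ j k
    ... | here refl                 = ⊥-elim (w≁2 (wK k))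
    ... | there (here refl)         = here refl
    ... | there (there (here refl)) = ⊥-elim (not68 (wK k) x8)
    ... | there (there (there m))   = there m
    fill : ∀ {j} → j ∈ b4 ∷ b8 ∷ b10 ∷ b12 ∷ [] → T (KB j)
    fill = fills KB (pB (# 1 ∷ # 3 ∷ # 4 ∷ # 5 ∷ [])) sub |KB|
    K4 = fill (here refl)
    K8 = fill (there (here refl))
    K10 = fill (there (there (here refl)))
    K12 = fill (there (there (there (here refl))))
    x∉ : ¬ T (KA x)
    x∉ k = x≁12 (comp _ _ k K12)
    a3∉ : ¬ T (KA a3)
    a3∉ k = ring short {xs = x ∷ a3 ∷ a11 ∷ w ∷ a5 ∷ a7 ∷ []} {b2 ∷ b10 ∷ b12 ∷ b4 ∷ b6 ∷ b8 ∷ []}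
      (x8 ∷ x2 ∷ a32 ∷ comp _ _ k K10 ∷ a1110 ∷ a1112 ∷ w12 ∷ wK K4 ∷ a54 ∷ a56 ∷ a76 ∷ a78 ∷ [])
      (pA (# 0 ∷ # 1 ∷ # 5 ∷ # 6 ∷ # 2 ∷ # 3 ∷ [])) (pB (# 0 ∷ # 4 ∷ # 5 ∷ # 1 ∷ # 2 ∷ # 3 ∷ [])) refl refl
    a5∉ : ¬ T (KA a5)
    a5∉ k = ring short {xs = x ∷ a3 ∷ w ∷ a11 ∷ a5 ∷ a7 ∷ []} {b2 ∷ b4 ∷ b12 ∷ b10 ∷ b6 ∷ b8 ∷ []}
      (x8 ∷ x2 ∷ a32 ∷ a34 ∷ wK K4 ∷ w12 ∷ a1112 ∷ a1110 ∷ comp _ _ k K10 ∷ a56 ∷ a76 ∷ a78 ∷ [])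
      (pA (# 0 ∷ # 1 ∷ # 6 ∷ # 5 ∷ # 2 ∷ # 3 ∷ [])) (pB (# 0 ∷ # 1 ∷ # 5 ∷ # 4 ∷ # 2 ∷ # 3 ∷ [])) refl refl
    a7∉ : ¬ T (KA a7)
    a7∉ k = ring short {xs = x ∷ a3 ∷ a5 ∷ a7 ∷ a11 ∷ w ∷ []} {b2 ∷ b4 ∷ b6 ∷ b10 ∷ b12 ∷ b8 ∷ []}
      (x8 ∷ x2 ∷ a32 ∷ a34 ∷ a54 ∷ a56 ∷ a76 ∷ comp _ _ k K10 ∷ a1110 ∷ a1112 ∷ w12 ∷ wK K8 ∷ [])
      (pA (# 0 ∷ # 1 ∷ # 2 ∷ # 3 ∷ # 5 ∷ # 6 ∷ [])) (pB (# 0 ∷ # 1 ∷ # 2 ∷ # 4 ∷ # 5 ∷ # 3 ∷ [])) refl refl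
    far : ∀ i → T (KA i) → ¬ T (E i b6)
    far i i∈ e with other₂ KA i∈ (≤-trans (n≤1+n 3) |KA|)
    ... | k , k' , k∈ , k'∈ , uK = ring short {xs = x ∷ a3 ∷ a5 ∷ i ∷ k ∷ k' ∷ []} {b2 ∷ b4 ∷ b6 ∷ b10 ∷ b12 ∷ b8 ∷ []}
      (x8 ∷ x2 ∷ a32 ∷ a34 ∷ a54 ∷ a56 ∷ e ∷ comp _ _ i∈ K10 ∷ comp _ _ k∈ K10 ∷ comp _ _ k∈ K12 ∷ comp _ _ k'∈ K12 ∷ comp _ _ k'∈ K8 ∷ [])
      (unique-++ {xs = x ∷ a3 ∷ a5 ∷ []} (pA (# 0 ∷ # 1 ∷ # 2 ∷ [])) uK (λ p q → out p (inKA q)))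
      (pB (# 0 ∷ # 1 ∷ # 2 ∷ # 4 ∷ # 5 ∷ # 3 ∷ [])) refl refl
      where
      inKA : ∀ {v} → v ∈ i ∷ k ∷ k' ∷ [] → T (KA v)
      inKA (here refl)                 = i∈
      inKA (there (here refl))         = k∈
      inKA (there (there (here refl))) = k'∈
      out : ∀ {v} → v ∈ x ∷ a3 ∷ a5 ∷ [] → ¬ T (KA v)
      out (here refl)                 = x∉
      out (there (here refl))         = a3∉
      out (there (there (here refl))) = a5∉

sideIsA : ∀ {α β q p n} → suc n ≤ β + p → ∀ s s' → s' ≡ s → by-side α β s + by-side q p s' ≤ n → s ≡ true
sideIsA h true  _     _    _ = refl
sideIsA h false false refl k = ⊥-elim (1+n≰n (≤-trans h k))

module _ {a b} {E : BipGraph a b} (M : MaxBi E) where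
  open MaxBi M
  open Relative M

  private
    onPath : ∀ {x w} ps → All (_∈ inj₁ x ∷ flat ps) (map inj₂ (elems (λ j → KB j ∧ E w j))) → T (KA w) → ∀ j → T (KB j) → j ∈ map proj₁ ps
    onPath {x} {w} ps on w∈ j h with All.lookup on (∈-map⁺ inj₂ (∈-elems (λ j → KB j ∧ E w j) (T-∧ᶜ (KB j) h (comp w j w∈ h))))
    ... | there m = flat-∋₂ {E = E} ps m

    uniA : ∀ {x} ps → Unique (inj₁ x ∷ flat {a} {b} ps) → Unique (x ∷ map proj₂ ps)
    uniA ps (h ∷ un) = unique-∷ (λ m → All.lookup h (flat-∈₁ {E = E} ps m) refl) (flat-unique₁ {E = E} ps un)

    exactly : ∀ {n k} → 2 * k ≤ suc (2 * n) → 2 * n ≤ suc (2 * k) → n ≡ k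
    exactly p q = ≤-antisym (halve-≤ q) (halve-≤ p)

  legsRaw₅ : EvenShort E 5 → 3 ≤ size KA → 3 ≤ size KB → ∀ {x w P} → Tr E (inj₁ x) P (inj₁ w) → Unique (inj₁ x ∷ P) →
    10 ≤ suc (length P) → length P + 5 ≤ 15 → Cross {E = E} (inj₁ x) P (inj₁ w) → T (KA w) →
    (∀ j → T (KB j) → inj₂ j ∈ P) → 3 ≤ nb E (inj₁ x) P → Legs E KA KB × ¬ T (KA x)
  legsRaw₅ short hA hB {x} {w} tr un long small crs w∈ on cnt = expand (toAlt tr) un long small crs on cnt
    where
    expand : ∀ {P} → (Σ (List (Fin b × Fin a)) λ ps → Alt E x ps w × P ≡ flat ps) → Unique (inj₁ x ∷ P) → 10 ≤ suc (length P) → length P + 5 ≤ 15 →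
      Cross {E = E} (inj₁ x) P (inj₁ w) → (∀ j → T (KB j) → inj₂ j ∈ P) → 3 ≤ nb E (inj₁ x) P → Legs E KA KB × ¬ T (KA x)
    -- The path has at least 9 edges, at most 10 by the length bound, and an even number.
    expand (ps , al , refl) un long small crs on cnt = named ps al (exactly {length ps} {5} (subst (λ k → 10 ≤ suc k) (flat-length {E = E} ps) long)
        (≤-trans (≤-reflexive (sym (flat-length {E = E} ps))) (≤-trans (+-cancelʳ-≤ 5 _ 10 small) (n≤1+n 10)))) un crs on cnt
      where
      named : ∀ ps → Alt E x ps w → length ps ≡ 5 → Unique (inj₁ x ∷ flat ps) → Cross {E = E} (inj₁ x) (flat ps) (inj₁ w) →
        (∀ j → T (KB j) → inj₂ j ∈ flat ps) → 3 ≤ nb E (inj₁ x) (flat ps) → Legs E KA KB × ¬ T (KA x)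
      named ((b2 , a3) ∷ (b4 , a5) ∷ (b6 , a7) ∷ (b8 , a9) ∷ (b10 , _) ∷ [])
        (step x2 a32 (step a34 a54 (step a56 a76 (step a78 a98 (step a910 w10 []))))) refl un crs on cnt =
        Legs₅.legs₅ {E = E} short KA KB comp hA hB x2 a32 a34 a54 a56 a76 a78 a98 a910 w10 uA uB w∈ onB crs
          -- With at least three neighbours on the path, `x` has one beyond `b4`.
          (late (bits-some (T? (E x b6)) (bits-late (T? (E x b2)) (T? (E x b4)) cnt)))
        where
        pp = (b2 , a3) ∷ (b4 , a5) ∷ (b6 , a7) ∷ (b8 , a9) ∷ (b10 , w) ∷ []
        uA = uniA pp un
        uB = flat-unique₂ {E = E} pp (AllPairs.tail un)
        onB : ∀ j → T (KB j) → j ∈ map proj₁ pp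
        onB j h = flat-∋₂ {E = E} pp (on j h)
        late : T (E x b6) ⊎ 1 ≤ bit (T? (E x b8)) + (bit (T? (E x b10)) + 0) → T (E x b6) ⊎ T (E x b8)
        late (inj₁ p) = inj₁ p
        late (inj₂ h) with bits-some (T? (E x b8)) h
        ... | inj₁ p  = inj₂ p
        ... | inj₂ h' with bits-some (T? (E x b10)) h'
        ...   | inj₁ p  = ⊥-elim (Legs₅.x≁10 {E = E} short KA KB comp hA hB x2 a32 a34 a54 a56 a76 a78 a98 a910 w10 uA uB w∈ onB crs p)
        ...   | inj₂ ()

  legsFrom₆ : EvenShort E 6 → 4 ≤ size KA → 4 ≤ size KB → ∀ {thr} {R : Region E thr} → 3 ≤ thr true →
    (o : OneShort R KRegion 6) → side (Stuck.x (OneShort.S o)) ≡ true → Legs E KA KB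
  legsFrom₆ short hA hB {thr} {R} h3 o = go (OneShort.S o) (OneShort.same o) (OneShort.small o) (OneShort.crs o)
    where
    go : (S : Stuck R KRegion 6) → side (Stuck.y S) ≡ side (Stuck.x S) → length (Stuck.P S) + 5 ≤ 18 → Cross {E = E} (Stuck.x S) (Stuck.P S) (Stuck.y S) →
      side (Stuck.x S) ≡ true → Legs E KA KB
    go S@record { x = inj₁ x ; y = inj₁ w ; P = P ; tr = tr ; un = un ; long = long ; iny = w∈ ; ony = ony } _ small crs _ =
      expand (toAlt tr) un long small crs ony (≤-trans h3 (stuck-x S))
      where
      expand : (Σ (List (Fin b × Fin a)) λ ps → Alt E x ps w × P ≡ flat ps) → Unique (inj₁ x ∷ P) → 12 ≤ suc (length P) → length P + 5 ≤ 18 →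
        Cross {E = E} (inj₁ x) P (inj₁ w) → All (_∈ inj₁ x ∷ P) (map inj₂ (elems (λ j → KB j ∧ E w j))) → 3 ≤ nb E (inj₁ x) (inj₁ x ∷ P) → Legs E KA KB
      expand (ps , al , refl) un long small crs on cnt = named ps al (exactly {length ps} {6} (subst (λ k → 12 ≤ suc k) (flat-length {E = E} ps) long)
          (≤-trans (≤-reflexive (sym (flat-length {E = E} ps))) (+-cancelʳ-≤ 5 _ 13 small))) un crs on cnt
        where
        named : ∀ ps → Alt E x ps w → length ps ≡ 6 → Unique (inj₁ x ∷ flat ps) → Cross {E = E} (inj₁ x) (flat ps) (inj₁ w) →
          All (_∈ inj₁ x ∷ flat ps) (map inj₂ (elems (λ j → KB j ∧ E w j))) → 3 ≤ nb E (inj₁ x) (inj₁ x ∷ flat ps) → Legs E KA KB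
        named ((b2 , a3) ∷ (b4 , a5) ∷ (b6 , a7) ∷ (b8 , a9) ∷ (b10 , a11) ∷ (b12 , _) ∷ [])
          (step x2 a32 (step a34 a54 (step a56 a76 (step a78 a98 (step a910 a1110 (step a1112 w12 [])))))) refl un crs on cnt =
          Legs₆.legs₆ {E = E} short KA KB comp hA hB x2 a32 a34 a54 a56 a76 a78 a98 a910 a1110 a1112 w12 uA uB w∈ onB crs
            (late (bits-some (T? (E x b6)) (bits-late (T? (E x b2)) (T? (E x b4)) cnt)))
          where
          pp = (b2 , a3) ∷ (b4 , a5) ∷ (b6 , a7) ∷ (b8 , a9) ∷ (b10 , a11) ∷ (b12 , w) ∷ []
          uA = uniA pp un
          uB = flat-unique₂ {E = E} pp (AllPairs.tail un)
          onB = onPath pp on w∈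
          late : T (E x b6) ⊎ 1 ≤ bit (T? (E x b8)) + (bit (T? (E x b10)) + (bit (T? (E x b12)) + 0)) → T (E x b6) ⊎ T (E x b8) ⊎ T (E x b10)
          late (inj₁ p) = inj₁ p
          late (inj₂ h) with bits-some (T? (E x b8)) h
          ... | inj₁ p  = inj₂ (inj₁ p)
          ... | inj₂ h' with bits-some (T? (E x b10)) h'
          ...   | inj₁ p  = inj₂ (inj₂ p)
          ...   | inj₂ h'' with bits-some (T? (E x b12)) h''
          ...     | inj₁ p  = ⊥-elim (Legs₆.x≁12 {E = E} short KA KB comp hA hB x2 a32 a34 a54 a56 a76 a78 a98 a910 a1110 a1112 w12 uA uB w∈ onB crs p)
          ...     | inj₂ ()
    go record { x = inj₂ _ } _ _ _ ()
    go record { x = inj₁ _ ; y = inj₂ _ } () _ _ _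

module _ {a b} {E : BipGraph a b} {KA : Fin a → Bool} {KB : Fin b → Bool} (comp : ∀ i j → T (KA i) → T (KB j) → T (E i j))
         (L : Legs E KA KB) (L' : Legs (flipE E) KB KA) where
  private
    module L = Legs L
    module L' = Legs L'
    ≢K : ∀ {n} {S : Fin n → Bool} {i k} → ¬ T (S i) → T (S k) → i ≢ k
    ≢K n h refl = n h
    apart₁ : ∀ {i} → T (E i L.u) ⊎ T (E i L.v) → i ≢ L'.β
    apart₁ (inj₁ e) refl = L'.far _ L.u∈ e
    apart₁ (inj₂ e) refl = L'.far _ L.v∈ e
    apart₂ : ∀ {j} → T (E L'.u j) ⊎ T (E L'.v j) → j ≢ L.β
    apart₂ (inj₁ e) refl = L.far _ L'.u∈ e
    apart₂ (inj₂ e) refl = L.far _ L'.v∈ e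

  -- The two legs leave different sides of K, so edges of K join them into a cycle with ten
  -- vertices. `far` keeps the middle vertex of each leg off the other leg.
  twoLegs₅ : EvenShort E 5 → ⊥
  twoLegs₅ short = ring short {xs = L.α₁ ∷ L.α₂ ∷ L'.u ∷ L'.β ∷ L'.v ∷ []} {L.β ∷ L.v ∷ L'.α₁ ∷ L'.α₂ ∷ L.u ∷ []}
    (L.uα₁ ∷ L.α₁β ∷ L.α₂β ∷ L.α₂v ∷ comp _ _ L'.u∈ L.v∈ ∷ L'.uα₁ ∷ L'.α₁β ∷ L'.α₂β ∷ L'.α₂v ∷ comp _ _ L'.v∈ L.u∈ ∷ [])
    ((L.α₁≢α₂ ∷ ≢K {S = KA} L.α₁∉ L'.u∈ ∷ apart₁ (inj₁ L.uα₁) ∷ ≢K {S = KA} L.α₁∉ L'.v∈ ∷ []) ∷ (≢K {S = KA} L.α₂∉ L'.u∈ ∷ apart₁ (inj₂ L.α₂v) ∷ ≢K {S = KA} L.α₂∉ L'.v∈ ∷ [])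
      ∷ ((λ e → ≢K {S = KA} L'.β∉ L'.u∈ (sym e)) ∷ L'.u≢v ∷ []) ∷ (≢K {S = KA} L'.β∉ L'.v∈ ∷ []) ∷ [] ∷ [])
    ((≢K {S = KB} L.β∉ L.v∈ ∷ (λ e → apart₂ (inj₁ L'.uα₁) (sym e)) ∷ (λ e → apart₂ (inj₂ L'.α₂v) (sym e)) ∷ ≢K {S = KB} L.β∉ L.u∈ ∷ [])
      ∷ ((λ e → ≢K {S = KB} L'.α₁∉ L.v∈ (sym e)) ∷ (λ e → ≢K {S = KB} L'.α₂∉ L.v∈ (sym e)) ∷ (λ e → L.u≢v (sym e)) ∷ [])
      ∷ (L'.α₁≢α₂ ∷ ≢K {S = KB} L'.α₁∉ L.u∈ ∷ []) ∷ (≢K {S = KB} L'.α₂∉ L.u∈ ∷ []) ∷ [] ∷ []) refl refl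

  -- A third vertex of K on each side lengthens the cycle of `twoLegs₅` to twelve.
  twoLegs₆ : EvenShort E 6 → 3 ≤ size KA → 3 ≤ size KB → ⊥
  twoLegs₆ short hA hB with escape KA (L'.u ∷ L'.v ∷ []) hA | escape KB (L.u ∷ L.v ∷ []) hB
  ... | w₃ , w₃∈ , w₃∉ | u₃ , u₃∈ , u₃∉ = ring short {xs = L.α₁ ∷ L.α₂ ∷ L'.u ∷ L'.β ∷ L'.v ∷ w₃ ∷ []} {L.β ∷ L.v ∷ L'.α₁ ∷ L'.α₂ ∷ u₃ ∷ L.u ∷ []}
    (L.uα₁ ∷ L.α₁β ∷ L.α₂β ∷ L.α₂v ∷ comp _ _ L'.u∈ L.v∈ ∷ L'.uα₁ ∷ L'.α₁β ∷ L'.α₂β ∷ L'.α₂v ∷ comp _ _ L'.v∈ u₃∈ ∷ comp _ _ w₃∈ u₃∈ ∷ comp _ _ w₃∈ L.u∈ ∷ [])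
    ((L.α₁≢α₂ ∷ ≢K {S = KA} L.α₁∉ L'.u∈ ∷ apart₁ (inj₁ L.uα₁) ∷ ≢K {S = KA} L.α₁∉ L'.v∈ ∷ ≢K {S = KA} L.α₁∉ w₃∈ ∷ [])
      ∷ (≢K {S = KA} L.α₂∉ L'.u∈ ∷ apart₁ (inj₂ L.α₂v) ∷ ≢K {S = KA} L.α₂∉ L'.v∈ ∷ ≢K {S = KA} L.α₂∉ w₃∈ ∷ [])
      ∷ ((λ e → ≢K {S = KA} L'.β∉ L'.u∈ (sym e)) ∷ L'.u≢v ∷ (λ e → w₃∉ (here (sym e))) ∷ []) ∷ (≢K {S = KA} L'.β∉ L'.v∈ ∷ ≢K {S = KA} L'.β∉ w₃∈ ∷ [])
      ∷ ((λ e → w₃∉ (there (here (sym e)))) ∷ []) ∷ [] ∷ [])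
    ((≢K {S = KB} L.β∉ L.v∈ ∷ (λ e → apart₂ (inj₁ L'.uα₁) (sym e)) ∷ (λ e → apart₂ (inj₂ L'.α₂v) (sym e)) ∷ ≢K {S = KB} L.β∉ u₃∈ ∷ ≢K {S = KB} L.β∉ L.u∈ ∷ [])
      ∷ ((λ e → ≢K {S = KB} L'.α₁∉ L.v∈ (sym e)) ∷ (λ e → ≢K {S = KB} L'.α₂∉ L.v∈ (sym e)) ∷ (λ e → u₃∉ (there (here (sym e)))) ∷ (λ e → L.u≢v (sym e)) ∷ [])
      ∷ (L'.α₁≢α₂ ∷ ≢K {S = KB} L'.α₁∉ u₃∈ ∷ ≢K {S = KB} L'.α₁∉ L.u∈ ∷ []) ∷ (≢K {S = KB} L'.α₂∉ u₃∈ ∷ ≢K {S = KB} L'.α₂∉ L.u∈ ∷ [])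
      ∷ ((λ e → u₃∉ (here e)) ∷ []) ∷ [] ∷ []) refl refl

module _ {a b} (G : Ctx 6 a b) where
  open Ctx G

  -- Thresholds 3 and 3 would meet all sum conditions, but their bound does not exclude a = b. With
  -- 2 and 3 the sum for ends in A is 3 + 4, one short; every path that escapes for this reason
  -- yields legs.
  legsOrBound : (M : MaxBi E) → size (MaxBi.KA M) ≡ 4 → size (MaxBi.KB M) ≡ 4 →
    edges E + 2 * 4 + 3 * 4 ≤ 4 * 4 + 2 * a + 3 * b ⊎ ¬ ¬ Legs E (MaxBi.KA M) (MaxBi.KB M)
  legsOrBound M eA eB with Relative.Proc.run M 2 3 0 (Relative.Proc.room₀ M 2 3 0 refl)
  ... | inj₁ R = inj₁ (subst₂ (λ p q → edges E + 2 * p + 3 * q ≤ p * q + 2 * a + 3 * b) eA eB (stopBound G M R))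
  ... | inj₂ C = inj₂ (λ k → coreLink G M {2} {3} {0} C (≤-trans (n≤1+n 3) (≤-reflexive (sym eB))) (≤-reflexive (sym eA))
          (≤-reflexive (cong (3 +_) (sym eA))) (≤-trans (n≤1+n 7) (≤-reflexive (cong (4 +_) (sym eB))))
          (≤-reflexive (cong (3 +_) (sym eB))) (≤-trans (n≤1+n 7) (≤-reflexive (cong (4 +_) (sym eA))))
          (λ o → k (legsFrom₆ M short (≤-reflexive (sym eA)) (≤-reflexive (sym eB)) (s≤s (s≤s (s≤s z≤n))) o (sideIsA {α = 3} {β = 4} (≤-reflexive (cong (4 +_) (sym eA))) _ _ (OneShort.same o) (OneShort.tight o)))))

-- If one of the two deletions reaches K, its bound lies below the assumed number of edges.
-- Otherwise both sides of K have legs.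
sixContra : ∀ {a b} (G : Ctx 6 a b) (M : MaxBi (Ctx.E G)) → size (MaxBi.KA M) ≡ 4 → size (MaxBi.KB M) ≡ 4 →
  a ≤ b → 6 ≤ a → 4 * b + 2 * a ≤ edges (Ctx.E G) + 8 → ⊥
sixContra {a} {b} G M eA eB a≤b a≥ big with legsOrBound G M eA eB | legsOrBound (flipCtx G) (flipMax M) eB eA
... | inj₁ h | _ = lin⊥ 1 (+-mono-≤ (+-mono-≤ big h) (≤-trans a≥ a≤b)) (arith (edges E) a b)
  where
  open Ctx G
  arith : ∀ e a b → suc (((e + 8) + (4 * 4 + 2 * a + 3 * b)) + b) + 1 ≡ ((4 * b + 2 * a) + (e + 2 * 4 + 3 * 4)) + 6
  arith = solve-∀
... | inj₂ _ | inj₁ h = lin⊥ 1 (+-mono-≤ (+-mono-≤ (+-mono-≤ big (subst (λ e → e + 2 * 4 + 3 * 4 ≤ 4 * 4 + 2 * b + 3 * a) (eS-flip (flipE E) full full) h)) a≤b) (≤-trans a≥ a≤b)) (arith (edges E) a b)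
  where
  open Ctx G
  arith : ∀ e a b → suc ((((e + 8) + (4 * 4 + 2 * b + 3 * a)) + b) + b) + 1 ≡ (((4 * b + 2 * a) + (e + 2 * 4 + 3 * 4)) + a) + 6
  arith = solve-∀
... | inj₂ nL | inj₂ nL' = nL (λ L → nL' (λ L' → twoLegs₆ (MaxBi.comp M) L L' (Ctx.short G) (≤-trans (n≤1+n 3) (≤-reflexive (sym eA))) (≤-trans (n≤1+n 3) (≤-reflexive (sym eB)))))

-- The case ℓ = 5

module _ {a b} {E : BipGraph a b} where

  nb-flip : ∀ x P → nb (flipE E) (sw x) (map sw P) ≡ nb E x P
  nb-flip x []      = refl
  nb-flip x (w ∷ P) = cong₂ _+_ (same x w) (nb-flip x P)
    where
    same : ∀ x w → bit (adj? (flipE E) (sw x) (sw w)) ≡ bit (adj? E x w)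
    same (inj₁ _) (inj₁ _) = refl
    same (inj₁ _) (inj₂ _) = refl
    same (inj₂ _) (inj₁ _) = refl
    same (inj₂ _) (inj₂ _) = refl

  cross-flip : ∀ {x P y} → Cross {E = E} x P y → Cross {E = flipE E} (sw x) (map sw P) (sw y)
  cross-flip {x} {P} {y} (cross X M Y j eq yi xj) = cross (map sw X) (map sw M) (map sw Y) (sw j)
    (trans (cong (map sw) eq) (trans (map-++ sw X (M ++ j ∷ Y)) (cong (map sw X ++_) (map-++ sw M (j ∷ Y)))))
    (subst (Adj (flipE E) (sw y)) (sym (endOf-map x X)) (sw-adj y (endOf x X) yi)) (sw-adj x j xj)
    where
    endOf-map : ∀ u X → endOf (sw u) (map sw X) ≡ sw (endOf u X)
    endOf-map u []      = refl
    endOf-map u (w ∷ X) = endOf-map w X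

  module _ (M : MaxBi E) (short : EvenShort E 5) (hA : 3 ≤ size (MaxBi.KA M)) (hB : 3 ≤ size (MaxBi.KB M)) where
    open MaxBi M
    open Relative M

    ShortSides : Vertex a b → Set
    ShortSides x = (Legs E KA KB × Σ (Fin a) λ i → x ≡ inj₁ i × ¬ T (KA i)) ⊎ (Legs (flipE E) KB KA × Σ (Fin b) λ j → x ≡ inj₂ j × ¬ T (KB j))

    shortSides : {R : Region E (by-side 3 3)} (o : OneShort R KRegion 5) → ShortSides (Stuck.x (OneShort.S o))
    shortSides {R} o = go (OneShort.S o) (OneShort.same o) (OneShort.small o) (OneShort.crs o)
      where
      go : (S : Stuck R KRegion 5) → side (Stuck.y S) ≡ side (Stuck.x S) → length (Stuck.P S) + 5 ≤ 15 → Cross {E = E} (Stuck.x S) (Stuck.P S) (Stuck.y S) →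
        ShortSides (Stuck.x S)
      go S@record { x = inj₁ x ; y = inj₁ w ; P = P ; tr = tr ; un = un ; long = long ; iny = w∈ ; ony = ony } _ small crs
        with legsRaw₅ M short hA hB tr un long small crs w∈ on (stuck-x S)
        where
        on : ∀ j → T (KB j) → inj₂ j ∈ P
        on j h with All.lookup ony (∈-map⁺ inj₂ (∈-elems (λ j → KB j ∧ E w j) (T-∧ᶜ (KB j) h (comp w j w∈ h))))
        ... | there m = m
      ... | L , x∉ = inj₁ (L , x , refl , x∉)
      go S@record { x = inj₂ x ; y = inj₂ w ; P = P ; tr = tr ; un = un ; long = long ; iny = w∈ ; ony = ony } _ small crs
        with legsRaw₅ (flipMax M) (flip-short {l = 5} short) hB hA (sw-Tr tr) (Uniq.map⁺ sw-injective un)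
               (subst (λ k → 10 ≤ suc k) (sym (length-map sw P)) long) (subst (λ k → k + 5 ≤ 15) (sym (length-map sw P)) small) (cross-flip crs) w∈ on
               (≤-trans (stuck-x S) (≤-reflexive (sym (nb-flip (inj₂ x) P))))
        where
        on : ∀ i → T (KA i) → inj₂ i ∈ map sw P
        on i h with All.lookup ony (∈-map⁺ inj₁ (∈-elems (λ i → KA i ∧ E i w) (T-∧ᶜ (KA i) h (comp i w h w∈))))
        ... | there m = ∈-map⁺ sw m
      ... | L , x∉ = inj₂ (L , x , refl , x∉)

deg-miss : ∀ {a b} (E : BipGraph a b) SB i {j} → T (SB j) → ¬ T (E i j) → degA E SB i < size SB
deg-miss E SB i {j} h n = ≤-trans (s≤s (size-mono {S = λ k → SB k ∧ E i k} {SB ∖ j} (λ k m → ∖-other SB (λ { refl → n (T-∧₂ (SB k) m) }) (T-∧₁ (SB k) m))))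
  (≤-reflexive (sym (size-∖ SB j h)))

module _ {a b} (G : Ctx 5 a b) (M : MaxBi (Ctx.E G)) where
  open Ctx G
  open MaxBi M
  open Relative M

  private
    p q : ℕ
    p = size KA
    q = size KB

  module _ (p≡3 : p ≡ 3) (q≥3 : 3 ≤ q) where

    private
      p≥3 : 3 ≤ p
      p≥3 = ≤-reflexive (sym p≡3)

      -- Different cores are viewed with uniform thresholds 3 and 3: vertices of K guarantee no
      -- more. All sums are then at least 6 = ℓ + 1, and paths with sum exactly 6 are handled by
      -- legs.
      module Weak {s t r} (hs : 2 ≤ s) (ht : 2 ≤ t) (C : Proc.Core s t r) where
        open Proc s t r
        open Core C
        weak : Region E (by-side 3 3)
        weak = setRegion E SA SB rA rB
          where
          rA : ∀ i → T (SA i) → 3 ≤ degA E SB i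
          rA i h with T? (KA i)
          ... | no n  = ≤-trans (s≤s hs) (richA i h n)
          ... | yes k = ≤-trans q≥3 (≤-trans (deg-complete E KB i (λ j → comp i j k)) (deg-mono E i (proj₂ (proj₁ inv))))
          rB : ∀ j → T (SB j) → 3 ≤ degA (flipE E) SA j
          rB j h with T? (KB j)
          ... | no n  = ≤-trans (s≤s ht) (richB j h n)
          ... | yes k = ≤-trans p≥3 (≤-trans (deg-complete (flipE E) KA j (λ i m → comp i j m k)) (deg-mono (flipE E) j (proj₁ (proj₁ inv))))

        weakShort : ¬ ¬ OneShort weak KRegion 5
        weakShort k with outer C
        ... | inj₁ (i , i∈ , i∉) with maxA i i∉
        ...   | j , j∈ , nadj = sat i j nadj (λ lp → k (noLink₁ G weak KRegion cond₁ cond₂ lp i∈ j∈))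
          where
          cond₁ = sideCase {α = 3} {3} (+-monoʳ-≤ 3 p≥3) (+-monoʳ-≤ 3 q≥3)
          cond₂ = sideSame {α = 3} {3} (+-monoʳ-≤ 3 q≥3) (+-monoʳ-≤ 3 p≥3)
        weakShort k | inj₂ (j , j∈ , j∉) with maxB j j∉
        ...   | i , i∈ , nadj = sat i j nadj (λ lp → k (noLink₁ G weak KRegion cond₁ cond₂ (longPath-rev {l = 5} lp) j∈ i∈))
          where
          cond₁ = sideCase {α = 3} {3} (+-monoʳ-≤ 3 p≥3) (+-monoʳ-≤ 3 q≥3)
          cond₂ = sideSame {α = 3} {3} (+-monoʳ-≤ 3 q≥3) (+-monoʳ-≤ 3 p≥3)

        -- An outer B-vertex of a (2,3)-core has four neighbours on the path, one too many.
        notB : 3 ≤ t → (o : OneShort weak KRegion 5) → ∀ j → Stuck.x (OneShort.S o) ≡ inj₂ j → ¬ T (KB j) → ⊥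
        notB t≥3 o j e j∉ = go (OneShort.S o) (OneShort.same o) (OneShort.ccount o) e
          where
          go : (S : Stuck weak KRegion 5) → side (Stuck.y S) ≡ side (Stuck.x S) →
            nb E (Stuck.x S) (Stuck.x S ∷ Stuck.P S) + nb E (Stuck.y S) (Stuck.x S ∷ Stuck.P S) ≡ 6 → Stuck.x S ≡ inj₂ j → ⊥
          go S@record { x = inj₂ _ ; y = inj₂ w ; inx = inx ; iny = iny ; onx = onx ; ony = ony } _ cc refl =
            1+n≰n (≤-trans (+-mono-≤ 4≤ 3≤) (≤-reflexive cc))
            where
            F = inj₂ j ∷ Stuck.P S
            N  = Region.nbrs weak (inj₂ j) inx
            N' = Region.nbrs KRegion (inj₂ w) iny
            4≤ : 4 ≤ nb E (inj₂ j) F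
            4≤ = ≤-trans (≤-trans (s≤s t≥3) (richB j inx j∉)) (≤-trans (≤-reflexive (sym (trans (length-map inj₁ (elems (λ i → SA i ∧ E i j))) (length-elems (λ i → SA i ∧ E i j)))))
                   (nb-≥ (inj₂ j) (proj₁ (proj₂ N)) (All.map proj₁ (proj₂ (proj₂ (proj₂ N)))) onx))
            3≤ : 3 ≤ nb E (inj₂ w) F
            3≤ = ≤-trans p≥3 (≤-trans (proj₁ (proj₂ (proj₂ N'))) (nb-≥ (inj₂ w) (proj₁ (proj₂ N')) (All.map proj₁ (proj₂ (proj₂ (proj₂ N')))) ony))

    private
      -- With a leg that starts and ends in `KA`, an outer vertex of A has at most one neighbour in
      -- `KB`, and by maximality an outer vertex of B has at most two in `KA`. The deletion stops
      -- with one vertex outside K, whose degree is thus one below its threshold; this saves the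
      -- edge that contradicts `big`.
      module Strict (L' : Legs (flipE E) KB KA) where
        module L = Legs L'

        outerA : ∀ i → ¬ T (KA i) → degA E KB i ≤ 1
        outerA i i∉ with degA E KB i ≤? 1
        ... | yes h = h
        ... | no h  = ⊥-elim (two (elems S) (elems-unique S) (elems-∈ S) (≤-trans (≰⇒> h) (≤-reflexive (sym (length-elems S)))))
          where
          S = λ j → KB j ∧ E i j
          two : ∀ xs → Unique xs → (∀ {j} → j ∈ xs → T (S j)) → 2 ≤ length xs → ⊥
          two (_ ∷ []) _ _ (s≤s ())
          two (u₁ ∷ u₂ ∷ _) ((u₁≢u₂ ∷ _) ∷ _) sub _ with escape KA (L.u ∷ L.v ∷ []) p≥3 | escape KB (u₁ ∷ u₂ ∷ []) q≥3
          ... | w₃ , w₃∈ , w₃∉ | u₃ , u₃∈ , u₃∉ = ring short {xs = i ∷ L.u ∷ L.β ∷ L.v ∷ w₃ ∷ []} {u₂ ∷ L.α₁ ∷ L.α₂ ∷ u₃ ∷ u₁ ∷ []}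
            (e₁ ∷ e₂ ∷ comp _ _ L.u∈ k₂ ∷ L.uα₁ ∷ L.α₁β ∷ L.α₂β ∷ L.α₂v ∷ comp _ _ L.v∈ u₃∈ ∷ comp _ _ w₃∈ u₃∈ ∷ comp _ _ w₃∈ k₁ ∷ [])
            ((≢A L.u∈ ∷ (λ { refl → L.far _ k₁ e₁ }) ∷ ≢A L.v∈ ∷ ≢A w₃∈ ∷ []) ∷ ((λ { refl → L.β∉ L.u∈ }) ∷ L.u≢v ∷ (λ e → w₃∉ (here (sym e))) ∷ [])
              ∷ ((λ { refl → L.β∉ L.v∈ }) ∷ (λ { refl → L.β∉ w₃∈ }) ∷ []) ∷ ((λ e → w₃∉ (there (here (sym e)))) ∷ []) ∷ [] ∷ [])
            (((λ { refl → L.α₁∉ k₂ }) ∷ (λ { refl → L.α₂∉ k₂ }) ∷ (λ e → u₃∉ (there (here (sym e)))) ∷ (λ e → u₁≢u₂ (sym e)) ∷ [])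
              ∷ (L.α₁≢α₂ ∷ (λ { refl → L.α₁∉ u₃∈ }) ∷ (λ { refl → L.α₁∉ k₁ }) ∷ []) ∷ ((λ { refl → L.α₂∉ u₃∈ }) ∷ (λ { refl → L.α₂∉ k₁ }) ∷ [])
              ∷ ((λ e → u₃∉ (here e)) ∷ []) ∷ [] ∷ []) refl refl
            where
            k₁ = T-∧₁ (KB u₁) (sub (here refl))
            e₁ = T-∧₂ (KB u₁) (sub (here refl))
            k₂ = T-∧₁ (KB u₂) (sub (there (here refl)))
            e₂ = T-∧₂ (KB u₂) (sub (there (here refl)))
            ≢A : ∀ {k} → T (KA k) → i ≢ k
            ≢A h refl = i∉ h

        outerB : ∀ j → ¬ T (KB j) → degA (flipE E) KA j ≤ 2
        outerB j j∉ with maxB j j∉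
        ... | i , i∈ , n = s≤s⁻¹ (≤-trans (deg-miss (flipE E) KA j i∈ n) (≤-reflexive p≡3))

        open Proc 2 3 1

        strict : Rem full full → 3 * b + 2 * a ≤ edges E + 6 → ⊥
        strict R big with size KA <? size (Stopped.SA' (stopped R))
        ... | yes p< = caseA (size-escape SA' KA p<)
          where
          open Stopped (stopped R)
          geB : q ≤ size SB'
          geB = size-mono {S = KB} {SB'} (proj₂ (proj₁ inv))
          szB : size SB' ≡ q
          szB = ≤-antisym (+-cancelˡ-≤ (suc p) (size SB') q (≤-trans (+-monoˡ-≤ (size SB') p<) stp)) geB
          szA : size SA' ≡ suc p
          szA = ≤-antisym (+-cancelʳ-≤ q (size SA') (suc p) (≤-trans (+-monoʳ-≤ (size SA') geB) stp)) p<
          caseA : (Σ (Fin a) λ i → T (SA' i) × ¬ T (KA i)) → ⊥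
          caseA (i , i∈ , i∉) = lin⊥ 0 (+-mono-≤ (+-mono-≤ big bound) eS') (trans (cong₂ (λ x y → suc (edges E + 6 + (eS E SA' SB' + 2 * x + 3 * y) + (1 + 3 * q)) + 0) (size-full a) (size-full b))
              (trans (arith (edges E) a b (eS E SA' SB') q) (cong₂ (λ x y → 3 * b + 2 * a + (edges E + 2 * x + 3 * y) + eS E SA' SB') (sym (trans szA (cong suc p≡3))) (sym szB))))
            where
            eS' : eS E SA' SB' ≤ 1 + 3 * q
            eS' = ≤-trans (≤-reflexive (eS-∖ E SA' SB' i i∈)) (+-mono-≤
              (≤-trans (deg-mono E i (size-⊆ {S = KB} {SB'} (proj₂ (proj₁ inv)) (sym szB))) (outerA i i∉))
              (≤-trans (eS≤ E (SA' ∖ i) SB' q (λ k _ → ≤-trans (deg≤size E SB' k) (≤-reflexive szB)))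
                (≤-reflexive (trans (*-comm q _) (cong (_* q) (trans (suc-injective (trans (sym (size-∖ SA' i i∈)) szA)) p≡3))))))
            arith : ∀ e a b x q → suc (e + 6 + (x + 2 * a + 3 * b) + (1 + 3 * q)) + 0 ≡ 3 * b + 2 * a + (e + 2 * 4 + 3 * q) + x
            arith = solve-∀
        ... | no p≮ = caseB (size-escape SB' KB q<)
          where
          open Stopped (stopped R)
          szA : size SA' ≡ p
          szA = ≤-antisym (≮⇒≥ p≮) (size-mono {S = KA} {SA'} (proj₁ (proj₁ inv)))
          szB : size SB' ≡ suc q
          szB = +-cancelˡ-≡ p (size SB') (suc q) (trans (cong (_+ size SB') (sym szA)) (trans (≤-antisym stp (proj₂ inv)) (sym (+-suc p q))))
          q< : q < size SB'
          q< = ≤-reflexive (sym szB)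
          caseB : (Σ (Fin b) λ j → T (SB' j) × ¬ T (KB j)) → ⊥
          caseB (j , j∈ , j∉) = lin⊥ 0 (+-mono-≤ (+-mono-≤ big bound) eS') (trans (cong₂ (λ x y → suc (edges E + 6 + (eS E SA' SB' + 2 * x + 3 * y) + (2 + 3 * q)) + 0) (size-full a) (size-full b))
              (trans (arith (edges E) a b (eS E SA' SB') q) (cong₂ (λ x y → 3 * b + 2 * a + (edges E + 2 * x + 3 * y) + eS E SA' SB') (sym (trans szA p≡3)) (sym szB))))
            where
            eS' : eS E SA' SB' ≤ 2 + 3 * q
            eS' = ≤-trans (≤-reflexive (eS-∖ᵇ E SA' SB' j j∈)) (+-mono-≤
              (≤-trans (deg-mono (flipE E) j (size-⊆ {S = KA} {SA'} (proj₁ (proj₁ inv)) (sym szA))) (outerB j j∉))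
              (≤-trans (eS≤ E SA' (SB' ∖ j) q (λ k _ → ≤-trans (deg≤size E (SB' ∖ j) k) (≤-reflexive (suc-injective (trans (sym (size-∖ SB' j j∈)) szB)))))
                (≤-reflexive (trans (*-comm q _) (cong (_* q) (trans szA p≡3))))))
            arith : ∀ e a b x q → suc (e + 6 + (x + 2 * a + 3 * b) + (2 + 3 * q)) + 0 ≡ 3 * b + 2 * a + (e + 2 * 3 + 3 * suc q) + x
            arith = solve-∀

    -- If the deletion stops, `strict` applies. A core would contain a stuck path, whose end in A
    -- gives a second leg on the other side of K and whose end in B has too many neighbours.
    noBLegs : 5 ≤ a → 3 * b + 2 * a ≤ edges E + 6 → Legs (flipE E) KB KA → ⊥
    noBLegs a≥ big L' with Proc.run 2 3 1 (+-mono-≤ (≤-trans (≤-reflexive (cong suc p≡3)) (≤-trans (n≤1+n 4) a≥)) (size-≤ KB))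
    ... | inj₁ R = Strict.strict L' R big
    ... | inj₂ C = W.weakShort (λ o → decide o (shortSides M short p≥3 q≥3 o))
      where
      module W = Weak {r = 1} ≤-refl (n≤1+n 2) C
      decide : (o : OneShort W.weak KRegion 5) → ShortSides M short p≥3 q≥3 (Stuck.x (OneShort.S o)) → ⊥
      decide o (inj₁ (L , _))            = twoLegs₅ comp L L' short
      decide o (inj₂ (_ , j , e , j∉)) = W.notB ≤-refl o j e j∉

    legsOrBound₅ : 5 ≤ a → 3 * b + 2 * a ≤ edges E + 6 → edges E + 2 * p + 2 * q ≤ p * q + 2 * a + 2 * b ⊎ (q ≡ 3 × ¬ ¬ Legs E KA KB)
    legsOrBound₅ a≥ big with Proc.run 2 2 0 (Proc.room₀ 2 2 0 refl)
    ... | inj₁ R = inj₁ (stopBound G M R)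
    ... | inj₂ C = inj₂ (decidable-stable (q ≟ 3) (λ n → W.weakShort (λ o → n (sizeB o (shortSides M short p≥3 q≥3 o)))) ,
                         λ k → W.weakShort (λ o → k (aLegs (shortSides M short p≥3 q≥3 o))))
      where
      module W = Weak {r = 0} ≤-refl ≤-refl C
      aLegs : ∀ {x} → ShortSides M short p≥3 q≥3 x → Legs E KA KB
      aLegs (inj₁ (L , _))  = L
      aLegs (inj₂ (L' , _)) = ⊥-elim (noBLegs a≥ big L')
      sizeB : (o : OneShort W.weak KRegion 5) → ShortSides M short p≥3 q≥3 (Stuck.x (OneShort.S o)) → q ≡ 3
      sizeB o (inj₂ (L' , _)) = ⊥-elim (noBLegs a≥ big L')
      sizeB o (inj₁ (_ , i , e , _)) = ≤-antisym (+-cancelˡ-≤ 3 q 3 (subst₂ (λ s s' → by-side 3 3 s + by-side q p s' ≤ 6) (cong side e) (trans (OneShort.same o) (cong side e)) (OneShort.tight o))) q≥3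

-- A vertex has at most two neighbours in a set of three unless it is joined to all of it, so every
-- edge beyond two per vertex marks another full vertex.
fullOnes : ∀ {a b} (E : BipGraph a b) SA SB {c} → size SB ≡ 3 → 2 * size SA + c ≤ eS E SA SB → c ≤ size (λ i → SA i ∧ toAll E SB i)
fullOnes {a} E SA SB {c} sz h = +-cancelˡ-≤ (2 * size SA) c _ (≤-trans h (≤-trans (sum-mono each) (≤-reflexive (trans (sum-+ (λ i → 2 * 𝟙 (SA i)) (λ i → 𝟙 (SA i ∧ toAll E SB i)))
    (cong (_+ size (λ i → SA i ∧ toAll E SB i)) (sum-*ˡ a 2 (λ i → 𝟙 (SA i))))))))
  where
  deg : ∀ i → degA E SB i ≤ 2 + 𝟙 (toAll E SB i)
  deg i with T? (toAll E SB i)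
  ... | yes t = ≤-trans (deg≤size E SB i) (≤-trans (≤-reflexive sz) (≤-reflexive (cong (2 +_) (sym (one (toAll E SB i) t)))))
    where
    one : ∀ c → T c → 𝟙 c ≡ 1
    one true _ = refl
  ... | no n with toAll-miss E SB n
  ...   | j , j∈ , nadj = ≤-trans (s≤s⁻¹ (≤-trans (deg-miss E SB i j∈ nadj) (≤-reflexive sz))) (m≤m+n 2 _)
  each : ∀ i → (if SA i then degA E SB i else 0) ≤ 2 * 𝟙 (SA i) + 𝟙 (SA i ∧ toAll E SB i)
  each i with SA i
  ... | true  = deg i
  ... | false = z≤n

record Seed {a b} (E : BipGraph a b) (p q : ℕ) : Set where
  field
    SA   : Fin a → Bool
    SB   : Fin b → Bool
    comp : ∀ i j → T (SA i) → T (SB j) → T (E i j)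
    |SA| : p ≤ size SA
    |SB| : q ≤ size SB

seedA : ∀ {a b} (E : BipGraph a b) SA SB {c} → size SB ≡ 3 → 2 * size SA + c ≤ eS E SA SB → Seed E c 3
seedA E SA SB sz h = record { SA = λ i → SA i ∧ toAll E SB i ; SB = SB ; comp = λ i j p q → toAll-adj E SB (T-∧₂ (SA i) p) j q
  ; |SA| = fullOnes E SA SB sz h ; |SB| = ≤-reflexive (sym sz) }

seedB : ∀ {a b} (E : BipGraph a b) SA SB {c} → size SA ≡ 3 → 2 * size SB + c ≤ eS E SA SB → Seed E 3 c
seedB E SA SB {c} sz h with seedA (flipE E) SB SA {c} sz (≤-trans h (≤-reflexive (eS-flip E SA SB)))
... | record { SA = SB' ; SB = SA' ; comp = comp ; |SA| = hB ; |SB| = hA } =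
  record { SA = SA' ; SB = SB' ; comp = λ i j p q → comp j i q p ; |SA| = hA ; |SB| = hB }

module _ {a b} (E : BipGraph a b) (s t : ℕ) (R : Absolute.Rem E s t 3 3 full full) where
  open Absolute E s t 3 3
  open Stopped (stopped R)

  private
    sums : edges E + s * size SA' + t * size SB' ≤ eS E SA' SB' + s * a + t * b
    sums = subst₂ (λ x y → edges E + s * size SA' + t * size SB' ≤ eS E SA' SB' + s * x + t * y) (size-full a) (size-full b) bound

  leftover : ∀ {f} → s * a + t * b ≤ edges E + f → (size SA' ≡ 3 ⊎ size SB' ≡ 3) × 3 ≤ size SA' × 3 ≤ size SB' × s * size SA' + t * size SB' ≤ eS E SA' SB' + f
  leftover {f} big = stp , proj₁ inv , proj₂ inv , lin _ _ 0 (+-mono-≤ sums big) (arith (edges E) (s * size SA') (t * size SB') (eS E SA' SB') (s * a) (t * b) f)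
    where
    arith : ∀ e x y k p q f → x + y + (k + p + q + (e + f)) + 0 ≡ k + f + (e + x + y + (p + q))
    arith = solve-∀

module Five {a b} (G : Ctx 5 a b) (a≥ : 5 ≤ a) (a≤b : a ≤ b) (big : 3 * b + 2 * a ≤ edges (Ctx.E G) + 6) where
  open Ctx G

  private
    big' : 3 * a + 2 * b ≤ edges E + 6
    big' = ≤-trans (lin (3 * a + 2 * b) (3 * b + 2 * a) 0 a≤b (arith a b)) big
      where arith : ∀ a b → 3 * a + 2 * b + b + 0 ≡ 3 * b + 2 * a + a
            arith = solve-∀
    3≤a : 3 ≤ a
    3≤a = ≤-trans (s≤s (s≤s (s≤s z≤n))) a≥
    b≥ : 5 ≤ b
    b≥ = ≤-trans a≥ a≤b

    small : (M : MaxBi E) → 4 ≤ size (MaxBi.KA M) → 4 ≤ size (MaxBi.KB M) → ⊥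
    small M hA hB = noBiclique rob short (s≤s (s≤s z≤n)) (biclique-take 4 (MaxBi.KA M) (MaxBi.KB M) (MaxBi.comp M) hA hB) a≥ b≥

    -- A deletion that stops with three vertices in a class leaves enough edges for three full
    -- vertices. Two cores would produce K(4,4), which is excluded because 4 = ℓ - 1.
    seed : Seed E 3 3
    seed with Absolute.run E 2 3 3 3 3≤a (≤-trans 3≤a a≤b) | Absolute.run E 3 2 3 3 3≤a (≤-trans 3≤a a≤b)
    ... | inj₁ R | _ = go (leftover E 2 3 R (≤-trans (≤-reflexive (+-comm (2 * a) (3 * b))) big))
      where
      open Absolute E 2 3 3 3
      open Stopped (stopped R)
      go : (size SA' ≡ 3 ⊎ size SB' ≡ 3) × 3 ≤ size SA' × 3 ≤ size SB' × 2 * size SA' + 3 * size SB' ≤ eS E SA' SB' + 6 → Seed E 3 3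
      go (inj₂ e , _ , _ , h) = seedA E SA' SB' e (lin _ _ 0 (subst (λ k → 2 * size SA' + 3 * k ≤ eS E SA' SB' + 6) e h) (ar (size SA') (eS E SA' SB')))
        where ar : ∀ x k → 2 * x + 3 + (k + 6) + 0 ≡ k + (2 * x + 3 * 3)
              ar = solve-∀
      go (inj₁ e , _ , hB , h) = seedB E SA' SB' e (lin _ _ 0 (+-mono-≤ (subst (λ k → 2 * k + 3 * size SB' ≤ eS E SA' SB' + 6) e h) hB) (ar (size SB') (eS E SA' SB')))
        where ar : ∀ x k → 2 * x + 3 + (k + 6 + x) + 0 ≡ k + (2 * 3 + 3 * x + 3)
              ar = solve-∀
    ... | inj₂ _ | inj₁ R = go (leftover E 3 2 R big')
      where
      open Absolute E 3 2 3 3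
      open Stopped (stopped R)
      go : (size SA' ≡ 3 ⊎ size SB' ≡ 3) × 3 ≤ size SA' × 3 ≤ size SB' × 3 * size SA' + 2 * size SB' ≤ eS E SA' SB' + 6 → Seed E 3 3
      go (inj₂ e , hA , _ , h) = seedA E SA' SB' e (lin _ _ 0 (+-mono-≤ (subst (λ k → 3 * size SA' + 2 * k ≤ eS E SA' SB' + 6) e h) hA) (ar (size SA') (eS E SA' SB')))
        where ar : ∀ x k → 2 * x + 3 + (k + 6 + x) + 0 ≡ k + (3 * x + 2 * 3 + 3)
              ar = solve-∀
      go (inj₁ e , _ , _ , h) = seedB E SA' SB' e (lin _ _ 0 (subst (λ k → 3 * k + 2 * size SB' ≤ eS E SA' SB' + 6) e h) (ar (size SB') (eS E SA' SB')))
        where ar : ∀ x k → 2 * x + 3 + (k + 6) + 0 ≡ k + (3 * 3 + 2 * x)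
              ar = solve-∀
    ... | inj₂ C | inj₂ C' = ⊥-elim (contra (maxClosure E (H₁.Core.SA C) (H₂.Core.SB C') (joined G (H₁.absRegion C) (H₂.absRegion C') ≤-refl (≤-trans (n≤1+n 6) (n≤1+n 7)) ≤-refl ≤-refl)))
      where
      module H₁ = Absolute E 2 3 3 3
      module H₂ = Absolute E 3 2 3 3
      contra : (Σ (MaxBi E) λ M → (∀ i → T (H₁.Core.SA C i) → T (MaxBi.KA M i)) × (∀ j → T (H₂.Core.SB C' j) → T (MaxBi.KB M j))) → ⊥
      contra (M , sA , sB) = small M (≤-trans (H₁.sizeA C) (size-mono {S = H₁.Core.SA C} {MaxBi.KA M} sA)) (≤-trans (H₂.sizeB C') (size-mono {S = H₂.Core.SB C'} {MaxBi.KB M} sB))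

  outcome₅ : Outcome E 3
  outcome₅ = start (maxClosure E (Seed.SA seed) (Seed.SB seed) (Seed.comp seed))
    where
    start : (Σ (MaxBi E) λ M → (∀ i → T (Seed.SA seed i) → T (MaxBi.KA M i)) × (∀ j → T (Seed.SB seed j) → T (MaxBi.KB M j))) → Outcome E 3
    start (M , sA , sB) = split (size KA ≟ 3)
      where
      open MaxBi M
      p = size KA
      q = size KB
      p≥ : 3 ≤ p
      p≥ = ≤-trans (Seed.|SA| seed) (size-mono {S = Seed.SA seed} {KA} sA)
      q≥ : 3 ≤ q
      q≥ = ≤-trans (Seed.|SB| seed) (size-mono {S = Seed.SB seed} {KB} sB)
      eF : edges (flipE E) ≡ edges E
      eF = eS-flip (flipE E) full full
      split : Dec (p ≡ 3) → Outcome E 3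
      split (yes p≡3) with legsOrBound₅ G M p≡3 q≥ a≥ big
      ... | inj₁ h = inj₁ (KA , p≡3 , λ i k j → comp i j k (full-set {S = KB} b≤q j))
        where
        b≤q : b ≤ q
        b≤q = lin b q 0 (+-mono-≤ big (subst (λ p → edges E + 2 * p + 2 * q ≤ p * q + 2 * a + 2 * b) p≡3 h)) (ar (edges E) a b q)
          where ar : ∀ e a b q → b + (e + 6 + (3 * q + 2 * a + 2 * b)) + 0 ≡ q + (3 * b + 2 * a + (e + 2 * 3 + 2 * q))
                ar = solve-∀
      -- After exchanging the classes these are the legs that `noBLegs` forbids, and q = 3 supplies
      -- its size hypothesis.
      ... | inj₂ (q≡3 , nL) = ⊥-elim (nL (noBLegs (flipCtx G) (flipMax M) q≡3 p≥ b≥ (≤-trans big' (≤-reflexive (cong (_+ 6) (sym eF))))))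
      split (no p≢3) with legsOrBound₅ (flipCtx G) (flipMax M) q≡3 p≥ b≥ (≤-trans big' (≤-reflexive (cong (_+ 6) (sym eF))))
        where
        q≡3 : q ≡ 3
        q≡3 = ≤-antisym (s≤s⁻¹ (≰⇒> (λ q4 → small M (≤∧≢⇒< p≥ (λ e → p≢3 (sym e))) q4))) q≥
      ... | inj₂ (p≡3 , _) = ⊥-elim (p≢3 p≡3)
      ... | inj₁ h = inj₂ (≤-antisym a≤b b≤a , KB , q≡3 , λ j k i → comp i j (full-set {S = KA} a≤p i) k)
        where
        q≡3 : q ≡ 3
        q≡3 = ≤-antisym (s≤s⁻¹ (≰⇒> (λ q4 → small M (≤∧≢⇒< p≥ (λ e → p≢3 (sym e))) q4))) q≥
        h' : edges E + 2 * 3 + 2 * p ≤ 3 * p + 2 * b + 2 * a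
        h' = subst₂ (λ e q → e + 2 * q + 2 * p ≤ q * p + 2 * b + 2 * a) eF q≡3 h
        a≤p : a ≤ p
        a≤p = lin a p 0 (+-mono-≤ big' h') (ar (edges E) a b p)
          where ar : ∀ e a b p → a + (e + 6 + (3 * p + 2 * b + 2 * a)) + 0 ≡ p + (3 * a + 2 * b + (e + 2 * 3 + 2 * p))
                ar = solve-∀
        b≤a : b ≤ a
        b≤a = lin b a 0 (+-mono-≤ (+-mono-≤ big h') (size-≤ KA)) (ar (edges E) a b p)
          where ar : ∀ e a b p → b + (e + 6 + (3 * p + 2 * b + 2 * a) + a) + 0 ≡ a + (3 * b + 2 * a + (e + 2 * 3 + 2 * p) + p)
                ar = solve-∀

-- The case ℓ = 4

pairSet : ∀ {n} → Fin n → Fin n → Fin n → Bool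
pairSet k k' i = isYes ((i Fin.≟ k) ⊎-dec (i Fin.≟ k'))

module _ {n} {k k' : Fin n} where
  pair-in : ∀ {i} → i ≡ k ⊎ i ≡ k' → T (pairSet k k' i)
  pair-in {i} = fromWitness {a? = (i Fin.≟ k) ⊎-dec (i Fin.≟ k')}

  pair-out : ∀ {i} → T (pairSet k k' i) → i ≡ k ⊎ i ≡ k'
  pair-out {i} = toWitness {a? = (i Fin.≟ k) ⊎-dec (i Fin.≟ k')}

  pair-size : k ≢ k' → size (pairSet k k') ≡ 2
  pair-size ne = ≤-antisym
    (≤-trans (≤-reflexive (sym (length-elems (pairSet k k')))) (⊆-length {ms = k ∷ k' ∷ []} (elems-unique (pairSet k k'))
      (λ m → [ here , (λ e → there (here e)) ]′ (pair-out (elems-∈ (pairSet k k') m)))))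
    (list-size (pairSet k k') {k ∷ k' ∷ []} ((ne ∷ []) ∷ [] ∷ []) (pair-in (inj₁ refl) ∷ pair-in (inj₂ refl) ∷ []))

twoOf : ∀ {n} (S : Fin n → Bool) → 2 ≤ size S → Σ (Fin n) λ i → Σ (Fin n) λ k → i ≢ k × T (S i) × T (S k)
twoOf S h with size-pos S (≤-trans (n≤1+n 1) h)
... | i , i∈ with other₁ S i∈ h
...   | k , k∈ , ne = i , k , ne , i∈ , k∈

-- Here K consists of two vertices and their common neighbours. The deletion with thresholds 2 and 2
-- always arrives at K, so a graph that reaches the bound is built from K by adding vertices of
-- degree exactly 2; 8-cycles then restrict where they attach.
module Four {a b} (G : Ctx 4 a b) (a≥ : 4 ≤ a) {k₁ k₂ : Fin a} (k₁≢k₂ : k₁ ≢ k₂)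
  (M : MaxBi (Ctx.E G)) (KA≡ : MaxBi.KA M ≡ pairSet k₁ k₂) (q≥3 : 3 ≤ size (MaxBi.KB M)) where
  open Ctx G
  open MaxBi M
  open Relative M

  private
    p q : ℕ
    p = size KA
    q = size KB
    p≡2 : p ≡ 2
    p≡2 = trans (cong size KA≡) (pair-size k₁≢k₂)
    inKA : ∀ {i} → i ≡ k₁ ⊎ i ≡ k₂ → T (KA i)
    inKA {i} e = subst (λ S → T (S i)) (sym KA≡) (pair-in e)
    KAis : ∀ {i} → T (KA i) → i ≡ k₁ ⊎ i ≡ k₂
    KAis {i} h = pair-out (subst (λ S → T (S i)) KA≡ h)
    k₁∈ = inKA (inj₁ refl)
    k₂∈ = inKA (inj₂ refl)

  open Proc 2 2 0

  private
    module Weak (C : Core) where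
      open Core C
      weak : Region E (by-side 3 2)
      weak = setRegion E SA SB rA rB
        where
        rA : ∀ i → T (SA i) → 3 ≤ degA E SB i
        rA i h with T? (KA i)
        ... | no n  = richA i h n
        ... | yes k = ≤-trans q≥3 (≤-trans (deg-complete E KB i (λ j → comp i j k)) (deg-mono E i (proj₂ (proj₁ inv))))
        rB : ∀ j → T (SB j) → 2 ≤ degA (flipE E) SA j
        rB j h with T? (KB j)
        ... | no n  = ≤-trans (n≤1+n 2) (richB j h n)
        ... | yes k = ≤-trans (≤-reflexive (sym p≡2)) (≤-trans (deg-complete (flipE E) KA j (λ i m → comp i j m k)) (deg-mono (flipE E) j (proj₁ (proj₁ inv))))

      evenLong : ∀ {n} → parity n ≡ false → 8 ≤ suc n → 8 ≤ n
      evenLong {n} pn h with 8 ≤? n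
      ... | yes g = g
      ... | no g with ≤-antisym (s≤s⁻¹ (≰⇒> g)) (s≤s⁻¹ h)
      evenLong {n} () h | no g | refl

      evenP : ∀ {u v : Vertex a b} {P} → Tr E u P v → side v ≡ side u → parity (length P) ≡ false
      evenP {u} {v} {P} t e with parity (length P) | side-Tr t
      ... | false | _ = refl
      ... | true  | h with side u | trans (sym e) h
      ...   | true  | ()
      ...   | false | ()

      -- The three cycles of a crossing have 2|P| + 4 vertices in total, at least 20, while each may
      -- have at most 6.
      threeCycles : ∀ {x y : Vertex a b} {P} → Tr E x P y → Unique (x ∷ P) → 8 ≤ length P → Cross {E = E} x P y → ⊥
      threeCycles t un lg c = lin⊥ 1 (+-mono-≤ (+-mono-≤ lg lg) (+-mono-≤ (len (crossCycle t un c)) (+-mono-≤ (len (rightCycle t un c)) (len (leftCycle t un c)))))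
          (trans (cong (λ k → suc (k + k + (8 + (8 + 8))) + 1) lenP) (arith (length X) (length M₀) (length Y)))
        where
        open Cross c renaming (M to M₀)
        len : ∀ {n} → (Σ (Vertex a b) λ u → Σ (List (Vertex a b)) λ cs → Tr E u cs u × Unique cs × length cs ≡ n) → 2 + n ≤ 8
        len (_ , _ , tc , uc , refl) = short tc uc
        lenP = trans (cong length eq) (trans (length-++ X) (cong (length X +_) (length-++ M₀)))
        arith : ∀ X M Y → suc ((X + (M + suc Y)) + (X + (M + suc Y)) + (8 + (8 + 8))) + 1 ≡ 8 + 8 + ((2 + (2 + X + Y)) + ((2 + (2 + M + Y)) + (2 + (2 + X + M))))
        arith = solve-∀

      -- Both ends in KB: they share the neighbours k₁, k₂, which gives a crossing.
      bothInK : ∀ {j w P} → Tr E (inj₂ j) P (inj₂ w) → Unique (inj₂ j ∷ P) → 8 ≤ length P → T (KB j) → T (KB w) → inj₁ k₁ ∈ P → inj₁ k₂ ∈ P → ⊥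
      bothInK {j} {w} {P} t un lg j∈ w∈ m₁ m₂ with ∈-∃++ m₁
      ... | l , r , refl with ∈-++⁻ l m₂
      ...   | inj₂ (here e) = k₁≢k₂ (inj₁-inj (sym e))
        where
        inj₁-inj : ∀ {i k : Fin a} → inj₁ {B = Fin b} i ≡ inj₁ k → i ≡ k
        inj₁-inj refl = refl
      ...   | inj₂ (there m) with ∈-∃++ m
      ...     | m' , Y , refl = threeCycles t un lg (cross (l ++ [ inj₁ k₁ ]) m' Y (inj₁ k₂) (sym (++-assoc l [ inj₁ k₁ ] (m' ++ inj₁ k₂ ∷ Y)))
                  (subst (Adj E (inj₂ w)) (sym (endOf-++ (inj₂ j) l (inj₁ k₁) [])) (comp k₁ w k₁∈ w∈)) (comp k₂ j k₂∈ j∈))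
      bothInK {j} {w} {P} t un lg j∈ w∈ m₁ m₂ | l , r , refl | inj₁ m with ∈-∃++ m
      ...     | l' , m' , refl = threeCycles t un lg (cross (l' ++ [ inj₁ k₂ ]) m' r (inj₁ k₁)
                  (trans (++-assoc l' (inj₁ k₂ ∷ m') (inj₁ k₁ ∷ r)) (sym (++-assoc l' [ inj₁ k₂ ] (m' ++ inj₁ k₁ ∷ r))))
                  (subst (Adj E (inj₂ w)) (sym (endOf-++ (inj₂ j) l' (inj₁ k₂) [])) (comp k₂ w k₂∈ w∈)) (comp k₁ j k₁∈ j∈))

      stuckContra : Stuck weak KRegion 4 → ⊥
      stuckContra S@record { x = inj₁ i ; y = inj₂ w ; tr = tr ; un = un ; long = long } =
        1+n≰n (≤-trans (≤-reflexive (cong (3 +_) (sym p≡2))) (≤-trans (stuck-count weak KRegion 4 S) (ends-diff (inj₁ i) (inj₂ w) tr un 4 short long rob l≥1 (λ ()))))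
      stuckContra S@record { x = inj₂ j ; y = inj₁ w ; tr = tr ; un = un ; long = long } =
        1+n≰n (≤-trans (+-monoʳ-≤ 2 q≥3) (≤-trans (stuck-count weak KRegion 4 S) (ends-diff (inj₂ j) (inj₁ w) tr un 4 short long rob l≥1 (λ ()))))
      stuckContra S@record { x = inj₁ i ; y = inj₁ w ; tr = tr ; un = un ; long = long } =
        1+n≰n (≤-trans (≤-trans (+-monoʳ-≤ 3 q≥3) (stuck-count weak KRegion 4 S)) ([ (λ h → ≤-trans h (n≤1+n 4)) , proj₁ ]′ (ends-same (inj₁ i) (inj₁ w) tr un 4 short long rob l≥1 refl)))
      stuckContra S@record { x = inj₂ j ; y = inj₂ w ; P = P ; tr = tr ; un = un ; long = long ; inx = inx ; iny = iny ; onx = onx ; ony = ony } = decide (T? (KB j))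
        where
        lg = evenLong {length P} (evenP tr refl) long
        onP : ∀ {i} → T (KA i) → inj₁ i ∈ P
        onP {i} h = Any.tail (λ ()) (All.lookup ony (∈-map⁺ inj₁ (∈-elems (λ i → KA i ∧ E i w) (T-∧ᶜ (KA i) h (comp i w h iny)))))
        five≤ : ¬ T (KB j) → 5 ≤ nb E (inj₂ j) (inj₂ j ∷ P) + nb E (inj₂ w) (inj₂ j ∷ P)
        five≤ j∉ = +-mono-≤
          (≤-trans (richB j inx j∉) (≤-trans (≤-reflexive (sym (trans (length-map inj₁ (elems (λ i → SA i ∧ E i j))) (length-elems (λ i → SA i ∧ E i j)))))
            (nb-≥ (inj₂ j) (proj₁ (proj₂ N)) (All.map proj₁ (proj₂ (proj₂ (proj₂ N)))) onx)))
          (≤-trans (≤-reflexive (sym p≡2)) (≤-trans (proj₁ (proj₂ (proj₂ N'))) (nb-≥ (inj₂ w) (proj₁ (proj₂ N')) (All.map proj₁ (proj₂ (proj₂ (proj₂ N')))) ony)))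
          where
          N  = Region.nbrs weak (inj₂ j) inx
          N' = Region.nbrs KRegion (inj₂ w) iny
        decide : Dec (T (KB j)) → ⊥
        decide (yes j∈) = bothInK tr un lg j∈ iny (onP k₁∈) (onP k₂∈)
        decide (no j∉)  = [ (λ h → 1+n≰n (≤-trans (five≤ j∉) h)) , (λ (_ , _ , k) → threeCycles tr un lg k) ]′
          (ends-same (inj₂ j) (inj₂ w) tr un 4 short long rob l≥1 refl)

      weakContra : ⊥
      weakContra with outer C
      ... | inj₁ (i , i∈ , i∉) with maxA i i∉
      ...   | j , j∈ , nadj = sat i j nadj (λ lp → stuckContra (makeStuck weak KRegion 4 lp i∈ j∈))
      weakContra | inj₂ (j , j∈ , j∉) with maxB j j∉
      ...   | i , i∈ , nadj = sat i j nadj (λ lp → stuckContra (makeStuck weak KRegion 4 (longPath-rev {l = 4} lp) j∈ i∈))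

    removal : Rem full full
    removal with run (room₀ refl)
    ... | inj₁ R = R
    ... | inj₂ C = ⊥-elim (Weak.weakContra C)

    Exact : (Fin a → Bool) → (Fin b → Bool) → Set
    Exact SA SB = 2 * size SA + 2 * size SB ≤ eS E SA SB + 4

    -- The remainder has at most 2q edges, which is 2·2 + 2q - 4, so the bound starts with equality
    -- there.
    upper : ∀ {SA SB} → Rem SA SB → eS E SA SB + 4 ≤ 2 * size SA + 2 * size SB
    upper {SA} {SB} R = lin _ _ 0 (+-mono-≤ bound eK) (arith₀ szA szB)
      where
      open Stopped (stopped R)
      geA : p ≤ size SA'
      geA = size-mono {S = KA} {SA'} (proj₁ (proj₁ inv))
      geB : q ≤ size SB'
      geB = size-mono {S = KB} {SB'} (proj₂ (proj₁ inv))
      szA : size SA' ≡ 2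
      szA = trans (≤-antisym (+-cancelʳ-≤ q (size SA') p (≤-trans (+-monoʳ-≤ (size SA') geB) stp)) geA) p≡2
      szB : size SB' ≡ q
      szB = ≤-antisym (+-cancelˡ-≤ p (size SB') q (≤-trans (+-monoˡ-≤ (size SB') geA) stp)) geB
      eK : eS E SA' SB' ≤ size SB' * size SA'
      eK = eS≤ E SA' SB' (size SB') (λ i _ → deg≤size E SB' i)
      arith₀ : ∀ {x y} → x ≡ 2 → y ≡ q → eS E SA SB + 4 + (eS E SA' SB' + 2 * size SA + 2 * size SB + (y * x)) + 0
        ≡ 2 * size SA + 2 * size SB + (eS E SA SB + 2 * x + 2 * y + eS E SA' SB')
      arith₀ refl refl = ar (eS E SA SB) (eS E SA' SB') (size SA) (size SB) q
        where ar : ∀ e k x y q → e + 4 + (k + 2 * x + 2 * y + (q * 2)) + 0 ≡ 2 * x + 2 * y + (e + 2 * 2 + 2 * q + k)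
              ar = solve-∀

    -- `upper` for the smaller graph leaves no slack: equality before the deletion forces degree 2
    -- and equality afterwards.
    stepA : ∀ {SA SB} i → T (SA i) → degA E SB i ≤ 2 → Rem (SA ∖ i) SB → Exact SA SB → 2 ≤ degA E SB i × Exact (SA ∖ i) SB
    stepA {SA} {SB} i i∈ d R ex = lin _ _ 0 (+-mono-≤ ex' (upper R)) (ar₁ x y e dg) , lin _ _ 0 (+-mono-≤ ex' d) (ar₂ x y e dg)
      where
      x = size (SA ∖ i)
      y = size SB
      e = eS E (SA ∖ i) SB
      dg = degA E SB i
      ex' : 2 * suc x + 2 * y ≤ dg + e + 4
      ex' = subst₂ (λ s k → 2 * s + 2 * y ≤ k + 4) (size-∖ SA i i∈) (eS-∖ E SA SB i i∈) ex
      ar₁ : ∀ x y e d → 2 + (d + e + 4 + (2 * x + 2 * y)) + 0 ≡ d + (2 * suc x + 2 * y + (e + 4))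
      ar₁ = solve-∀
      ar₂ : ∀ x y e d → 2 * x + 2 * y + (d + e + 4 + 2) + 0 ≡ e + 4 + (2 * suc x + 2 * y + d)
      ar₂ = solve-∀

    stepB : ∀ {SA SB} j → T (SB j) → degA (flipE E) SA j ≤ 2 → Rem SA (SB ∖ j) → Exact SA SB → 2 ≤ degA (flipE E) SA j × Exact SA (SB ∖ j)
    stepB {SA} {SB} j j∈ d R ex = lin _ _ 0 (+-mono-≤ ex' (upper R)) (ar₁ x y e dg) , lin _ _ 0 (+-mono-≤ ex' d) (ar₂ x y e dg)
      where
      x = size SA
      y = size (SB ∖ j)
      e = eS E SA (SB ∖ j)
      dg = degA (flipE E) SA j
      ex' : 2 * x + 2 * suc y ≤ dg + e + 4
      ex' = subst₂ (λ s k → 2 * x + 2 * s ≤ k + 4) (size-∖ SB j j∈) (eS-∖ᵇ E SA SB j j∈) ex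
      ar₁ : ∀ x y e d → 2 + (d + e + 4 + (2 * x + 2 * y)) + 0 ≡ d + (2 * x + 2 * suc y + (e + 4))
      ar₁ = solve-∀
      ar₂ : ∀ x y e d → 2 * x + 2 * y + (d + e + 4 + 2) + 0 ≡ e + 4 + (2 * x + 2 * suc y + d)
      ar₂ = solve-∀

    stopA : ∀ {SA SB} → AtStop SA SB → Room SA SB → size SA ≤ p
    stopA {SA} {SB} st ((_ , B⊆) , _) = +-cancelʳ-≤ q (size SA) p (≤-trans (+-monoʳ-≤ (size SA) (size-mono {S = KB} {SB} B⊆)) st)

    stopB : ∀ {SA SB} → AtStop SA SB → Room SA SB → size SB ≤ q
    stopB {SA} {SB} st ((A⊆ , _) , _) = +-cancelˡ-≤ p (size SB) q (≤-trans (+-monoˡ-≤ (size SB) (size-mono {S = KA} {SA} A⊆)) st)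

    tight : ∀ {n} {S K : Fin n → Bool} → (∀ i → T (K i) → T (S i)) → size S ≤ size K → ∀ i → T (S i) → T (K i)
    tight {S = S} {K} sub le = size-⊆ {S = K} {S} sub (≤-antisym (size-mono {S = K} {S} sub) le)

    -- A vertex has degree 2 when it is deleted, and at every earlier stage the sets, and with them
    -- its degree, are larger.
    minDeg : ∀ {SA SB} → Rem SA SB → Exact SA SB →
      (∀ i → T (SA i) → ¬ T (KA i) → 2 ≤ degA E SB i) × (∀ j → T (SB j) → ¬ T (KB j) → 2 ≤ degA (flipE E) SA j)
    minDeg {SA} {SB} (stop st inv) ex =
      (λ i h n → ⊥-elim (n (tight {S = SA} {KA} (proj₁ (proj₁ inv)) (stopA st inv) i h))) ,
      (λ j h n → ⊥-elim (n (tight {S = SB} {KB} (proj₂ (proj₁ inv)) (stopB st inv) j h)))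
    minDeg {SA} {SB} (remA _ _ k k∈ _ d R) ex with stepA k k∈ d R ex
    ... | d≥ , ex' with minDeg R ex'
    ...   | hA , hB = (λ i h n → at i h n (i Fin.≟ k)) , λ j h n → ≤-trans (hB j h n) (deg-mono (flipE E) j (λ i → ∖-sub SA))
      where
      at : ∀ i → T (SA i) → ¬ T (KA i) → Dec (i ≡ k) → 2 ≤ degA E SB i
      at i h n (yes refl) = d≥
      at i h n (no ne)    = hA i (∖-other SA ne h) n
    minDeg {SA} {SB} (remB _ _ k k∈ _ d R) ex with stepB k k∈ d R ex
    ... | d≥ , ex' with minDeg R ex'
    ...   | hA , hB = (λ i h n → ≤-trans (hA i h n) (deg-mono E i (λ j → ∖-sub SB))) , λ j h n → at j h n (j Fin.≟ k)
      where
      at : ∀ j → T (SB j) → ¬ T (KB j) → Dec (j ≡ k) → 2 ≤ degA (flipE E) SA j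
      at j h n (yes refl) = d≥
      at j h n (no ne)    = hB j (∖-other SB ne h) n

    above : ∀ {SA SB} → Rem SA SB → Above SA SB
    above (stop _ inv)         = proj₁ inv
    above (remA _ inv _ _ _ _ _) = proj₁ inv
    above (remB _ inv _ _ _ _ _) = proj₁ inv

    -- The first vertex of A joined to the biclique is joined before any vertex of B,
    -- since the latter would have both its neighbours in KA.
    firstDeg : ∀ {SA SB} → Rem SA SB → Exact SA SB → size SA ≡ 3 → ∀ i → T (SA i) → ¬ T (KA i) → 2 ≤ degA E KB i
    firstDeg (stop st inv) ex sz i i∈ i∉ = ⊥-elim (1+n≰n (≤-trans (≤-reflexive (sym sz)) (≤-trans (stopA st inv) (≤-reflexive p≡2))))
    firstDeg {SA} {SB} R₀@(remA _ _ k k∈ _ d R) ex sz i i∈ i∉ = ≤-trans (proj₁ (minDeg R₀ ex) i i∈ i∉) (deg-mono E i inKB)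
      where
      onlyKA : ∀ m → T ((SA ∖ k) m) → T (KA m)
      onlyKA = tight {S = SA ∖ k} {KA} (proj₁ (above R)) (≤-trans (s≤s⁻¹ (≤-reflexive (trans (sym (size-∖ SA k k∈)) sz))) (≤-reflexive (sym p≡2)))
      inKB : ∀ j → T (SB j) → T (KB j)
      inKB j j∈ = decidable-stable (T? (KB j)) λ j∉ → let m , m∈ , nadj = maxB j j∉ in
        1+n≰n (≤-trans (s≤s (≤-trans (proj₂ (minDeg R (proj₂ (stepA k k∈ d R ex))) j j∈ j∉) (deg-mono (flipE E) j onlyKA)))
          (≤-trans (deg-miss (flipE E) KA j m∈ nadj) (≤-reflexive p≡2)))
    firstDeg (remB _ _ k k∈ _ d R) ex sz i i∈ i∉ = firstDeg R (proj₂ (stepB k k∈ d R ex)) sz i i∈ i∉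

    partner : ∀ {k} → T (KA k) → Σ (Fin a) λ k' → T (KA k') × k ≢ k' × (∀ i → T (KA i) → i ≡ k ⊎ i ≡ k')
    partner k∈ with KAis k∈
    ... | inj₁ refl = k₂ , k₂∈ , k₁≢k₂ , λ _ → KAis
    ... | inj₂ refl = k₁ , k₁∈ , k₁≢k₂ ∘ sym , λ _ h → [ inj₂ , inj₁ ]′ (KAis h)

    eight : ∀ {x₁ x₂ x₃ x₄ y₁ y₂ y₃ y₄} → Unique (x₁ ∷ x₂ ∷ x₃ ∷ x₄ ∷ []) → Unique (y₁ ∷ y₂ ∷ y₃ ∷ y₄ ∷ []) →
      T (E x₁ y₄) → T (E x₁ y₁) → T (E x₂ y₁) → T (E x₂ y₂) → T (E x₃ y₂) → T (E x₃ y₃) → T (E x₄ y₃) → T (E x₄ y₄) → ⊥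
    eight {x₁} {x₂} {x₃} {x₄} {y₁} {y₂} {y₃} {y₄} ux uy e₁ e₂ e₃ e₄ e₅ e₆ e₇ e₈ =
      ring short {xs = x₁ ∷ x₂ ∷ x₃ ∷ x₄ ∷ []} {y₁ ∷ y₂ ∷ y₃ ∷ y₄ ∷ []} (e₁ ∷ e₂ ∷ e₃ ∷ e₄ ∷ e₅ ∷ e₆ ∷ e₇ ∷ e₈ ∷ []) ux uy refl refl

    distinct : ∀ {A : Set} {w x y z : A} → w ≢ x → w ≢ y → w ≢ z → x ≢ y → x ≢ z → y ≢ z → Unique (w ∷ x ∷ y ∷ z ∷ [])
    distinct p q r s t u = (p ∷ q ∷ r ∷ []) ∷ (s ∷ t ∷ []) ∷ (u ∷ []) ∷ [] ∷ []

    apart : ∀ {n} (S : Fin n → Bool) {x y} → T (S x) → ¬ T (S y) → x ≢ y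
    apart S h n refl = n h

    third : ∀ {n} (S : Fin n → Bool) → 3 ≤ size S → ∀ x y → Σ (Fin n) λ w → T (S w) × x ≢ w × y ≢ w
    third S h x y with escape S (x ∷ y ∷ []) h
    ... | w , w∈ , n = w , w∈ , (λ e → n (here (sym e))) , λ e → n (there (here (sym e)))

    two : ∀ SB i → 2 ≤ degA E SB i → Σ (Fin b) λ u → Σ (Fin b) λ v → u ≢ v × T (SB u) × T (SB v) × T (E i u) × T (E i v)
    two SB i h with twoOf (λ j → SB j ∧ E i j) h
    ... | u , v , ne , hu , hv = u , v , ne , T-∧₁ (SB u) hu , T-∧₁ (SB v) hv , T-∧₂ (SB u) hu , T-∧₂ (SB v) hv

    twoB : ∀ SA j → 2 ≤ degA (flipE E) SA j → Σ (Fin a) λ u → Σ (Fin a) λ v → u ≢ v × T (SA u) × T (SA v) × T (E u j) × T (E v j)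
    twoB SA j h with twoOf (λ i → SA i ∧ E i j) h
    ... | u , v , ne , hu , hv = u , v , ne , T-∧₁ (SA u) hu , T-∧₁ (SA v) hv , T-∧₂ (SA u) hu , T-∧₂ (SA v) hv

    -- One outer vertex z of B and at least two outer vertices of A, all of them attached to KB twice.
    module LastB {SA : Fin a → Bool} {z} (A≥ : 4 ≤ size SA) (deg : ∀ i → T (SA i) → ¬ T (KA i) → 2 ≤ degA E KB i)
      (z∉ : ¬ T (KB z)) (zdeg : 2 ≤ degA (flipE E) SA z) where

      shared : ∀ {k k' x x' u v} → T (KA k) → T (KA k') → ¬ T (KA x) → ¬ T (KA x') → k ≢ k' → x ≢ x' → T (KB u) → T (KB v) → u ≢ v →
        T (E x z) → T (E k z) → T (E x u) → T (E x' u) → T (E x' v) → ⊥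
      shared {k} {k'} {x} {x'} {u} {v} k∈ k'∈ x∉ x'∉ k≢ x≢ u∈ v∈ u≢ xz kz xu x'u x'v with third KB q≥3 u v
      ... | w , w∈ , u≢w , v≢w = eight {x} {x'} {k'} {k} {u} {v} {w} {z}
        (distinct x≢ (apart KA k'∈ x∉ ∘ sym) (apart KA k∈ x∉ ∘ sym) (apart KA k'∈ x'∉ ∘ sym) (apart KA k∈ x'∉ ∘ sym) (k≢ ∘ sym))
        (distinct u≢ u≢w (apart KB u∈ z∉) v≢w (apart KB v∈ z∉) (apart KB w∈ z∉))
        xz xu x'u x'v (comp k' v k'∈ v∈) (comp k' w k'∈ w∈) (comp k w k∈ w∈) kz

      mixed : ∀ {x k} → T (SA x) → ¬ T (KA x) → T (KA k) → T (E x z) → T (E k z) → ⊥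
      mixed {x} {k} x∈ x∉ k∈ xz kz with partner k∈
      ... | k' , k'∈ , k≢k' , only with escape SA (x ∷ k ∷ k' ∷ []) A≥
      ...   | x' , x'∈ , new = go (two KB x (deg x x∈ x∉)) (two KB x' (deg x' x'∈ x'∉))
        where
        x'∉ : ¬ T (KA x')
        x'∉ h = [ (λ e → new (there (here e))) , (λ e → new (there (there (here e)))) ]′ (only x' h)
        x≢x' : x ≢ x'
        x≢x' e = new (here (sym e))
        go : (Σ (Fin b) λ u → Σ (Fin b) λ v → u ≢ v × T (KB u) × T (KB v) × T (E x u) × T (E x v)) →
             (Σ (Fin b) λ c → Σ (Fin b) λ d → c ≢ d × T (KB c) × T (KB d) × T (E x' c) × T (E x' d)) → ⊥
        go (u , _ , _ , u∈ , _ , xu , _) (c , d , c≢d , c∈ , d∈ , x'c , x'd) with u Fin.≟ c | u Fin.≟ d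
        ... | yes refl | _        = shared k∈ k'∈ x∉ x'∉ k≢k' x≢x' u∈ d∈ c≢d xz kz xu x'c x'd
        ... | no _     | yes refl = shared k∈ k'∈ x∉ x'∉ k≢k' x≢x' u∈ c∈ (c≢d ∘ sym) xz kz xu x'd x'c
        ... | no u≢c   | no u≢d   = eight {x} {k'} {x'} {k} {u} {c} {d} {z}
          (distinct (apart KA k'∈ x∉ ∘ sym) x≢x' (apart KA k∈ x∉ ∘ sym) (apart KA k'∈ x'∉) (k≢k' ∘ sym) (apart KA k∈ x'∉ ∘ sym))
          (distinct u≢c u≢d (apart KB u∈ z∉) c≢d (apart KB c∈ z∉) (apart KB d∈ z∉))
          xz xu (comp k' u k'∈ u∈) (comp k' c k'∈ c∈) x'c x'd (comp k d k∈ d∈) kz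

      both : ∀ {x x'} → T (SA x) → ¬ T (KA x) → T (SA x') → ¬ T (KA x') → x ≢ x' → T (E x z) → T (E x' z) → ⊥
      both {x} {x'} x∈ x∉ x'∈ x'∉ x≢x' xz x'z with two KB x (deg x x∈ x∉) | two KB x' (deg x' x'∈ x'∉)
      ... | u₁ , u₂ , u≢ , u₁∈ , u₂∈ , xu₁ , xu₂ | c , _ , _ , c∈ , _ , x'c , _ = [ (λ (ne , h , e) → go ne h e) , (λ (ne , h , e) → go ne h e) ]′ choice
        where
        choice : (u₁ ≢ c × T (KB u₁) × T (E x u₁)) ⊎ (u₂ ≢ c × T (KB u₂) × T (E x u₂))
        choice with u₁ Fin.≟ c
        ... | no n  = inj₁ (n , u₁∈ , xu₁)
        ... | yes e = inj₂ ((λ e' → u≢ (trans e (sym e'))) , u₂∈ , xu₂)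
        go : ∀ {u} → u ≢ c → T (KB u) → T (E x u) → ⊥
        go {u} u≢c u∈ xu with third KB q≥3 u c
        ... | v , v∈ , u≢v , c≢v = eight {x} {k₁} {k₂} {x'} {u} {v} {c} {z}
          (distinct (apart KA k₁∈ x∉ ∘ sym) (apart KA k₂∈ x∉ ∘ sym) x≢x' k₁≢k₂ (apart KA k₁∈ x'∉) (apart KA k₂∈ x'∉))
          (distinct u≢v u≢c (apart KB u∈ z∉) (c≢v ∘ sym) (apart KB v∈ z∉) (apart KB c∈ z∉))
          xz xu (comp k₁ u k₁∈ u∈) (comp k₁ v k₁∈ v∈) (comp k₂ v k₂∈ v∈) (comp k₂ c k₂∈ c∈) x'c x'z

      contraB : ⊥
      contraB with twoB SA z zdeg
      ... | n₁ , n₂ , ne , n₁∈ , n₂∈ , e₁ , e₂ with T? (KA n₁) | T? (KA n₂)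
      ...   | no h₁  | no h₂  = both n₁∈ h₁ n₂∈ h₂ ne e₁ e₂
      ...   | no h₁  | yes h₂ = mixed n₁∈ h₁ h₂ e₁ e₂
      ...   | yes h₁ | no h₂  = mixed n₂∈ h₂ h₁ e₂ e₁
      ...   | yes h₁ | yes h₂ = let m , m∈ , nadj = maxB z z∉ in
        1+n≰n (≤-trans (s≤s (list-size (λ i → KA i ∧ E i z) {n₁ ∷ n₂ ∷ []} ((ne ∷ []) ∷ [] ∷ []) (T-∧ᶜ (KA n₁) h₁ e₁ ∷ T-∧ᶜ (KA n₂) h₂ e₂ ∷ [])))
          (≤-trans (deg-miss (flipE E) KA z m∈ nadj) (≤-reflexive p≡2)))

    -- A second outer vertex i of A, added after the outer vertices x of A and z of B.
    module LastA {SA : Fin a → Bool} {SB : Fin b → Bool} {i x z} (A⊆ : ∀ m → T (SA m) → T (KA m) ⊎ m ≡ x) (i∉ : ¬ T (SA i)) (K⊆ : ∀ m → T (KA m) → T (SA m))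
      (x∈ : T (SA x)) (x∉ : ¬ T (KA x)) (xdeg : 2 ≤ degA E KB x) (z∈ : T (SB z)) (z∉ : ¬ T (KB z))
      (bdeg : ∀ j → T (SB j) → ¬ T (KB j) → 2 ≤ degA (flipE E) SA j) where

      outerB : ∀ j → T (SB j) → ¬ T (KB j) → T (E x j) × Σ (Fin a) λ k → T (KA k) × T (E k j)
      outerB j j∈ j∉ with twoB SA j (bdeg j j∈ j∉)
      ... | n₁ , n₂ , ne , n₁∈ , n₂∈ , e₁ , e₂ with A⊆ n₁ n₁∈ | A⊆ n₂ n₂∈
      ...   | inj₁ h₁   | inj₂ refl = e₂ , n₁ , h₁ , e₁
      ...   | inj₂ refl | inj₁ h₂   = e₁ , n₂ , h₂ , e₂
      ...   | inj₂ refl | inj₂ refl = ⊥-elim (ne refl)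
      ...   | inj₁ h₁   | inj₁ h₂   = let m , m∈ , nadj = maxB j j∉ in
        ⊥-elim (1+n≰n (≤-trans (s≤s (list-size (λ i → KA i ∧ E i j) {n₁ ∷ n₂ ∷ []} ((ne ∷ []) ∷ [] ∷ []) (T-∧ᶜ (KA n₁) h₁ e₁ ∷ T-∧ᶜ (KA n₂) h₂ e₂ ∷ [])))
          (≤-trans (deg-miss (flipE E) KA j m∈ nadj) (≤-reflexive p≡2))))

      someK : ∀ j → T (SB j) → Σ (Fin a) λ k → T (KA k) × T (E k j)
      someK j j∈ with T? (KB j)
      ... | yes h = k₁ , k₁∈ , comp k₁ j k₁∈ h
      ... | no n  = proj₂ (outerB j j∈ n)

      i≢K : ∀ {k} → T (KA k) → i ≢ k
      i≢K h refl = i∉ (K⊆ i h)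
      i≢x : i ≢ x
      i≢x refl = i∉ x∈
      K≢x : ∀ {k} → T (KA k) → k ≢ x
      K≢x h = apart KA h x∉

      -- c and u are adjacent to all of k₁, k₂, x.
      oneFull : ∀ {c d u} → T (E i c) → T (E i d) → T (KB c) → T (E x c) → T (KB u) → T (E x u) → T (SB d) → c ≢ d → c ≢ u → d ≢ u → ⊥
      oneFull {c} {d} {u} ic id c∈ xc u∈ xu d∈ c≢d c≢u d≢u with T? (KB d)
      oneFull {c} {d} {u} ic id c∈ xc u∈ xu d∈ c≢d c≢u d≢u | yes dK with outerB z z∈ z∉
      ... | xz , k , k∈ , kz with partner k∈
      ...   | k' , k'∈ , k≢k' , _ = eight {i} {k'} {x} {k} {c} {u} {z} {d}
        (distinct (i≢K k'∈) i≢x (i≢K k∈) (K≢x k'∈) (k≢k' ∘ sym) (K≢x k∈ ∘ sym))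
        (distinct c≢u (apart KB c∈ z∉) c≢d (apart KB u∈ z∉) (d≢u ∘ sym) (apart KB dK z∉ ∘ sym))
        id ic (comp k' c k'∈ c∈) (comp k' u k'∈ u∈) xu xz kz (comp k d k∈ dK)
      oneFull {c} {d} {u} ic id c∈ xc u∈ xu d∈ c≢d c≢u d≢u | no dK with someK d d∈ | third KB q≥3 c u
      ... | k , k∈ , kd | w , w∈ , c≢w , u≢w with partner k∈
      ...   | k' , k'∈ , k≢k' , _ = eight {i} {x} {k'} {k} {c} {u} {w} {d}
        (distinct i≢x (i≢K k'∈) (i≢K k∈) (K≢x k'∈ ∘ sym) (K≢x k∈ ∘ sym) (k≢k' ∘ sym))
        (distinct c≢u c≢w c≢d u≢w (d≢u ∘ sym) (apart KB w∈ dK))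
        id ic xc xu (comp k' u k'∈ u∈) (comp k' w k'∈ w∈) (comp k w k∈ w∈) kd

      twoFull : ∀ {c d} → T (E i c) → T (E i d) → T (KB c) → T (KB d) → T (E x d) → c ≢ d → ⊥
      twoFull {c} {d} ic id c∈ d∈ xd c≢d with outerB z z∈ z∉ | third KB q≥3 c d
      ... | xz , k , k∈ , kz | w , w∈ , c≢w , d≢w with partner k∈
      ...   | k' , k'∈ , k≢k' , _ = eight {i} {k'} {k} {x} {c} {w} {z} {d}
        (distinct (i≢K k'∈) (i≢K k∈) i≢x (k≢k' ∘ sym) (K≢x k'∈) (K≢x k∈))
        (distinct c≢w (apart KB c∈ z∉) c≢d (apart KB w∈ z∉) (d≢w ∘ sym) (apart KB d∈ z∉ ∘ sym))
        id ic (comp k' c k'∈ c∈) (comp k' w k'∈ w∈) (comp k w k∈ w∈) kz xz xd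

      noFull : ∀ {c d u v} → T (E i c) → T (E i d) → T (SB c) → T (SB d) → T (KB u) → T (KB v) → T (E x u) → T (E x v) →
        c ≢ d → c ≢ u → c ≢ v → d ≢ u → d ≢ v → u ≢ v → ⊥
      noFull {c} {d} {u} {v} ic id c∈ d∈ u∈ v∈ xu xv c≢d c≢u c≢v d≢u d≢v u≢v = go (someK c c∈) (someK d d∈)
        where
        ys : Unique (c ∷ u ∷ v ∷ d ∷ [])
        ys = distinct c≢u c≢v c≢d u≢v (d≢u ∘ sym) (d≢v ∘ sym)
        viaX : ∀ {k k'} → T (KA k) → T (KA k') → k ≢ k' → T (E k c) → T (E k' d) → ⊥
        viaX {k} {k'} k∈ k'∈ ne kc k'd = eight {i} {k} {x} {k'} {c} {u} {v} {d}
          (distinct (i≢K k∈) i≢x (i≢K k'∈) (K≢x k∈) ne (K≢x k'∈ ∘ sym)) ys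
          id ic kc (comp k u k∈ u∈) xu xv (comp k' v k'∈ v∈) k'd
        go : (Σ (Fin a) λ k → T (KA k) × T (E k c)) → (Σ (Fin a) λ k → T (KA k) × T (E k d)) → ⊥
        go (k , k∈ , kc) (k° , k°∈ , kd) with k Fin.≟ k°
        ... | no ne = viaX k∈ k°∈ ne kc kd
        ... | yes refl with partner k∈ | T? (KB c) | T? (KB d)
        ...   | k' , k'∈ , k≢k' , _ | yes cK | _      = viaX k'∈ k∈ (k≢k' ∘ sym) (comp k' c k'∈ cK) kd
        ...   | k' , k'∈ , k≢k' , _ | no _   | yes dK = viaX k∈ k'∈ k≢k' kc (comp k' d k'∈ dK)
        ...   | k' , k'∈ , k≢k' , _ | no c∉  | no _   = eight {i} {x} {k'} {k} {c} {u} {v} {d}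
          (distinct i≢x (i≢K k'∈) (i≢K k∈) (K≢x k'∈ ∘ sym) (K≢x k∈ ∘ sym) (k≢k' ∘ sym)) ys
          id ic (proj₁ (outerB c c∈ c∉)) xu (comp k' u k'∈ u∈) (comp k' v k'∈ v∈) (comp k v k∈ v∈) kd

      contraA : 2 ≤ degA E SB i → ⊥
      contraA ideg = go (two SB i ideg) (two KB x xdeg)
        where
        go : (Σ (Fin b) λ c → Σ (Fin b) λ d → c ≢ d × T (SB c) × T (SB d) × T (E i c) × T (E i d)) →
             (Σ (Fin b) λ u → Σ (Fin b) λ v → u ≢ v × T (KB u) × T (KB v) × T (E x u) × T (E x v)) → ⊥
        go (c , d , c≢d , c∈ , d∈ , ic , id) (u , v , u≢v , u∈ , v∈ , xu , xv) = cases (c Fin.≟ u) (c Fin.≟ v) (d Fin.≟ u) (d Fin.≟ v)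
          where
          cases : Dec (c ≡ u) → Dec (c ≡ v) → Dec (d ≡ u) → Dec (d ≡ v) → ⊥
          cases (yes refl) _          (yes refl) _          = c≢d refl
          cases (yes refl) _          (no _)     (yes refl) = twoFull ic id u∈ v∈ xv c≢d
          cases (yes refl) _          (no _)     (no d≢v)   = oneFull ic id u∈ xu v∈ xv d∈ c≢d u≢v d≢v
          cases (no _)     (yes refl) (yes refl) _          = twoFull ic id v∈ u∈ xu c≢d
          cases (no _)     (yes refl) (no _)     (yes refl) = c≢d refl
          cases (no _)     (yes refl) (no d≢u)   (no _)     = oneFull ic id v∈ xv u∈ xu d∈ c≢d (u≢v ∘ sym) d≢u
          cases (no _)     (no c≢v)   (yes refl) _          = oneFull id ic u∈ xu v∈ xv c∈ (c≢d ∘ sym) u≢v c≢v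
          cases (no c≢u)   (no _)     (no _)     (yes refl) = oneFull id ic v∈ xv u∈ xu c∈ (c≢d ∘ sym) (u≢v ∘ sym) c≢u
          cases (no c≢u)   (no c≢v)   (no d≢u)   (no d≢v)   = noFull ic id c∈ d∈ u∈ v∈ xu xv c≢d c≢u c≢v d≢u d≢v u≢v

    -- Read backwards, the process adds vertices to K. At the first moment with two outer vertices
    -- in A and one in B, the vertex just added lies in A (`LastA`) or in B (`LastB`), and either
    -- case contains an 8-cycle.
    noBoth : ∀ {SA SB} → Rem SA SB → Exact SA SB → 4 ≤ size SA → q < size SB → ⊥
    noBoth (stop st inv) ex A≥ B> = 1+n≰n (≤-trans B> (stopB st inv))
    noBoth {SA} {SB} (remA _ _ i i∈ i∉ d R) ex A≥ B> with 4 ≤? size (SA ∖ i) | stepA i i∈ d R ex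
    ... | yes A≥' | _ , ex' = noBoth R ex' A≥' B>
    ... | no A<   | d≥ , ex' = final (escape (SA ∖ i) (k₁ ∷ k₂ ∷ []) (≤-reflexive (sym szA))) (size-escape SB KB B>)
      where
      szA : size (SA ∖ i) ≡ 3
      szA = ≤-antisym (s≤s⁻¹ (≰⇒> A<)) (s≤s⁻¹ (≤-trans A≥ (≤-reflexive (size-∖ SA i i∈))))
      final : (Σ (Fin a) λ x → T ((SA ∖ i) x) × x ∉ k₁ ∷ k₂ ∷ []) → (Σ (Fin b) λ z → T (SB z) × ¬ T (KB z)) → ⊥
      final (x , x∈ , new) (z , z∈ , z∉) = LastA.contraA {SA ∖ i} {SB} {i} {x} {z} A⊆ (∖-self SA i) (proj₁ (above R)) x∈ x∉ (firstDeg R ex' szA x x∈ x∉) z∈ z∉ (proj₂ (minDeg R ex')) d≥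
        where
        x∉ : ¬ T (KA x)
        x∉ h = [ (λ e → new (here e)) , (λ e → new (there (here e))) ]′ (KAis h)
        A⊆ : ∀ m → T ((SA ∖ i) m) → T (KA m) ⊎ m ≡ x
        A⊆ m m∈ with T? (KA m) | m Fin.≟ x
        ... | yes h | _     = inj₁ h
        ... | no _  | yes e = inj₂ e
        ... | no h  | no ne = ⊥-elim (1+n≰n (≤-trans (list-size (SA ∖ i) {m ∷ x ∷ k₁ ∷ k₂ ∷ []}
            (distinct ne (apart KA k₁∈ h ∘ sym) (apart KA k₂∈ h ∘ sym) (apart KA k₁∈ x∉ ∘ sym) (apart KA k₂∈ x∉ ∘ sym) k₁≢k₂)
            (m∈ ∷ x∈ ∷ proj₁ (above R) k₁ k₁∈ ∷ proj₁ (above R) k₂ k₂∈ ∷ [])) (≤-reflexive szA)))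
    noBoth {SA} {SB} R₀@(remB _ _ j j∈ j∉ d R) ex A≥ B> with q <? size (SB ∖ j) | stepB j j∈ d R ex
    ... | yes B>' | _ , ex' = noBoth R ex' A≥ B>'
    ... | no B≤   | d≥ , ex' = LastB.contraB {SA} {j} A≥ (λ i h n → ≤-trans (proj₁ (minDeg R ex') i h n) (deg-mono E i (tight {S = SB ∖ j} {KB} (proj₂ (above R)) (≮⇒≥ B≤)))) j∉ d≥

  universal₄ : 2 * b + 2 * a ≤ edges E + 4 → Universal E 2
  universal₄ big = KA , p≡2 , λ i i∈ j → comp i j i∈ (full-set {S = KB} b≤q j)
    where
    exact : Exact full full
    exact = subst₂ (λ x y → 2 * x + 2 * y ≤ edges E + 4) (sym (size-full a)) (sym (size-full b)) (≤-trans (≤-reflexive (+-comm (2 * a) (2 * b))) big)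
    b≤q : b ≤ q
    b≤q = ≮⇒≥ λ h → noBoth removal exact (≤-trans a≥ (≤-reflexive (sym (size-full a)))) (≤-trans h (≤-reflexive (sym (size-full b))))

edges-flip : ∀ {a b} (E : BipGraph a b) → edges (flipE E) ≡ edges E
edges-flip E = eS-flip (flipE E) full full

-- The pair `u₁`, `u₂` is universal from the other side, so for m = 2 the extremal structure is
-- symmetric in the two classes.
specials : ∀ {a b m} {E : BipGraph a b} → Good E m → Universal (flipE E) 2
specials {E = E} g = pairSet u₁ u₂ , pair-size u₁≢u₂ , λ j h i → at i (pair-out h)
  where
  open Good g
  at : ∀ {j} i → j ≡ u₁ ⊎ j ≡ u₂ → T (E i j)
  at i e with T? (A₀ i)
  at i e           | yes h = univ i h _
  at i (inj₁ refl) | no n  = rest₁ i n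
  at i (inj₂ refl) | no n  = rest₂ i n

seed⇒universal₄ : ∀ {a b} (G : Ctx 4 a b) → 4 ≤ a → 4 ≤ b → Seed (Ctx.E G) 2 3 → 2 * b + 2 * a ≤ edges (Ctx.E G) + 4 → Universal (Ctx.E G) 2
seed⇒universal₄ {a} {b} G a≥ b≥ S big with twoOf (Seed.SA S) (Seed.|SA| S)
... | k₁ , k₂ , ne , k₁∈ , k₂∈ = Four.universal₄ G a≥ ne M refl (≤-trans (Seed.|SB| S) (size-mono {S = Seed.SB S} {KB} S⊆)) big
  where
  open Ctx G
  KA = pairSet k₁ k₂
  KB = toAll (flipE E) KA
  inS : ∀ {i} → i ≡ k₁ ⊎ i ≡ k₂ → T (Seed.SA S i)
  inS (inj₁ refl) = k₁∈
  inS (inj₂ refl) = k₂∈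
  S⊆ : ∀ j → T (Seed.SB S j) → T (KB j)
  S⊆ j h = adj-toAll (flipE E) KA (λ i k → Seed.comp S i j (inS (pair-out k)) h)
  K⊆ : ∀ {i} → i ≡ k₁ ⊎ i ≡ k₂ → T (toAll E KB i)
  K⊆ {i} e = adj-toAll E KB (λ j h → toAll-adj (flipE E) KA h i (pair-in e))
  -- A third vertex joined to all of `KB` would complete K(3,3), impossible since 3 = ℓ - 1. Thus
  -- the pair with its common neighbours is already maximal.
  noThird : ∀ i → ¬ T (KA i) → ¬ T (toAll E KB i)
  noThird i i∉ h = noBiclique rob short (s≤s (s≤s z≤n))
    (biclique-take 3 (toAll E KB) KB (λ m j p q → toAll-adj E KB p j q)
      (list-size (toAll E KB) {k₁ ∷ k₂ ∷ i ∷ []} ((ne ∷ (λ { refl → i∉ (pair-in (inj₁ refl)) }) ∷ []) ∷ ((λ { refl → i∉ (pair-in (inj₂ refl)) }) ∷ []) ∷ [] ∷ [])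
        (K⊆ (inj₁ refl) ∷ K⊆ (inj₂ refl) ∷ h ∷ []))
      (≤-trans (Seed.|SB| S) (size-mono {S = Seed.SB S} {KB} S⊆))) a≥ b≥
  M : MaxBi E
  M = record { KA = KA ; KB = KB ; comp = λ i j p q → toAll-adj (flipE E) KA q i p
             ; maxA = λ i n → toAll-miss E KB (noThird i n) ; maxB = λ j n → toAll-miss (flipE E) KA n }

-- The deletion stops with three vertices in one class and two full vertices in the other, a K(2,3).
-- If the two lie in B, the classes are exchanged and `specials` carries the result back.
outcome₄ : ∀ {a b} (G : Ctx 4 a b) → 4 ≤ a → 4 ≤ b → 2 * b + 2 * a ≤ edges (Ctx.E G) + 4 → Universal (Ctx.E G) 2
outcome₄ {a} {b} G a≥ b≥ big = [ (λ S → seed⇒universal₄ G a≥ b≥ S big) , (λ S → unflip (seed⇒universal₄ (flipCtx G) b≥ a≥ S flipBig)) ]′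
    (seeds (run (≤-trans (n≤1+n 3) a≥) (≤-trans (n≤1+n 3) b≥)))
  where
  open Ctx G
  open Absolute E 2 2 3 3
  big' : 2 * a + 2 * b ≤ edges E + 4
  big' = ≤-trans (≤-reflexive (+-comm (2 * a) (2 * b))) big
  flipBig : 2 * a + 2 * b ≤ edges (flipE E) + 4
  flipBig = ≤-trans big' (≤-reflexive (cong (_+ 4) (sym (edges-flip E))))
  unflip : Universal (flipE E) 2 → Universal E 2
  unflip (B₀ , card , univ) = specials (universal⇒Good (flip-robust rob) (flip-short {l = 4} short) ≤-refl b≥ a≥ B₀ card univ)
  Left : (Fin a → Bool) → (Fin b → Bool) → Set
  Left SA SB = (size SA ≡ 3 ⊎ size SB ≡ 3) × 3 ≤ size SA × 3 ≤ size SB × 2 * size SA + 2 * size SB ≤ eS E SA SB + 4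
  fromRem : (R : Rem full full) → Left (Stopped.SA' (stopped R)) (Stopped.SB' (stopped R)) → Seed E 2 3 ⊎ Seed (flipE E) 2 3
  fromRem R (inj₂ e , _ , _ , h) = inj₁ (seedA E SA' SB' e (lin _ _ 0 (subst (λ k → 2 * size SA' + 2 * k ≤ eS E SA' SB' + 4) e h) (ar (size SA') (eS E SA' SB'))))
    where
    open Stopped (stopped R)
    ar : ∀ x k → 2 * x + 2 + (k + 4) + 0 ≡ k + (2 * x + 2 * 3)
    ar = solve-∀
  fromRem R (inj₁ e , _ , _ , h) = inj₂ (seedA (flipE E) SB' SA' e (≤-trans (lin _ _ 0 (subst (λ k → 2 * k + 2 * size SB' ≤ eS E SA' SB' + 4) e h) (ar (size SB') (eS E SA' SB'))) (≤-reflexive (eS-flip E SA' SB'))))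
    where
    open Stopped (stopped R)
    ar : ∀ x k → 2 * x + 2 + (k + 4) + 0 ≡ k + (2 * 3 + 2 * x)
    ar = solve-∀
  seeds : Rem full full ⊎ Core → Seed E 2 3 ⊎ Seed (flipE E) 2 3
  seeds (inj₁ R) = fromRem R (leftover E 2 2 R big')
  seeds (inj₂ C) = ⊥-elim (noBiclique rob short (s≤s (s≤s z≤n))
    (biclique-take 3 (Core.SA C) (Core.SB C) (joined G (absRegion C) (absRegion C) (n≤1+n 5) (n≤1+n 5) ≤-refl ≤-refl) (sizeA C) (sizeB C)) a≥ b≥)

outcome : ∀ {a b} m (G : Ctx (2 + m) a b) → 2 ≤ m → 2 + m ≤ a → a ≤ b → m * b + 2 * a ≤ edges (Ctx.E G) + 2 * m → Outcome (Ctx.E G) m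
outcome 0 G () _ _ _
outcome 1 G (s≤s ()) _ _ _
outcome 2 G _ a≥ a≤b big = inj₁ (outcome₄ G a≥ (≤-trans a≥ a≤b) big)
outcome 3 G _ a≥ a≤b big = Five.outcome₅ G a≥ a≤b big
outcome {a} {b} m@(suc (suc (suc (suc n)))) G _ a≥ a≤b big = go (halves n)
  where
  halves : ∀ n → Σ ℕ λ s → Σ ℕ λ t → 6 + n ≡ s + t × 3 ≤ s × s ≤ t × t ≤ suc s
  halves zero          = 3 , 3 , refl , ≤-refl , ≤-refl , n≤1+n 3
  halves (suc zero)    = 3 , 4 , refl , ≤-refl , n≤1+n 3 , ≤-refl
  halves (suc (suc n)) with halves n
  ... | s , t , e , h₁ , h₂ , h₃ = suc s , suc t , cong suc (trans (cong suc e) (sym (+-suc s t))) , ≤-trans h₁ (n≤1+n s) , s≤s h₂ , s≤s h₃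
  go : (Σ ℕ λ s → Σ ℕ λ t → 6 + n ≡ s + t × 3 ≤ s × s ≤ t × t ≤ suc s) → Outcome (Ctx.E G) m
  go (s , t , e , s≥ , s≤t , t≤) with Large.bigBiclique G s t e s≥ s≤t t≤ a≥ a≤b big
  ... | M , p≥ , q≥ = LargeEnd.outcome G M t (s≤s (s≤s (s≤s (s≤s z≤n)))) (≤-trans s≥ s≤t) (≤-trans (≤-reflexive e) (+-monoˡ-≤ t s≤t)) a≥ a≤b big p≥ q≥
    (six n {G} a≥ big {M})
    where
    -- Stated for variable n so that the equation 4 + n ≡ 4 turns ℓ into the numeral 6.
    six : ∀ n {G : Ctx (6 + n) a b} → 6 + n ≤ a → (4 + n) * b + 2 * a ≤ edges (Ctx.E G) + 2 * (4 + n) → {M : MaxBi (Ctx.E G)} →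
      4 + n ≡ 4 → size (MaxBi.KA M) ≡ 4 → size (MaxBi.KB M) ≡ 4 → ⊥
    six zero {G} a≥ big {M} _ eA eB = sixContra G M eA eB a≤b a≥ big

-- Reduction to saturated graphs

sum-bump : ∀ {n} {f g : Fin n → ℕ} i → g i ≡ suc (f i) → (∀ k → k ≢ i → g k ≡ f k) → sumFin n g ≡ suc (sumFin n f)
sum-bump {n} {f} {g} i at off = trans (sum-at g i) (trans (cong₂ _+_ at (sum-cong same)) (cong suc (sym (sum-at f i))))
  where
  same : ∀ k → (if does (k Fin.≟ i) then 0 else g k) ≡ (if does (k Fin.≟ i) then 0 else f k)
  same k with k Fin.≟ i
  ... | yes _ = refl
  ... | no ne = off k ne

module _ {a b} (E : BipGraph a b) (i : Fin a) (j : Fin b) where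

  edges-addE : ¬ T (E i j) → edges (addE E i j) ≡ suc (edges E)
  edges-addE nadj = sum-bump i (sum-bump j at off) λ k ne → sum-cong (λ l → offRow k l ne)
    where
    at : 𝟙 (addE E i j i j) ≡ suc (𝟙 (E i j))
    at with i Fin.≟ i | j Fin.≟ j | E i j
    ... | no n  | _     | _     = ⊥-elim (n refl)
    ... | yes _ | no n  | _     = ⊥-elim (n refl)
    ... | yes _ | yes _ | false = refl
    ... | yes _ | yes _ | true  = ⊥-elim (nadj tt)
    off : ∀ l → l ≢ j → 𝟙 (addE E i j i l) ≡ 𝟙 (E i l)
    off l ne with i Fin.≟ i | l Fin.≟ j
    ... | no _  | _     = refl
    ... | yes _ | yes e = ⊥-elim (ne e)
    ... | yes _ | no _  = refl
    offRow : ∀ k l → k ≢ i → 𝟙 (addE E i j k l) ≡ 𝟙 (E k l)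
    offRow k l ne with k Fin.≟ i
    ... | yes e = ⊥-elim (ne e)
    ... | no _  = refl

  addE-robust : Robust E → Robust (addE E i j)
  addE-robust rob x u v nu nv = mono (rob x u v nu nv)
    where
    keep : ∀ k l → T (E k l) → T (addE E i j k l)
    keep k l h with k Fin.≟ i | l Fin.≟ j
    ... | no _  | _     = h
    ... | yes _ | yes _ = tt
    ... | yes _ | no _  = h
    adj : ∀ u v → Adj E u v → Adj (addE E i j) u v
    adj (inj₁ k) (inj₂ l) e = keep k l e
    adj (inj₂ l) (inj₁ k) e = keep k l e
    mono : ∀ {u v} → Reach E (λ w → w ≢ x) u v → Reach (addE E i j) (λ w → w ≢ x) u v
    mono (here p)                   = here p
    mono {u} (step {w = w} p e r) = step p (adj u w e) (mono r)

edges≤ : ∀ {a b} (E : BipGraph a b) → edges E ≤ b * a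
edges≤ {a} {b} E = ≤-trans (eS≤ E full full b (λ i _ → ≤-trans (deg≤size E full i) (≤-reflexive (size-full b)))) (≤-reflexive (cong (b *_) (size-full a)))

good-edges : ∀ {a b m} {E : BipGraph a b} → Good E m → edges E + 2 * m ≡ m * b + 2 * a
good-edges {a} {b} {m} {E} good = begin
  edges E + 2 * m                                             ≡⟨ cong (λ c → edges E + 2 * c) (sym card) ⟩
  edges E + 2 * size A₀                                       ≡⟨ cong (edges E +_) (sym (sum-*ˡ a 2 (λ i → 𝟙 (A₀ i)))) ⟩
  edges E + sumFin a (λ i → 2 * 𝟙 (A₀ i))                     ≡⟨ sym (sum-+ (λ i → size (E i)) (λ i → 2 * 𝟙 (A₀ i))) ⟩
  sumFin a (λ i → size (E i) + 2 * 𝟙 (A₀ i))                  ≡⟨ sum-cong row ⟩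
  sumFin a (λ i → b * 𝟙 (A₀ i) + 2 * 1)                       ≡⟨ sum-+ (λ i → b * 𝟙 (A₀ i)) (λ _ → 2 * 1) ⟩
  sumFin a (λ i → b * 𝟙 (A₀ i)) + sumFin a (λ _ → 2 * 1)      ≡⟨ cong₂ _+_ (sum-*ˡ a b (λ i → 𝟙 (A₀ i))) (sum-*ˡ a 2 (λ _ → 1)) ⟩
  b * size A₀ + 2 * size {a} full                             ≡⟨ cong₂ (λ c d → b * c + 2 * d) card (size-full a) ⟩
  b * m + 2 * a                                               ≡⟨ cong (_+ 2 * a) (*-comm b m) ⟩
  m * b + 2 * a                                               ∎
  where
  open Good good
  open ≡-Reasoning
  one : ∀ c → T c → 𝟙 c ≡ 1
  one true _ = refl
  none : ∀ c → ¬ T c → 𝟙 c ≡ 0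
  none false _ = refl
  none true  n = ⊥-elim (n tt)
  row : ∀ i → size (E i) + 2 * 𝟙 (A₀ i) ≡ b * 𝟙 (A₀ i) + 2
  row i with T? (A₀ i)
  ... | yes h = cong₂ _+_ (trans deg (sym (trans (cong (b *_) (one (A₀ i) h)) (*-identityʳ b)))) (cong (2 *_) (one (A₀ i) h))
    where deg : size (E i) ≡ b
          deg = ≤-antisym (size-≤ (E i)) (≤-trans (≤-reflexive (sym (size-full b))) (size-mono {S = full} {E i} (λ j _ → univ i h j)))
  ... | no n = trans (cong₂ _+_ deg (cong (2 *_) (none (A₀ i) n))) (sym (cong (_+ 2) (trans (cong (b *_) (none (A₀ i) n)) (*-zeroʳ b))))
    where
    there' : ∀ j → j ≡ u₁ ⊎ j ≡ u₂ → T (E i j)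
    there' j (inj₁ refl) = rest₁ i n
    there' j (inj₂ refl) = rest₂ i n
    deg : size (E i) ≡ 2
    deg = trans (≤-antisym (size-mono {S = E i} {pairSet u₁ u₂} (λ j e → pair-in (rest i n j e))) (size-mono {S = pairSet u₁ u₂} {E i} (λ j h → there' j (pair-out h)))) (pair-size u₁≢u₂)

Extremal : ∀ {a b} → BipGraph a b → ℕ → Set
Extremal {a} {b} E m = Good E m ⊎ (a ≡ b × Good (flipE E) m)

extremal-edges : ∀ {a b m} {E : BipGraph a b} → Extremal E m → edges E + 2 * m ≡ m * b + 2 * a
extremal-edges (inj₁ g)                   = good-edges g
extremal-edges {m = m} {E} (inj₂ (refl , g)) = trans (cong (_+ 2 * m) (sym (edges-flip E))) (good-edges g)

-- Adding edges one at a time reduces to graphs in which every new edge closes a long cycle.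
dichotomy : ∀ {a b m} → 2 ≤ m → 2 + m ≤ a → a ≤ b → (E : BipGraph a b) → Robust E → NoCycleAtLeast E (2 * (2 + m)) →
  edges E + 2 * m < m * b + 2 * a ⊎ Extremal E m
dichotomy {a} {b} {m} m≥ a≥ a≤b E rob none = go (b * a) E (m≤m+n _ _) rob none
  where
  b≥ = ≤-trans a≥ a≤b
  l≥ : 2 ≤ 2 + m
  l≥ = m≤m+n 2 m
  go : ∀ n (E : BipGraph a b) → b * a ≤ n + edges E → Robust E → NoCycleAtLeast E (2 * (2 + m)) → edges E + 2 * m < m * b + 2 * a ⊎ Extremal E m
  go n E room rob none with edges E + 2 * m <? m * b + 2 * a
  ... | yes h = inj₁ h
  ... | no h  = inj₂ (finish (outcome m G m≥ a≥ a≤b big))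
    where
    big : m * b + 2 * a ≤ edges E + 2 * m
    big = ≮⇒≥ h
    -- The graph already reaches the bound, so with one more edge it would contradict both
    -- alternatives of the induction hypothesis. Hence every new edge creates a long cycle.
    over : ∀ (E' : BipGraph a b) → edges E' ≡ suc (edges E) → edges E' + 2 * m < m * b + 2 * a ⊎ Extremal E' m → ⊥
    over E' e (inj₁ lt) = 1+n≰n (≤-trans (≤-trans (n≤1+n _) (≤-trans (s≤s (≤-reflexive (cong (_+ 2 * m) (sym e)))) lt)) big)
    over E' e (inj₂ ex) = 1+n≰n (≤-trans (≤-reflexive (trans (cong (_+ 2 * m) (sym e)) (extremal-edges {E = E'} ex))) big)
    grow : ∀ n → b * a ≤ n + edges E → ∀ i j → ¬ T (E i j) → ¬ NoCycleAtLeast (addE E i j) (2 * (2 + m))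
    grow zero    room i j nadj none' = 1+n≰n (≤-trans (≤-reflexive (sym (edges-addE E i j nadj))) (≤-trans (edges≤ (addE E i j)) room))
    grow (suc n) room i j nadj none' = over (addE E i j) (edges-addE E i j nadj) (go n (addE E i j) (≤-trans room (≤-reflexive (trans (sym (+-suc n (edges E))) (cong (n +_) (sym (edges-addE E i j nadj)))))) (addE-robust E i j rob) none')
    G : Ctx (2 + m) a b
    G = record { E = E ; rob = rob ; short = evenShort {l = 2 + m} l≥ none ; sat = saturated {l = 2 + m} l≥ none (grow n room) ; l≥1 = s≤s z≤n }
    finish : Outcome E m → Extremal E m
    finish (inj₁ (A₀ , card , univ))     = inj₁ (universal⇒Good rob (Ctx.short G) m≥ a≥ b≥ A₀ card univ)
    finish (inj₂ (e , A₀ , card , univ)) = inj₂ (e , universal⇒Good (flip-robust rob) (flip-short {l = 2 + m} (Ctx.short G)) m≥ b≥ a≥ A₀ card univ)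

-- Isomorphisms

sum-punchIn : ∀ {n} (f : Fin (suc n) → ℕ) i → sumFin (suc n) f ≡ f i + sumFin n (f ∘ punchIn i)
sum-punchIn         f fzero    = refl
sum-punchIn {suc n} f (fsuc i) = trans (cong (f fzero +_) (sum-punchIn (f ∘ fsuc) i)) (swapˡ (f fzero) (f (fsuc i)) _)
  where swapˡ : ∀ x y z → x + (y + z) ≡ y + (x + z)
        swapˡ = solve-∀

-- Send the first index to any index with the same value and continue with the rest. If there were
-- none, `S'` would be constant with the opposite value, against the equal sizes.
align : ∀ {n} (S S' : Fin n → Bool) → size S ≡ size S' → Σ (Permutation n n) λ π → ∀ i → S' (π ⟨$⟩ʳ i) ≡ S i
align {zero}  S S' e = idₚ , λ ()
align {suc n} S S' e = insert fzero k (proj₁ IH) , at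
  where
  flip≢ : ∀ c d → c ≢ d → c ≡ not d
  flip≢ true  true  n = ⊥-elim (n refl)
  flip≢ true  false n = refl
  flip≢ false true  n = refl
  flip≢ false false n = ⊥-elim (n refl)
  hit : Σ (Fin (suc n)) λ k → S' k ≡ S fzero
  hit with Fin.any? (λ k → S' k ≟ᵇ S fzero)
  ... | yes p = p
  ... | no ¬p = ⊥-elim (miss (S fzero) refl (λ k → flip≢ (S' k) (S fzero) (λ h → ¬p (k , h))))
    where
    miss : ∀ c → S fzero ≡ c → (∀ k → S' k ≡ not c) → ⊥
    miss true  eq h = 1+n≢0 (trans (cong (λ c → 𝟙 c + size (S ∘ fsuc)) (sym eq)) (trans e (trans (sum-cong (λ k → cong 𝟙 (h k))) (sum-0 (suc n)))))
    miss false eq h = 1+n≰n (≤-trans (≤-reflexive (sym (trans (sum-cong (λ k → cong 𝟙 (h k))) (size-full (suc n)))))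
      (≤-trans (≤-reflexive (sym e)) (≤-trans (≤-reflexive (cong (λ c → 𝟙 c + size (S ∘ fsuc)) eq)) (size-≤ (S ∘ fsuc)))))
  k = proj₁ hit
  IH : Σ (Permutation n n) λ π → ∀ i → S' (punchIn k (π ⟨$⟩ʳ i)) ≡ S (fsuc i)
  IH = align (S ∘ fsuc) (S' ∘ punchIn k) (+-cancelˡ-≡ (𝟙 (S fzero)) _ _
    (trans e (trans (sum-punchIn (λ i → 𝟙 (S' i)) k) (cong (λ c → 𝟙 c + size (S' ∘ punchIn k)) (proj₂ hit)))))
  at : ∀ i → S' (insert fzero k (proj₁ IH) ⟨$⟩ʳ i) ≡ S i
  at fzero    = proj₂ hit
  at (fsuc i) = trans (cong S' (insert-punchIn fzero k (proj₁ IH) i)) (proj₂ IH i)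

good-adj : ∀ {a b m} {E : BipGraph a b} (g : Good E m) i j → T (E i j) ⇔ (T (Good.A₀ g i) ⊎ T (pairSet (Good.u₁ g) (Good.u₂ g) j))
good-adj {E = E} g i j = mk⇔ to from
  where
  open Good g
  to : T (E i j) → T (A₀ i) ⊎ T (pairSet u₁ u₂ j)
  to e with T? (A₀ i)
  ... | yes h = inj₁ h
  ... | no n  = inj₂ (pair-in (rest i n j e))
  from : T (A₀ i) ⊎ T (pairSet u₁ u₂ j) → T (E i j)
  from h with T? (A₀ i)
  from h        | yes h' = univ i h' j
  from (inj₁ h) | no n   = ⊥-elim (n h)
  from (inj₂ h) | no n with pair-out h
  ... | inj₁ refl = rest₁ i n
  ... | inj₂ refl = rest₂ i n

good-iso : ∀ {a b m} {E E' : BipGraph a b} → Good E m → Good E' m → Isomorphic E E'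
good-iso {a} {b} {m} {E} {E'} g g' = (σ ⊎-↔ τ) , adj
  where
  module g  = Good g
  module g' = Good g'
  alignA = align g.A₀ g'.A₀ (trans g.card (sym g'.card))
  alignB = align (pairSet g.u₁ g.u₂) (pairSet g'.u₁ g'.u₂) (trans (pair-size g.u₁≢u₂) (sym (pair-size g'.u₁≢u₂)))
  σ = proj₁ alignA
  τ = proj₁ alignB
  edge⇔ : ∀ i j → T (E i j) ⇔ T (E' (σ ⟨$⟩ʳ i) (τ ⟨$⟩ʳ j))
  edge⇔ i j = mk⇔ (λ e → Equivalence.from (good-adj g' _ _) (subst₂ (λ x y → T x ⊎ T y) (sym (proj₂ alignA i)) (sym (proj₂ alignB j)) (Equivalence.to (good-adj g i j) e)))
                 (λ e → Equivalence.from (good-adj g i j) (subst₂ (λ x y → T x ⊎ T y) (proj₂ alignA i) (proj₂ alignB j) (Equivalence.to (good-adj g' _ _) e)))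
  adj : ∀ u v → Adj E u v ⇔ Adj E' (Inverse.to (σ ⊎-↔ τ) u) (Inverse.to (σ ⊎-↔ τ) v)
  adj (inj₁ i) (inj₂ j) = edge⇔ i j
  adj (inj₂ j) (inj₁ i) = edge⇔ i j
  adj (inj₁ _) (inj₁ _) = mk⇔ id id
  adj (inj₂ _) (inj₂ _) = mk⇔ id id

flip-iso : ∀ {a b} (E : BipGraph a b) → Isomorphic E (flipE E)
flip-iso E = mk↔ₛ′ sw sw sw-sw sw-sw , adj
  where
  adj : ∀ u v → Adj E u v ⇔ Adj (flipE E) (sw u) (sw v)
  adj (inj₁ _) (inj₂ _) = mk⇔ id id
  adj (inj₂ _) (inj₁ _) = mk⇔ id id
  adj (inj₁ _) (inj₁ _) = mk⇔ id id
  adj (inj₂ _) (inj₂ _) = mk⇔ id id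

iso-trans : ∀ {a b a' b' a'' b''} {E : BipGraph a b} {E' : BipGraph a' b'} {E'' : BipGraph a'' b''} → Isomorphic E E' → Isomorphic E' E'' → Isomorphic E E''
iso-trans (f , p) (g , q) = (g ↔-∘ f) , λ u v → q _ _ ⇔-∘ p u v

iso-sym : ∀ {a b a' b'} {E : BipGraph a b} {E' : BipGraph a' b'} → Isomorphic E E' → Isomorphic E' E
iso-sym {E = E} {E'} (f , p) = mk↔ₛ′ (Inverse.from f) (Inverse.to f) (Inverse.strictlyInverseʳ f) (Inverse.strictlyInverseˡ f) ,
  λ u v → mk⇔ (λ e → Equivalence.from (p _ _) (subst₂ (Adj E') (sym (Inverse.strictlyInverseˡ f u)) (sym (Inverse.strictlyInverseˡ f v)) e))
              (λ e → subst₂ (Adj E') (Inverse.strictlyInverseˡ f u) (Inverse.strictlyInverseˡ f v) (Equivalence.to (p _ _) e))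

-- Edge numbers of isomorphic graphs

module _ {a b} (E : BipGraph a b) where

  edgeList : List (Fin a × Fin b)
  edgeList = concat (tabulate (λ i → map (i ,_) (elems (E i))))

  edgeList-length : length edgeList ≡ edges E
  edgeList-length = go a (λ i → map (i ,_) (elems (E i))) (λ i → trans (length-map (i ,_) (elems (E i))) (length-elems (E i)))
    where
    go : ∀ {A : Set} n (f : Fin n → List A) {g} → (∀ i → length (f i) ≡ g i) → length (concat (tabulate f)) ≡ sumFin n g
    go zero    f h = refl
    go (suc n) f h = trans (length-++ (f fzero)) (cong₂ _+_ (h fzero) (go n (f ∘ fsuc) (h ∘ fsuc)))

  edgeList-unique : Unique edgeList
  edgeList-unique = Uniq.concat⁺ (All.tabulate⁺ (λ i → Uniq.map⁺ (λ { refl → refl }) (elems-unique (E i))))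
    (AllPairs.tabulate⁺ (λ i≢k (p , q) → apart i≢k (∈-map⁻ _ p) (∈-map⁻ _ q)))
    where
    apart : ∀ {i k : Fin a} {js ks : List (Fin b)} {e} → i ≢ k → (∃ λ j → j ∈ js × e ≡ (i , j)) → (∃ λ j → j ∈ ks × e ≡ (k , j)) → ⊥
    apart ne (_ , _ , refl) (_ , _ , refl) = ne refl

  ∈-edgeList : ∀ {i j} → T (E i j) → (i , j) ∈ edgeList
  ∈-edgeList {i} h = ∈-concat⁺′ (∈-map⁺ (i ,_) (∈-elems (E i) h)) (∈-tabulate⁺ i)

  edgeList-∈ : ∀ {i j} → (i , j) ∈ edgeList → T (E i j)
  edgeList-∈ {i} {j} h with ∈-concat⁻′ (tabulate (λ i → map (i ,_) (elems (E i)))) h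
  ... | _ , m , n with ∈-tabulate⁻ n
  ...   | k , refl with ∈-map⁻ (k ,_) m
  ...     | _ , m' , refl = elems-∈ (E k) m'

  forth back : Fin a × Fin b → Vertex a b × Vertex a b
  forth (i , j) = inj₁ i , inj₂ j
  back  (i , j) = inj₂ j , inj₁ i

  -- An isomorphism need not respect the classes, so edges are compared as ordered pairs of adjacent
  -- vertices, two for each edge.
  darts : List (Vertex a b × Vertex a b)
  darts = map forth edgeList ++ map back edgeList

  darts-length : length darts ≡ 2 * edges E
  darts-length = trans (length-++ (map forth edgeList)) (cong₂ _+_ (trans (length-map forth edgeList) edgeList-length)
    (trans (length-map back edgeList) (trans edgeList-length (sym (+-identityʳ _)))))

  darts-unique : Unique darts
  darts-unique = Uniq.++⁺ (Uniq.map⁺ (λ { refl → refl }) edgeList-unique) (Uniq.map⁺ (λ { refl → refl }) edgeList-unique)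
    (λ (p , q) → apart (∈-map⁻ forth p) (∈-map⁻ back q))
    where
    apart : ∀ {e es es'} → (∃ λ x → x ∈ es × e ≡ forth x) → (∃ λ x → x ∈ es' × e ≡ back x) → ⊥
    apart (_ , _ , refl) (_ , _ , ())

  ∈-darts : ∀ u v → Adj E u v → (u , v) ∈ darts
  ∈-darts (inj₁ i) (inj₂ j) e = ∈-++⁺ˡ (∈-map⁺ forth (∈-edgeList e))
  ∈-darts (inj₂ j) (inj₁ i) e = ∈-++⁺ʳ (map forth edgeList) (∈-map⁺ back (∈-edgeList e))

  darts-∈ : ∀ {u v} → (u , v) ∈ darts → Adj E u v
  darts-∈ m with ∈-++⁻ (map forth edgeList) m
  ... | inj₁ m' with ∈-map⁻ forth m'
  ...   | _ , m'' , refl = edgeList-∈ m''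
  darts-∈ m | inj₂ m' with ∈-map⁻ back m'
  ...   | _ , m'' , refl = edgeList-∈ m''

iso-edges≤ : ∀ {a b a' b'} {E : BipGraph a b} {E' : BipGraph a' b'} → Isomorphic E E' → edges E ≤ edges E'
iso-edges≤ {a} {b} {a'} {b'} {E} {E'} (f , p) = *-cancelˡ-≤ 2 (subst₂ _≤_ (trans (length-map both (darts E)) (darts-length E)) (darts-length E')
  (⊆-length (Uniq.map⁺ both-injective (darts-unique E)) λ m → image (∈-map⁻ both m)))
  where
  both : Vertex a b × Vertex a b → Vertex a' b' × Vertex a' b'
  both (u , v) = Inverse.to f u , Inverse.to f v
  to-injective : ∀ {u v} → Inverse.to f u ≡ Inverse.to f v → u ≡ v
  to-injective {u} {v} e = trans (sym (Inverse.strictlyInverseʳ f u)) (trans (cong (Inverse.from f) e) (Inverse.strictlyInverseʳ f v))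
  both-injective : ∀ {d d'} → both d ≡ both d' → d ≡ d'
  both-injective e = cong₂ _,_ (to-injective (cong proj₁ e)) (to-injective (cong proj₂ e))
  image : ∀ {d} → (∃ λ c → c ∈ darts E × d ≡ both c) → d ∈ darts E'
  image ((u , v) , m , refl) = ∈-darts E' _ _ (Equivalence.to (p u v) (darts-∈ E m))

iso-edges : ∀ {a b a' b'} {E : BipGraph a b} {E' : BipGraph a' b'} → Isomorphic E E' → edges E ≡ edges E'
iso-edges {E = E} {E'} iso = ≤-antisym (iso-edges≤ {E = E} {E'} iso) (iso-edges≤ {E = E'} {E} (iso-sym {E = E} {E'} iso))

size-below : ∀ {n m} → m ≤ n → size {n} (λ i → does (toℕ i <? m)) ≡ m
size-below {n} {zero} _ = trans (sum-cong {n} (λ i → refl)) (sum-0 n)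
size-below {suc n} {suc m} (s≤s h) = cong suc (size-below h)

good-B₂ : ∀ {a b} m → m ≤ a → 2 ≤ b → Good (B₂ a b (2 + m)) m
good-B₂ {a} {suc (suc b)} m m≤a (s≤s (s≤s _)) = record
  { A₀ = A₀ ; u₁ = fzero ; u₂ = fsuc fzero ; u₁≢u₂ = λ () ; card = size-below m≤a
  ; univ = univ ; rest = rest ; rest₁ = λ i n → special i n fzero tt ; rest₂ = λ i n → special i n (fsuc fzero) tt }
  where
  A₀ : Fin a → Bool
  A₀ i = does (toℕ i <? m)
  univ : ∀ i → T (A₀ i) → ∀ j → T (B₂ a (2 + b) (2 + m) i j)
  univ i h j with does (toℕ i <? m)
  ... | true = tt
  special : ∀ i → ¬ T (A₀ i) → ∀ j → T (does (toℕ j <? 2)) → T (B₂ a (2 + b) (2 + m) i j)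
  special i n j h with does (toℕ i <? m)
  ... | true  = tt
  ... | false = h
  low : ∀ (j : Fin (2 + b)) → T (does (toℕ j <? 2)) → j ≡ fzero ⊎ j ≡ fsuc fzero
  low fzero        _ = inj₁ refl
  low (fsuc fzero) _ = inj₂ refl
  rest : ∀ i → ¬ T (A₀ i) → ∀ j → T (B₂ a (2 + b) (2 + m) i j) → j ≡ fzero ⊎ j ≡ fsuc fzero
  rest i n j h with does (toℕ i <? m)
  ... | true  = ⊥-elim (n tt)
  ... | false = low j h

-- The bound over the integers

open import Data.Integer as ℤ using (+_)
import Data.Integer.Properties as ℤ
import Data.Integer.Tactic.RingSolver as ℤ

twiceBound≡ : ∀ k a b → twiceBound (4 + k) a b ≡ + (2 * ((2 + k) * b + 2 * a)) ℤ.- + (2 * (2 * (2 + k)))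
twiceBound≡ k a b = begin
  + ((4 + k) * (a + b)) ℤ.+ + k ℤ.* ((+ b ℤ.- + a) ℤ.- + 4) ℤ.- + 8
    ≡⟨ cong (λ x → x ℤ.+ + k ℤ.* ((+ b ℤ.- + a) ℤ.- + 4) ℤ.- + 8) (ℤ.pos-* (4 + k) (a + b)) ⟩
  (+ 4 ℤ.+ + k) ℤ.* (+ a ℤ.+ + b) ℤ.+ + k ℤ.* ((+ b ℤ.- + a) ℤ.- + 4) ℤ.- + 8
    ≡⟨ arith (+ k) (+ a) (+ b) ⟩
  + 2 ℤ.* ((+ 2 ℤ.+ + k) ℤ.* + b ℤ.+ + 2 ℤ.* + a) ℤ.- + 2 ℤ.* (+ 2 ℤ.* (+ 2 ℤ.+ + k))
    ≡⟨ cong₂ (λ x y → + 2 ℤ.* (x ℤ.+ y) ℤ.- + 2 ℤ.* (+ 2 ℤ.* (+ 2 ℤ.+ + k))) (sym (ℤ.pos-* (2 + k) b)) (sym (ℤ.pos-* 2 a)) ⟩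
  + 2 ℤ.* + ((2 + k) * b + 2 * a) ℤ.- + 2 ℤ.* (+ 2 ℤ.* + (2 + k))
    ≡⟨ cong₂ ℤ._-_ (sym (ℤ.pos-* 2 ((2 + k) * b + 2 * a))) (trans (cong (+ 2 ℤ.*_) (sym (ℤ.pos-* 2 (2 + k)))) (sym (ℤ.pos-* 2 (2 * (2 + k))))) ⟩
  + (2 * ((2 + k) * b + 2 * a)) ℤ.- + (2 * (2 * (2 + k))) ∎
  where
  open ≡-Reasoning
  arith : ∀ k a b → (+ 4 ℤ.+ k) ℤ.* (a ℤ.+ b) ℤ.+ k ℤ.* ((b ℤ.- a) ℤ.- + 4) ℤ.- + 8
    ≡ + 2 ℤ.* ((+ 2 ℤ.+ k) ℤ.* b ℤ.+ + 2 ℤ.* a) ℤ.- + 2 ℤ.* (+ 2 ℤ.* (+ 2 ℤ.+ k))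
  arith = ℤ.solve-∀

module _ (e x y : ℕ) where
  private
    cancel : ∀ u v → u ≡ u ℤ.+ v ℤ.- v
    cancel = ℤ.solve-∀
    shift : + (2 * e) ≡ + (2 * (e + y)) ℤ.- + (2 * y)
    shift = trans (cancel (+ (2 * e)) (+ (2 * y))) (cong (λ n → + n ℤ.- + (2 * y)) (sym (*-distribˡ-+ 2 e y)))

  sub-≤ : e + y ≤ x → + (2 * e) ℤ.≤ + (2 * x) ℤ.- + (2 * y)
  sub-≤ h = ℤ.≤-trans (ℤ.≤-reflexive shift) (ℤ.+-monoˡ-≤ (ℤ.- + (2 * y)) (ℤ.+≤+ (*-monoʳ-≤ 2 h)))

  sub-≡ : e + y ≡ x → + (2 * e) ≡ + (2 * x) ℤ.- + (2 * y)
  sub-≡ refl = shift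

  sub-≡⁻¹ : + (2 * e) ≡ + (2 * x) ℤ.- + (2 * y) → e + y ≡ x
  sub-≡⁻¹ h = *-cancelˡ-≡ (e + y) x 2 (ℤ.+-injective (trans (cong +_ (*-distribˡ-+ 2 e y)) (trans (cong (ℤ._+ + (2 * y)) h) (restore (+ (2 * x)) (+ (2 * y))))))
    where restore : ∀ u v → u ℤ.- v ℤ.+ v ≡ u
          restore = ℤ.solve-∀

theorem1 : (ℓ a b : ℕ) → 4 ≤ ℓ → ℓ ≤ a → a ≤ b →
    (G : BipGraph a b) → TwoConnected G → NoCycleAtLeast G (2 * ℓ) →
    ((+ (2 * edges G)) ℤ.≤ twiceBound ℓ a b) ×
    (((+ (2 * edges G)) ≡ twiceBound ℓ a b) ⇔ Isomorphic G (B₂ a b ℓ))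
theorem1 _ a b (s≤s (s≤s (s≤s (s≤s {n = k} z≤n)))) ℓ≤a a≤b G (_ , rob) none = subst
    (λ t → (+ (2 * edges G) ℤ.≤ t) × ((+ (2 * edges G) ≡ t) ⇔ Isomorphic G (B₂ a b (4 + k)))) (sym (twiceBound≡ k a b))
    (sub-≤ (edges G) F (2 * m) (atMost cases) , mk⇔ (λ e → extremal cases (sub-≡⁻¹ (edges G) F (2 * m) e)) (λ iso → sub-≡ (edges G) F (2 * m) (attained iso)))
  where
  m = 2 + k
  F = m * b + 2 * a
  cases : edges G + 2 * m < F ⊎ Extremal G m
  cases = dichotomy (m≤m+n 2 k) ℓ≤a a≤b G rob none
  extremalGraph : Good (B₂ a b (4 + k)) m
  extremalGraph = good-B₂ m (≤-trans (m≤n+m m 2) ℓ≤a) (≤-trans (≤-trans (m≤m+n 2 (2 + k)) ℓ≤a) a≤b)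
  atMost : edges G + 2 * m < F ⊎ Extremal G m → edges G + 2 * m ≤ F
  atMost (inj₁ h) = <⇒≤ h
  atMost (inj₂ x) = ≤-reflexive (extremal-edges {E = G} x)
  extremal : edges G + 2 * m < F ⊎ Extremal G m → edges G + 2 * m ≡ F → Isomorphic G (B₂ a b (4 + k))
  extremal (inj₁ h)                 e = ⊥-elim (<⇒≢ h e)
  extremal (inj₂ (inj₁ g))          _ = good-iso g extremalGraph
  extremal (inj₂ (inj₂ (refl , g))) _ = iso-trans {E = G} {flipE G} {B₂ a b (4 + k)} (flip-iso G) (good-iso g extremalGraph)
  attained : Isomorphic G (B₂ a b (4 + k)) → edges G + 2 * m ≡ F
  attained iso = trans (cong (_+ 2 * m) (iso-edges {E = G} {B₂ a b (4 + k)} iso)) (good-edges extremalGraph)
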